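{- Let $W$ be of type $A_n$ and let $c$ be any Coxeter element. For every positive root $\beta\in\Phi^+$, let $k$ be the unique index $k\in\{n+1,\dots,n+N\}$ with $r(I_g,k)=\beta$. Then the following two statements hold: (1) $\mathrm{Newton}(F_\beta)=\mathrm{conv}\{w(I,k)-w(I_{ag},k): I \text{ facet of } \mathcal{S}(Q)\}$; (2) the set of exponent vectors $\{\lambda_1\alpha_1+\dots+\lambda_n\alpha_n : y_1^{\lambda_1}\cdots y_n^{\lambda_n}\text{ is a monomial of } F_\beta\}$ equals $\mathrm{Newton}(F_\beta)\cap\mathbb{Z}_{\ge0}\Delta$.
   Context: Let $(W,\mathcal{S})$ be a finite crystallographic Coxeter system of rank $n$ with simple roots $\Delta$ and fundamental weights $\omega_s$. Let $\Phi^+$ be the positive roots, $N=|\Phi^+|$, and $w_\circ$ the longest element. Fix a Coxeter element $c$ with reduced word $s_1\cdots s_n$, and write $\alpha_i=\alpha_{s_i}$. Let $\mathbf{w}_\circ(c)=q_1\cdots q_N$ be the lexicographically first subword of $s_1\cdots s_n s_1\cdots s_n\cdots$ that is a reduced word for $w_\circ$. Let $Q=Q_1\cdots Q_{n+N}=s_1\cdots s_nq_1\cdots q_N$. Facets of $\mathcal{S}(Q)$ are the $n$-subsets $I\subseteq[n+N]$ whose deletion from $Q$ leaves a reduced word for $w_\circ$. The greedy facet $I_g$ and antigreedy facet $I_{ag}$ are the lexicographically first and last facets. For a facet $I$ and position $k$, let $\Pi_{I,k}$ be the ordered product of the $Q_x$ for $x\in[k-1]\setminus I$. The root function is $r(I,k)=\Pi_{I,k}(\alpha_{Q_k})$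 and the weight function is $w(I,k)=\Pi_{I,k}(\omega_{Q_k})$. $\mathcal{A}(W,c)$ is the cluster algebra with principal coefficients with initial extended exchange matrix $\begin{bmatrix}B_c\\ \mathrm{Id}_n\end{bmatrix}$, where $B_c=(b_{ij})$ has $b_{ij}=-a_{s_is_j}$ if $i<j$, $b_{ij}=a_{s_is_j}$ if $i>j$, $b_{ii}=0$, and $a$ is the Cartan matrix. Its initial variables are $x_1,\dots,x_n$ and coefficients $y_1,\dots,y_n$. Every cluster variable has the form $u=p(\mathbf{x},\mathbf{y})/x^{d}$, with $d$-vector $\sum d_i\alpha_i$. The $d$-vectors of non-initial cluster variables are exactly the positive roots. For $\beta\in\Phi^+$, the $F$-polynomial is $F_\beta(\mathbf{y})=u(1,\dots,1,\mathbf{y})$ for the cluster variable $u$ with $d$-vector $\beta$. Its Newton polytope is $\mathrm{Newton}(F_\beta)=\mathrm{conv}\{\sum\lambda_i\alpha_i : \mathbf{y}^\lambda\text{ a monomial of }F_\beta\}$.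
   Formalization: Convex hulls and Newton polytopes are taken over the rational numbers (rational points, rational convex coefficients) instead of over the reals; all generating points are integral. -}

module Defs where

open import Data.Nat as ℕ using (ℕ; zero; suc; NonZero; _<_; _≤_)
open import Data.Nat.DivMod using (_mod_)
open import Data.Integer as ℤ using (ℤ; +_; -[1+_]; _-_; -_)
open import Data.Rational as ℚ using (ℚ; 0ℚ; 1ℚ)
open import Data.Fin as Fin using (Fin; toℕ)
open import Data.Vec as Vec using (Vec; lookup; tabulate; toList)
import Data.Vec.Properties as VecP
open import Data.List as List using (List; []; _∷_; _++_; length; foldr)
open import Data.Bool.ListAction using (any)
open import Data.List.Relation.Unary.All using (All)
open import Data.List.Relation.Unary.Linked using (Linked)
open import Data.Product using (Σ; ∃; _×_; _,_; proj₁; proj₂)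
import Data.Product.Properties as ProdP
open import Data.Bool using (Bool; true; false; if_then_else_; _∧_; not)
open import Relation.Binary.PropositionalEquality using (_≡_; _≢_)
open import Relation.Nullary using (¬_; does)
open import Function using (Injective)

pos : ℤ → ℤ
pos (+ m)    = + m
pos -[1+ _ ] = + 0

posℕ : ℤ → ℕ
posℕ (+ m)    = m
posℕ -[1+ _ ] = 0

sgn : ℤ → ℤ
sgn (+ zero)  = + 0
sgn (+ suc _) = + 1
sgn -[1+ _ ]  = -[1+ 0 ]

sumℤ : {n : ℕ} → (Fin n → ℤ) → ℤ
sumℤ {zero}  f = + 0
sumℤ {suc n} f = f Fin.zero ℤ.+ sumℤ (λ i → f (Fin.suc i))

-- The root system of type A_n, written in the basis of fundamental
-- weights: a vector v : Fin n → ℤ stands for Σ_j v j · ω_j.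

cartan : {n : ℕ} → Fin n → Fin n → ℤ
cartan i j =
  if does (toℕ i ℕ.≟ toℕ j) then + 2
  else if does (suc (toℕ i) ℕ.≟ toℕ j) ∨' does (suc (toℕ j) ℕ.≟ toℕ i) then -[1+ 0 ]
  else + 0
  where
  _∨'_ : Bool → Bool → Bool
  true  ∨' _ = true
  false ∨' b = b

Wt : ℕ → Set
Wt n = Fin n → ℤ

_≋_ : {n : ℕ} → Wt n → Wt n → Set
v ≋ w = ∀ j → v j ≡ w j

ω : {n : ℕ} → Fin n → Wt n
ω s j = if does (s Fin.≟ j) then + 1 else + 0

α : {n : ℕ} → Fin n → Wt n
α s j = cartan s j

-- simple reflection: s(v) = v - ⟨v, α_s^∨⟩ α_s, and ⟨v, α_s^∨⟩ = v s
refl-s : {n : ℕ} → Fin n → Wt n → Wt n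
refl-s s v j = v j - v s ℤ.* α s j

act : {n : ℕ} → List (Fin n) → Wt n → Wt n
act []      v = v
act (s ∷ w) v = refl-s s (act w v)

SameElt : {n : ℕ} → List (Fin n) → List (Fin n) → Set
SameElt u v = ∀ x → act u x ≋ act v x

Reduced : {n : ℕ} → List (Fin n) → Set
Reduced u = ∀ v → SameElt u v → length u ≤ length v

IsRedW0 : {n : ℕ} → List (Fin n) → Set
IsRedW0 {n} u = Reduced u × (∀ (v : List (Fin n)) → Reduced v → length v ≤ length u)

IsPosRoot : {n : ℕ} → Wt n → Set
IsPosRoot {n} β =
  (Σ (List (Fin n)) λ w → Σ (Fin n) λ i → act w (α i) ≋ β)
  × (Σ (Fin n → ℕ) λ λ' → β ≋ (λ j → sumℤ (λ i → + λ' i ℤ.* α i j)))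

IsCoxeterWord : {n : ℕ} → Vec (Fin n) n → Set
IsCoxeterWord c = Injective _≡_ _≡_ (lookup c)

-- letter at position p (0-indexed) of the infinite word c c c ⋯
letter : {n : ℕ} .{{_ : NonZero n}} → Vec (Fin n) n → ℕ → Fin n
letter {n} c p = lookup c (p mod n)

data LexLeq : List ℕ → List ℕ → Set where
  lex-[] : ∀ {ys} → LexLeq [] ys
  lex-<  : ∀ {x y xs ys} → x < y → LexLeq (x ∷ xs) (y ∷ ys)
  lex-≡  : ∀ {x xs ys} → LexLeq xs ys → LexLeq (x ∷ xs) (x ∷ ys)

-- ps (strictly increasing positions in c^∞) is the lexicographically
-- first subword of c c c ⋯ that is a reduced word for w∘, i.e. w∘(c)
IsWoc : {n : ℕ} .{{_ : NonZero n}} → Vec (Fin n) n → List ℕ → Set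
IsWoc c ps =
  Linked _<_ ps × IsRedW0 (List.map (letter c) ps)
  × (∀ ps' → Linked _<_ ps' → IsRedW0 (List.map (letter c) ps') → LexLeq ps ps')

Qword : {n : ℕ} .{{_ : NonZero n}} → Vec (Fin n) n → List ℕ → List (Fin n)
Qword c ps = toList c ++ List.map (letter c) ps

_∈ᵇ_ : ℕ → List ℕ → Bool
x ∈ᵇ I = any (λ y → does (x ℕ.≟ y)) I

-- letters of Q (positions counted from `off`) at positions x < k with x ∉ I,
-- in order. Positions are 0-indexed.
prefixFrom : {n : ℕ} → ℕ → List (Fin n) → List ℕ → ℕ → List (Fin n)
prefixFrom off []      I k = []
prefixFrom off (q ∷ Q) I k =
  if does (off ℕ.<? k) ∧ not (off ∈ᵇ I)
  then q ∷ prefixFrom (suc off) Q I k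
  else prefixFrom (suc off) Q I k

Π : {n : ℕ} → List (Fin n) → List ℕ → ℕ → List (Fin n)
Π Q I k = prefixFrom 0 Q I k

deleteAt : {n : ℕ} → List (Fin n) → List ℕ → List (Fin n)
deleteAt Q I = prefixFrom 0 Q I (length Q)

-- facets of S(Q): n-subsets I of positions whose deletion leaves a
-- reduced word for w∘ (I encoded as its strictly increasing list)
IsFacet : {n : ℕ} → List (Fin n) → List ℕ → Set
IsFacet {n} Q I =
  Linked _<_ I × length I ≡ n × All (_< length Q) I × IsRedW0 (deleteAt Q I)

IsGreedy : {n : ℕ} → List (Fin n) → List ℕ → Set
IsGreedy Q I = IsFacet Q I × (∀ J → IsFacet Q J → LexLeq I J)

IsAntigreedy : {n : ℕ} → List (Fin n) → List ℕ → Set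
IsAntigreedy Q I = IsFacet Q I × (∀ J → IsFacet Q J → LexLeq J I)

rootFn : {n : ℕ} (Q : List (Fin n)) → List ℕ → Fin (length Q) → Wt n
rootFn Q I k = act (Π Q I (toℕ k)) (α (List.lookup Q k))

weightFn : {n : ℕ} (Q : List (Fin n)) → List ℕ → Fin (length Q) → Wt n
weightFn Q I k = act (Π Q I (toℕ k)) (ω (List.lookup Q k))

Mono : ℕ → Set
Mono n = Vec ℕ n × Vec ℕ n      -- (x-exponents , y-exponents)

-- a polynomial as a finite list of terms; the coefficient of a monomial
-- is the sum of the coefficients of the terms carrying it
Poly : ℕ → Set
Poly n = List (ℤ × Mono n)

coeff : {n : ℕ} → Poly n → Mono n → ℤ
coeff []              e = + 0
coeff ((a , e') ∷ p) e =
  if does (ProdP.≡-dec (VecP.≡-dec ℕ._≟_) (VecP.≡-dec ℕ._≟_) e' e)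
  then a ℤ.+ coeff p e else coeff p e

_≈P_ : {n : ℕ} → Poly n → Poly n → Set
p ≈P q = ∀ e → coeff p e ≡ coeff q e

_+P_ : {n : ℕ} → Poly n → Poly n → Poly n
p +P q = p ++ q

_*P_ : {n : ℕ} → Poly n → Poly n → Poly n
p *P q = List.concatMap (λ { (a , (ex , ey)) →
           List.map (λ { (b , (fx , fy)) →
             (a ℤ.* b , (Vec.zipWith ℕ._+_ ex fx , Vec.zipWith ℕ._+_ ey fy)) }) q }) p

zeros : {n : ℕ} → Vec ℕ n
zeros = Vec.replicate _ 0

oneP : {n : ℕ} → Poly n
oneP = (+ 1 , (zeros , zeros)) ∷ []

xMono : {n : ℕ} → Vec ℕ n → Poly n
xMono a = (+ 1 , (a , zeros)) ∷ []

yMono : {n : ℕ} → Vec ℕ n → Poly n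
yMono b = (+ 1 , (zeros , b)) ∷ []

xVar : {n : ℕ} → Fin n → Poly n
xVar i = xMono (tabulate (λ j → if does (i Fin.≟ j) then 1 else 0))

Frac : ℕ → Set
Frac n = Poly n × Poly n

_≈F_ : {n : ℕ} → Frac n → Frac n → Set
(a , b) ≈F (c , d) = (a *P d) ≈P (c *P b)

_+F_ : {n : ℕ} → Frac n → Frac n → Frac n
(a , b) +F (c , d) = ((a *P d) +P (c *P b)) , (b *P d)

_*F_ : {n : ℕ} → Frac n → Frac n → Frac n
(a , b) *F (c , d) = (a *P c) , (b *P d)

invF : {n : ℕ} → Frac n → Frac n
invF (a , b) = b , a

oneF : {n : ℕ} → Frac n
oneF = oneP , oneP

powF : {n : ℕ} → Frac n → ℕ → Frac n
powF f zero    = oneF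
powF f (suc m) = f *F powF f m

prodF : {n m : ℕ} → (Fin m → Frac n) → Frac n
prodF {m = zero}  f = oneF
prodF {m = suc m} f = f Fin.zero *F prodF (λ i → f (Fin.suc i))

xPowℤ : {n : ℕ} → (Fin n → ℤ) → Frac n
xPowℤ d = xMono (tabulate (λ i → posℕ (d i))) , xMono (tabulate (λ i → posℕ (- d i)))

-- B_c, rows/columns indexed by positions in the word c
Bc : {n : ℕ} → Vec (Fin n) n → Fin n → Fin n → ℤ
Bc c i j =
  if does (toℕ i ℕ.<? toℕ j) then - cartan (lookup c i) (lookup c j)
  else if does (toℕ j ℕ.<? toℕ i) then cartan (lookup c i) (lookup c j)
  else + 0

record Seed (n : ℕ) : Set where
  field
    cluster : Fin n → Frac n
    B       : Fin n → Fin n → ℤ     -- exchange matrix (top part)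
    C       : Fin n → Fin n → ℤ     -- coefficient rows (bottom part)

initialSeed : {n : ℕ} → Vec (Fin n) n → Seed n
initialSeed c = record
  { cluster = λ i → xVar i , oneP
  ; B = Bc c
  ; C = λ i j → if does (i Fin.≟ j) then + 1 else + 0 }

mutate : {n : ℕ} → Fin n → Seed n → Seed n
mutate {n} k s = record
  { cluster = λ j → if does (j Fin.≟ k) then newx else Seed.cluster s j
  ; B = λ i j → if does (i Fin.≟ k) ∨' does (j Fin.≟ k) then - B i j
                else B i j ℤ.+ sgn (B i k) ℤ.* pos (B i k ℤ.* B k j)
  ; C = λ i j → if does (j Fin.≟ k) then - C i j
                else C i j ℤ.+ sgn (C i k) ℤ.* pos (C i k ℤ.* B k j) }
  where
  B = Seed.B s
  C = Seed.C s
  x = Seed.cluster s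
  _∨'_ : Bool → Bool → Bool
  true  ∨' _ = true
  false ∨' b = b
  ymon : (ℤ → ℕ) → Frac n
  ymon f = yMono (tabulate (λ i → f (C i k))) , oneP
  P⁺ P⁻ : Frac n
  P⁺ = prodF (λ i → powF (x i) (posℕ (B i k))) *F ymon posℕ
  P⁻ = prodF (λ i → powF (x i) (posℕ (- B i k))) *F ymon (λ z → posℕ (- z))
  newx : Frac n
  newx = (P⁺ +F P⁻) *F invF (x k)

mutSeq : {n : ℕ} → Vec (Fin n) n → List (Fin n) → Seed n
mutSeq c []       = initialSeed c
mutSeq c (k ∷ ks) = mutate k (mutSeq c ks)

clusterVar : {n : ℕ} → Vec (Fin n) n → List (Fin n) → Fin n → Frac n
clusterVar c ks j = Seed.cluster (mutSeq c ks) j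

-- u = p / x^d with p a polynomial not divisible by any x_i
-- (so d is the d-vector of u)
HasDenomForm : {n : ℕ} → Frac n → (Fin n → ℤ) → Poly n → Set
HasDenomForm {n} u d p =
  (u *F xPowℤ d) ≈F (p , oneP)
  × (∀ i → ¬ (Σ (Poly n) λ q → p ≈P (xVar i *P q)))

rootComb : {n : ℕ} → Vec (Fin n) n → (Fin n → ℤ) → Wt n
rootComb c d j = sumℤ (λ i → d i ℤ.* α (lookup c i) j)

YPoly : ℕ → Set
YPoly n = List (ℤ × Vec ℕ n)

coeffY : {n : ℕ} → YPoly n → Vec ℕ n → ℤ
coeffY []              e = + 0
coeffY ((a , e') ∷ p) e =
  if does (VecP.≡-dec ℕ._≟_ e' e) then a ℤ.+ coeffY p e else coeffY p e

evalX1 : {n : ℕ} → Poly n → YPoly n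
evalX1 p = List.map (λ { (a , (_ , ey)) → (a , ey) }) p

Vℚ : ℕ → Set
Vℚ n = Fin n → ℚ

toℚv : {n : ℕ} → Wt n → Vℚ n
toℚv v j = v j ℚ./ 1

ConvHull : {n : ℕ} → (Vℚ n → Set) → Vℚ n → Set
ConvHull {n} S v =
  Σ (List (ℚ × Vℚ n)) λ L →
    All (λ tp → (0ℚ ℚ.≤ proj₁ tp) × S (proj₂ tp)) L
    × foldr (λ tp r → proj₁ tp ℚ.+ r) 0ℚ L ≡ 1ℚ
    × (∀ j → foldr (λ tp r → proj₁ tp ℚ.* proj₂ tp j ℚ.+ r) 0ℚ L ≡ v j)

NewtonPts : {n : ℕ} → Vec (Fin n) n → YPoly n → Vℚ n → Set
NewtonPts c F v =
  Σ (Vec ℕ _) λ λ' → (coeffY F λ' ≢ + 0)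
    × (∀ j → v j ≡ toℚv (rootComb c (λ i → + lookup λ' i)) j)

Newton : {n : ℕ} → Vec (Fin n) n → YPoly n → Vℚ n → Set
Newton c F = ConvHull (NewtonPts c F)

FacetPts : {n : ℕ} (Q : List (Fin n)) → List ℕ → Fin (length Q) → Vℚ n → Set
FacetPts Q Iag k v =
  Σ (List ℕ) λ I → IsFacet Q I
    × (∀ j → v j ≡ toℚv (λ j' → weightFn Q I k j' - weightFn Q Iag k j') j)

InNatSpan : {n : ℕ} → Vec (Fin n) n → Wt n → Set
InNatSpan {n} c v = Σ (Fin n → ℕ) λ μ → v ≋ rootComb c (λ i → + μ i)

ExpPts : {n : ℕ} → Vec (Fin n) n → YPoly n → Wt n → Set
ExpPts c F v =
  Σ (Vec ℕ _) λ λ' → (coeffY F λ' ≢ + 0) × (v ≋ rootComb c (λ i → + lookup λ' i))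

module Submission where

-- Call a set of simple roots in the support of β an order ideal if it is closed under the order on adjacent
-- simple roots given by the letters of c; supports of positive roots are intervals.  The exponent vectors of F_β
-- and the differences w(I, k) - w(I_ag, k) are both exactly the indicator vectors of these ideals.
--
-- Facets: the rank array of a permutation v records the coordinates (heights) of all weights v(ω_s).  Let q be the
-- part of w∘(c) before Q_k = s.  For every facet I the heights of Π_{I,k}(ω_s) lie between V, those of the Demazure
-- product of c and q (reached by I_ag), and U, those of q (reached by I_g).  Since w∘(c) is greedy in c c c ⋯, V also
-- gives the heights of q s(ω_s), so U - V is the root r(I_g, k) = β, and comparing U with the letters of c that form V
-- shows that the difference to V is an ideal.  Conversely, the letters of c outside an ideal, completed greedily by
-- w∘(c), are the complement of a facet with that ideal.
--
-- Cluster algebra: seeds are triangulations of the (n + 3)-gon, with B and C given by shear coordinates, and the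
-- initial triangulation consists of nested chords.  Cluster variables are subtraction-free, so they can be
-- evaluated at positive integers and in the tropical semiring.  Tropically, minus the crossing numbers with an
-- initial chord satisfy the Plücker relations, which yields the d-vector; over the integers, weighted 2 × 2
-- determinants of vertex vectors satisfy the exchange relations, which yields F_β as the sum over all ideals.
--
-- Ideals are cut out of the lattice by linear inequalities, so the hull contains no further lattice points.

open import Defs
open import Data.Nat as ℕ using (ℕ; zero; suc; NonZero; _≤_; _<_; z≤n; s≤s)
import Data.Nat.Properties as ℕP
open import Data.Integer as ℤ using (ℤ; +_; -[1+_]; _+_; _*_; _-_; -_; _⊔_; _⊓_)
import Data.Integer.Properties as ℤP
open import Data.Integer.Tactic.RingSolver using (solve-∀)
open import Data.Rational as ℚ using (ℚ; 0ℚ; 1ℚ)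
import Data.Rational.Properties as ℚP
import Data.Rational.Unnormalised as ℚᵘ
import Data.Rational.Unnormalised.Properties as ℚᵘP
import Data.Rational.Solver as ℚS
open import Data.Fin as Fin using (Fin; toℕ; fromℕ<)
import Data.Fin.Properties as FinP
import Data.Fin.Permutation as Perm
import Algebra.Properties.CommutativeMonoid.Sum ℤP.+-0-commutativeMonoid as Sum
open import Data.Vec as Vec using (Vec; []; _∷_; lookup; tabulate; toList)
import Data.Vec.Properties as VecP
import Data.Product.Properties as ProdP
open import Data.List as List using (List; []; _∷_; _++_; _∷ʳ_; length; foldr)
import Data.List.Properties as ListP
open import Data.List.Relation.Unary.All as All using (All; []; _∷_)
import Data.List.Relation.Unary.All.Properties as AllP
open import Data.List.Relation.Unary.Any as Any using (Any; here; there)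
import Data.List.Relation.Unary.Any.Properties as AnyP
open import Data.List.Relation.Unary.Linked using (Linked; []; [-]; _∷_)
open import Data.List.Relation.Binary.Sublist.Propositional using (_⊆_; []; _∷_) renaming (_∷ʳ_ to skip)
open import Data.Product using (Σ; ∃; ∃₂; _×_; _,_; proj₁; proj₂)
open import Data.Sum using (_⊎_; inj₁; inj₂)
open import Data.Empty using (⊥)
open import Data.Unit using (tt)
open import Data.Bool using (T?; Bool; true; false; if_then_else_; _∧_; not; T)
open import Relation.Nullary using (¬_; Dec; yes; no; does; contradiction)
open import Relation.Nullary.Decidable using (dec-true; dec-false; _→-dec_; toWitness)
open import Relation.Binary using (tri<; tri≈; tri>)
open import Relation.Binary.PropositionalEquality
open import Function using (_∘_; Injective; case_of_)
open import Function.Bundles using (_⇔_; mk⇔)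
open import Algebra.Properties.AbelianGroup ℤP.+-0-abelianGroup using () renaming (∙-cancelˡ to +-cancelˡ)

-- Elements of W are hardly ever compared directly. On rank arrays the Demazure product with a
-- simple reflection is a max-plus operation, and left and right multiplication act on different
-- indices and commute by a 3 × 3 interchange law. Larger elements have smaller arrays and w∘ has
-- the smallest, so being a reduced word for w∘ becomes an inequality. Heights are coefficients at
-- simple roots up to a common shift, whereas weights are given in the basis of fundamental weights;
-- the passage is minus a second difference. Inverting it, also for rational convex combinations, is
-- the invertibility of the Cartan matrix (`harmonic`). Fractions are unreduced pairs of
-- polynomials, so cluster variables have no usable normal form and are known only through values.
-- Values at x = 1 and all positive integral y determine F_β, the lowest degree in x_l determines
-- the d-vector, and one induction over mutations follows both. The two halves meet in β: its
-- coefficients at the simple roots are U - V on one side and the d-vector on the other.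

variable
  n : ℕ

Word : ℕ → Set
Word n = List (Fin n)

-- Words act on {0,…,n}: the letter s is the transposition of s and s + 1.

τ : ℕ → ℕ → ℕ
τ zero    zero          = 1
τ zero    (suc zero)    = 0
τ zero    (suc (suc m)) = suc (suc m)
τ (suc s) zero          = zero
τ (suc s) (suc m)       = suc (τ s m)

τ-left : ∀ s → τ s s ≡ suc s
τ-left zero    = refl
τ-left (suc s) = cong suc (τ-left s)

τ-right : ∀ s → τ s (suc s) ≡ s
τ-right zero    = refl
τ-right (suc s) = cong suc (τ-right s)

τ-other : ∀ s m → m ≢ s → m ≢ suc s → τ s m ≡ m
τ-other zero    zero          p q = contradiction refl p
τ-other zero    (suc zero)    p q = contradiction refl q
τ-other zero    (suc (suc m)) p q = refl
τ-other (suc s) zero          p q = refl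
τ-other (suc s) (suc m)       p q = cong suc (τ-other s m (p ∘ cong suc) (q ∘ cong suc))

τ-involutive : ∀ s m → τ s (τ s m) ≡ m
τ-involutive zero    zero          = refl
τ-involutive zero    (suc zero)    = refl
τ-involutive zero    (suc (suc m)) = refl
τ-involutive (suc s) zero          = refl
τ-involutive (suc s) (suc m)       = cong suc (τ-involutive s m)

τ-≤ : ∀ s m k → s < k → m ≤ k → τ s m ≤ k
τ-≤ zero    zero          k s<k m≤k = s<k
τ-≤ zero    (suc zero)    k s<k m≤k = z≤n
τ-≤ zero    (suc (suc m)) k s<k m≤k = m≤k
τ-≤ (suc s) zero          k s<k m≤k = z≤n
τ-≤ (suc s) (suc m) (suc k) (s≤s s<k) (s≤s m≤k) = s≤s (τ-≤ s m k s<k m≤k)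

τ-> : ∀ s m k → s < k → k < m → τ s m ≡ m
τ-> s m k s<k k<m = τ-other s m
  (λ e → ℕP.<-irrefl (sym e) (ℕP.<-trans s<k k<m))
  (λ e → ℕP.<⇒≱ k<m (subst (_≤ k) (sym e) s<k))

-- A non-inverted pair that a transposition inverts is the transposed pair itself.
τ-inverts : ∀ t a b → a < b → τ t b < τ t a → a ≡ t × b ≡ suc t
τ-inverts zero zero (suc zero) p q = refl , refl
τ-inverts zero zero (suc (suc b)) p (s≤s ())
τ-inverts zero (suc zero) (suc (suc b)) p ()
τ-inverts zero (suc zero) (suc zero) (s≤s ()) q
τ-inverts zero (suc (suc a)) (suc zero) (s≤s ()) q
τ-inverts zero (suc (suc a)) (suc (suc b)) p q = contradiction (ℕP.<-trans p q) (ℕP.<-irrefl refl)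
τ-inverts (suc t) zero (suc b) p ()
τ-inverts (suc t) (suc a) (suc b) (s≤s p) (s≤s q) with τ-inverts t a b p q
... | refl , refl = refl , refl

n≢1+n : ∀ {m} → m ≢ suc m
n≢1+n e = ℕP.1+n≢n (sym e)

n≢2+n : ∀ {m} → m ≢ suc (suc m)
n≢2+n {m} e = ℕP.<-irrefl e (ℕP.<-trans (ℕP.n<1+n m) (ℕP.n<1+n (suc m)))

perm : Word n → ℕ → ℕ
perm []      m = m
perm (s ∷ w) m = τ (toℕ s) (perm w m)

perm⁻¹ : Word n → ℕ → ℕ
perm⁻¹ []      m = m
perm⁻¹ (s ∷ w) m = perm⁻¹ w (τ (toℕ s) m)

perm-++ : (u v : Word n) → ∀ m → perm (u ++ v) m ≡ perm u (perm v m)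
perm-++ []      v m = refl
perm-++ (s ∷ u) v m = cong (τ (toℕ s)) (perm-++ u v m)

perm-perm⁻¹ : (w : Word n) → ∀ m → perm w (perm⁻¹ w m) ≡ m
perm-perm⁻¹ []      m = refl
perm-perm⁻¹ (s ∷ w) m =
  trans (cong (τ (toℕ s)) (perm-perm⁻¹ w _)) (τ-involutive (toℕ s) m)

perm⁻¹-perm : (w : Word n) → ∀ m → perm⁻¹ w (perm w m) ≡ m
perm⁻¹-perm []      m = refl
perm⁻¹-perm (s ∷ w) m =
  trans (cong (perm⁻¹ w) (τ-involutive (toℕ s) _)) (perm⁻¹-perm w m)

perm-injective : (w : Word n) → ∀ {a b} → perm w a ≡ perm w b → a ≡ b
perm-injective w {a} {b} e =
  trans (sym (perm⁻¹-perm w a)) (trans (cong (perm⁻¹ w) e) (perm⁻¹-perm w b))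

perm-≤ : (w : Word n) → ∀ m → m ≤ n → perm w m ≤ n
perm-≤ []      m m≤n = m≤n
perm-≤ (s ∷ w) m m≤n = τ-≤ (toℕ s) _ _ (FinP.toℕ<n s) (perm-≤ w m m≤n)

perm⁻¹-> : (w : Word n) → ∀ m → n < m → perm⁻¹ w m ≡ m
perm⁻¹-> []      m n<m = refl
perm⁻¹-> (s ∷ w) m n<m rewrite τ-> (toℕ s) m _ (FinP.toℕ<n s) n<m = perm⁻¹-> w m n<m

_≃_ : Word n → Word n → Set
u ≃ v = ∀ m → perm u m ≡ perm v m

≃⇒perm⁻¹ : (u v : Word n) → u ≃ v → ∀ m → perm⁻¹ u m ≡ perm⁻¹ v m
≃⇒perm⁻¹ u v e m =
  trans (sym (cong (perm⁻¹ u) (perm-perm⁻¹ v m)))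
  (trans (cong (perm⁻¹ u) (sym (e _))) (perm⁻¹-perm u _))

perm⁻¹⇒≃ : (u v : Word n) → (∀ m → perm⁻¹ u m ≡ perm⁻¹ v m) → u ≃ v
perm⁻¹⇒≃ u v e m =
  trans (sym (perm-perm⁻¹ v _)) (trans (cong (perm v) (sym (e _))) (cong (perm v) (perm⁻¹-perm u m)))

≃-++ : (u u' v v' : Word n) → u ≃ u' → v ≃ v' → (u ++ v) ≃ (u' ++ v')
≃-++ u u' v v' e f m =
  trans (perm-++ u v m) (trans (cong (perm u) (f m)) (trans (e _) (sym (perm-++ u' v' m))))

-- The Cartan matrix and the action on weights

data Near (a b : ℕ) : Set where
  near-eq    : a ≡ b → Near a b
  near-below : suc a ≡ b → Near a b
  near-above : suc b ≡ a → Near a b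
  near-far   : a ≢ b → suc a ≢ b → suc b ≢ a → Near a b

near : ∀ a b → Near a b
near a b with a ℕ.≟ b | suc a ℕ.≟ b | suc b ℕ.≟ a
... | yes p | _ | _ = near-eq p
... | no p | yes q | _ = near-below q
... | no p | no q | yes r = near-above r
... | no p | no q | no r = near-far p q r

cartan-same : (i j : Fin n) → toℕ i ≡ toℕ j → cartan i j ≡ + 2
cartan-same i j e rewrite dec-true (toℕ i ℕ.≟ toℕ j) e = refl

cartan-below : (i j : Fin n) → suc (toℕ i) ≡ toℕ j → cartan i j ≡ -[1+ 0 ]
cartan-below i j e
  rewrite dec-false (toℕ i ℕ.≟ toℕ j) (λ p → ℕP.1+n≢n (trans e (sym p)))
        | dec-true (suc (toℕ i) ℕ.≟ toℕ j) e = refl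

cartan-above : (i j : Fin n) → suc (toℕ j) ≡ toℕ i → cartan i j ≡ -[1+ 0 ]
cartan-above i j e
  rewrite dec-false (toℕ i ℕ.≟ toℕ j) (λ p → ℕP.1+n≢n (trans e p))
        | dec-false (suc (toℕ i) ℕ.≟ toℕ j) (λ p → ℕP.<-asym (ℕP.≤-reflexive p) (ℕP.≤-reflexive e))
        | dec-true (suc (toℕ j) ℕ.≟ toℕ i) e = refl

cartan-far : (i j : Fin n) → toℕ i ≢ toℕ j → suc (toℕ i) ≢ toℕ j → suc (toℕ j) ≢ toℕ i →
  cartan i j ≡ + 0
cartan-far i j p q r
  rewrite dec-false (toℕ i ℕ.≟ toℕ j) p
        | dec-false (suc (toℕ i) ℕ.≟ toℕ j) q
        | dec-false (suc (toℕ j) ℕ.≟ toℕ i) r = refl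

-- In the permutation representation with coordinates `Y 0`, ..., `Y n` a weight is the sequence of
-- successive differences, and a simple reflection swaps two coordinates. The cases of `Near` are
-- the possible entries of a Cartan row: 2, -1 on either side, and 0.
refl-s-lift : (s : Fin n) (Y : ℕ → ℤ) (v : Wt n) → (∀ j → v j ≡ Y (toℕ j) - Y (suc (toℕ j))) →
  ∀ j → refl-s s v j ≡ Y (τ (toℕ s) (toℕ j)) - Y (τ (toℕ s) (suc (toℕ j)))
refl-s-lift s Y v e j rewrite e j | e s with near (toℕ s) (toℕ j)
... | near-eq p rewrite cartan-same s j p | sym p | τ-left (toℕ s) | τ-right (toℕ s) =
  lem (Y (toℕ s)) (Y (suc (toℕ s)))
  where
  lem : ∀ a b → a - b - (a - b) * + 2 ≡ b - a
  lem = solve-∀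
... | near-below p rewrite cartan-below s j p | sym p | τ-right (toℕ s)
      | τ-other (toℕ s) (suc (suc (toℕ s))) (n≢2+n ∘ sym) (n≢1+n ∘ sym) =
  lem (Y (toℕ s)) (Y (suc (toℕ s))) (Y (suc (suc (toℕ s))))
  where
  lem : ∀ a b c → b - c - (a - b) * -[1+ 0 ] ≡ a - c
  lem = solve-∀
... | near-above p rewrite cartan-above s j p | sym p | τ-left (suc (toℕ j))
      | τ-other (suc (toℕ j)) (toℕ j) n≢1+n n≢2+n =
  lem (Y (toℕ j)) (Y (suc (toℕ j))) (Y (suc (suc (toℕ j))))
  where
  lem : ∀ a b c → a - b - (b - c) * -[1+ 0 ] ≡ a - c
  lem = solve-∀
... | near-far p q r rewrite cartan-far s j p q r
      | τ-other (toℕ s) (toℕ j) (p ∘ sym) (q ∘ sym)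
      | τ-other (toℕ s) (suc (toℕ j)) (r) (p ∘ sym ∘ ℕP.suc-injective) =
  lem (Y (toℕ j)) (Y (suc (toℕ j))) (Y (toℕ s) - Y (suc (toℕ s)))
  where
  lem : ∀ a b c → a - b - c * + 0 ≡ a - b
  lem = solve-∀

-- The inverse appears because words act on the coordinates by precomposition.
act-lift : (w : Word n) (X : ℕ → ℤ) (v : Wt n) → (∀ j → v j ≡ X (toℕ j) - X (suc (toℕ j))) →
  ∀ j → act w v j ≡ X (perm⁻¹ w (toℕ j)) - X (perm⁻¹ w (suc (toℕ j)))
act-lift []      X v e = e
act-lift (s ∷ w) X v e = refl-s-lift s (X ∘ perm⁻¹ w) (act w v) (act-lift w X v e)

potential : Wt n → ℕ → ℤ
potential {zero}  v i       = + 0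
potential {suc n} v zero    = + 0
potential {suc n} v (suc i) = potential (v ∘ Fin.suc) i - v Fin.zero

potential-zero : (v : Wt n) → potential v 0 ≡ + 0
potential-zero {zero}  v = refl
potential-zero {suc n} v = refl

potential-diff : (v : Wt n) → ∀ j → v j ≡ potential v (toℕ j) - potential v (suc (toℕ j))
potential-diff {suc n} v Fin.zero rewrite potential-zero (v ∘ Fin.suc) = lem (v Fin.zero)
  where
  lem : ∀ a → a ≡ + 0 - (+ 0 - a)
  lem = solve-∀
potential-diff {suc n} v (Fin.suc j) =
  trans (potential-diff (v ∘ Fin.suc) j)
    (lem (potential (v ∘ Fin.suc) (toℕ j)) (potential (v ∘ Fin.suc) (suc (toℕ j))) (v Fin.zero))
  where
  lem : ∀ a b c → a - b ≡ (a - c) - (b - c)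
  lem = solve-∀

≃⇒SameElt : (u v : Word n) → u ≃ v → SameElt u v
≃⇒SameElt u v e x j
  rewrite act-lift u (potential x) x (potential-diff x) j
        | act-lift v (potential x) x (potential-diff x) j
        | ≃⇒perm⁻¹ u v e (toℕ j) | ≃⇒perm⁻¹ u v e (suc (toℕ j)) = refl

-- It suffices to act on the sum of the fundamental weights, whose lift `- i` is injective: the
-- inverse permutations then have equal differences on {0,...,n} and differ there by a constant `K`.
-- Both take the value 0 and have no negative values, which forces `K` to be 0.
SameElt⇒≃ : (u v : Word n) → SameElt u v → u ≃ v
SameElt⇒≃ {n} u v e = perm⁻¹⇒≃ u v same-inverse
  where
  f g : ℕ → ℤ
  f m = + perm⁻¹ u m
  g m = + perm⁻¹ v m
  ones : ∀ (j : Fin n) → + 1 ≡ - + toℕ j - - + suc (toℕ j)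
  ones j = trans (lem (+ toℕ j)) (cong (λ z → - + toℕ j - - z) (ℤP.pos-+ 1 (toℕ j)))
    where
    lem : ∀ a → + 1 ≡ - a - - (+ 1 + a)
    lem = solve-∀
  step : ∀ (j : Fin n) → f (suc (toℕ j)) - f (toℕ j) ≡ g (suc (toℕ j)) - g (toℕ j)
  step j = trans (lem (f (suc (toℕ j))) (f (toℕ j))) (trans
      (trans (sym (act-lift u (λ i → - + i) _ ones j)) (trans (e _ j) (act-lift v (λ i → - + i) _ ones j)))
      (sym (lem (g (suc (toℕ j))) (g (toℕ j)))))
    where
    lem : ∀ a b → a - b ≡ - b - - a
    lem = solve-∀
  K : ℤ
  K = f 0 - g 0
  const : ∀ m → m ≤ n → f m ≡ g m + K
  const zero    _   = lem (f 0) (g 0)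
    where
    lem : ∀ a b → a ≡ b + (a - b)
    lem = solve-∀
  const (suc m) m<n = trans (lem₁ (f (suc m)) (f m))
    (trans (cong₂ _+_ (subst (λ i → f (suc i) - f i ≡ g (suc i) - g i) (FinP.toℕ-fromℕ< m<n) (step (fromℕ< m<n)))
      (const m (ℕP.<⇒≤ m<n))) (lem₂ (g (suc m)) (g m) K))
    where
    lem₁ : ∀ a b → a ≡ (a - b) + b
    lem₁ = solve-∀
    lem₂ : ∀ a b c → (a - b) + (b + c) ≡ a + c
    lem₂ = solve-∀
  K≥0 : + 0 ℤ.≤ K
  K≥0 = subst (+ 0 ℤ.≤_) (trans (const (perm v 0) (perm-≤ v 0 z≤n))
    (trans (cong (λ z → + z + K) (perm⁻¹-perm v 0)) (ℤP.+-identityˡ K))) (ℤ.+≤+ z≤n)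
  K≤0 : K ℤ.≤ + 0
  K≤0 = subst (ℤ._≤ + 0) (sym (lem (g (perm u 0)) K
      (trans (sym (cong +_ (perm⁻¹-perm u 0))) (const (perm u 0) (perm-≤ u 0 z≤n))))) (ℤP.neg-mono-≤ (ℤ.+≤+ z≤n))
    where
    lem : ∀ a k → + 0 ≡ a + k → k ≡ - a
    lem a k h = trans (l₁ a k) (trans (cong (_- a) (sym h)) (ℤP.+-identityˡ (- a)))
      where
      l₁ : ∀ a k → k ≡ (a + k) - a
      l₁ = solve-∀
  same-inverse : ∀ m → perm⁻¹ u m ≡ perm⁻¹ v m
  same-inverse m with ℕP.≤-<-connex m n
  ... | inj₁ m≤n = ℤP.+-injective (trans (const m m≤n)
          (trans (cong (_+_ (g m)) (ℤP.≤-antisym K≤0 K≥0)) (ℤP.+-identityʳ (g m))))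
  ... | inj₂ n<m = trans (perm⁻¹-> u m n<m) (sym (perm⁻¹-> v m n<m))

-- Exchange and reduced words

-- Reading the word from the right, some letter `t` is the first to turn s and s + 1 into an
-- inversion. By `τ-inverts` it swaps exactly the two values there, so deleting `t` has the same
-- effect as appending `s`.
exchange : (v : Word n) (s : Fin n) → perm v (suc (toℕ s)) < perm v (toℕ s) →
  ∃ λ v' → length v ≡ suc (length v') × v' ≃ (v ∷ʳ s)
exchange [] s p = contradiction (ℕP.<-trans p (ℕP.n<1+n _)) (ℕP.<-irrefl refl)
exchange (t ∷ v) s p with ℕP.<-cmp (perm v (toℕ s)) (perm v (suc (toℕ s)))
... | tri> _ _ q with exchange v s q
...   | v' , l , e = t ∷ v' , cong suc l , λ m → cong (τ (toℕ t)) (e m)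
exchange (t ∷ v) s p | tri≈ _ q _ = contradiction (perm-injective v q) n≢1+n
exchange (t ∷ v) s p | tri< q _ _ with τ-inverts (toℕ t) _ _ q p
... | es , et = v , refl , λ m → sym (trans (cong (τ (toℕ t)) (perm-++ v (s ∷ []) m)) (main m))
  where
  main : ∀ m → τ (toℕ t) (perm v (τ (toℕ s) m)) ≡ perm v m
  main m with m ℕ.≟ toℕ s | m ℕ.≟ suc (toℕ s)
  ... | yes refl | _ rewrite τ-left (toℕ s) | et | es = τ-right (toℕ t)
  ... | no _ | yes refl rewrite τ-right (toℕ s) | et | es = τ-left (toℕ t)
  ... | no a | no b rewrite τ-other (toℕ s) m a b =
        τ-other (toℕ t) _ (λ c → a (perm-injective v (trans c (sym es))))
                          (λ c → b (perm-injective v (trans c (sym et))))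

Reduced-prefix : (u v : Word n) → Reduced (u ++ v) → Reduced u
Reduced-prefix u v R u' e = ℕP.+-cancelʳ-≤ (length v) _ _
  (subst₂ _≤_ (ListP.length-++ u) (ListP.length-++ u')
    (R (u' ++ v) (≃⇒SameElt (u ++ v) (u' ++ v) (≃-++ u u' v v (SameElt⇒≃ u u' e) (λ _ → refl)))))

length-∷ʳ : (w : Word n) (s : Fin n) → length (w ∷ʳ s) ≡ suc (length w)
length-∷ʳ w s = trans (ListP.length-++ w) (ℕP.+-comm (length w) 1)

perm-∷ʳ-left : (w : Word n) (s : Fin n) → perm (w ∷ʳ s) (toℕ s) ≡ perm w (suc (toℕ s))
perm-∷ʳ-left w s = trans (perm-++ w _ _) (cong (perm w) (τ-left (toℕ s)))

perm-∷ʳ-right : (w : Word n) (s : Fin n) → perm (w ∷ʳ s) (suc (toℕ s)) ≡ perm w (toℕ s)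
perm-∷ʳ-right w s = trans (perm-++ w _ _) (cong (perm w) (τ-right (toℕ s)))

Ascent Descent : Word n → Fin n → Set
Ascent  w s = perm w (toℕ s) < perm w (suc (toℕ s))
Descent w s = perm w (suc (toℕ s)) < perm w (toℕ s)

ascent? : (w : Word n) (s : Fin n) → Ascent w s ⊎ Descent w s
ascent? w s with ℕP.<-cmp (perm w (toℕ s)) (perm w (suc (toℕ s)))
... | tri< p _ _ = inj₁ p
... | tri≈ _ p _ = contradiction (perm-injective w p) n≢1+n
... | tri> _ _ p = inj₂ p

Reduced⇒Ascent : (w : Word n) (s : Fin n) → Reduced (w ∷ʳ s) → Ascent w s
Reduced⇒Ascent w s R with ascent? w s
... | inj₁ p = p
... | inj₂ p with exchange w s p
...   | w' , l , e = contradiction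
        (R w' (≃⇒SameElt (w ∷ʳ s) w' (λ m → sym (e m))))
        (ℕP.<⇒≱ (subst₂ _<_ refl (sym (trans (length-∷ʳ w s) (cong suc l)))
          (ℕP.<-trans (ℕP.n<1+n _) (ℕP.n<1+n _))))

-- A competitor `v` for `w ∷ʳ s` has a descent at `s`, so `exchange` turns it into a word for `w`
-- that is shorter by one letter, and `w` is reduced.
Ascent⇒Reduced : (w : Word n) (s : Fin n) → Reduced w → Ascent w s → Reduced (w ∷ʳ s)
Ascent⇒Reduced w s R p v e with exchange v s
  (subst₂ _<_ (trans (sym (perm-∷ʳ-right w s)) (SameElt⇒≃ (w ∷ʳ s) v e _))
              (trans (sym (perm-∷ʳ-left w s)) (SameElt⇒≃ (w ∷ʳ s) v e _)) p)
... | v' , l , f = subst₂ _≤_ (sym (length-∷ʳ w s)) (sym l) (s≤s (R v' (≃⇒SameElt w v' w≃v')))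
  where
  w≃v' : w ≃ v'
  w≃v' m = sym (trans (f m) (trans (perm-++ v (s ∷ []) m)
    (trans (sym (SameElt⇒≃ (w ∷ʳ s) v e _)) (trans (perm-++ w (s ∷ []) _) (cong (perm w) (τ-involutive (toℕ s) m))))))

Reduced-[] : Reduced {n} []
Reduced-[] v e = z≤n

-- Rank arrays: ρ w j i counts the j' < j with perm w j' < i.

𝟙 : ℕ → ℕ → ℤ
𝟙 v       zero    = + 0
𝟙 zero    (suc i) = + 1
𝟙 (suc v) (suc i) = 𝟙 v i

-- `τ s v < s + 1` means `v < s` or `v = s + 1`, and the indicator of the latter is a difference of
-- two indicators. This is the origin of `lin`.
𝟙-τ-hit : ∀ s v → 𝟙 (τ s v) (suc s) ≡ 𝟙 v s + 𝟙 v (suc (suc s)) - 𝟙 v (suc s)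
𝟙-τ-hit zero    zero          = refl
𝟙-τ-hit zero    (suc zero)    = refl
𝟙-τ-hit zero    (suc (suc v)) = refl
𝟙-τ-hit (suc s) zero          = refl
𝟙-τ-hit (suc s) (suc v)       = 𝟙-τ-hit s v

𝟙-τ-miss : ∀ s v i → i ≢ suc s → 𝟙 (τ s v) i ≡ 𝟙 v i
𝟙-τ-miss s       v             zero          p = refl
𝟙-τ-miss zero    v             (suc zero)    p = contradiction refl p
𝟙-τ-miss zero    zero          (suc (suc i)) p = refl
𝟙-τ-miss zero    (suc zero)    (suc (suc i)) p = refl
𝟙-τ-miss zero    (suc (suc v)) (suc (suc i)) p = refl
𝟙-τ-miss (suc s) zero          (suc i)       p = refl
𝟙-τ-miss (suc s) (suc v)       (suc i)       p = 𝟙-τ-miss s v i (p ∘ cong suc)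

𝟙-bit : ∀ v i → 𝟙 v i ≡ + 0 ⊎ 𝟙 v i ≡ + 1
𝟙-bit v       zero    = inj₁ refl
𝟙-bit zero    (suc i) = inj₂ refl
𝟙-bit (suc v) (suc i) = 𝟙-bit v i

-- The combination (0 , 1) is missing: a bound that excludes the smaller of two numbers also
-- excludes the larger.
data Pair (p q : ℤ) : Set where
  00′ : p ≡ + 0 → q ≡ + 0 → Pair p q
  10′ : p ≡ + 1 → q ≡ + 0 → Pair p q
  11′ : p ≡ + 1 → q ≡ + 1 → Pair p q

𝟙-anti : ∀ v w i → v < w → Pair (𝟙 v i) (𝟙 w i)
𝟙-anti v       w       zero    p       = 00′ refl refl
𝟙-anti zero    (suc w) (suc i) p with 𝟙-bit w i
... | inj₁ e = 10′ refl e
... | inj₂ e = 11′ refl e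
𝟙-anti (suc v) (suc w) (suc i) (s≤s p) = 𝟙-anti v w i p

𝟙-injective : ∀ a b → (∀ i → 𝟙 a i ≡ 𝟙 b i) → a ≡ b
𝟙-injective zero    zero    h = refl
𝟙-injective zero    (suc b) h = contradiction (h 1) (λ ())
𝟙-injective (suc a) zero    h = contradiction (h 1) (λ ())
𝟙-injective (suc a) (suc b) h = cong suc (𝟙-injective a b (h ∘ suc))

Arr : Set
Arr = ℕ → ℕ → ℤ

_≗A_ _≤A_ : Arr → Arr → Set
a ≗A b = ∀ j i → a j i ≡ b j i
a ≤A b = ∀ j i → a j i ℤ.≤ b j i

set : ℕ → ℤ → (ℕ → ℤ) → ℕ → ℤ
set t x h j = if does (j ℕ.≟ t) then x else h j

set-hit : ∀ t x h → set t x h t ≡ x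
set-hit t x h rewrite dec-true (t ℕ.≟ t) refl = refl

set-miss : ∀ t x h j → j ≢ t → set t x h j ≡ h j
set-miss t x h j p rewrite dec-false (j ℕ.≟ t) p = refl

Op : Set
Op = ℤ → ℤ → ℤ → ℤ

-- lin describes multiplication by a simple reflection, trop the Demazure product with it, and
-- mn right multiplication when it decreases the length.
lin trop mn : Op
lin  l m r = l + r - m
trop l m r = l ⊔ (r - + 1)
mn   l m r = (l + + 1) ⊓ r

-- Columns stand for bounds on values and rows for bounds on positions, so left multiplication by
-- `s` rewrites column s + 1 and right multiplication rewrites row s + 1.
L R : Op → ℕ → Arr → Arr
L f s a j   = set (suc s) (f (a j s) (a j (suc s)) (a j (suc (suc s)))) (a j)
R f s a j i = set (suc s) (f (a s i) (a (suc s) i) (a (suc (suc s)) i)) (λ j → a j i) j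

L-hit : ∀ f s a j → L f s a j (suc s) ≡ f (a j s) (a j (suc s)) (a j (suc (suc s)))
L-hit f s a j = set-hit (suc s) _ (a j)

L-miss : ∀ f s a j i → i ≢ suc s → L f s a j i ≡ a j i
L-miss f s a j i = set-miss (suc s) _ (a j) i

R-hit : ∀ f s a i → R f s a (suc s) i ≡ f (a s i) (a (suc s) i) (a (suc (suc s)) i)
R-hit f s a i = set-hit (suc s) _ (λ j → a j i)

R-miss : ∀ f s a j i → j ≢ suc s → R f s a j i ≡ a j i
R-miss f s a j i = set-miss (suc s) _ (λ j → a j i) j

cong₃ : (f : Op) → ∀ {a b c a' b' c'} → a ≡ a' → b ≡ b' → c ≡ c' → f a b c ≡ f a' b' c'
cong₃ f refl refl refl = refl

L-cong : ∀ f s {a b} → a ≗A b → L f s a ≗A L f s b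
L-cong f s {a} {b} e j i with i ℕ.≟ suc s
... | yes refl = trans (L-hit f s a j) (trans (cong₃ f (e _ _) (e _ _) (e _ _)) (sym (L-hit f s b j)))
... | no p = trans (L-miss f s a j i p) (trans (e j i) (sym (L-miss f s b j i p)))

R-cong : ∀ f s {a b} → a ≗A b → R f s a ≗A R f s b
R-cong f s {a} {b} e j i with j ℕ.≟ suc s
... | yes refl = trans (R-hit f s a i) (trans (cong₃ f (e _ _) (e _ _) (e _ _)) (sym (R-hit f s b i)))
... | no p = trans (R-miss f s a j i p) (trans (e j i) (sym (R-miss f s b j i p)))

-- `swap` says that a 3 × 3 block may be combined first along rows or first along columns. `idem`
-- and `line` fix the identity array off the diagonal, where three consecutive entries are constant
-- or increase by one.
record Interchange (f : Op) : Set where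
  field
    swap : ∀ a b c d e g h i j →
      f (f a b c) (f d e g) (f h i j) ≡ f (f a d h) (f b e i) (f c g j)
    idem : ∀ a → f a a a ≡ a
    line : ∀ s → f (+ s) (+ suc s) (+ suc (suc s)) ≡ + suc s

lin-interchange : Interchange lin
lin-interchange = record { swap = sw ; idem = idm ; line = ln }
  where
  sw : ∀ a b c d e g h i j → (a + c - b) + (h + j - i) - (d + g - e) ≡ (a + h - d) + (c + j - g) - (b + i - e)
  sw = solve-∀
  idm : ∀ a → a + a - a ≡ a
  idm = solve-∀
  ln : ∀ s → + s + + suc (suc s) - + suc s ≡ + suc s
  ln s rewrite ℤP.pos-+ 1 (suc s) | ℤP.pos-+ 1 s = lem (+ s)
    where
    lem : ∀ s → s + (+ 1 + (+ 1 + s)) - (+ 1 + s) ≡ + 1 + s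
    lem = solve-∀

trop-interchange : Interchange trop
trop-interchange = record { swap = sw ; idem = idm ; line = ln }
  where
  open import Algebra.Properties.CommutativeSemigroup ℤP.⊔-commutativeSemigroup using (interchange)
  dist : ∀ x y → (x ⊔ y) - + 1 ≡ (x - + 1) ⊔ (y - + 1)
  dist = ℤP.mono-≤-distrib-⊔ (ℤP.+-monoˡ-≤ (- + 1))
  sw : ∀ a b c d e g h i j →
    (a ⊔ (c - + 1)) ⊔ ((h ⊔ (j - + 1)) - + 1) ≡ (a ⊔ (h - + 1)) ⊔ ((c ⊔ (j - + 1)) - + 1)
  sw a b c d e g h i j rewrite dist h (j - + 1) | dist c (j - + 1) =
    interchange a (c - + 1) (h - + 1) ((j - + 1) - + 1)
  idm : ∀ a → a ⊔ (a - + 1) ≡ a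
  idm a = ℤP.i≥j⇒i⊔j≡i (ℤP.i-j≤i a (+ 1))
  ln : ∀ s → + s ⊔ (+ suc (suc s) - + 1) ≡ + suc s
  ln s = ℤP.i≤j⇒i⊔j≡j (ℤ.+≤+ (ℕP.n≤1+n s))

L-R-commute : ∀ {f} → Interchange f → ∀ s t a → L f s (R f t a) ≗A R f t (L f s a)
L-R-commute {f} F s t a j i with i ℕ.≟ suc s | j ℕ.≟ suc t
... | yes refl | yes refl = trans (L-hit f s (R f t a) (suc t)) (trans
      (trans (cong₃ f (R-hit f t a _) (R-hit f t a _) (R-hit f t a _))
        (trans (Interchange.swap F _ _ _ _ _ _ _ _ _)
          (sym (cong₃ f (L-hit f s a _) (L-hit f s a _) (L-hit f s a _)))))
      (sym (R-hit f t (L f s a) (suc s))))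
... | yes refl | no q = trans (L-hit f s (R f t a) j) (trans
      (cong₃ f (R-miss f t a j _ q) (R-miss f t a j _ q) (R-miss f t a j _ q))
      (trans (sym (L-hit f s a j)) (sym (R-miss f t (L f s a) j _ q))))
... | no p | yes refl = trans (L-miss f s (R f t a) (suc t) i p) (trans (R-hit f t a i)
      (trans (sym (cong₃ f (L-miss f s a _ i p) (L-miss f s a _ i p) (L-miss f s a _ i p)))
        (sym (R-hit f t (L f s a) i))))
... | no p | no q = trans (L-miss f s (R f t a) j i p) (trans (R-miss f t a j i q)
      (trans (sym (L-miss f s a j i p)) (sym (R-miss f t (L f s a) j i q))))

id-arr : Arr
id-arr j i = + (j ℕ.⊓ i)

id-line : ∀ {f} → Interchange f → ∀ j s → j ≢ suc s →
  f (id-arr j s) (id-arr j (suc s)) (id-arr j (suc (suc s))) ≡ id-arr j (suc s)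
id-line {f} F j s p with ℕP.<-cmp j (suc s)
... | tri< (s≤s j≤s) _ _ rewrite ℕP.m≤n⇒m⊓n≡m j≤s | ℕP.m≤n⇒m⊓n≡m (ℕP.m≤n⇒m≤1+n j≤s)
      | ℕP.m≤n⇒m⊓n≡m (ℕP.m≤n⇒m≤1+n (ℕP.m≤n⇒m≤1+n j≤s)) = Interchange.idem F (+ j)
... | tri≈ _ q _ = contradiction q p
... | tri> _ _ q rewrite ℕP.m≥n⇒m⊓n≡n q | ℕP.m≥n⇒m⊓n≡n (ℕP.<⇒≤ q)
      | ℕP.m≥n⇒m⊓n≡n (ℕP.<⇒≤ (ℕP.<⇒≤ q)) = Interchange.line F s

L-R-id : ∀ {f} → Interchange f → ∀ s → L f s id-arr ≗A R f s id-arr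
L-R-id {f} F s j i with i ℕ.≟ suc s | j ℕ.≟ suc s
... | yes refl | yes refl = trans (L-hit f s id-arr (suc s)) (trans
      (cong₃ f (comm (suc s) s) (comm (suc s) (suc s)) (comm (suc s) (suc (suc s))))
      (sym (R-hit f s id-arr (suc s))))
  where
  comm : ∀ a b → id-arr a b ≡ id-arr b a
  comm a b = cong +_ (ℕP.⊓-comm a b)
... | yes refl | no q = trans (L-hit f s id-arr j) (trans (id-line F j s q) (sym (R-miss f s id-arr j (suc s) q)))
... | no p | yes refl = trans (L-miss f s id-arr (suc s) i p) (sym (trans (R-hit f s id-arr i)
      (trans (cong₃ f (comm s i) (comm (suc s) i) (comm (suc (suc s)) i)) (trans (id-line F i s p) (comm i (suc s))))))
  where
  comm : ∀ a b → id-arr a b ≡ id-arr b a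
  comm a b = cong +_ (ℕP.⊓-comm a b)
... | no p | no q = trans (L-miss f s id-arr j i p) (sym (R-miss f s id-arr j i q))

arr : Op → Word n → Arr
arr f []      = id-arr
arr f (s ∷ w) = L f (toℕ s) (arr f w)

-- Arrays are built from the left but can be extended on the right. For `trop` this is the
-- associativity of the Demazure product, obtained without defining that product on permutations.
arr-∷ʳ : ∀ {f} → Interchange f → (w : Word n) (s : Fin n) → arr f (w ∷ʳ s) ≗A R f (toℕ s) (arr f w)
arr-∷ʳ F []      s j i = L-R-id F (toℕ s) j i
arr-∷ʳ {f = f} F (t ∷ w) s j i =
  trans (L-cong f (toℕ t) (arr-∷ʳ F w s) j i) (L-R-commute F (toℕ t) (toℕ s) (arr f w) j i)

ρ Dem : Word n → Arr
ρ   = arr lin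
Dem = arr trop

ρ-∷ʳ : (w : Word n) (s : Fin n) → ρ (w ∷ʳ s) ≗A R lin (toℕ s) (ρ w)
ρ-∷ʳ = arr-∷ʳ lin-interchange

Dem-∷ʳ : (w : Word n) (s : Fin n) → Dem (w ∷ʳ s) ≗A R trop (toℕ s) (Dem w)
Dem-∷ʳ = arr-∷ʳ trop-interchange

id-step : ∀ j i → + (suc j ℕ.⊓ i) ≡ + (j ℕ.⊓ i) + 𝟙 j i
id-step j       zero    rewrite ℕP.⊓-zeroʳ j = refl
id-step zero    (suc i) = refl
id-step (suc j) (suc i) = trans (cong (_+_ (+ 1)) (id-step j i))
  (sym (ℤP.+-assoc (+ 1) (+ (j ℕ.⊓ i)) (𝟙 j i)))

ρ-row : (w : Word n) → ∀ j i → ρ w (suc j) i ≡ ρ w j i + 𝟙 (perm w j) i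
ρ-row []      j i = id-step j i
ρ-row (s ∷ w) j i with i ℕ.≟ suc (toℕ s)
... | yes refl rewrite L-hit lin (toℕ s) (ρ w) j | L-hit lin (toℕ s) (ρ w) (suc j)
      | 𝟙-τ-hit (toℕ s) (perm w j)
      | ρ-row w j (toℕ s) | ρ-row w j (suc (toℕ s)) | ρ-row w j (suc (suc (toℕ s))) =
  lem (ρ w j (toℕ s)) _ (ρ w j (suc (suc (toℕ s)))) _ (ρ w j (suc (toℕ s))) _
  where
  lem : ∀ a b c d e f → (a + b) + (c + d) - (e + f) ≡ (a + c - e) + (b + d - f)
  lem = solve-∀
... | no p rewrite L-miss lin (toℕ s) (ρ w) j i p | L-miss lin (toℕ s) (ρ w) (suc j) i p
      | 𝟙-τ-miss (toℕ s) (perm w j) i p = ρ-row w j i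

ρ-col : (w : Word n) → ∀ j i → ρ w j (suc i) ≡ ρ w j i + 𝟙 (perm⁻¹ w i) j
ρ-col []      j i = trans (cong +_ (ℕP.⊓-comm j (suc i))) (trans (id-step i j)
  (cong (λ z → + z + 𝟙 i j) (ℕP.⊓-comm i j)))
ρ-col (s ∷ w) j i with i ℕ.≟ toℕ s | i ℕ.≟ suc (toℕ s)
... | yes refl | _ rewrite L-hit lin (toℕ s) (ρ w) j | L-miss lin (toℕ s) (ρ w) j (toℕ s) n≢1+n
      | τ-left (toℕ s) | ρ-col w j (suc (toℕ s)) =
  lem (ρ w j (toℕ s)) (ρ w j (suc (toℕ s))) _
  where
  lem : ∀ a b c → a + (b + c) - b ≡ a + c
  lem = solve-∀
... | no _ | yes refl rewrite L-hit lin (toℕ s) (ρ w) j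
      | L-miss lin (toℕ s) (ρ w) j (suc (suc (toℕ s))) (n≢1+n ∘ sym)
      | τ-right (toℕ s) | ρ-col w j (toℕ s) =
  lem (ρ w j (suc (suc (toℕ s)))) (ρ w j (toℕ s)) _
  where
  lem : ∀ a b c → a ≡ b + a - (b + c) + c
  lem = solve-∀
... | no p | no q rewrite L-miss lin (toℕ s) (ρ w) j i q
      | L-miss lin (toℕ s) (ρ w) j (suc i) (p ∘ ℕP.suc-injective)
      | τ-other (toℕ s) i p q = ρ-col w j i

ρ⇒≃ : (u v : Word n) → ρ u ≗A ρ v → u ≃ v
ρ⇒≃ u v e j = 𝟙-injective _ _ (λ i → cancel (ρ u j i) _ _
  (trans (sym (ρ-row u j i)) (trans (e (suc j) i) (trans (ρ-row v j i) (cong (_+ _) (sym (e j i)))))))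
  where
  cancel : ∀ a b c → a + b ≡ a + c → b ≡ c
  cancel a b c = +-cancelˡ a b c

i≤i+1 : ∀ i → i ℤ.≤ i + + 1
i≤i+1 i = ℤP.i≤i+j i (+ 1)

-- `l`, `l + p` and `l + p + q` are the ranks in three consecutive rows, and an ascent means
-- `Pair p q`. Then the max-plus update gives `l + q`, the rank after the swap; at a descent
-- (`lemma-desc`) it changes nothing, and `lemma-mn` recovers the entry before an ascent.
lemma-asc : ∀ l p q → Pair p q → l ⊔ ((l + p + q) - + 1) ≡ l + (l + p + q) - (l + p)
lemma-asc l p q (00′ refl refl) = trans (cong (l ⊔_) (f₁ l)) (trans (ℤP.i≥j⇒i⊔j≡i (ℤP.i-j≤i l (+ 1))) (f₂ l))
  where
  f₁ : ∀ l → (l + + 0 + + 0) - + 1 ≡ l - + 1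
  f₁ = solve-∀
  f₂ : ∀ l → l ≡ l + (l + + 0 + + 0) - (l + + 0)
  f₂ = solve-∀
lemma-asc l p q (10′ refl refl) = trans (cong (l ⊔_) (f₁ l)) (trans (ℤP.⊔-idem l) (f₂ l))
  where
  f₁ : ∀ l → (l + + 1 + + 0) - + 1 ≡ l
  f₁ = solve-∀
  f₂ : ∀ l → l ≡ l + (l + + 1 + + 0) - (l + + 1)
  f₂ = solve-∀
lemma-asc l p q (11′ refl refl) = trans (cong (l ⊔_) (f₁ l)) (trans (ℤP.i≤j⇒i⊔j≡j (i≤i+1 l)) (f₂ l))
  where
  f₁ : ∀ l → (l + + 1 + + 1) - + 1 ≡ l + + 1
  f₁ = solve-∀
  f₂ : ∀ l → l + + 1 ≡ l + (l + + 1 + + 1) - (l + + 1)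
  f₂ = solve-∀

lemma-desc : ∀ l p q → Pair q p → l ⊔ ((l + p + q) - + 1) ≡ l + p
lemma-desc l p q (00′ refl refl) = trans (cong (l ⊔_) (f₁ l)) (trans (ℤP.i≥j⇒i⊔j≡i (ℤP.i-j≤i l (+ 1))) (f₂ l))
  where
  f₁ : ∀ l → (l + + 0 + + 0) - + 1 ≡ l - + 1
  f₁ = solve-∀
  f₂ : ∀ l → l ≡ l + + 0
  f₂ = solve-∀
lemma-desc l p q (10′ refl refl) = trans (cong (l ⊔_) (f₁ l)) (trans (ℤP.⊔-idem l) (f₂ l))
  where
  f₁ : ∀ l → (l + + 0 + + 1) - + 1 ≡ l
  f₁ = solve-∀
  f₂ : ∀ l → l ≡ l + + 0
  f₂ = solve-∀
lemma-desc l p q (11′ refl refl) = trans (cong (l ⊔_) (f₁ l)) (ℤP.i≤j⇒i⊔j≡j (i≤i+1 l))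
  where
  f₁ : ∀ l → (l + + 1 + + 1) - + 1 ≡ l + + 1
  f₁ = solve-∀

lemma-mn : ∀ l p q → Pair p q → (l + + 1) ⊓ (l + p + q) ≡ l + p
lemma-mn l p q (00′ refl refl) = trans (cong ((l + + 1) ⊓_) (f₁ l)) (trans (ℤP.i≥j⇒i⊓j≡j (i≤i+1 l)) (f₂ l))
  where
  f₁ : ∀ l → (l + + 0 + + 0) ≡ l
  f₁ = solve-∀
  f₂ : ∀ l → l ≡ l + + 0
  f₂ = solve-∀
lemma-mn l p q (10′ refl refl) = trans (cong ((l + + 1) ⊓_) (ℤP.+-identityʳ (l + + 1))) (ℤP.⊓-idem (l + + 1))
lemma-mn l p q (11′ refl refl) = ℤP.i≤j⇒i⊓j≡i (i≤i+1 (l + + 1))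

ρ-row₂ : (w : Word n) → ∀ j i → ρ w (suc (suc j)) i ≡ ρ w j i + 𝟙 (perm w j) i + 𝟙 (perm w (suc j)) i
ρ-row₂ w j i = trans (ρ-row w (suc j) i) (cong (_+ 𝟙 (perm w (suc j)) i) (ρ-row w j i))

R-ascent : (w : Word n) (s : Fin n) → Ascent w s → R trop (toℕ s) (ρ w) ≗A ρ (w ∷ʳ s)
R-ascent w s p j i = trans (main j i) (sym (ρ-∷ʳ w s j i))
  where
  main : R trop (toℕ s) (ρ w) ≗A R lin (toℕ s) (ρ w)
  main j i with j ℕ.≟ suc (toℕ s)
  ... | yes refl rewrite R-hit trop (toℕ s) (ρ w) i | R-hit lin (toℕ s) (ρ w) i
        | ρ-row₂ w (toℕ s) i | ρ-row w (toℕ s) i = lemma-asc (ρ w (toℕ s) i) _ _ (𝟙-anti _ _ i p)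
  ... | no q = trans (R-miss trop (toℕ s) (ρ w) j i q) (sym (R-miss lin (toℕ s) (ρ w) j i q))

R-descent : (w : Word n) (s : Fin n) → Descent w s → R trop (toℕ s) (ρ w) ≗A ρ w
R-descent w s p j i with j ℕ.≟ suc (toℕ s)
... | yes refl rewrite R-hit trop (toℕ s) (ρ w) i
      | ρ-row₂ w (toℕ s) i | ρ-row w (toℕ s) i = lemma-desc (ρ w (toℕ s) i) _ _ (𝟙-anti _ _ i p)
... | no q = R-miss trop (toℕ s) (ρ w) j i q

R-mn-ascent : (w : Word n) (s : Fin n) → Ascent w s → R mn (toℕ s) (ρ (w ∷ʳ s)) ≗A ρ w
R-mn-ascent w s p j i with j ℕ.≟ suc (toℕ s)
... | yes refl rewrite R-hit mn (toℕ s) (ρ (w ∷ʳ s)) i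
      | ρ-∷ʳ w s (toℕ s) i | ρ-∷ʳ w s (suc (suc (toℕ s))) i
      | R-miss lin (toℕ s) (ρ w) (toℕ s) i n≢1+n
      | R-miss lin (toℕ s) (ρ w) (suc (suc (toℕ s))) i (n≢1+n ∘ sym)
      | ρ-row₂ w (toℕ s) i | ρ-row w (toℕ s) i = lemma-mn (ρ w (toℕ s) i) _ _ (𝟙-anti _ _ i p)
... | no q rewrite R-miss mn (toℕ s) (ρ (w ∷ʳ s)) j i q | ρ-∷ʳ w s j i = R-miss lin (toℕ s) (ρ w) j i q

-- Each letter of a reduced word is an ascent for the letters before it, and there the Demazure
-- product is the ordinary one. The prefix is allowed to be reached by another word `u`.
Dem≗ρ : (v w u : Word n) → ρ w ≗A Dem u → Reduced (w ++ v) → ρ (w ++ v) ≗A Dem (u ++ v)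
Dem≗ρ []      w u e red rewrite ListP.++-identityʳ w | ListP.++-identityʳ u = e
Dem≗ρ (s ∷ v) w u e red rewrite sym (ListP.++-assoc w (s ∷ []) v) | sym (ListP.++-assoc u (s ∷ []) v) =
  Dem≗ρ v (w ∷ʳ s) (u ∷ʳ s) step red
  where
  step : ρ (w ∷ʳ s) ≗A Dem (u ∷ʳ s)
  step j i = trans (sym (R-ascent w s (Reduced⇒Ascent w s (Reduced-prefix (w ∷ʳ s) v red)) j i))
    (trans (R-cong trop (toℕ s) e j i) (sym (Dem-∷ʳ u s j i)))

Reduced⇒Dem : (w : Word n) → Reduced w → ρ w ≗A Dem w
Reduced⇒Dem w = Dem≗ρ w [] [] (λ _ _ → refl)

-- Greedy subwords; the Boolean attached to a letter says whether it may be used.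

data Greedy {n} : Word n → List (Bool × Fin n) → List Bool → Set where
  done   : ∀ {w} → Greedy w [] []
  take   : ∀ {w s Q m} → Ascent w s → Greedy (w ∷ʳ s) Q m → Greedy w ((true , s) ∷ Q) (true ∷ m)
  drop   : ∀ {w s Q m} → Descent w s → Greedy w Q m → Greedy w ((true , s) ∷ Q) (false ∷ m)
  forbid : ∀ {w s Q m} → Greedy w Q m → Greedy w ((false , s) ∷ Q) (false ∷ m)

greedy : (w : Word n) (Q : List (Bool × Fin n)) → ∃ λ m → Greedy w Q m
greedy w [] = [] , done
greedy w ((false , s) ∷ Q) with greedy w Q
... | m , g = false ∷ m , forbid g
greedy w ((true , s) ∷ Q) with ascent? w s
... | inj₁ p = let m , g = greedy (w ∷ʳ s) Q in true ∷ m , take p g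
... | inj₂ p = let m , g = greedy w Q in false ∷ m , drop p g

select : {A : Set} → List Bool → List A → List A
select []          xs       = []
select (b ∷ m)     []       = []
select (true ∷ m)  (x ∷ xs) = x ∷ select m xs
select (false ∷ m) (x ∷ xs) = select m xs

allowed : List (Bool × Fin n) → Word n
allowed []                = []
allowed ((true , s) ∷ Q)  = s ∷ allowed Q
allowed ((false , s) ∷ Q) = allowed Q

letters : List (Bool × Fin n) → Word n
letters = List.map proj₂

-- `v` collects the allowed letters read so far, used or not. A dropped letter is a descent, which
-- the Demazure product absorbs, so the used letters and the allowed letters keep a common array.
Greedy-correct : ∀ {w : Word n} {Q m} → Greedy w Q m → ∀ v → Reduced w → ρ w ≗A Dem v →
  Reduced (w ++ select m (letters Q)) × ρ (w ++ select m (letters Q)) ≗A Dem (v ++ allowed Q)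
Greedy-correct {w = w} done v red e rewrite ListP.++-identityʳ w | ListP.++-identityʳ v = red , e
Greedy-correct {w = w} (take {s = s} {Q} {m} p g) v red e
  rewrite sym (ListP.++-assoc w (s ∷ []) (select m (letters Q))) | sym (ListP.++-assoc v (s ∷ []) (allowed Q)) =
  Greedy-correct g (v ∷ʳ s) (Ascent⇒Reduced w s red p)
    (λ j i → trans (sym (R-ascent w s p j i)) (trans (R-cong trop (toℕ s) e j i) (sym (Dem-∷ʳ v s j i))))
Greedy-correct {w = w} (drop {s = s} {Q} {m} p g) v red e rewrite sym (ListP.++-assoc v (s ∷ []) (allowed Q)) =
  Greedy-correct g (v ∷ʳ s) red
    (λ j i → trans (sym (R-descent w s p j i)) (trans (R-cong trop (toℕ s) e j i) (sym (Dem-∷ʳ v s j i))))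
Greedy-correct (forbid g) v red e = Greedy-correct g v red e

allow : Word n → List (Bool × Fin n)
allow = List.map (true ,_)

allowed-allow : (Q : Word n) → allowed (allow Q) ≡ Q
allowed-allow []      = refl
allowed-allow (s ∷ Q) = cong (s ∷_) (allowed-allow Q)

letters-allow : (Q : Word n) → letters (allow Q) ≡ Q
letters-allow []      = refl
letters-allow (s ∷ Q) = cong (s ∷_) (letters-allow Q)

-- The witness is the greedy subword. Through it properties of rank arrays, such as steps of 0 or 1,
-- pass to Demazure products.
Dem-is-ρ : (v : Word n) → ∃ λ w → Reduced w × ρ w ≗A Dem v
Dem-is-ρ v with greedy [] (allow v)
... | m , g with Greedy-correct g [] Reduced-[] (λ _ _ → refl)
...   | red , e rewrite allowed-allow v = select m (letters (allow v)) , red , e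

L-trop-mono : ∀ s {a b} → a ≤A b → L trop s a ≤A L trop s b
L-trop-mono s {a} {b} h j i with i ℕ.≟ suc s
... | yes refl = subst₂ ℤ._≤_ (sym (L-hit trop s a j)) (sym (L-hit trop s b j))
      (ℤP.⊔-mono-≤ (h _ _) (ℤP.+-monoˡ-≤ (- + 1) (h _ _)))
... | no p = subst₂ ℤ._≤_ (sym (L-miss trop s a j i p)) (sym (L-miss trop s b j i p)) (h j i)

R-mn-mono : ∀ s {a b} → a ≤A b → R mn s a ≤A R mn s b
R-mn-mono s {a} {b} h j i with j ℕ.≟ suc s
... | yes refl = subst₂ ℤ._≤_ (sym (R-hit mn s a i)) (sym (R-hit mn s b i))
      (ℤP.⊓-mono-≤ (ℤP.+-monoˡ-≤ (+ 1) (h _ _)) (h _ _))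
... | no p = subst₂ ℤ._≤_ (sym (R-miss mn s a j i p)) (sym (R-miss mn s b j i p)) (h j i)

bit-≤ : ∀ a p → p ≡ + 0 ⊎ p ≡ + 1 → a ℤ.≤ a + p × a + p ℤ.≤ a + + 1
bit-≤ a _ (inj₁ refl) = ℤP.≤-reflexive (sym (ℤP.+-identityʳ a)) , ℤP.+-monoʳ-≤ a (ℤ.+≤+ z≤n)
bit-≤ a _ (inj₂ refl) = i≤i+1 a , ℤP.≤-refl

ρ-row-≤ : (w : Word n) → ∀ j i → ρ w j i ℤ.≤ ρ w (suc j) i × ρ w (suc j) i ℤ.≤ ρ w j i + + 1
ρ-row-≤ w j i rewrite ρ-row w j i = bit-≤ _ _ (𝟙-bit (perm w j) i)

ρ-col-≤ : (w : Word n) → ∀ j i → ρ w j i ℤ.≤ ρ w j (suc i) × ρ w j (suc i) ℤ.≤ ρ w j i + + 1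
ρ-col-≤ w j i rewrite ρ-col w j i = bit-≤ _ _ (𝟙-bit (perm⁻¹ w i) j)

≤+1⇒-1≤ : ∀ {a b} → a ℤ.≤ b + + 1 → a - + 1 ℤ.≤ b
≤+1⇒-1≤ {a} {b} h = subst (a - + 1 ℤ.≤_) (lem b) (ℤP.+-monoˡ-≤ (- + 1) h)
  where
  lem : ∀ b → b + + 1 - + 1 ≡ b
  lem = solve-∀

-- Neighbouring ranks differ by 0 or 1, so neither term of the maximum exceeds the old entry.
Dem-∷-≤ : (s : Fin n) (v : Word n) → Dem (s ∷ v) ≤A Dem v
Dem-∷-≤ s v j i with i ℕ.≟ suc (toℕ s) | Dem-is-ρ v
... | yes refl | w , _ , e = subst (ℤ._≤ Dem v j (suc (toℕ s))) (sym (L-hit trop (toℕ s) (Dem v) j))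
      (subst₂ (λ a b → a ⊔ (b - + 1) ℤ.≤ Dem v j (suc (toℕ s))) (e _ _) (e _ _)
        (subst (_ ℤ.≤_) (e _ _) (ℤP.⊔-lub (proj₁ (ρ-col-≤ w j (toℕ s))) (≤+1⇒-1≤ (proj₂ (ρ-col-≤ w j (suc (toℕ s))))))))
... | no p | _ = ℤP.≤-reflexive (L-miss trop (toℕ s) (Dem v) j i p)

≤A-trans : ∀ {a b c} → a ≤A b → b ≤A c → a ≤A c
≤A-trans p q j i = ℤP.≤-trans (p j i) (q j i)

Dem-++-≤ : (u v : Word n) → Dem (u ++ v) ≤A Dem v
Dem-++-≤ []      v j i = ℤP.≤-refl
Dem-++-≤ (s ∷ u) v = ≤A-trans (Dem-∷-≤ s (u ++ v)) (Dem-++-≤ u v)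

-- This is Bruhat order turned upside down: every further letter can only lower ranks.
Dem-anti : {w' w : Word n} → w' ⊆ w → Dem w ≤A Dem w'
Dem-anti [] j i = ℤP.≤-refl
Dem-anti (skip {ys = v} s p) = ≤A-trans (Dem-∷-≤ s v) (Dem-anti p)
Dem-anti (_∷_ {x = s} refl p) = L-trop-mono (toℕ s) (Dem-anti p)

-- The longest element

w0-descent : (u : Word n) → IsRedW0 u → ∀ s → Descent u s
w0-descent u (red , max) s with ascent? u s
... | inj₂ p = p
... | inj₁ p = contradiction (max (u ∷ʳ s) (Ascent⇒Reduced u s red p))
        (subst (λ l → ¬ (l ≤ length u)) (sym (length-∷ʳ u s)) (ℕP.<⇒≱ (ℕP.n<1+n _)))

w0-absorbs : (u : Word n) → IsRedW0 u → ∀ u' v → ρ u ≗A Dem u' → ρ u ≗A Dem (u' ++ v)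
w0-absorbs u h u' []      e rewrite ListP.++-identityʳ u' = e
w0-absorbs u h u' (s ∷ v) e rewrite sym (ListP.++-assoc u' (s ∷ []) v) = w0-absorbs u h (u' ∷ʳ s) v
  (λ j i → trans (sym (R-descent u s (w0-descent u h s) j i))
    (trans (R-cong trop (toℕ s) e j i) (sym (Dem-∷ʳ u' s j i))))

-- Appending `v` to `u` changes nothing, as `u` has a descent at every letter; prepending `u` to `v`
-- can only lower the array of `v`.
w0-min : (u : Word n) → IsRedW0 u → ∀ v → ρ u ≤A Dem v
w0-min u h v j i = subst (ℤ._≤ Dem v j i) (sym (w0-absorbs u h u v (Reduced⇒Dem u (proj₁ h)) j i)) (Dem-++-≤ u v j i)

-- By minimality the arrays agree, so both are reduced words of one element. Every later proof that
-- some subword spells w∘ goes through this inequality.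
w0-recognise : (u v : Word n) → IsRedW0 u → Reduced v → Dem v ≤A ρ u → IsRedW0 v × ρ v ≗A ρ u
w0-recognise u v h red le = (red , λ w r → ℕP.≤-trans (proj₂ h w r) (proj₁ h v (≃⇒SameElt u v (λ m → sym (ρ⇒≃ v u eq m))))) , eq
  where
  eq : ρ v ≗A ρ u
  eq j i = trans (Reduced⇒Dem v red j i) (ℤP.≤-antisym (le j i) (w0-min u h v j i))

w0-length : (u v : Word n) → IsRedW0 u → IsRedW0 v → length u ≡ length v
w0-length u v (r , m) (r' , m') = ℕP.≤-antisym (m' u r) (m v r')

w0-ρ : (u v : Word n) → IsRedW0 u → IsRedW0 v → ρ u ≗A ρ v
w0-ρ u v h h' j i = ℤP.≤-antisym
  (subst (_ ℤ.≤_) (sym (Reduced⇒Dem v (proj₁ h') j i)) (w0-min u h v j i))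
  (subst (_ ℤ.≤_) (sym (Reduced⇒Dem u (proj₁ h) j i)) (w0-min v h' u j i))

-- Shortening a word from the right increases ρ, as little as possible in each step.

unwind : Word n → Arr → Arr
unwind []      a = a
unwind (s ∷ w) a = R mn (toℕ s) (unwind w a)

unwind-ρ : (w v : Word n) → Reduced (w ++ v) → unwind v (ρ (w ++ v)) ≗A ρ w
unwind-ρ w []      red j i rewrite ListP.++-identityʳ w = refl
unwind-ρ w (s ∷ v) red j i rewrite sym (ListP.++-assoc w (s ∷ []) v) =
  trans (R-cong mn (toℕ s) (unwind-ρ (w ∷ʳ s) v red) j i)
    (R-mn-ascent w s (Reduced⇒Ascent w s (Reduced-prefix (w ∷ʳ s) v red)) j i)

unwind-cong : (v : Word n) → ∀ {a b} → a ≗A b → unwind v a ≗A unwind v b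
unwind-cong []      e = e
unwind-cong (s ∷ v) e = R-cong mn (toℕ s) (unwind-cong v e)

-- Steps of 0 or 1 between rows make both terms of the minimum at least the old entry; hence the
-- restriction to arrays of permutations.
R-mn-≥ : (w : Word n) (s : ℕ) → ∀ {a} → a ≗A ρ w → a ≤A R mn s a
R-mn-≥ w s {a} e j i with j ℕ.≟ suc s
... | yes refl rewrite R-hit mn s a i | e s i | e (suc s) i | e (suc (suc s)) i =
      ℤP.⊓-glb (proj₂ (ρ-row-≤ w s i)) (proj₁ (ρ-row-≤ w (suc s) i))
... | no p rewrite R-miss mn s a j i p = ℤP.≤-refl

unwind-mono : {v' v : Word n} → v' ⊆ v → (w : Word n) → Reduced (w ++ v) →
  unwind v' (ρ (w ++ v)) ≤A unwind v (ρ (w ++ v))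
unwind-mono [] w red j i = ℤP.≤-refl
unwind-mono (skip {ys = v} s p) w red rewrite sym (ListP.++-assoc w (s ∷ []) v) =
  ≤A-trans (unwind-mono p (w ∷ʳ s) red) (R-mn-≥ (w ∷ʳ s) (toℕ s) (unwind-ρ (w ∷ʳ s) v red))
unwind-mono (_∷_ {y = s} {ys = v} refl p) w red rewrite sym (ListP.++-assoc w (s ∷ []) v) =
  R-mn-mono (toℕ s) (unwind-mono p (w ∷ʳ s) red)

-- Both prefixes arise from the array of w∘ by unwinding the remaining letters, and unwinding fewer
-- letters raises the array less. For facets this becomes the upper bound on heights.
w0-prefix-≤ : (w v u' v' : Word n) → IsRedW0 (w ++ v) → IsRedW0 (u' ++ v') → v' ⊆ v → ρ u' ≤A ρ w
w0-prefix-≤ w v u' v' h h' p j i = subst₂ ℤ._≤_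
  (trans (unwind-cong v' (w0-ρ (w ++ v) (u' ++ v') h h') j i) (unwind-ρ u' v' (proj₁ h') j i))
  (unwind-ρ w v (proj₁ h) j i)
  (unwind-mono p w (proj₁ h) j i)

-- Weights in terms of heights

-- A row of the Cartan matrix of type A is minus a second difference: if `h (suc j)` are
-- coefficients at simple roots and `h` vanishes at both ends, then `dd h` are the coefficients at
-- fundamental weights.
dd : (ℕ → ℤ) → ℕ → ℤ
dd h j = + 2 * h (suc j) - h j - h (suc (suc j))

𝟙-< : ∀ {v i} → v < i → 𝟙 v i ≡ + 1
𝟙-< {zero}  {suc i} p       = refl
𝟙-< {suc v} {suc i} (s≤s p) = 𝟙-< p

𝟙-≥ : ∀ {v i} → i ≤ v → 𝟙 v i ≡ + 0
𝟙-≥ {v}     {zero}  p       = refl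
𝟙-≥ {suc v} {suc i} (s≤s p) = 𝟙-≥ p

ω-lift : (q j : Fin n) → ω q j ≡ 𝟙 (toℕ j) (suc (toℕ q)) - 𝟙 (suc (toℕ j)) (suc (toℕ q))
ω-lift q j with q Fin.≟ j
... | yes refl rewrite 𝟙-< (ℕP.n<1+n (toℕ q)) | 𝟙-≥ (ℕP.≤-refl {toℕ q}) = refl
... | no p with ℕP.<-cmp (toℕ j) (toℕ q)
...   | tri< a _ _ rewrite 𝟙-< (ℕP.m≤n⇒m≤1+n a) | 𝟙-< a = refl
...   | tri≈ _ e _ = contradiction (FinP.toℕ-injective (sym e)) p
...   | tri> _ _ b rewrite 𝟙-≥ b | 𝟙-≥ (ℕP.<⇒≤ b) = refl

-- By `ρ-col` the column differences in row q + 1 are the lifted coordinates of the weight, so the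
-- row itself holds its heights.
act-ω : (w : Word n) (q j : Fin n) → act w (ω q) j ≡ dd (ρ w (suc (toℕ q))) (toℕ j)
act-ω w q j = trans (act-lift w (λ i → 𝟙 i (suc (toℕ q))) (ω q) (ω-lift q) j)
  (trans (lem _ _ (ρ w (suc (toℕ q)) (toℕ j)))
    (sym (cong₂ (λ a b → + 2 * a - ρ w (suc (toℕ q)) (toℕ j) - b)
      (ρ-col w (suc (toℕ q)) (toℕ j))
      (trans (ρ-col w (suc (toℕ q)) (suc (toℕ j))) (cong (_+ 𝟙 (perm⁻¹ w (suc (toℕ j))) (suc (toℕ q))) (ρ-col w (suc (toℕ q)) (toℕ j)))))))
  where
  lem : ∀ a b r → a - b ≡ + 2 * (r + a) - r - (r + a + b)
  lem = solve-∀

refl-s-minus : (s : Fin n) (u v x : Wt n) → (∀ j → x j ≡ u j - v j) → ∀ j → refl-s s x j ≡ refl-s s u j - refl-s s v j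
refl-s-minus s u v x e j rewrite e j | e s = lem (u j) (v j) (u s) (v s) (α s j)
  where
  lem : ∀ a b c d k → a - b - (c - d) * k ≡ (a - c * k) - (b - d * k)
  lem = solve-∀

act-minus : (w : Word n) (u v x : Wt n) → (∀ j → x j ≡ u j - v j) → ∀ j → act w x j ≡ act w u j - act w v j
act-minus []      u v x e = e
act-minus (s ∷ w) u v x e = refl-s-minus s (act w u) (act w v) (act w x) (act-minus w u v x e)

act-∷ʳ : (w : Word n) (s : Fin n) (x : Wt n) → act (w ∷ʳ s) x ≡ act w (refl-s s x)
act-∷ʳ []      s x = refl
act-∷ʳ (t ∷ w) s x = cong (refl-s t) (act-∷ʳ w s x)

-- Since α_s = ω_s - s(ω_s), a root is a difference of two weights. This connects the root function
-- with the weight function.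
act-α : (w : Word n) (s : Fin n) → ∀ j → act w (α s) j ≡ dd (ρ w (suc (toℕ s))) (toℕ j) - dd (ρ (w ∷ʳ s) (suc (toℕ s))) (toℕ j)
act-α w s j = trans (act-minus w (ω s) (refl-s s (ω s)) (α s) split j)
  (cong₂ _-_ (act-ω w s j) (trans (cong (λ f → f j) (sym (act-∷ʳ w s (ω s)))) (act-ω (w ∷ʳ s) s j)))
  where
  ωss : ω s s ≡ + 1
  ωss rewrite dec-true (s Fin.≟ s) refl = refl
  split : ∀ i → α s i ≡ ω s i - refl-s s (ω s) i
  split i rewrite ωss = lem (α s i) (ω s i)
    where
    lem : ∀ a b → a ≡ b - (b - + 1 * a)
    lem = solve-∀

-- Position lists and Boolean masks

-- Masks have `true` at kept letters and run in step with the word, which turns statements about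
-- position sets into structural recursion; `off` is the position of the head.
removed kept : ℕ → List Bool → List ℕ
removed off []          = []
removed off (true ∷ m)  = removed (suc off) m
removed off (false ∷ m) = off ∷ removed (suc off) m
kept off []          = []
kept off (true ∷ m)  = off ∷ kept (suc off) m
kept off (false ∷ m) = kept (suc off) m

mask : ℕ → List ℕ → ℕ → List Bool
mask off I zero    = []
mask off I (suc l) = not (off ∈ᵇ I) ∷ mask (suc off) I l

length-mask : ∀ off I l → length (mask off I l) ≡ l
length-mask off I zero    = refl
length-mask off I (suc l) = cong suc (length-mask (suc off) I l)

mask-+ : ∀ off I k l → mask off I (k ℕ.+ l) ≡ mask off I k ++ mask (off ℕ.+ k) I l
mask-+ off I zero    l rewrite ℕP.+-identityʳ off = refl
mask-+ off I (suc k) l rewrite ℕP.+-suc off k = cong (_ ∷_) (mask-+ (suc off) I k l)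

prefixFrom-select : ∀ off (Q : Word n) I k → prefixFrom off Q I k ≡ select (mask off I (k ℕ.∸ off)) Q
prefixFrom-select off [] I k with mask off I (k ℕ.∸ off)
... | []    = refl
... | _ ∷ _ = refl
prefixFrom-select off (q ∷ Q) I k with off ℕ.<? k
... | no p rewrite dec-false (off ℕ.<? k) p | ℕP.m≤n⇒m∸n≡0 (ℕP.≮⇒≥ p) =
      trans (prefixFrom-select (suc off) Q I k) (cong (λ l → select (mask (suc off) I l) Q) (ℕP.m≤n⇒m∸n≡0 (ℕP.m≤n⇒m≤1+n (ℕP.≮⇒≥ p))))
... | yes p rewrite dec-true (off ℕ.<? k) p | sym (ℕP.suc-pred (k ℕ.∸ off) {{ℕ.≢-nonZero (λ e → ℕP.<⇒≱ p (ℕP.m∸n≡0⇒m≤n e))}})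
      | ℕP.pred[m∸n]≡m∸[1+n] k off with not (off ∈ᵇ I)
...   | true  = cong (q ∷_) (prefixFrom-select (suc off) Q I k)
...   | false = prefixFrom-select (suc off) Q I k

∈ᵇ-head : ∀ x I → x ∈ᵇ (x ∷ I) ≡ true
∈ᵇ-head x I rewrite dec-true (x ℕ.≟ x) refl = refl

∈ᵇ-tail : ∀ x y I → x ≢ y → x ∈ᵇ (y ∷ I) ≡ x ∈ᵇ I
∈ᵇ-tail x y I p rewrite dec-false (x ℕ.≟ y) p = refl

mask-tail : ∀ off y I l → y < off → mask off (y ∷ I) l ≡ mask off I l
mask-tail off y I zero    p = refl
mask-tail off y I (suc l) p rewrite ∈ᵇ-tail off y I (λ e → ℕP.<-irrefl (sym e) p) =
  cong (_ ∷_) (mask-tail (suc off) y I l (ℕP.m≤n⇒m≤1+n p))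

-- Strict increase together with a lower bound that moves with the offset of a mask; `Linked` does
-- not bound the head.
data Sorted : ℕ → List ℕ → Set where
  []  : ∀ {off} → Sorted off []
  _∷_ : ∀ {off x I} → off ≤ x → Sorted (suc x) I → Sorted off (x ∷ I)

Sorted-weaken : ∀ {a b I} → a ≤ b → Sorted b I → Sorted a I
Sorted-weaken p []      = []
Sorted-weaken p (q ∷ s) = ℕP.≤-trans p q ∷ s

Linked⇒Sorted : ∀ {I} → Linked _<_ I → Sorted 0 I
Linked⇒Sorted = go z≤n
  where
  go′ : ∀ {x I} → Linked _<_ (x ∷ I) → Sorted (suc x) I
  go′ [-]     = []
  go′ (p ∷ l) = p ∷ go′ l
  go : ∀ {off I} → off ≤ 0 → Linked _<_ I → Sorted off I
  go z []          = []
  go z≤n [-]       = z≤n ∷ []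
  go z≤n (p ∷ l)   = z≤n ∷ go′ (p ∷ l)

Sorted⇒Linked : ∀ {off I} → Sorted off I → Linked _<_ I
Sorted⇒Linked []            = []
Sorted⇒Linked (p ∷ [])      = [-]
Sorted⇒Linked (p ∷ (q ∷ s)) = q ∷ Sorted⇒Linked (q ∷ s)

∉-Sorted : ∀ off {I} → Sorted (suc off) I → off ∈ᵇ I ≡ false
∉-Sorted off []                = refl
∉-Sorted off (_∷_ {x = x} {I = I} p s) = trans (∈ᵇ-tail off x I (λ e → ℕP.<-irrefl e p))
  (∉-Sorted off (Sorted-weaken (ℕP.≤-trans p (ℕP.n≤1+n x)) s))

removed-mask : ∀ {off I} l → Sorted off I → All (_< off ℕ.+ l) I → removed off (mask off I l) ≡ I
removed-mask {off} zero [] a = refl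
removed-mask {off} zero (p ∷ s) (q ∷ a) rewrite ℕP.+-identityʳ off = contradiction p (ℕP.<⇒≱ q)
removed-mask {off} (suc l) [] a = removed-mask l [] []
removed-mask {off} (suc l) (_∷_ {x = x} {I = I} p s) (q ∷ a) with off ℕ.≟ x
... | yes refl rewrite ∈ᵇ-head off I | mask-tail (suc off) off I l (ℕP.n<1+n off) | ℕP.+-suc off l =
      cong (off ∷_) (removed-mask l s a)
... | no ne rewrite ∉-Sorted off (ℕP.≤∧≢⇒< p ne ∷ s) | ℕP.+-suc off l =
      removed-mask l (ℕP.≤∧≢⇒< p ne ∷ s) (q ∷ a)

removed-Sorted : ∀ off m → Sorted off (removed off m)
removed-Sorted off []          = []
removed-Sorted off (true ∷ m)  = Sorted-weaken (ℕP.n≤1+n off) (removed-Sorted (suc off) m)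
removed-Sorted off (false ∷ m) = ℕP.≤-refl ∷ removed-Sorted (suc off) m

removed-< : ∀ off m → All (_< off ℕ.+ length m) (removed off m)
removed-< off []          = []
removed-< off (true ∷ m) rewrite ℕP.+-suc off (length m) = removed-< (suc off) m
removed-< off (false ∷ m) rewrite ℕP.+-suc off (length m) = s≤s (ℕP.m≤m+n off _) ∷ removed-< (suc off) m

mask-removed : ∀ off m → mask off (removed off m) (length m) ≡ m
mask-removed off []          = refl
mask-removed off (true ∷ m) rewrite ∉-Sorted off (removed-Sorted (suc off) m) = cong (true ∷_) (mask-removed (suc off) m)
mask-removed off (false ∷ m) rewrite ∈ᵇ-head off (removed (suc off) m)
  | mask-tail (suc off) off (removed (suc off) m) (length m) (ℕP.n<1+n off) = cong (false ∷_) (mask-removed (suc off) m)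

kept-not : ∀ off m → kept off (List.map not m) ≡ removed off m
kept-not off []          = refl
kept-not off (true ∷ m)  = kept-not (suc off) m
kept-not off (false ∷ m) = cong (off ∷_) (kept-not (suc off) m)

removed-not : ∀ off m → removed off (List.map not m) ≡ kept off m
removed-not off []          = refl
removed-not off (true ∷ m)  = cong (off ∷_) (removed-not (suc off) m)
removed-not off (false ∷ m) = removed-not (suc off) m

kept-Sorted : ∀ off m → Sorted off (kept off m)
kept-Sorted off m = subst (Sorted off) (removed-not off m) (removed-Sorted off (List.map not m))

length-select : {A : Set} (m : List Bool) (xs : List A) → length m ≡ length xs → ∀ off →
  length (select m xs) ≡ length (kept off m)
length-select []          []       e off = refl
length-select (true ∷ m)  (x ∷ xs) e off = cong suc (length-select m xs (ℕP.suc-injective e) (suc off))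
length-select (false ∷ m) (x ∷ xs) e off = length-select m xs (ℕP.suc-injective e) (suc off)

length-kept-removed : ∀ off m → length (kept off m) ℕ.+ length (removed off m) ≡ length m
length-kept-removed off []          = refl
length-kept-removed off (true ∷ m)  = cong suc (length-kept-removed (suc off) m)
length-kept-removed off (false ∷ m) = trans (ℕP.+-suc _ _) (cong suc (length-kept-removed (suc off) m))

select-++ : {A : Set} (m m' : List Bool) (xs ys : List A) → length m ≡ length xs →
  select (m ++ m') (xs ++ ys) ≡ select m xs ++ select m' ys
select-++ []          m' []       ys e = refl
select-++ (true ∷ m)  m' (x ∷ xs) ys e = cong (x ∷_) (select-++ m m' xs ys (ℕP.suc-injective e))
select-++ (false ∷ m) m' (x ∷ xs) ys e = select-++ m m' xs ys (ℕP.suc-injective e)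

select-prefix : {A : Set} (m : List Bool) (xs ys : List A) → length m ≡ length xs →
  select m (xs ++ ys) ≡ select m xs
select-prefix m xs ys e = trans (cong (λ m → select m (xs ++ ys)) (sym (ListP.++-identityʳ m)))
  (trans (select-++ m [] xs ys e) (ListP.++-identityʳ _))

select-⊆ : {A : Set} (m : List Bool) (xs : List A) → select m xs ⊆ xs
select-⊆ []          []       = []
select-⊆ []          (x ∷ xs) = skip x (select-⊆ [] xs)
select-⊆ (b ∷ m)     []       = []
select-⊆ (true ∷ m)  (x ∷ xs) = refl ∷ select-⊆ m xs
select-⊆ (false ∷ m) (x ∷ xs) = skip x (select-⊆ m xs)

range : ℕ → ℕ → List ℕ
range off zero    = []
range off (suc l) = off ∷ range (suc off) l

length-range : ∀ off l → length (range off l) ≡ l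
length-range off zero    = refl
length-range off (suc l) = cong suc (length-range (suc off) l)

range-+ : ∀ off k l → range off (k ℕ.+ l) ≡ range off k ++ range (off ℕ.+ k) l
range-+ off zero    l rewrite ℕP.+-identityʳ off = refl
range-+ off (suc k) l rewrite ℕP.+-suc off k = cong (off ∷_) (range-+ (suc off) k l)

select-range : {A : Set} (f : ℕ → A) → ∀ off m → select m (List.map f (range off (length m))) ≡ List.map f (kept off m)
select-range f off []          = refl
select-range f off (true ∷ m)  = cong (f off ∷_) (select-range f (suc off) m)
select-range f off (false ∷ m) = select-range f (suc off) m

facet-mask : (Q : Word n) (I : List ℕ) → IsFacet Q I →
  removed 0 (mask 0 I (length Q)) ≡ I × IsRedW0 (select (mask 0 I (length Q)) Q)
facet-mask Q I (l , _ , a , w) = removed-mask (length Q) (Linked⇒Sorted l) a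
  , subst IsRedW0 (prefixFrom-select 0 Q I (length Q)) w

mask-facet : (Q : Word n) (m : List Bool) → length m ≡ length Q → IsRedW0 (select m Q) →
  length (select m Q) ℕ.+ n ≡ length Q → IsFacet Q (removed 0 m)
mask-facet {n} Q m e w l = Sorted⇒Linked (removed-Sorted 0 m)
  , ℕP.+-cancelˡ-≡ (length (select m Q)) _ _ (trans (cong (ℕ._+ length (removed 0 m)) (length-select m Q e 0))
      (trans (length-kept-removed 0 m) (trans e (sym l))))
  , subst (λ z → All (_< z) (removed 0 m)) e (removed-< 0 m)
  , subst IsRedW0 (sym (trans (prefixFrom-select 0 Q (removed 0 m) (length Q))
      (cong (λ z → select z Q) (trans (cong (mask 0 (removed 0 m)) (sym e)) (mask-removed 0 m))))) w

mask-prefix : ∀ m (Q : Word n) k l → length m ≡ k ℕ.+ l → ∀ m₁ m₂ → m ≡ m₁ ++ m₂ → length m₁ ≡ k →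
  Π Q (removed 0 m) k ≡ select m₁ Q
mask-prefix m Q k l e m₁ m₂ refl refl = trans (prefixFrom-select 0 Q (removed 0 m) (length m₁))
  (cong (λ z → select z Q) (prefix-eq (trans (sym (mask-+ 0 (removed 0 m) (length m₁) l))
    (trans (cong (mask 0 (removed 0 m)) (sym e)) (mask-removed 0 m)))))
  where
  prefix-eq : mask 0 (removed 0 m) (length m₁) ++ mask (length m₁) (removed 0 m) l ≡ m₁ ++ m₂ →
    mask 0 (removed 0 m) (length m₁) ≡ m₁
  prefix-eq eq = go _ m₁ (length-mask 0 (removed 0 m) (length m₁)) eq
    where
    go : ∀ {b d : List Bool} a c → length a ≡ length c → a ++ b ≡ c ++ d → a ≡ c
    go []      []      _ _ = refl
    go (x ∷ a) (y ∷ c) l f = cong₂ _∷_ (ListP.∷-injectiveˡ f) (go a c (ℕP.suc-injective l) (ListP.∷-injectiveʳ f))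

Lex-∷ : ∀ {x y xs ys} → LexLeq (x ∷ xs) (y ∷ ys) → x < y ⊎ (x ≡ y × LexLeq xs ys)
Lex-∷ (lex-< p) = inj₁ p
Lex-∷ (lex-≡ l) = inj₂ (refl , l)

-- The length hypothesis excludes the empty list, which `LexLeq` puts below every list.
Lex-late : ∀ {off ys} I → Sorted (suc off) I → length I ≡ suc (length ys) → ¬ LexLeq I (off ∷ ys)
Lex-late []      s       () l
Lex-late (x ∷ I) (p ∷ s) e  l with Lex-∷ l
... | inj₁ q          = ℕP.<-asym p q
... | inj₂ (refl , _) = ℕP.<-irrefl refl p

Lex-cons : ∀ {x xs ys} → LexLeq (x ∷ xs) (x ∷ ys) → LexLeq xs ys
Lex-cons l with Lex-∷ l
... | inj₁ q       = contradiction q (ℕP.<-irrefl refl)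
... | inj₂ (_ , r) = r

Reduced-middle : (w : Word n) (s : Fin n) (v : Word n) → Reduced (w ++ s ∷ v) → Ascent w s
Reduced-middle w s v red = Reduced⇒Ascent w s (Reduced-prefix (w ∷ʳ s) v (subst Reduced (sym (ListP.++-assoc w (s ∷ []) v)) red))

-- The removed positions of a reduced subword are lexicographically at most those of the greedy one, and
-- its kept positions at least; equality forces the same mask.
antigreedy-mask : ∀ {w : Word n} {Q mg} off m → Greedy w Q mg → allowed Q ≡ letters Q → length m ≡ length Q →
  Reduced (w ++ select m (letters Q)) → length (removed off mg) ≡ length (removed off m) →
  LexLeq (removed off mg) (removed off m) → m ≡ mg
antigreedy-mask off [] done al e red l lex = refl
antigreedy-mask {w = w} off (true ∷ m) (take {s = s} {Q} p g) al e red l lex =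
  cong (true ∷_) (antigreedy-mask (suc off) m g (ListP.∷-injectiveʳ al) (ℕP.suc-injective e)
    (subst Reduced (sym (ListP.++-assoc w (s ∷ []) (select m (letters Q)))) red) l lex)
antigreedy-mask off (false ∷ m) (take {m = mg} p g) al e red l lex =
  contradiction lex (Lex-late (removed (suc off) mg) (removed-Sorted (suc off) mg) l)
antigreedy-mask {w = w} off (true ∷ m) (drop {s = s} {Q} p g) al e red l lex =
  contradiction p (ℕP.<-asym (Reduced-middle w s (select m (letters Q)) red))
antigreedy-mask off (false ∷ m) (drop p g) al e red l lex =
  cong (false ∷_) (antigreedy-mask (suc off) m g (ListP.∷-injectiveʳ al) (ℕP.suc-injective e) red (ℕP.suc-injective l) (Lex-cons lex))
-- By `al` no letter is forbidden; otherwise `allowed Q` would be too short.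
antigreedy-mask {w = w} off m (forbid {Q = Q} g) al e red l lex = contradiction (cong length al) (short Q)
  where
  le : ∀ Q → length (allowed Q) ≤ length (letters Q)
  le []                = z≤n
  le ((true , s) ∷ Q)  = s≤s (le Q)
  le ((false , s) ∷ Q) = ℕP.m≤n⇒m≤1+n (le Q)
  short : ∀ Q → length (allowed Q) ≢ suc (length (letters Q))
  short Q eq = ℕP.1+n≰n (subst (_≤ length (letters Q)) eq (le Q))

first-mask : ∀ {w : Word n} {Q : Word n} {mg} off m → Greedy w (allow Q) mg → length m ≡ length Q →
  Reduced (w ++ select m Q) → length (kept off m) ≡ length (kept off mg) →
  LexLeq (kept off m) (kept off mg) → m ≡ mg
first-mask {Q = []}    off [] done e red l lex = refl
first-mask {w = w} {s ∷ Q} off (true ∷ m) (take p g) e red l lex =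
  cong (true ∷_) (first-mask (suc off) m g (ℕP.suc-injective e)
    (subst Reduced (sym (ListP.++-assoc w (s ∷ []) (select m Q))) red) (ℕP.suc-injective l) (Lex-cons lex))
first-mask {Q = s ∷ Q} off (false ∷ m) (take p g) e red l lex =
  contradiction lex (Lex-late (kept (suc off) m) (kept-Sorted (suc off) m) l)
first-mask {w = w} {s ∷ Q} off (true ∷ m) (drop p g) e red l lex =
  contradiction p (ℕP.<-asym (Reduced-middle w s (select m Q) red))
first-mask {Q = s ∷ Q} off (false ∷ m) (drop p g) e red l lex =
  cong (false ∷_) (first-mask (suc off) m g (ℕP.suc-injective e) red l lex)

kept-split : ∀ off m ps₁ p ps₂ → kept off m ≡ ps₁ ++ p ∷ ps₂ →
  ∃₂ λ m₁ m₂ → m ≡ m₁ ++ true ∷ m₂ × off ℕ.+ length m₁ ≡ p × kept off m₁ ≡ ps₁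
kept-split off [] []        p ps₂ ()
kept-split off [] (x ∷ ps₁) p ps₂ ()
kept-split off (true ∷ m) []        p ps₂ e = [] , m , refl , trans (ℕP.+-identityʳ off) (ListP.∷-injectiveˡ e) , refl
kept-split off (true ∷ m) (x ∷ ps₁) p ps₂ e with kept-split (suc off) m ps₁ p ps₂ (ListP.∷-injectiveʳ e)
... | m₁ , m₂ , f , g , h = true ∷ m₁ , m₂ , cong (true ∷_) f , trans (ℕP.+-suc off _) g , cong₂ _∷_ (ListP.∷-injectiveˡ e) h
kept-split off (false ∷ m) ps₁ p ps₂ e with kept-split (suc off) m ps₁ p ps₂ e
... | m₁ , m₂ , f , g , h = false ∷ m₁ , m₂ , cong (false ∷_) f , trans (ℕP.+-suc off _) g , h

Greedy-length : ∀ {w : Word n} {Q m} → Greedy w Q m → length m ≡ length Q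
Greedy-length done       = refl
Greedy-length (take p g) = cong suc (Greedy-length g)
Greedy-length (drop p g) = cong suc (Greedy-length g)
Greedy-length (forbid g) = cong suc (Greedy-length g)

Greedy-prefix : ∀ {w : Word n} Q₁ {Q₂} m₁ {m₂} → Greedy w (Q₁ ++ Q₂) (m₁ ++ m₂) → length m₁ ≡ length Q₁ → Greedy w Q₁ m₁
Greedy-prefix []       []       g          e = done
Greedy-prefix (_ ∷ Q₁) (_ ∷ m₁) (take p g) e = take p (Greedy-prefix Q₁ m₁ g (ℕP.suc-injective e))
Greedy-prefix (_ ∷ Q₁) (_ ∷ m₁) (drop p g) e = drop p (Greedy-prefix Q₁ m₁ g (ℕP.suc-injective e))
Greedy-prefix (_ ∷ Q₁) (_ ∷ m₁) (forbid g) e = forbid (Greedy-prefix Q₁ m₁ g (ℕP.suc-injective e))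

open import Data.Nat.DivMod using (_mod_; _%_; _/_; m%n<n; m<n⇒m%n≡m; [m+n]%n≡m%n; m≡m%n+[m/n]*n)

≤-via : ∀ {x y a b} → x ℤ.≤ y → b - a ≡ y - x → a ℤ.≤ b
≤-via p e = ℤP.0≤i-j⇒j≤i (subst (+ 0 ℤ.≤_) (sym e) (ℤP.i≤j⇒0≤j-i p))

-- Heights under the Demazure product

-- Left multiplication acts on each row by itself, so the heights of one weight can be followed
-- without the rest of the array. In `push` the last letter of the word acts first.
step : ℕ → (ℕ → ℤ) → ℕ → ℤ
step s h = set (suc s) (trop (h s) (h (suc s)) (h (suc (suc s)))) h

push : Word n → (ℕ → ℤ) → ℕ → ℤ
push []      h = h
push (s ∷ w) h = step (toℕ s) (push w h)

step-cong : ∀ s {g h : ℕ → ℤ} → (∀ i → g i ≡ h i) → ∀ i → step s g i ≡ step s h i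
step-cong s {g} {h} e = λ i → L-cong trop s {λ _ → g} {λ _ → h} (λ _ → e) 0 i

push-cong : (w : Word n) → ∀ {g h : ℕ → ℤ} → (∀ i → g i ≡ h i) → ∀ i → push w g i ≡ push w h i
push-cong []      e = e
push-cong (s ∷ w) e = step-cong (toℕ s) (push-cong w e)

Dem-push : (w v : Word n) → ∀ j i → Dem (w ++ v) j i ≡ push w (Dem v j) i
Dem-push []      v j i = refl
Dem-push (s ∷ w) v j i = step-cong (toℕ s) (Dem-push w v j) i

push-miss : (w : Word n) → ∀ h i → All (λ s → i ≢ suc (toℕ s)) w → push w h i ≡ h i
push-miss []      h i []      = refl
push-miss (s ∷ w) h i (p ∷ a) = trans (set-miss (suc (toℕ s)) _ (push w h) i p) (push-miss w h i a)

push-++ : (u v : Word n) → ∀ h i → push (u ++ v) h i ≡ push u (push v h) i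
push-++ []      v h i = refl
push-++ (s ∷ u) v h i = step-cong (toℕ s) (push-++ u v h) i

push-at : (u : Word n) (s : Fin n) (v : Word n) → ∀ h → All (λ t → suc (toℕ s) ≢ suc (toℕ t)) u →
  push (u ++ s ∷ v) h (suc (toℕ s)) ≡ push v h (toℕ s) ⊔ (push v h (suc (suc (toℕ s))) - + 1)
push-at u s v h a = trans (push-++ u (s ∷ v) h _) (trans (push-miss u _ _ a) (set-hit (suc (toℕ s)) _ (push v h)))

-- The array form of the fact that a fundamental weight is fixed by all other simple reflections.
Dem-row : (u v : Word n) → ∀ j i → All (λ t → j ≢ suc (toℕ t)) v → Dem (u ++ v) j i ≡ Dem u j i
Dem-row u [] j i [] rewrite ListP.++-identityʳ u = refl
Dem-row u (t ∷ v) j i (p ∷ a) rewrite sym (ListP.++-assoc u (t ∷ []) v) =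
  trans (Dem-row (u ∷ʳ t) v j i a) (trans (Dem-∷ʳ u t j i) (R-miss trop (toℕ t) (Dem u) j i p))

Dem-cong : (u v v' : Word n) → Dem v ≗A Dem v' → Dem (u ++ v) ≗A Dem (u ++ v')
Dem-cong []      v v' e = e
Dem-cong (s ∷ u) v v' e = L-cong trop (toℕ s) (Dem-cong u v v' e)

bound : ∀ ps → ∃ λ M → All (_< M) ps
bound []       = 0 , []
bound (p ∷ ps) = let M , a = bound ps in
  suc p ℕ.⊔ M , ℕP.m≤m⊔n (suc p) M ∷ All.map (λ q → ℕP.≤-trans q (ℕP.m≤n⊔m (suc p) M)) a

All-range : (P : ℕ → Set) → ∀ off l → (∀ i → off ≤ i → i < off ℕ.+ l → P i) → All P (range off l)
All-range P off zero    f = []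
All-range P off (suc l) f = f off ℕP.≤-refl (ℕP.m<m+n off ℕ.z<s)
  ∷ All-range P (suc off) l (λ i a b → f i (ℕP.<⇒≤ a) (subst (i <_) (sym (ℕP.+-suc off l)) b))

toList-range : {A : Set} {m : ℕ} (v : Vec A m) (f : ℕ → A) → ∀ off → (∀ i → lookup v i ≡ f (off ℕ.+ toℕ i)) →
  toList v ≡ List.map f (range off m)
toList-range []      f off e = refl
toList-range (x ∷ v) f off e = cong₂ _∷_ (trans (e Fin.zero) (cong f (ℕP.+-identityʳ off)))
  (toList-range v f (suc off) (λ i → trans (e (Fin.suc i)) (cong f (ℕP.+-suc off (toℕ i)))))

-- Coxeter words and the sorting word of w∘

module Coxeter {n : ℕ} .{{_ : NonZero n}} (c : Vec (Fin n) n) (c-inj : IsCoxeterWord c) where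

  toℕ-mod : ∀ p → toℕ (p mod n) ≡ p % n
  toℕ-mod p = FinP.toℕ-fromℕ< (m%n<n p n)

  letter-lookup : ∀ i → letter c (toℕ i) ≡ lookup c i
  letter-lookup i = cong (lookup c) (FinP.toℕ-injective (trans (toℕ-mod (toℕ i)) (m<n⇒m%n≡m (FinP.toℕ<n i))))

  letter-period : ∀ p → letter c (n ℕ.+ p) ≡ letter c p
  letter-period p = cong (lookup c) (FinP.toℕ-injective (trans (toℕ-mod (n ℕ.+ p))
    (trans (trans (cong (_% n) (ℕP.+-comm n p)) ([m+n]%n≡m%n p n)) (sym (toℕ-mod p)))))

  -- Equal letters sit at positions congruent modulo n, hence at distance at least n.
  letter-distinct : ∀ p q → p < q → q < p ℕ.+ n → letter c p ≢ letter c q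
  letter-distinct p q p<q q<p+n e = bad (p / n) (q / n) (m≡m%n+[m/n]*n p n) (m≡m%n+[m/n]*n q n)
    where
    same-mod : p % n ≡ q % n
    same-mod = trans (sym (toℕ-mod p)) (trans (cong toℕ (c-inj e)) (toℕ-mod q))
    bad : ∀ a b → p ≡ p % n ℕ.+ a ℕ.* n → q ≡ q % n ℕ.+ b ℕ.* n → ⊥
    bad a b ep eq with ℕP.≤-<-connex b a
    ... | inj₁ b≤a = ℕP.<⇒≱ p<q (subst₂ _≤_ (sym eq) (sym ep)
            (ℕP.+-mono-≤ (ℕP.≤-reflexive (sym same-mod)) (ℕP.*-monoˡ-≤ n b≤a)))
    ... | inj₂ a<b = ℕP.<⇒≱ q<p+n (subst₂ _≤_ (trans (trans (cong (r ℕ.+_) (ℕP.+-comm n (a ℕ.* n)))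
              (sym (ℕP.+-assoc r (a ℕ.* n) n))) (cong (ℕ._+ n) (sym ep))) (trans (cong (ℕ._+ b ℕ.* n) same-mod) (sym eq))
            (ℕP.+-monoʳ-≤ r (ℕP.*-monoˡ-≤ n a<b)))
      where
      r = p % n

  letters-c : toList c ≡ List.map (letter c) (range 0 n)
  letters-c = toList-range c (letter c) 0 (λ i → sym (letter-lookup i))

  word : ℕ → ℕ → Word n
  word off l = List.map (letter c) (range off l)

  word-+ : ∀ off k l → word off (k ℕ.+ l) ≡ word off k ++ word (off ℕ.+ k) l
  word-+ off k l = trans (cong (List.map (letter c)) (range-+ off k l)) (ListP.map-++ (letter c) (range off k) _)

  word-period : ∀ off l → word (n ℕ.+ off) l ≡ word off l
  word-period off zero    = refl
  word-period off (suc l) = cong₂ _∷_ (letter-period off)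
    (trans (cong (λ z → word z l) (sym (ℕP.+-suc n off))) (word-period (suc off) l))

  word-avoids : ∀ p off l → p < off → off ℕ.+ l ≤ p ℕ.+ n → All (λ t → suc (toℕ (letter c p)) ≢ suc (toℕ t)) (word off l)
  word-avoids p off l a b = AllP.map⁺ (All-range _ off l
    (λ i x y e → letter-distinct p i (ℕP.≤-trans a x) (ℕP.≤-trans y b) (FinP.toℕ-injective (ℕP.suc-injective e))))

  before-avoids : ∀ p l → l ≤ p → p < n → All (λ t → suc (toℕ (letter c p)) ≢ suc (toℕ t)) (word 0 l)
  before-avoids p l a b = AllP.map⁺ (All-range _ 0 l
    (λ i x y e → letter-distinct i p (ℕP.≤-trans y a) (ℕP.≤-trans b (ℕP.m≤n+m n i)) (sym (FinP.toℕ-injective (ℕP.suc-injective e)))))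

  module Sorting (ps : List ℕ) (woc : IsWoc c ps) where

    -- In a prefix of length `M` containing all of `ps`, the greedy subword has the Demazure product
    -- of the whole prefix, so it spells w∘ as well. At a first difference it would use a letter
    -- that `ps` omits, against `ps` being lexicographically first.
    woc-greedy : ∃ λ mp → kept 0 mp ≡ ps × Greedy [] (allow (word 0 (length mp))) mp
    woc-greedy = mp , kept-mp , subst (λ z → Greedy [] (allow (word 0 z)) mp) (sym length-mp)
        (subst (Greedy [] (allow (word 0 M))) (sym same-mask) g)
      where
      M = proj₁ (bound ps)
      mp = List.map not (mask 0 ps M)
      length-mp : length mp ≡ M
      length-mp = trans (ListP.length-map not (mask 0 ps M)) (length-mask 0 ps M)
      kept-mp : kept 0 mp ≡ ps
      kept-mp = trans (kept-not 0 (mask 0 ps M)) (removed-mask M (Linked⇒Sorted (proj₁ woc)) (proj₂ (bound ps)))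
      mg = proj₁ (greedy [] (allow (word 0 M)))
      g = proj₂ (greedy [] (allow (word 0 M)))
      length-mg : length mg ≡ M
      length-mg = trans (Greedy-length g) (trans (ListP.length-map _ (word 0 M)) (trans (ListP.length-map _ (range 0 M)) (length-range 0 M)))
      select-word : ∀ m → length m ≡ M → select m (word 0 M) ≡ List.map (letter c) (kept 0 m)
      select-word m e = trans (cong (λ z → select m (word 0 z)) (sym e)) (select-range (letter c) 0 m)
      correct : Reduced (select mg (word 0 M)) × ρ (select mg (word 0 M)) ≗A Dem (word 0 M)
      correct = subst₂ (λ a b → Reduced (select mg a) × ρ (select mg a) ≗A Dem b) (letters-allow (word 0 M)) (allowed-allow (word 0 M))
        (Greedy-correct g [] Reduced-[] (λ _ _ → refl))
      q : Word n
      q = List.map (letter c) ps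
      w0 : IsRedW0 (List.map (letter c) ps)
      w0 = proj₁ (proj₂ woc)
      subword : List.map (letter c) ps ⊆ word 0 M
      subword = subst (_⊆ word 0 M) (trans (select-word mp length-mp) (cong (List.map (letter c)) kept-mp)) (select-⊆ mp (word 0 M))
      mg-w0 : IsRedW0 (List.map (letter c) (kept 0 mg))
      mg-w0 = subst IsRedW0 (select-word mg length-mg) (proj₁ (w0-recognise q (select mg (word 0 M)) w0 (proj₁ correct)
        (λ j i → subst₂ ℤ._≤_ (trans (sym (proj₂ correct j i)) (Reduced⇒Dem (select mg (word 0 M)) (proj₁ correct) j i))
          (sym (Reduced⇒Dem q (proj₁ w0) j i)) (Dem-anti subword j i))))
      same-mask : mp ≡ mg
      same-mask = first-mask 0 mp g (trans length-mp (sym (trans (ListP.length-map _ (range 0 M)) (length-range 0 M))))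
        (subst Reduced (sym (trans (select-word mp length-mp) (cong (List.map (letter c)) kept-mp))) (proj₁ w0))
        (trans (cong length kept-mp) (trans (sym (ListP.length-map (letter c) ps))
          (trans (w0-length q (List.map (letter c) (kept 0 mg)) w0 mg-w0) (ListP.length-map (letter c) (kept 0 mg)))))
        (subst (λ z → LexLeq z (kept 0 mg)) (sym kept-mp)
          (proj₂ (proj₂ woc) (kept 0 mg) (Sorted⇒Linked (kept-Sorted 0 mg)) mg-w0))

    module At (ps₁ : List ℕ) (p : ℕ) (ps₂ : List ℕ) (split : ps ≡ ps₁ ++ p ∷ ps₂) where

      qs₁ qs₂ : Word n
      qs₁ = List.map (letter c) ps₁
      qs₂ = List.map (letter c) ps₂

      s₀ : Fin n
      s₀ = letter c p

      split-word : List.map (letter c) ps ≡ qs₁ ++ s₀ ∷ qs₂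
      split-word = trans (cong (List.map (letter c)) split) (ListP.map-++ (letter c) ps₁ (p ∷ ps₂))

      w0-split : IsRedW0 (qs₁ ++ s₀ ∷ qs₂)
      w0-split = subst IsRedW0 split-word (proj₁ (proj₂ woc))

      qs₁s-reduced : Reduced (qs₁ ∷ʳ s₀)
      qs₁s-reduced = Reduced-prefix (qs₁ ∷ʳ s₀) qs₂ (subst Reduced (sym (ListP.++-assoc qs₁ (s₀ ∷ []) qs₂)) (proj₁ w0-split))

      qs₁-reduced : Reduced qs₁
      qs₁-reduced = Reduced-prefix qs₁ (s₀ ∷ []) qs₁s-reduced

      -- An initial part of a greedy subword is the greedy subword of an initial part, so it has the
      -- Demazure product of all letters before position `p`.
      qs₁-Dem : ρ qs₁ ≗A Dem (word 0 p)
      qs₁-Dem with woc-greedy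
      ... | mp , kept-mp , g with kept-split 0 mp ps₁ p ps₂ (trans kept-mp split)
      ...   | m₁ , m₂ , refl , refl , refl = λ j i → trans
          (cong (λ z → ρ z j i) (sym (trans (cong (select m₁) (letters-allow (word 0 (length m₁)))) (select-range (letter c) 0 m₁))))
          (trans (proj₂ (Greedy-correct (Greedy-prefix (allow (word 0 (length m₁))) m₁ g′ len) [] Reduced-[] (λ _ _ → refl)) j i)
            (cong (λ z → Dem z j i) (allowed-allow (word 0 (length m₁)))))
        where
        len : length m₁ ≡ length (allow (word 0 (length m₁)))
        len = sym (trans (ListP.length-map _ (word 0 (length m₁))) (trans (ListP.length-map _ (range 0 (length m₁))) (length-range 0 (length m₁))))
        g′ : Greedy [] (allow (word 0 (length m₁)) ++ allow (word (length m₁) (suc (length m₂)))) (m₁ ++ true ∷ m₂)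
        g′ = subst (λ z → Greedy [] z (m₁ ++ true ∷ m₂))
          (trans (cong allow (trans (cong (word 0) (ListP.length-++ m₁)) (word-+ 0 (length m₁) (suc (length m₂)))))
            (ListP.map-++ _ (word 0 (length m₁)) _)) g

      -- One further round of the Coxeter element moves the weight exactly as the letter s₀ does.
      round : ∀ i → Dem (toList c ++ qs₁) (suc (toℕ s₀)) i ≡ ρ (qs₁ ∷ʳ s₀) (suc (toℕ s₀)) i
      round i = trans (Dem-cong (toList c) qs₁ (word 0 p) (λ j k → trans (sym (Reduced⇒Dem qs₁ qs₁-reduced j k)) (qs₁-Dem j k)) _ i)
        (trans (cong (λ z → Dem z (suc (toℕ s₀)) i) rotate)
        (trans (Dem-row (word 0 p ∷ʳ s₀) (word (suc p) (ℕ.pred n)) (suc (toℕ s₀)) i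
          (word-avoids p (suc p) (ℕ.pred n) ℕP.≤-refl (ℕP.≤-reflexive (trans (sym (ℕP.+-suc p (ℕ.pred n))) (cong (p ℕ.+_) (ℕP.suc-pred n))))))
        (trans (Dem-∷ʳ (word 0 p) s₀ (suc (toℕ s₀)) i)
        (trans (R-cong trop (toℕ s₀) (λ j k → sym (qs₁-Dem j k)) _ i)
          (R-ascent qs₁ s₀ (Reduced⇒Ascent qs₁ s₀ qs₁s-reduced) _ i)))))
        where
        -- A copy of c in front of the first `p` letters gives the first n + p letters of the
        -- periodic word. Behind `s₀` there remain n - 1 letters, all different from it, and these
        -- leave its row alone.
        rotate : toList c ++ word 0 p ≡ (word 0 p ∷ʳ s₀) ++ word (suc p) (ℕ.pred n)
        rotate = trans (cong₂ _++_ letters-c (trans (sym (word-period 0 p)) (cong (λ z → word z p) (ℕP.+-identityʳ n))))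
          (trans (sym (word-+ 0 n p)) (trans (cong (word 0) (ℕP.+-comm n p)) (trans (word-+ 0 p n)
            (trans (cong (λ z → word 0 p ++ word p z) (sym (ℕP.suc-pred n))) (sym (ListP.++-assoc (word 0 p) (s₀ ∷ []) _))))))

extF : (Fin n → ℤ) → ℕ → ℤ
extF {zero}  f m       = + 0
extF {suc n} f zero    = f Fin.zero
extF {suc n} f (suc m) = extF (f ∘ Fin.suc) m

-- Shifted by one and padded by zeros, so that `dd` needs no special case at the two ends of the
-- diagram.
ext : (Fin n → ℤ) → ℕ → ℤ
ext f zero    = + 0
ext f (suc m) = extF f m

extF-toℕ : (f : Fin n → ℤ) → ∀ i → extF f (toℕ i) ≡ f i
extF-toℕ f Fin.zero    = refl
extF-toℕ f (Fin.suc i) = extF-toℕ (f ∘ Fin.suc) i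

extF-top : (f : Fin n → ℤ) → extF f n ≡ + 0
extF-top {zero}  f = refl
extF-top {suc n} f = extF-top (f ∘ Fin.suc)

dd-ext : (h g : ℕ → ℤ) (f : Fin n → ℤ) → h 0 ≡ g 0 → (∀ s → h (suc (toℕ s)) ≡ g (suc (toℕ s)) + f s) →
  h (suc n) ≡ g (suc n) → ∀ (j : Fin n) → dd h (toℕ j) - dd g (toℕ j) ≡ dd (ext f) (toℕ j)
dd-ext {n} h g f e₀ e eₙ j = trans
  (cong (_- dd g (toℕ j)) (cong₃ (λ a b e → + 2 * a - b - e) (at (suc (toℕ j)) (ℕP.m≤n⇒m≤1+n (FinP.toℕ<n j)))
    (at (toℕ j) (ℕP.<⇒≤ (ℕP.m≤n⇒m≤1+n (FinP.toℕ<n j)))) (at (suc (suc (toℕ j))) (s≤s (FinP.toℕ<n j)))))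
  (lem _ _ _ (g (toℕ j)) (g (suc (toℕ j))) (g (suc (suc (toℕ j)))))
  where
  at : ∀ i → i ≤ suc n → h i ≡ g i + ext f i
  at zero    p = trans e₀ (sym (ℤP.+-identityʳ (g 0)))
  at (suc m) (s≤s p) with ℕP.m≤n⇒m<n∨m≡n p
  ... | inj₁ q = subst (λ z → h (suc z) ≡ g (suc z) + extF f z) (FinP.toℕ-fromℕ< q)
        (trans (e (fromℕ< q)) (cong (_+_ (g (suc (toℕ (fromℕ< q))))) (sym (extF-toℕ f (fromℕ< q)))))
  ... | inj₂ refl = trans eₙ (trans (sym (ℤP.+-identityʳ (g (suc n)))) (cong (_+_ (g (suc n))) (sym (extF-top f))))
  lem : ∀ x y z a b c → (+ 2 * (b + y) - (a + x) - (c + z)) - (+ 2 * b - a - c) ≡ + 2 * y - x - z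
  lem = solve-∀

injective⇒preimage : (f : Fin n → Fin n) → Injective _≡_ _≡_ f → ∀ x → ∃ λ j → f j ≡ x
injective⇒preimage {zero}  f inj ()
injective⇒preimage {suc n} f inj x with FinP.any? (λ j → f j Fin.≟ x)
... | yes p = p
... | no p = contradiction (FinP.injective⇒≤ {f = λ j → Fin.punchOut {i = x} {f j} (λ e → p (j , sym e))}
        (λ {a} {b} e → inj (FinP.punchOut-injective (λ e → p (a , sym e)) (λ e → p (b , sym e)) e))) ℕP.1+n≰n

-- The order ideals (or filters, according to the order of the letters in c) of the support of a root D.
record Ideal {n} (c : Vec (Fin n) n) (D μ : Fin n → ℤ) : Set where
  field
    nonneg : ∀ s → + 0 ℤ.≤ μ s
    under  : ∀ s → μ s ℤ.≤ D s
    fwd    : ∀ i j → suc (toℕ (lookup c i)) ≡ toℕ (lookup c j) → D (lookup c i) ≡ + 1 → D (lookup c j) ≡ + 1 →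
             toℕ i < toℕ j → μ (lookup c j) ℤ.≤ μ (lookup c i)
    bwd    : ∀ i j → suc (toℕ (lookup c i)) ≡ toℕ (lookup c j) → D (lookup c i) ≡ + 1 → D (lookup c j) ≡ + 1 →
             toℕ j < toℕ i → μ (lookup c i) ℤ.≤ μ (lookup c j)

Bit : ℤ → Set
Bit z = z ≡ + 0 ⊎ z ≡ + 1

squeeze : ∀ {z d} → + 0 ℤ.≤ z → z ℤ.≤ d → Bit d → Bit z
squeeze (ℤ.+≤+ {n = zero} _)        _ _ = inj₁ refl
squeeze (ℤ.+≤+ {n = suc zero} _)    _ _ = inj₂ refl
squeeze (ℤ.+≤+ {n = suc (suc m)} _) (ℤ.+≤+ ()) (inj₁ refl)
squeeze (ℤ.+≤+ {n = suc (suc m)} _) (ℤ.+≤+ (s≤s ())) (inj₂ refl)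

-- The initial segment is the lexicographically least increasing list of its length; this identifies
-- the greedy facet.
Sorted-range : ∀ off I → Sorted off I → LexLeq I (range off (length I)) → I ≡ range off (length I)
Sorted-range off []      s       l = refl
Sorted-range off (x ∷ I) (p ∷ s) l with Lex-∷ l
... | inj₁ q          = contradiction p (ℕP.<⇒≱ q)
... | inj₂ (refl , r) = cong (x ∷_) (Sorted-range (suc x) I s r)

removed-replicate : ∀ off k l → removed off (List.replicate k false ++ List.replicate l true) ≡ range off k
removed-replicate off zero    zero    = refl
removed-replicate off zero    (suc l) = removed-replicate (suc off) zero l
removed-replicate off (suc k) l       = cong (off ∷_) (removed-replicate (suc off) k l)

replicate-+ : {A : Set} → ∀ k l (x : A) → List.replicate (k ℕ.+ l) x ≡ List.replicate k x ++ List.replicate l x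
replicate-+ zero    l x = refl
replicate-+ (suc k) l x = cong (x ∷_) (replicate-+ k l x)

select-false : {A : Set} (xs ys : List A) (m : List Bool) → select (List.replicate (length xs) false ++ m) (xs ++ ys) ≡ select m ys
select-false []       ys m = refl
select-false (x ∷ xs) ys m = select-false xs ys m

select-true : {A : Set} (xs ys : List A) → select (List.replicate (length xs) true) (xs ++ ys) ≡ xs
select-true []       []       = refl
select-true []       (y ∷ ys) = refl
select-true (x ∷ xs) ys       = cong (x ∷_) (select-true xs ys)

-- From facets to order ideals

module Facets {n : ℕ} .{{_ : NonZero n}} (c : Vec (Fin n) n) (c-inj : IsCoxeterWord c) (ps : List ℕ) (woc : IsWoc c ps)
  (ps₁ : List ℕ) (p : ℕ) (ps₂ : List ℕ) (split : ps ≡ ps₁ ++ p ∷ ps₂) where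

  open Coxeter c c-inj
  open Sorting ps woc
  open At ps₁ p ps₂ split

  C Q′ Rest q : Word n
  C    = toList c
  Q′   = Qword c ps
  Rest = s₀ ∷ qs₂
  q    = qs₁ ++ Rest

  K : ℕ
  K = length (C ++ qs₁)

  Q-split : Q′ ≡ (C ++ qs₁) ++ Rest
  Q-split = trans (cong (C ++_) split-word) (sym (ListP.++-assoc C qs₁ Rest))

  Q-split′ : Q′ ≡ C ++ q
  Q-split′ = cong (C ++_) split-word

  length-C : length C ≡ n
  length-C = VecP.length-toList c

  length-Q : length Q′ ≡ K ℕ.+ length Rest
  length-Q = trans (cong length Q-split) (ListP.length-++ (C ++ qs₁))

  U V : ℕ → ℤ
  U = ρ qs₁ (suc (toℕ s₀))
  V = Dem (C ++ qs₁) (suc (toℕ s₀))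

  D : Fin n → ℤ
  D s = U (suc (toℕ s)) - V (suc (toℕ s))

  V-push : ∀ i → V i ≡ push C U i
  V-push i = trans (Dem-push C qs₁ _ i) (push-cong C (λ k → sym (Reduced⇒Dem qs₁ qs₁-reduced _ k)) i)

  low : (w : Word n) → ∀ h → push w h 0 ≡ h 0
  low w h = push-miss w h 0 (All.universal (λ _ ()) w)

  high : (w : Word n) → ∀ h → push w h (suc n) ≡ h (suc n)
  high w h = push-miss w h (suc n) (All.universal (λ t e → ℕP.<-irrefl (sym (ℕP.suc-injective e)) (FinP.toℕ<n t)) w)

  -- `CS` marks the letters of c that may be used. Since all of w∘(c) is available afterwards, the
  -- greedy subword spells w∘ whatever the marks are, and counting letters leaves n positions for
  -- the facet.
  greedy-facet : (CS : List (Bool × Fin n)) → letters CS ≡ C → ∀ {g} → Greedy [] (CS ++ allow q) g →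
    length g ≡ length Q′ × IsRedW0 (select g Q′) × IsFacet Q′ (removed 0 g) × ρ (Π Q′ (removed 0 g) K) ≗A Dem (allowed CS ++ qs₁)
  greedy-facet CS eq {g} G = length-g , w0 , mask-facet Q′ g length-g w0 count , prefix
    where
    letters-QS : letters (CS ++ allow q) ≡ Q′
    letters-QS = trans (ListP.map-++ proj₂ CS (allow q)) (trans (cong₂ _++_ eq (letters-allow q)) (sym Q-split′))
    allowed-++ : ∀ A B → allowed {n} (A ++ B) ≡ allowed A ++ allowed B
    allowed-++ []                B = refl
    allowed-++ ((true , s) ∷ A)  B = cong (s ∷_) (allowed-++ A B)
    allowed-++ ((false , s) ∷ A) B = allowed-++ A B
    length-g : length g ≡ length Q′
    length-g = trans (Greedy-length G) (trans (sym (ListP.length-map proj₂ (CS ++ allow q))) (cong length letters-QS))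
    correct : Reduced (select g Q′) × ρ (select g Q′) ≗A Dem (allowed CS ++ q)
    correct = subst₂ (λ a b → Reduced (select g a) × ρ (select g a) ≗A Dem b) letters-QS
      (trans (allowed-++ CS (allow q)) (cong (allowed CS ++_) (allowed-allow q)))
      (Greedy-correct G [] Reduced-[] (λ _ _ → refl))
    w0 : IsRedW0 (select g Q′)
    w0 = proj₁ (w0-recognise q (select g Q′) w0-split (proj₁ correct) (λ j i → subst₂ ℤ._≤_
      (trans (sym (proj₂ correct j i)) (Reduced⇒Dem (select g Q′) (proj₁ correct) j i)) (sym (Reduced⇒Dem q (proj₁ w0-split) j i))
      (Dem-++-≤ (allowed CS) q j i)))
    count : length (select g Q′) ℕ.+ n ≡ length Q′
    count = trans (cong₂ ℕ._+_ (w0-length (select g Q′) q w0 w0-split) (sym length-C))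
      (trans (ℕP.+-comm (length q) (length C)) (sym (trans (cong length Q-split′) (ListP.length-++ C))))
    QS₁ : List (Bool × Fin n)
    QS₁ = CS ++ allow qs₁
    length-QS₁ : length QS₁ ≡ K
    length-QS₁ = trans (sym (ListP.length-map proj₂ QS₁)) (cong length
      (trans (ListP.map-++ proj₂ CS (allow qs₁)) (cong₂ _++_ eq (letters-allow qs₁))))
    m₁ m₂ : List Bool
    m₁ = List.take K g
    m₂ = List.drop K g
    length-m₁ : length m₁ ≡ K
    length-m₁ = trans (ListP.length-take K g) (ℕP.m≤n⇒m⊓n≡m (subst (K ≤_) (sym (trans length-g length-Q)) (ℕP.m≤m+n K _)))
    G₁ : Greedy [] QS₁ m₁
    G₁ = Greedy-prefix QS₁ m₁ (subst₂ (Greedy []) (trans (cong (CS ++_) (ListP.map-++ _ qs₁ Rest)) (sym (ListP.++-assoc CS (allow qs₁) (allow Rest))))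
      (sym (ListP.take++drop≡id K g)) G) (trans length-m₁ (sym length-QS₁))
    prefix : ρ (Π Q′ (removed 0 g) K) ≗A Dem (allowed CS ++ qs₁)
    prefix j i = trans (cong (λ z → ρ z j i) (trans (mask-prefix g Q′ K (length Rest) (trans length-g length-Q) m₁ m₂ (sym (ListP.take++drop≡id K g)) length-m₁)
        (trans (cong (select m₁) Q-split) (select-prefix m₁ (C ++ qs₁) Rest length-m₁))))
      (trans (cong (λ z → ρ (select m₁ z) j i) (sym (trans (ListP.map-++ proj₂ CS (allow qs₁)) (cong₂ _++_ eq (letters-allow qs₁)))))
        (trans (proj₂ (Greedy-correct G₁ [] Reduced-[] (λ _ _ → refl)) j i)
          (cong (λ z → Dem z j i) (trans (allowed-++ CS (allow qs₁)) (cong (allowed CS ++_) (allowed-allow qs₁))))))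

  -- Deleting the initial copy of c leaves w∘(c), so the greedy facet consists of the first n
  -- positions.
  greedy-prefix : ∀ Ig → IsGreedy Q′ Ig → Π Q′ Ig K ≡ qs₁
  greedy-prefix Ig (facet , least) = trans (cong (λ z → Π Q′ z K) Ig≡)
      (trans (mask-prefix m₀ Q′ K (length Rest) (trans length-m₀ length-Q) (F ++ List.replicate (length qs₁) true) (List.replicate (length Rest) true)
        (trans (cong (F ++_) (trans (cong (λ z → List.replicate z true) (ListP.length-++ qs₁)) (replicate-+ (length qs₁) (length Rest) true)))
          (sym (ListP.++-assoc F _ _)))
        (trans (ListP.length-++ F) (trans (cong₂ ℕ._+_ (ListP.length-replicate (length C)) (ListP.length-replicate (length qs₁))) (sym (ListP.length-++ C)))))
      (trans (cong (select (F ++ List.replicate (length qs₁) true)) Q-split′) (trans (select-false C q _) (select-true qs₁ Rest))))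
    where
    F m₀ : List Bool
    F  = List.replicate (length C) false
    m₀ = F ++ List.replicate (length q) true
    length-m₀ : length m₀ ≡ length Q′
    length-m₀ = trans (ListP.length-++ F) (trans (cong₂ ℕ._+_ (ListP.length-replicate (length C)) (ListP.length-replicate (length q)))
      (sym (trans (cong length Q-split′) (ListP.length-++ C))))
    select-m₀ : select m₀ Q′ ≡ q
    select-m₀ = trans (cong (select m₀) Q-split′) (trans (select-false C q _)
      (trans (cong (select (List.replicate (length q) true)) (sym (ListP.++-identityʳ q))) (select-true q [])))
    facet₀ : IsFacet Q′ (removed 0 m₀)
    facet₀ = mask-facet Q′ m₀ length-m₀ (subst IsRedW0 (sym select-m₀) w0-split)
      (trans (cong₂ ℕ._+_ (cong length select-m₀) (sym length-C))
        (trans (ℕP.+-comm (length q) (length C)) (sym (trans (cong length Q-split′) (ListP.length-++ C)))))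
    removed-m₀ : removed 0 m₀ ≡ range 0 (length Ig)
    removed-m₀ = trans (removed-replicate 0 (length C) (length q)) (cong (range 0) (trans length-C (sym (proj₁ (proj₂ facet)))))
    Ig≡ : Ig ≡ removed 0 m₀
    Ig≡ = trans (Sorted-range 0 Ig (Linked⇒Sorted (proj₁ facet)) (subst (LexLeq Ig) removed-m₀ (least _ facet₀))) (sym removed-m₀)

  -- By `act-α` the root compares the weights moved by `qs₁` and by `qs₁ ∷ʳ s₀`, and `round`
  -- replaces the heights of the second by `V`. At both ends `U` and `V` agree because no letter
  -- acts there.
  root-heights : ∀ Ig → IsGreedy Q′ Ig → ∀ j → act (Π Q′ Ig K) (α s₀) j ≡ dd (ext D) (toℕ j)
  root-heights Ig greedy-Ig j = trans (cong (λ w → act w (α s₀) j) (greedy-prefix Ig greedy-Ig)) (trans (act-α qs₁ s₀ j)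
    (trans (cong (λ z → dd U (toℕ j) - z) (cong₃ (λ a b e → + 2 * a - b - e) (sym (round _)) (sym (round _)) (sym (round _))))
      (dd-ext U V D (sym (trans (V-push 0) (low C U))) (λ s → lem (U (suc (toℕ s))) (V (suc (toℕ s)))) (sym (trans (V-push (suc n)) (high C U))) j)))
    where
    lem : ∀ a b → a ≡ b + (a - b)
    lem = solve-∀

  -- Removing letters as late as possible is using them as early as possible: the complement of the
  -- antigreedy facet is the greedy subword of Q.
  antigreedy-heights : ∀ Iag → IsAntigreedy Q′ Iag → ρ (Π Q′ Iag K) ≗A Dem (C ++ qs₁)
  antigreedy-heights Iag (facet , last) with greedy [] (allow C ++ allow q)
  ... | g , G with greedy-facet (allow C) (letters-allow C) G
  ...   | length-g , w0 , facet-g , prefix = subst₂ (λ I w → ρ (Π Q′ I K) ≗A Dem (w ++ qs₁)) I≡ (allowed-allow C) prefix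
    where
    m : List Bool
    m = mask 0 Iag (length Q′)
    QS≡ : allow C ++ allow q ≡ allow Q′
    QS≡ = trans (sym (ListP.map-++ _ C q)) (cong allow (sym Q-split′))
    m≡g : m ≡ g
    m≡g = antigreedy-mask 0 m (subst (λ z → Greedy [] z g) QS≡ G)
      (trans (allowed-allow Q′) (sym (letters-allow Q′)))
      (trans (length-mask 0 Iag (length Q′)) (sym (ListP.length-map _ Q′)))
      (subst (λ z → Reduced (select m z)) (sym (letters-allow Q′)) (proj₁ (proj₂ (facet-mask Q′ Iag facet))))
      (trans (proj₁ (proj₂ facet-g)) (sym (trans (cong length (proj₁ (facet-mask Q′ Iag facet))) (proj₁ (proj₂ facet)))))
      (subst (LexLeq (removed 0 g)) (sym (proj₁ (facet-mask Q′ Iag facet))) (last _ facet-g))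
    I≡ : removed 0 g ≡ Iag
    I≡ = trans (cong (removed 0) (sym m≡g)) (proj₁ (facet-mask Q′ Iag facet))

  -- For the lower bound, the letters kept before `K` form a subword of `C ++ qs₁`. For the upper
  -- bound, those kept from `K` on form a subword of `Rest`, and `w0-prefix-≤` applies.
  facet-bounds : ∀ I → IsFacet Q′ I → ∀ i → V i ℤ.≤ ρ (Π Q′ I K) (suc (toℕ s₀)) i × ρ (Π Q′ I K) (suc (toℕ s₀)) i ℤ.≤ U i
  facet-bounds I facet i = subst (λ w → V i ℤ.≤ ρ w (suc (toℕ s₀)) i × ρ w (suc (toℕ s₀)) i ℤ.≤ U i) (sym Π≡)
      ( subst (V i ℤ.≤_) (sym (Reduced⇒Dem A (Reduced-prefix A B (proj₁ w0)) _ i)) (Dem-anti (select-⊆ (mask 0 I K) (C ++ qs₁)) _ i)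
      , w0-prefix-≤ qs₁ Rest A B w0-split w0 (select-⊆ (mask K I (length Rest)) Rest) _ i)
    where
    A B : Word n
    A = select (mask 0 I K) (C ++ qs₁)
    B = select (mask K I (length Rest)) Rest
    Π≡ : Π Q′ I K ≡ A
    Π≡ = trans (prefixFrom-select 0 Q′ I K) (trans (cong (select (mask 0 I K)) Q-split) (select-prefix (mask 0 I K) (C ++ qs₁) Rest (length-mask 0 I K)))
    w0 : IsRedW0 (A ++ B)
    w0 = subst IsRedW0 (trans (cong₂ select (trans (cong (mask 0 I) length-Q) (mask-+ 0 I K (length Rest))) Q-split)
      (select-++ (mask 0 I K) _ (C ++ qs₁) Rest (length-mask 0 I K))) (proj₂ (facet-mask Q′ I facet))

  after : ℕ → Word n
  after i = word (suc i) (n ℕ.∸ suc i)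

  C-at : ∀ i → i < n → C ≡ word 0 i ++ letter c i ∷ after i
  C-at i p = trans letters-c (trans (cong (word 0) (sym (trans (ℕP.+-suc i (n ℕ.∸ suc i)) (ℕP.m+[n∸m]≡n p)))) (word-+ 0 i (suc (n ℕ.∸ suc i))))

  after-fix : ∀ i j → j ≤ i → i < n → ∀ h → push (after i) h (suc (toℕ (letter c j))) ≡ h (suc (toℕ (letter c j)))
  after-fix i j j≤i i<n h = push-miss (after i) h _ (word-avoids j (suc i) (n ℕ.∸ suc i) (s≤s j≤i)
    (subst (_≤ j ℕ.+ n) (sym (ℕP.m+[n∸m]≡n i<n)) (ℕP.m≤n+m n j)))

  -- A letter occurs once in c, so the height at its label changes only when it acts: after the
  -- later letters of c and before the earlier ones.
  V-at : ∀ i → i < n → V (suc (toℕ (letter c i))) ≡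
    push (after i) U (toℕ (letter c i)) ⊔ (push (after i) U (suc (suc (toℕ (letter c i)))) - + 1)
  V-at i p = trans (V-push _) (trans (cong (λ w → push w U (suc (toℕ (letter c i)))) (C-at i p))
    (push-at (word 0 i) (letter c i) (after i) U (before-avoids i i ℕP.≤-refl p)))

  -- When the letter at `j` acts, its lower neighbour stands earlier in c and has not acted yet; its
  -- height is still that of `U` and is one term of the maximum. `V-bwd` uses the other term.
  V-fwd : ∀ i j → suc (toℕ (lookup c i)) ≡ toℕ (lookup c j) → toℕ i < toℕ j → U (suc (toℕ (lookup c i))) ℤ.≤ V (suc (toℕ (lookup c j)))
  V-fwd i j adj i<j = subst₂ (λ a b → U (suc (toℕ a)) ℤ.≤ V (suc (toℕ b))) (letter-lookup i) (letter-lookup j)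
    (subst (U (suc (toℕ a′)) ℤ.≤_) (sym (V-at (toℕ j) (FinP.toℕ<n j)))
      (subst (λ z → U (suc (toℕ a′)) ℤ.≤ push (after (toℕ j)) U z ⊔ (push (after (toℕ j)) U (suc (suc (toℕ b′))) - + 1)) adj′
        (subst (λ z → z ℤ.≤ push (after (toℕ j)) U (suc (toℕ a′)) ⊔ (push (after (toℕ j)) U (suc (suc (toℕ b′))) - + 1)) (after-fix (toℕ j) (toℕ i) (ℕP.<⇒≤ i<j) (FinP.toℕ<n j) U) (ℤP.i≤i⊔j (push (after (toℕ j)) U (suc (toℕ a′))) _))))
    where
    a′ b′ : Fin n
    a′ = letter c (toℕ i)
    b′ = letter c (toℕ j)
    adj′ : suc (toℕ a′) ≡ toℕ b′
    adj′ = trans (cong (suc ∘ toℕ) (letter-lookup i)) (trans adj (cong toℕ (sym (letter-lookup j))))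

  V-bwd : ∀ i j → suc (toℕ (lookup c i)) ≡ toℕ (lookup c j) → toℕ j < toℕ i → U (suc (toℕ (lookup c j))) - + 1 ℤ.≤ V (suc (toℕ (lookup c i)))
  V-bwd i j adj j<i = subst₂ (λ a b → U (suc (toℕ b)) - + 1 ℤ.≤ V (suc (toℕ a))) (letter-lookup i) (letter-lookup j)
    (subst (U (suc (toℕ b′)) - + 1 ℤ.≤_) (sym (V-at (toℕ i) (FinP.toℕ<n i)))
      (subst (λ z → U (suc (toℕ b′)) - + 1 ℤ.≤ push (after (toℕ i)) U (toℕ a′) ⊔ (push (after (toℕ i)) U (suc z) - + 1)) (sym adj′)
        (subst (λ z → z - + 1 ℤ.≤ push (after (toℕ i)) U (toℕ a′) ⊔ (push (after (toℕ i)) U (suc (toℕ b′)) - + 1)) (after-fix (toℕ i) (toℕ j) (ℕP.<⇒≤ j<i) (FinP.toℕ<n i) U) (ℤP.i≤j⊔i (push (after (toℕ i)) U (toℕ a′)) (push (after (toℕ i)) U (suc (toℕ b′)) - + 1)))))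
    where
    a′ b′ : Fin n
    a′ = letter c (toℕ i)
    b′ = letter c (toℕ j)
    adj′ : suc (toℕ a′) ≡ toℕ b′
    adj′ = trans (cong (suc ∘ toℕ) (letter-lookup i)) (trans adj (cong toℕ (sym (letter-lookup j))))

  weight-difference : ∀ I Iag → IsAntigreedy Q′ Iag → (μ : Fin n → ℤ) → (∀ s → ρ (Π Q′ I K) (suc (toℕ s₀)) (suc (toℕ s)) ≡ V (suc (toℕ s)) + μ s) →
    ρ (Π Q′ I K) (suc (toℕ s₀)) 0 ≡ V 0 → ρ (Π Q′ I K) (suc (toℕ s₀)) (suc n) ≡ V (suc n) →
    ∀ j → act (Π Q′ I K) (ω s₀) j - act (Π Q′ Iag K) (ω s₀) j ≡ dd (ext μ) (toℕ j)
  weight-difference I Iag anti μ e e₀ eₙ j = trans (cong₂ _-_ (act-ω (Π Q′ I K) s₀ j)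
      (trans (act-ω (Π Q′ Iag K) s₀ j) (cong₃ (λ a b e → + 2 * a - b - e) (ag _) (ag _) (ag _))))
    (dd-ext (ρ (Π Q′ I K) (suc (toℕ s₀))) V μ e₀ e eₙ j)
    where
    ag : ∀ i → ρ (Π Q′ Iag K) (suc (toℕ s₀)) i ≡ V i
    ag = antigreedy-heights Iag anti (suc (toℕ s₀))

  facet⇒ideal : ∀ I Iag → IsFacet Q′ I → IsAntigreedy Q′ Iag →
    ∃ λ μ → Ideal c D μ × (∀ j → act (Π Q′ I K) (ω s₀) j - act (Π Q′ Iag K) (ω s₀) j ≡ dd (ext μ) (toℕ j))
  facet⇒ideal I Iag facet anti = μ , ideal , weight-difference I Iag anti μ (λ s → lem (h (suc (toℕ s))) (V (suc (toℕ s))))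
      (pinch 0 (trans (V-push 0) (low C U))) (pinch (suc n) (trans (V-push (suc n)) (high C U)))
    where
    h : ℕ → ℤ
    h = ρ (Π Q′ I K) (suc (toℕ s₀))
    lo : ∀ i → V i ℤ.≤ h i
    lo i = proj₁ (facet-bounds I facet i)
    hi : ∀ i → h i ℤ.≤ U i
    hi i = proj₂ (facet-bounds I facet i)
    pinch : ∀ i → V i ≡ U i → h i ≡ V i
    pinch i e = ℤP.≤-antisym (subst (h i ℤ.≤_) (sym e) (hi i)) (lo i)
    μ : Fin n → ℤ
    μ s = h (suc (toℕ s)) - V (suc (toℕ s))
    lem : ∀ a b → a ≡ b + (a - b)
    lem = solve-∀
    l₁ : ∀ h₁ h₂ v₁ v₂ → (h₁ - v₁) - (h₂ - v₂) ≡ (h₁ + + 1 + v₂) - (h₂ + (v₁ + + 1))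
    l₁ = solve-∀
    l₂ : ∀ h₁ h₂ v₁ v₂ → (h₂ - v₂) - (h₁ - v₁) ≡ (h₂ + v₁) - (h₁ + v₂)
    l₂ = solve-∀
    l₃ : ∀ u v → u - v ≡ + 1 → u ≡ v + + 1
    l₃ u v e = trans (lem u v) (cong (_+_ v) e)
    l₄ : ∀ v → v + + 1 - + 1 ≡ v
    l₄ = solve-∀
    ideal : Ideal c D μ
    ideal = record
      { nonneg = λ s → ℤP.i≤j⇒0≤j-i (lo (suc (toℕ s)))
      ; under  = λ s → ℤP.+-monoˡ-≤ (- V (suc (toℕ s))) (hi (suc (toℕ s)))
      -- Between neighbours h grows by at most 1, while V grows by at least 1: `Di` says U = V + 1
      -- at the lower label, and `V-fwd` bounds this U by V at the upper one. Subtraction gives the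
      -- claim.
      ; fwd = λ i j adj Di Dj i<j → ≤-via (ℤP.+-mono-≤
          (subst (λ z → h z ℤ.≤ h (suc (toℕ (lookup c i))) + + 1) (cong suc adj) (proj₂ (ρ-col-≤ (Π Q′ I K) _ (suc (toℕ (lookup c i))))))
          (subst (ℤ._≤ V (suc (toℕ (lookup c j)))) (l₃ (U (suc (toℕ (lookup c i)))) (V (suc (toℕ (lookup c i)))) Di) (V-fwd i j adj i<j)))
          (l₁ (h (suc (toℕ (lookup c i)))) (h (suc (toℕ (lookup c j)))) (V (suc (toℕ (lookup c i)))) (V (suc (toℕ (lookup c j)))))
      ; bwd = λ i j adj Di Dj j<i → ≤-via (ℤP.+-mono-≤
          (subst (λ z → h (suc (toℕ (lookup c i))) ℤ.≤ h z) (cong suc adj) (proj₁ (ρ-col-≤ (Π Q′ I K) _ (suc (toℕ (lookup c i))))))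
          (subst (ℤ._≤ V (suc (toℕ (lookup c i)))) (trans (cong (_- + 1) (l₃ (U (suc (toℕ (lookup c j)))) (V (suc (toℕ (lookup c j)))) Dj)) (l₄ (V (suc (toℕ (lookup c j)))))) (V-bwd i j adj j<i)))
          (l₂ (h (suc (toℕ (lookup c i)))) (h (suc (toℕ (lookup c j)))) (V (suc (toℕ (lookup c i)))) (V (suc (toℕ (lookup c j)))))
      }

-- From order ideals back to facets

step-hit : ∀ s h → step s h (suc s) ≡ h s ⊔ (h (suc (suc s)) - + 1)
step-hit s h = set-hit (suc s) _ h

step-miss : ∀ s h i → i ≢ suc s → step s h i ≡ h i
step-miss s h i = set-miss (suc s) _ h i

zero? : (z : ℤ) → z ≡ + 0 ⊎ z ≢ + 0
zero? z with z ℤ.≟ + 0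
... | yes e = inj₁ e
... | no e  = inj₂ e

-- Inside the ideal heights have to stay at `U`, so those letters of c must not act.
flag : (Fin n → ℤ) → Word n → List (Bool × Fin n)
flag μ = List.map (λ s → does (μ s ℤ.≟ + 0) , s)

letters-flag : (μ : Fin n → ℤ) (w : Word n) → letters (flag μ w) ≡ w
letters-flag μ []      = refl
letters-flag μ (s ∷ w) = cong (s ∷_) (letters-flag μ w)

allowed-yes : (μ : Fin n → ℤ) (s : Fin n) (w : Word n) → μ s ≡ + 0 → allowed (flag μ (s ∷ w)) ≡ s ∷ allowed (flag μ w)
allowed-yes μ s w e rewrite dec-true (μ s ℤ.≟ + 0) e = refl

allowed-no : (μ : Fin n → ℤ) (s : Fin n) (w : Word n) → μ s ≢ + 0 → allowed (flag μ (s ∷ w)) ≡ allowed (flag μ w)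
allowed-no μ s w e rewrite dec-false (μ s ℤ.≟ + 0) e = refl

All-allowed : {P : Fin n → Set} (μ : Fin n → ℤ) (w : Word n) → All P w → All P (allowed (flag μ w))
All-allowed μ []      []      = []
All-allowed μ (s ∷ w) (p ∷ a) with does (μ s ℤ.≟ + 0)
... | true  = p ∷ All-allowed μ w a
... | false = All-allowed μ w a

allowed-zero : (μ : Fin n → ℤ) (w : Word n) → All (λ t → μ t ≡ + 0) (allowed (flag μ w))
allowed-zero μ []      = []
allowed-zero μ (s ∷ w) with μ s ℤ.≟ + 0
... | yes e = e ∷ allowed-zero μ w
... | no e  = allowed-zero μ w

module Realise {n : ℕ} .{{_ : NonZero n}} (c : Vec (Fin n) n) (c-inj : IsCoxeterWord c) (ps : List ℕ) (woc : IsWoc c ps)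
  (ps₁ : List ℕ) (p : ℕ) (ps₂ : List ℕ) (split : ps ≡ ps₁ ++ p ∷ ps₂) where

  open Coxeter c c-inj
  open Sorting ps woc
  open At ps₁ p ps₂ split
  open Facets c c-inj ps woc ps₁ p ps₂ split

  push-≤ : (w : Word n) → ∀ i → push w U i ℤ.≤ U i
  push-≤ w i = subst (ℤ._≤ U i) (trans (Dem-push w qs₁ _ i) (push-cong w (λ k → sym (Reduced⇒Dem qs₁ qs₁-reduced _ k)) i))
    (subst (Dem (w ++ qs₁) (suc (toℕ s₀)) i ℤ.≤_) (sym (Reduced⇒Dem qs₁ qs₁-reduced _ i)) (Dem-++-≤ w qs₁ _ i))

  letter-fromℕ< : ∀ {i} (i<n : i < n) → letter c i ≡ lookup c (fromℕ< i<n)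
  letter-fromℕ< {i} i<n = trans (cong (letter c) (sym (FinP.toℕ-fromℕ< i<n))) (letter-lookup (fromℕ< i<n))

  position : ∀ x → ∃ λ j → j < n × letter c j ≡ x
  position x with injective⇒preimage (lookup c) c-inj x
  ... | j , e = toℕ j , FinP.toℕ<n j , trans (letter-lookup j) e

  module _ (μ : Fin n → ℤ) (D-bit : ∀ s → Bit (D s)) (ideal : Ideal c D μ) where

    open Ideal ideal

    zero-off : ∀ x → μ x ℤ.≤ + 0 → μ x ≡ + 0
    zero-off x e = ℤP.≤-antisym e (nonneg x)

    -- The ideal condition as propagation of zeros to a neighbour; a neighbour off the support has
    -- the value 0 anyway.
    fwd′ : ∀ i j → i < n → j < n → suc (toℕ (letter c i)) ≡ toℕ (letter c j) → D (letter c i) ≡ + 1 → μ (letter c i) ≡ + 0 → i < j → μ (letter c j) ≡ + 0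
    fwd′ i j i<n j<n adj Di μi i<j with D-bit (letter c j)
    ... | inj₁ e = zero-off _ (subst (μ (letter c j) ℤ.≤_) e (under _))
    ... | inj₂ e rewrite letter-fromℕ< i<n | letter-fromℕ< j<n = zero-off _ (subst (μ _ ℤ.≤_) μi
          (fwd (fromℕ< i<n) (fromℕ< j<n) adj Di e (subst₂ _<_ (sym (FinP.toℕ-fromℕ< i<n)) (sym (FinP.toℕ-fromℕ< j<n)) i<j)))

    bwd′ : ∀ i j → i < n → j < n → suc (toℕ (letter c i)) ≡ toℕ (letter c j) → D (letter c j) ≡ + 1 → μ (letter c j) ≡ + 0 → j < i → μ (letter c i) ≡ + 0
    bwd′ i j i<n j<n adj Dj μj j<i with D-bit (letter c i)
    ... | inj₁ e = zero-off _ (subst (μ (letter c i) ℤ.≤_) e (under _))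
    ... | inj₂ e rewrite letter-fromℕ< i<n | letter-fromℕ< j<n = zero-off _ (subst (μ _ ℤ.≤_) μj
          (bwd (fromℕ< i<n) (fromℕ< j<n) adj e Dj (subst₂ _<_ (sym (FinP.toℕ-fromℕ< j<n)) (sym (FinP.toℕ-fromℕ< i<n)) j<i)))

    G H : ℕ → ℕ → ℕ → ℤ
    G k l = push (word k l) U
    H k l = push (allowed (flag μ (word k l))) U

    G-V : ∀ k l → k ℕ.+ suc l ≡ n → G k (suc l) (suc (toℕ (letter c k))) ≡ V (suc (toℕ (letter c k)))
    G-V k l e = sym (trans (V-push _) (trans (cong (λ w → push w U (suc (toℕ (letter c k)))) (trans letters-c (trans (cong (word 0) (sym e)) (word-+ 0 k (suc l)))))
      (trans (push-++ (word 0 k) (word k (suc l)) U _) (push-miss (word 0 k) _ _ (before-avoids k k ℕP.≤-refl (subst (k <_) e (ℕP.m<m+n k ℕ.z<s)))))))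

    distinct-index : ∀ k i → k < i → i < n → suc (toℕ (letter c i)) ≢ suc (toℕ (letter c k))
    distinct-index k i k<i i<n e = letter-distinct k i k<i (ℕP.≤-trans i<n (ℕP.m≤n+m n k)) (FinP.toℕ-injective (sym (ℕP.suc-injective e)))

    -- Skipping letters leaves heights too high in general, but not at labels outside the ideal.
    -- When such a letter acts, a neighbour that stands later in c is again outside the ideal by
    -- `fwd′` or `bwd′`, and one that stands earlier still has its height from `U` in both `G` and
    -- `H`. Where D is 0, `U` and `V` agree already.
    H≤G : ∀ l k → k ℕ.+ l ≡ n → ∀ i → k ≤ i → i < n → μ (letter c i) ≡ + 0 →
      H k l (suc (toℕ (letter c i))) ℤ.≤ G k l (suc (toℕ (letter c i)))
    H≤G zero k e i k≤i i<n z = contradiction k≤i (ℕP.<⇒≱ (subst (i <_) (trans (sym e) (ℕP.+-identityʳ k)) i<n))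
    H≤G (suc l) k e i k≤i i<n z with ℕP.m≤n⇒m<n∨m≡n k≤i | zero? (μ (letter c k))
    ... | inj₁ k<i | inj₂ ne rewrite allowed-no μ (letter c k) (word (suc k) l) ne =
          subst (H (suc k) l (suc (toℕ (letter c i))) ℤ.≤_) (sym (step-miss (toℕ (letter c k)) (G (suc k) l) _ (distinct-index k i k<i i<n)))
            (H≤G l (suc k) (trans (sym (ℕP.+-suc k l)) e) i k<i i<n z)
    ... | inj₁ k<i | inj₁ y rewrite allowed-yes μ (letter c k) (word (suc k) l) y =
          subst₂ ℤ._≤_ (sym (step-miss (toℕ (letter c k)) (H (suc k) l) _ (distinct-index k i k<i i<n))) (sym (step-miss (toℕ (letter c k)) (G (suc k) l) _ (distinct-index k i k<i i<n)))
            (H≤G l (suc k) (trans (sym (ℕP.+-suc k l)) e) i k<i i<n z)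
    ... | inj₂ refl | inj₂ ne = contradiction z ne
    ... | inj₂ refl | inj₁ y with D-bit (letter c k)
    ...   | inj₁ D0 = ℤP.≤-trans (push-≤ (allowed (flag μ (word k (suc l)))) _)
            (ℤP.≤-reflexive (trans (ℤP.i-j≡0⇒i≡j _ _ D0) (sym (G-V k l e))))
    ...   | inj₂ D1 rewrite allowed-yes μ (letter c k) (word (suc k) l) y =
            subst₂ ℤ._≤_ (sym (step-hit (toℕ s) (H (suc k) l))) (sym (step-hit (toℕ s) (G (suc k) l)))
              (ℤP.⊔-mono-≤ (left (toℕ s) refl) (ℤP.+-monoˡ-≤ (- + 1) right))
      where
      s : Fin n
      s = letter c k
      e′ : suc k ℕ.+ l ≡ n
      e′ = trans (sym (ℕP.+-suc k l)) e
      neighbour : ∀ j → j < n → (k < j → μ (letter c j) ≡ + 0) → H (suc k) l (suc (toℕ (letter c j))) ℤ.≤ G (suc k) l (suc (toℕ (letter c j)))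
      neighbour j j<n zj with ℕP.≤-<-connex j k
      ... | inj₂ k<j = H≤G l (suc k) e′ j k<j j<n (zj k<j)
      ... | inj₁ j≤k = ℤP.≤-reflexive (trans (push-miss _ U _ (All-allowed μ (word (suc k) l) avoid)) (sym (push-miss _ U _ avoid)))
        where
        avoid : All (λ t → suc (toℕ (letter c j)) ≢ suc (toℕ t)) (word (suc k) l)
        avoid = word-avoids j (suc k) l (s≤s j≤k) (subst (_≤ j ℕ.+ n) (sym e′) (ℕP.m≤n+m n j))
      left : ∀ m → m ≡ toℕ s → H (suc k) l m ℤ.≤ G (suc k) l m
      left zero    _ = ℤP.≤-reflexive (trans (low (allowed (flag μ (word (suc k) l))) U) (sym (low (word (suc k) l) U)))
      left (suc m) f with position (fromℕ< m<n)
        where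
        m<n : m < n
        m<n = ℕP.<-trans (subst (m <_) f (ℕP.n<1+n m)) (FinP.toℕ<n s)
      ... | j , j<n , lj = subst (λ z → H (suc k) l (suc z) ℤ.≤ G (suc k) l (suc z)) tj
            (neighbour j j<n (bwd′ j k j<n i<n (trans (cong suc tj) f) D1 y))
        where
        tj : toℕ (letter c j) ≡ m
        tj = trans (cong toℕ lj) (FinP.toℕ-fromℕ< _)
      right : H (suc k) l (suc (suc (toℕ s))) ℤ.≤ G (suc k) l (suc (suc (toℕ s)))
      right with ℕP.m≤n⇒m<n∨m≡n (FinP.toℕ<n s)
      ... | inj₂ f = ℤP.≤-reflexive (subst (λ z → H (suc k) l (suc z) ≡ G (suc k) l (suc z)) (sym f) (trans (high (allowed (flag μ (word (suc k) l))) U) (sym (high (word (suc k) l) U))))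
      ... | inj₁ lt with position (fromℕ< lt)
      ...   | j , j<n , lj = subst (λ z → H (suc k) l (suc z) ℤ.≤ G (suc k) l (suc z)) tj
            (neighbour j j<n (fwd′ k j i<n j<n (sym tj) D1 y))
        where
        tj : toℕ (letter c j) ≡ suc (toℕ s)
        tj = trans (cong toℕ lj) (FinP.toℕ-fromℕ< lt)

    -- Outside the ideal `H≤G` meets the lower bound of `facet-bounds`. Inside it the letter never
    -- acts, so the height stays at U = V + 1.
    ideal⇒facet : ∀ Iag → IsAntigreedy Q′ Iag →
      ∃ λ I → IsFacet Q′ I × (∀ j → act (Π Q′ I K) (ω s₀) j - act (Π Q′ Iag K) (ω s₀) j ≡ dd (ext μ) (toℕ j))
    ideal⇒facet Iag anti with greedy [] (flag μ C ++ allow q)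
    ... | g , Gr with greedy-facet (flag μ C) (letters-flag μ C) Gr
    ...   | _ , _ , facet , prefix = removed 0 g , facet , weight-difference (removed 0 g) Iag anti μ at-label
            (trans (heights 0) (trans (low S U) (sym (trans (V-push 0) (low C U)))))
            (trans (heights (suc n)) (trans (high S U) (sym (trans (V-push (suc n)) (high C U)))))
      where
      S : Word n
      S = allowed (flag μ C)
      h : ℕ → ℤ
      h = ρ (Π Q′ (removed 0 g) K) (suc (toℕ s₀))
      heights : ∀ i → h i ≡ push S U i
      heights i = trans (prefix _ i) (trans (Dem-push S qs₁ _ i) (push-cong S (λ k → sym (Reduced⇒Dem qs₁ qs₁-reduced _ k)) i))
      split-D : ∀ s → U (suc (toℕ s)) ≡ V (suc (toℕ s)) + D s
      split-D s = lem (U (suc (toℕ s))) (V (suc (toℕ s)))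
        where
        lem : ∀ a b → a ≡ b + (a - b)
        lem = solve-∀
      at-zero : ∀ s → μ s ≡ + 0 → h (suc (toℕ s)) ℤ.≤ V (suc (toℕ s))
      at-zero s z with position s
      ... | j , j<n , refl = subst₂ ℤ._≤_ (sym (trans (heights (suc (toℕ (letter c j)))) (cong (λ w → push (allowed (flag μ w)) U (suc (toℕ (letter c j)))) letters-c)))
            (sym (trans (V-push (suc (toℕ (letter c j)))) (cong (λ w → push w U (suc (toℕ (letter c j)))) letters-c))) (H≤G n 0 refl j z≤n j<n z)
      at-label : ∀ s → h (suc (toℕ s)) ≡ V (suc (toℕ s)) + μ s
      at-label s with squeeze (nonneg s) (under s) (D-bit s)
      ... | inj₁ z = trans (ℤP.≤-antisym (at-zero s z) (proj₁ (facet-bounds (removed 0 g) facet _)))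
            (trans (sym (ℤP.+-identityʳ (V (suc (toℕ s))))) (cong (_+_ (V (suc (toℕ s)))) (sym z)))
      ... | inj₂ z = trans (heights _) (trans (push-miss S U _ (All.map (λ t0 f → one≢zero (trans (sym z) (trans (cong μ (FinP.toℕ-injective (ℕP.suc-injective f))) t0))) (allowed-zero μ C)))
            (trans (split-D s) (cong (_+_ (V (suc (toℕ s)))) (trans D1 (sym z)))))
        where
        one≢zero : + 1 ≢ + 0
        one≢zero ()
        D1 : D s ≡ + 1
        D1 with D-bit s
        ... | inj₂ d = d
        ... | inj₁ d = contradiction (subst₂ ℤ._≤_ z d (under s)) (λ { (ℤ.+≤+ ()) })

-- Evaluation of polynomials

pw : {m : ℕ} → Vec ℕ m → Vec ℕ m → ℕ
pw []       []       = 1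
pw (e ∷ es) (y ∷ ys) = y ℕ.^ e ℕ.* pw es ys

evY : {m : ℕ} → YPoly m → Vec ℕ m → ℤ
evY []            y = + 0
evY ((a , e) ∷ p) y = a * + pw e y + evY p y

Positive : {m : ℕ} → Vec ℕ m → Set
Positive y = ∀ i → 0 < lookup y i

Positive-∷ : ∀ {m t} {y : Vec ℕ m} → 0 < t → Positive y → Positive (t ∷ y)
Positive-∷ p q Fin.zero    = p
Positive-∷ p q (Fin.suc i) = q i

horner : (ℕ → ℤ) → ℕ → ℕ → ℤ
horner c zero    t = + 0
horner c (suc K) t = c 0 + + t * horner (c ∘ suc) K t

horner-cong : ∀ {c d} K t → (∀ k → c k ≡ d k) → horner c K t ≡ horner d K t
horner-cong zero    t e = refl
horner-cong (suc K) t e = cong₂ (λ a b → a + + t * b) (e 0) (horner-cong K t (e ∘ suc))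

horner-zero : ∀ K t → horner (λ _ → + 0) K t ≡ + 0
horner-zero zero    t = refl
horner-zero (suc K) t rewrite horner-zero K t | ℤP.*-zeroʳ (+ t) = refl

horner-add : ∀ c d K t → horner (λ k → c k + d k) K t ≡ horner c K t + horner d K t
horner-add c d zero    t = refl
horner-add c d (suc K) t rewrite horner-add (c ∘ suc) (d ∘ suc) K t =
  lem (c 0) (d 0) (+ t) (horner (c ∘ suc) K t) (horner (d ∘ suc) K t)
  where
  lem : ∀ a b t x y → (a + b) + t * (x + y) ≡ (a + t * x) + (b + t * y)
  lem = solve-∀

spike : ℕ → ℤ → ℕ → ℤ
spike k v i = if does (k ℕ.≟ i) then v else + 0

horner-spike : ∀ k v K t → k < K → horner (spike k v) K t ≡ v * + (t ℕ.^ k)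
horner-spike zero    v (suc K) t _ = trans (cong (λ z → v + + t * z) (horner-zero K t)) (lem v (+ t))
  where
  lem : ∀ v t → v + t * + 0 ≡ v * + 1
  lem = solve-∀
horner-spike (suc k) v (suc K) t (s≤s p) = trans (cong (λ z → + 0 + + t * z) (horner-spike k v K t p))
  (trans (lem (+ t) v (+ (t ℕ.^ k))) (cong (_*_ v) (sym (ℤP.pos-* t (t ℕ.^ k)))))
  where
  lem : ∀ t v x → + 0 + t * (v * x) ≡ v * (t * x)
  lem = solve-∀

-- A polynomial with constant term c₀ that vanishes at t = 1 + ∣c₀∣ has c₀ = 0, as t divides c₀.
constant-zero : ∀ c₀ r → c₀ + + suc ℤ.∣ c₀ ∣ * r ≡ + 0 → c₀ ≡ + 0
constant-zero c₀ r e = ℤP.∣i∣≡0⇒i≡0 (absurd ℤ.∣ r ∣ (trans (cong ℤ.∣_∣ (lem c₀ (+ suc ℤ.∣ c₀ ∣ * r) e))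
  (trans (ℤP.∣-i∣≡∣i∣ (+ suc ℤ.∣ c₀ ∣ * r)) (ℤP.abs-* (+ suc ℤ.∣ c₀ ∣) r))))
  where
  lem : ∀ a b → a + b ≡ + 0 → a ≡ - b
  lem a b h = trans (l₁ a b) (trans (cong (_- b) h) (ℤP.+-identityˡ (- b)))
    where
    l₁ : ∀ a b → a ≡ a + b - b
    l₁ = solve-∀
  absurd : ∀ {a} r → a ≡ suc a ℕ.* r → a ≡ 0
  absurd {a} zero    f = trans f (ℕP.*-zeroʳ (suc a))
  absurd {a} (suc r) f = contradiction f (ℕP.<⇒≢ (ℕP.<-≤-trans (ℕP.n<1+n a) (ℕP.m≤m*n (suc a) (suc r))))

-- Once the constant coefficient is known to be 0, dividing by `t` leaves a polynomial that still
-- vanishes at all positive integers.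
horner-vanish : ∀ K c → (∀ t → 0 < t → horner c K t ≡ + 0) → ∀ k → k < K → c k ≡ + 0
horner-vanish (suc K) c h zero    _       = constant-zero (c 0) _ (h (suc ℤ.∣ c 0 ∣) ℕ.z<s)
horner-vanish (suc K) c h (suc k) (s≤s p) = horner-vanish K (c ∘ suc) shifted k p
  where
  shifted : ∀ t → 0 < t → horner (c ∘ suc) K t ≡ + 0
  shifted (suc t) q = ℤP.*-cancelˡ-≡ (+ suc t) _ _ (trans
    (trans (sym (ℤP.+-identityˡ _)) (trans (cong (_+ + suc t * horner (c ∘ suc) K (suc t)) (sym (horner-vanish (suc K) c h zero ℕ.z<s))) (h (suc t) q)))
    (sym (ℤP.*-zeroʳ (+ suc t))))

slice : {m : ℕ} → ℕ → YPoly (suc m) → YPoly m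
slice k []                  = []
slice k ((a , (i ∷ e)) ∷ p) = if does (i ℕ.≟ k) then (a , e) ∷ slice k p else slice k p

coeff-slice : ∀ {m} (p : YPoly (suc m)) k e → coeffY p (k ∷ e) ≡ coeffY (slice k p) e
coeff-slice []                  k e = refl
coeff-slice ((a , (i ∷ f)) ∷ p) k e with does (i ℕ.≟ k)
... | false = coeff-slice p k e
... | true with does (VecP.≡-dec ℕ._≟_ f e)
...   | true  = cong (_+_ a) (coeff-slice p k e)
...   | false = coeff-slice p k e

ev-slice : ∀ {m} (p : YPoly (suc m)) K → All (λ u → Vec.head (proj₂ u) < K) p →
  ∀ t y → evY p (t ∷ y) ≡ horner (λ k → evY (slice k p) y) K t
ev-slice [] K [] t y = sym (horner-zero K t)
ev-slice ((a , (i ∷ e)) ∷ p) K (q ∷ b) t y = trans (cong₂ _+_ monomial (ev-slice p K b t y))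
  (trans (sym (horner-add (spike i (a * + pw e y)) (λ k → evY (slice k p) y) K t))
    (horner-cong K t split))
  where
  monomial : a * + (t ℕ.^ i ℕ.* pw e y) ≡ horner (spike i (a * + pw e y)) K t
  monomial = trans (cong (_*_ a) (ℤP.pos-* (t ℕ.^ i) (pw e y)))
    (trans (lem a (+ (t ℕ.^ i)) (+ pw e y)) (sym (horner-spike i _ K t q)))
    where
    lem : ∀ a b c → a * (b * c) ≡ a * c * b
    lem = solve-∀
  split : ∀ k → spike i (a * + pw e y) k + evY (slice k p) y ≡ evY (slice k ((a , (i ∷ e)) ∷ p)) y
  split k with does (i ℕ.≟ k)
  ... | true  = refl
  ... | false = ℤP.+-identityˡ _

head-bound : ∀ {m} (p : YPoly (suc m)) k → ∃ λ K → k < K × All (λ u → Vec.head (proj₂ u) < K) p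
head-bound []            k = suc k , ℕP.n<1+n k , []
head-bound ((a , e) ∷ p) k = let K , q , b = head-bound p k in
  suc (Vec.head e) ℕ.⊔ K , ℕP.≤-trans q (ℕP.m≤n⊔m (suc (Vec.head e)) K) ,
  ℕP.m≤m⊔n (suc (Vec.head e)) K ∷ All.map (λ r → ℕP.≤-trans r (ℕP.m≤n⊔m (suc (Vec.head e)) K)) b

-- Induction on the number of variables: with the other variables fixed, the values of the slices
-- are the coefficients of a polynomial in the first variable, to which `horner-vanish` applies.
vanish⇒coeff : ∀ {m} (p : YPoly m) → (∀ y → Positive y → evY p y ≡ + 0) → ∀ e → coeffY p e ≡ + 0
vanish⇒coeff {zero} p h [] = trans (sym (constant p)) (h [] (λ ()))
  where
  constant : ∀ p → evY p [] ≡ coeffY p []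
  constant []             = refl
  constant ((a , []) ∷ p) = cong₂ _+_ (ℤP.*-identityʳ a) (constant p)
vanish⇒coeff {suc m} p h (k ∷ e) with head-bound p k
... | K , k<K , b = trans (coeff-slice p k e) (vanish⇒coeff (slice k p)
        (λ y y>0 → horner-vanish K (λ i → evY (slice i p) y) (λ t t>0 → trans (sym (ev-slice p K b t y)) (h (t ∷ y) (Positive-∷ t>0 y>0))) k k<K) e)

coeff⇒vanish : ∀ {m} (p : YPoly m) → (∀ e → coeffY p e ≡ + 0) → ∀ y → evY p y ≡ + 0
coeff⇒vanish {zero} p h [] = trans (constant p) (h [])
  where
  constant : ∀ p → evY p [] ≡ coeffY p []
  constant []             = refl
  constant ((a , []) ∷ p) = cong₂ _+_ (ℤP.*-identityʳ a) (constant p)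
coeff⇒vanish {suc m} p h (t ∷ y) with head-bound p 0
... | K , _ , b = trans (ev-slice p K b t y) (trans (horner-cong K t
        (λ k → coeff⇒vanish (slice k p) (λ e → trans (sym (coeff-slice p k e)) (h (k ∷ e))) y)) (horner-zero K t))

neg : ∀ {m} → YPoly m → YPoly m
neg = List.map (λ u → - proj₁ u , proj₂ u)

coeff-++ : ∀ {m} (p q : YPoly m) e → coeffY (p ++ q) e ≡ coeffY p e + coeffY q e
coeff-++ []            q e = sym (ℤP.+-identityˡ _)
coeff-++ ((a , f) ∷ p) q e with does (VecP.≡-dec ℕ._≟_ f e)
... | true  = trans (cong (_+_ a) (coeff-++ p q e)) (sym (ℤP.+-assoc a _ _))
... | false = coeff-++ p q e

coeff-neg : ∀ {m} (p : YPoly m) e → coeffY (neg p) e ≡ - coeffY p e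
coeff-neg []            e = refl
coeff-neg ((a , f) ∷ p) e with does (VecP.≡-dec ℕ._≟_ f e)
... | true  = trans (cong (_+_ (- a)) (coeff-neg p e)) (sym (ℤP.neg-distrib-+ a _))
... | false = coeff-neg p e

evY-++ : ∀ {m} (p q : YPoly m) y → evY (p ++ q) y ≡ evY p y + evY q y
evY-++ []            q y = sym (ℤP.+-identityˡ _)
evY-++ ((a , f) ∷ p) q y = trans (cong (_+_ (a * + pw f y)) (evY-++ p q y)) (sym (ℤP.+-assoc (a * + pw f y) _ _))

evY-neg : ∀ {m} (p : YPoly m) y → evY (neg p) y ≡ - evY p y
evY-neg []            y = refl
evY-neg ((a , f) ∷ p) y = trans (cong (_+_ (- a * + pw f y)) (evY-neg p y)) (lem a (+ pw f y) (evY p y))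
  where
  lem : ∀ a b c → - a * b + - c ≡ - (a * b + c)
  lem = solve-∀

values⇒coeff : ∀ {m} (p q : YPoly m) → (∀ y → Positive y → evY p y ≡ evY q y) → ∀ e → coeffY p e ≡ coeffY q e
values⇒coeff p q h e = ℤP.i-j≡0⇒i≡j _ _ (trans (sym (trans (coeff-++ p (neg q) e) (cong (_+_ (coeffY p e)) (coeff-neg q e))))
  (vanish⇒coeff (p ++ neg q) (λ y y>0 → trans (trans (evY-++ p (neg q) y) (cong (_+_ (evY p y)) (evY-neg q y))) (ℤP.i≡j⇒i-j≡0 (h y y>0))) e))

coeff⇒values : ∀ {m} (p q : YPoly m) → (∀ e → coeffY p e ≡ coeffY q e) → ∀ y → evY p y ≡ evY q y
coeff⇒values p q h y = ℤP.i-j≡0⇒i≡j _ _ (trans (sym (trans (evY-++ p (neg q) y) (cong (_+_ (evY p y)) (evY-neg q y))))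
  (coeff⇒vanish (p ++ neg q) (λ e → trans (trans (coeff-++ p (neg q) e) (cong (_+_ (coeffY p e)) (coeff-neg q e))) (ℤP.i≡j⇒i-j≡0 (h e))) y))

ev : Poly n → Vec ℕ n → Vec ℕ n → ℤ
ev []                    x y = + 0
ev ((a , (ex , ey)) ∷ p) x y = a * (+ pw ex x * + pw ey y) + ev p x y

-- Joins the exponents of x and y, so that one vanishing theorem serves both kinds of polynomials.
flat : Poly n → YPoly (n ℕ.+ n)
flat = List.map (λ u → proj₁ u , proj₁ (proj₂ u) Vec.++ proj₂ (proj₂ u))

pw-++ : ∀ {k l} (e : Vec ℕ k) (f : Vec ℕ l) x y → pw (e Vec.++ f) (x Vec.++ y) ≡ pw e x ℕ.* pw f y
pw-++ []      f []      y = sym (ℕP.*-identityˡ _)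
pw-++ (k ∷ e) f (t ∷ x) y = trans (cong (t ℕ.^ k ℕ.*_) (pw-++ e f x y)) (sym (ℕP.*-assoc (t ℕ.^ k) _ _))

ev-flat : (p : Poly n) → ∀ x y → evY (flat p) (x Vec.++ y) ≡ ev p x y
ev-flat [] x y = refl
ev-flat ((a , (ex , ey)) ∷ p) x y = cong₂ _+_
  (cong (_*_ a) (trans (cong +_ (pw-++ ex ey x y)) (ℤP.pos-* (pw ex x) (pw ey y)))) (ev-flat p x y)

coeff-flat : (p : Poly n) → ∀ ex ey → coeffY (flat p) (ex Vec.++ ey) ≡ coeff p (ex , ey)
coeff-flat [] ex ey = refl
coeff-flat ((a , (fx , fy)) ∷ p) ex ey with ProdP.≡-dec (VecP.≡-dec ℕ._≟_) (VecP.≡-dec ℕ._≟_) (fx , fy) (ex , ey)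
... | yes refl rewrite dec-true (VecP.≡-dec ℕ._≟_ (fx Vec.++ fy) (fx Vec.++ fy)) refl = cong (_+_ a) (coeff-flat p ex ey)
... | no ne rewrite dec-false (VecP.≡-dec ℕ._≟_ (fx Vec.++ fy) (ex Vec.++ ey))
      (λ e → ne (cong₂ _,_ (VecP.++-injectiveˡ fx ex e) (VecP.++-injectiveʳ fx ex e))) = coeff-flat p ex ey

≈P⇒ev : (p q : Poly n) → p ≈P q → ∀ x y → ev p x y ≡ ev q x y
≈P⇒ev {n} p q h x y = trans (sym (ev-flat p x y)) (trans (coeff⇒values (flat p) (flat q) same (x Vec.++ y)) (ev-flat q x y))
  where
  same : ∀ e → coeffY (flat p) e ≡ coeffY (flat q) e
  same e with Vec.splitAt n e
  ... | ex , ey , refl = trans (coeff-flat p ex ey) (trans (h (ex , ey)) (sym (coeff-flat q ex ey)))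

ev⇒≈P : (p q : Poly n) → (∀ x y → Positive x → Positive y → ev p x y ≡ ev q x y) → p ≈P q
ev⇒≈P {n} p q h (ex , ey) = trans (sym (coeff-flat p ex ey)) (trans (values⇒coeff (flat p) (flat q) same (ex Vec.++ ey)) (coeff-flat q ex ey))
  where
  same : ∀ z → Positive z → evY (flat p) z ≡ evY (flat q) z
  same z z>0 with Vec.splitAt n z
  ... | x , y , refl = trans (ev-flat p x y) (trans
        (h x y (λ i → subst (0 <_) (VecP.lookup-++ˡ x y i) (z>0 _)) (λ i → subst (0 <_) (VecP.lookup-++ʳ x y i) (z>0 _)))
        (sym (ev-flat q x y)))

pw-zeros : ∀ {m} (y : Vec ℕ m) → pw zeros y ≡ 1
pw-zeros []      = refl
pw-zeros (t ∷ y) = trans (ℕP.*-identityˡ _) (pw-zeros y)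

pw-+ : ∀ {m} (e f y : Vec ℕ m) → pw (Vec.zipWith ℕ._+_ e f) y ≡ pw e y ℕ.* pw f y
pw-+ []      []      []      = refl
pw-+ (a ∷ e) (b ∷ f) (t ∷ y) = trans (cong₂ ℕ._*_ (ℕP.^-distribˡ-+-* t a b) (pw-+ e f y)) (lem (t ℕ.^ a) (t ℕ.^ b) (pw e y) (pw f y))
  where
  open import Data.Nat.Tactic.RingSolver renaming (solve-∀ to solveℕ-∀)
  lem : ∀ a b c d → a ℕ.* b ℕ.* (c ℕ.* d) ≡ a ℕ.* c ℕ.* (b ℕ.* d)
  lem = solveℕ-∀

ev-++ : (p q : Poly n) → ∀ x y → ev (p ++ q) x y ≡ ev p x y + ev q x y
ev-++ []                    q x y = sym (ℤP.+-identityˡ _)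
ev-++ ((a , (ex , ey)) ∷ p) q x y = trans (cong (_+_ (a * (+ pw ex x * + pw ey y))) (ev-++ p q x y)) (sym (ℤP.+-assoc (a * (+ pw ex x * + pw ey y)) _ _))

times : ℤ × Mono n → ℤ × Mono n → ℤ × Mono n
times (a , (ex , ey)) (b , (fx , fy)) = a * b , (Vec.zipWith ℕ._+_ ex fx , Vec.zipWith ℕ._+_ ey fy)

*P-∷ : (u : ℤ × Mono n) (p q : Poly n) → (u ∷ p) *P q ≡ List.map (times u) q ++ (p *P q)
*P-∷ u p q = cong (_++ (p *P q)) (ListP.map-cong (λ _ → refl) q)

ev-times : (u : ℤ × Mono n) (q : Poly n) → ∀ x y → ev (List.map (times u) q) x y ≡ ev (u ∷ []) x y * ev q x y
ev-times (a , (ex , ey)) [] x y = sym (ℤP.*-zeroʳ (ev ((a , (ex , ey)) ∷ []) x y))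
ev-times (a , (ex , ey)) ((b , (fx , fy)) ∷ q) x y = trans
  (cong₂ _+_ monomial (ev-times (a , (ex , ey)) q x y))
  (lem a b (+ pw ex x) (+ pw fx x) (+ pw ey y) (+ pw fy y) (ev q x y))
  where
  monomial : a * b * (+ pw (Vec.zipWith ℕ._+_ ex fx) x * + pw (Vec.zipWith ℕ._+_ ey fy) y) ≡
    a * b * ((+ pw ex x * + pw fx x) * (+ pw ey y * + pw fy y))
  monomial = cong₂ (λ c d → a * b * (c * d))
    (trans (cong +_ (pw-+ ex fx x)) (ℤP.pos-* (pw ex x) (pw fx x)))
    (trans (cong +_ (pw-+ ey fy y)) (ℤP.pos-* (pw ey y) (pw fy y)))
  lem : ∀ a b c d e f r → a * b * (c * d * (e * f)) + (a * (c * e) + + 0) * r ≡ (a * (c * e) + + 0) * (b * (d * f) + r)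
  lem = solve-∀

ev-* : (p q : Poly n) → ∀ x y → ev (p *P q) x y ≡ ev p x y * ev q x y
ev-* []      q x y = refl
ev-* (u ∷ p) q x y = trans (cong (λ z → ev z x y) (*P-∷ u p q)) (trans (ev-++ (List.map (times u) q) (p *P q) x y) (trans
  (cong₂ _+_ (ev-times u q x y) (ev-* p q x y))
  (trans (sym (ℤP.*-distribʳ-+ (ev q x y) (ev (u ∷ []) x y) (ev p x y)))
    (cong (_* ev q x y) (sym (ev-++ (u ∷ []) p x y))))))

ev-x : (e x y : Vec ℕ n) → ev (xMono e) x y ≡ + pw e x
ev-x e x y rewrite pw-zeros y = lem (+ pw e x)
  where
  lem : ∀ a → + 1 * (a * + 1) + + 0 ≡ a
  lem = solve-∀

ev-y : (e x y : Vec ℕ n) → ev (yMono e) x y ≡ + pw e y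
ev-y e x y rewrite pw-zeros x = lem (+ pw e y)
  where
  lem : ∀ a → + 1 * (+ 1 * a) + + 0 ≡ a
  lem = solve-∀

ev-one : (x y : Vec ℕ n) → ev oneP x y ≡ + 1
ev-one x y = trans (ev-x zeros x y) (cong +_ (pw-zeros x))

ones : {m : ℕ} → Vec ℕ m
ones = Vec.replicate _ 1

pw-ones : ∀ {m} (e : Vec ℕ m) → pw e ones ≡ 1
pw-ones []      = refl
pw-ones (k ∷ e) rewrite ℕP.^-zeroˡ k = trans (ℕP.*-identityˡ _) (pw-ones e)

ev-X1 : (p : Poly n) → ∀ y → evY (evalX1 p) y ≡ ev p ones y
ev-X1 []                    y = refl
ev-X1 ((a , (ex , ey)) ∷ p) y rewrite pw-ones ex = cong₂ _+_ (cong (_*_ a) (sym (ℤP.*-identityˡ (+ pw ey y)))) (ev-X1 p y)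

-- Valuations of subtraction-free fractions

-- A homomorphism from subtraction-free fractions to the integers, with × and + or with + and
-- minimum. `V` is a relation because fractions are not identified up to equality, and `V-div` is
-- handed the quotient `c` because integer division need not be exact.
record Valuation (n : ℕ) : Set₁ where
  infixl 7 _·_
  infixl 6 _⊕_
  field
    _·_ _⊕_ : ℤ → ℤ → ℤ
    ε       : ℤ
    ·-assoc : ∀ a b c → (a · b) · c ≡ a · (b · c)
    ·-comm  : ∀ a b → a · b ≡ b · a
    ·-idˡ   : ∀ a → ε · a ≡ a
    ⊕-comm  : ∀ a b → a ⊕ b ≡ b ⊕ a
    Y       : Vec ℕ n → ℤ
    V       : Frac n → ℤ → Set
    V-one   : V oneF ε
    V-y     : ∀ b → V (yMono b , oneP) (Y b)
    V-mul   : ∀ {f g a b} → V f a → V g b → V (f *F g) (a · b)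
    V-add   : ∀ {f g a b} → V f a → V g b → V (f +F g) (a ⊕ b)
    V-div   : ∀ {f g a b} → V f a → V g b → ∀ c → c · b ≡ a → V (f *F invF g) c

  pow : ℤ → ℕ → ℤ
  pow a zero    = ε
  pow a (suc k) = a · pow a k

  prod : {m : ℕ} → (Fin m → ℤ) → ℤ
  prod {zero}  f = ε
  prod {suc m} f = f Fin.zero · prod (f ∘ Fin.suc)

  V-pow : ∀ {f a} → V f a → ∀ k → V (powF f k) (pow a k)
  V-pow v zero    = V-one
  V-pow v (suc k) = V-mul v (V-pow v k)

  V-prod : {m : ℕ} (f : Fin m → Frac n) (a : Fin m → ℤ) → (∀ i → V (f i) (a i)) → V (prodF f) (prod a)
  V-prod {zero}  f a v = V-one
  V-prod {suc m} f a v = V-mul (v Fin.zero) (V-prod (f ∘ Fin.suc) (a ∘ Fin.suc) (v ∘ Fin.suc))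

  prod-cong : {m : ℕ} {f g : Fin m → ℤ} → (∀ i → f i ≡ g i) → prod f ≡ prod g
  prod-cong {zero}  e = refl
  prod-cong {suc m} e = cong₂ _·_ (e Fin.zero) (prod-cong (e ∘ Fin.suc))

  ·-swap : ∀ a b c d → (a · b) · (c · d) ≡ (a · c) · (b · d)
  ·-swap a b c d = trans (·-assoc a b (c · d)) (trans (cong (a ·_) (trans (sym (·-assoc b c d))
    (trans (cong (_· d) (·-comm b c)) (·-assoc c b d)))) (sym (·-assoc a c (b · d))))

  prod-· : {m : ℕ} (f g : Fin m → ℤ) → prod (λ i → f i · g i) ≡ prod f · prod g
  prod-· {zero}  f g = sym (·-idˡ ε)
  prod-· {suc m} f g = trans (cong (_ ·_) (prod-· (f ∘ Fin.suc) (g ∘ Fin.suc))) (·-swap _ _ _ _)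

  prod-ε : {m : ℕ} (f : Fin m → ℤ) → (∀ i → f i ≡ ε) → prod f ≡ ε
  prod-ε {zero}  f e = refl
  prod-ε {suc m} f e = trans (cong₂ _·_ (e Fin.zero) (prod-ε (f ∘ Fin.suc) (e ∘ Fin.suc))) (·-idˡ ε)

  ·-idʳ : ∀ a → a · ε ≡ a
  ·-idʳ a = trans (·-comm a ε) (·-idˡ a)

  prod-single : {m : ℕ} (f : Fin m → ℤ) (k : Fin m) → (∀ i → i ≢ k → f i ≡ ε) → prod f ≡ f k
  prod-single f Fin.zero    e = trans (cong (f Fin.zero ·_) (prod-ε _ (λ i → e (Fin.suc i) (λ ())))) (·-idʳ _)
  prod-single f (Fin.suc k) e = trans (cong₂ _·_ (e Fin.zero (λ ())) (prod-single (f ∘ Fin.suc) k (λ i ne → e (Fin.suc i) (ne ∘ FinP.suc-injective)))) (·-idˡ _)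

pos-*-pos : ∀ {a b} → + 0 ℤ.< a → + 0 ℤ.< b → + 0 ℤ.< a * b
pos-*-pos (ℤ.+<+ {n = suc a} _) (ℤ.+<+ {n = suc b} _) = ℤ.+<+ ℕ.z<s

evaluation : (y : Vec ℕ n) → Positive y → Valuation n
evaluation {n} y y>0 = record
  { _·_ = _*_ ; _⊕_ = _+_ ; ε = + 1
  ; ·-assoc = ℤP.*-assoc ; ·-comm = ℤP.*-comm ; ·-idˡ = ℤP.*-identityˡ ; ⊕-comm = ℤP.+-comm
  ; Y = λ b → + pw b y
  ; V = V
  ; V-one = one>0 , trans (ev-one ones y) (sym (trans (ℤP.*-identityˡ (ev {n} oneP ones y)) (ev-one ones y))) , ℤ.+<+ ℕ.z<s
  ; V-y = λ b → one>0 , trans (ev-y b ones y) (sym (trans (cong (_*_ (+ pw b y)) (ev-one {n} ones y)) (ℤP.*-identityʳ _))) , ℤ.+<+ (pw-pos b y y>0)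
  ; V-mul = λ {f} {g} → mul {f} {g} ; V-add = λ {f} {g} → add {f} {g} ; V-div = λ {f} {g} → div {f} {g} }
  where
  e : Poly n → ℤ
  e p = ev p ones y
  -- Denominator and value are both kept positive, so inverting never produces a zero denominator.
  V : Frac n → ℤ → Set
  V (p , q) a = + 0 ℤ.< e q × e p ≡ a * e q × + 0 ℤ.< a
  pw-pos : ∀ {m} (b y : Vec ℕ m) → Positive y → 0 < pw b y
  pw-pos []      []      p = ℕ.z<s
  pw-pos (k ∷ b) (t ∷ y) p = ℕP.*-mono-< (ℕP.m^n>0 t {{ℕ.>-nonZero (p Fin.zero)}} k) (pw-pos b y (p ∘ Fin.suc))
  one>0 : + 0 ℤ.< e oneP
  one>0 = subst (+ 0 ℤ.<_) (sym (ev-one {n} ones y)) (ℤ.+<+ ℕ.z<s)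
  mul : ∀ {f g a b} → V f a → V g b → V (f *F g) (a * b)
  mul {p , q} {p' , q'} {a} {b} (u , v , w) (u' , v' , w') =
    subst (+ 0 ℤ.<_) (sym (ev-* q q' ones y)) (pos-*-pos u u') ,
    trans (ev-* p p' ones y) (trans (cong₂ _*_ v v') (trans (lem a (e q) b (e q')) (cong (_*_ (a * b)) (sym (ev-* q q' ones y))))) ,
    pos-*-pos w w'
    where
    lem : ∀ a x b z → a * x * (b * z) ≡ a * b * (x * z)
    lem = solve-∀
  add : ∀ {f g a b} → V f a → V g b → V (f +F g) (a + b)
  add {p , q} {p' , q'} {a} {b} (u , v , w) (u' , v' , w') =
    subst (+ 0 ℤ.<_) (sym (ev-* q q' ones y)) (pos-*-pos u u') ,
    trans (ev-++ (p *P q') (p' *P q) ones y) (trans (cong₂ _+_ (ev-* p q' ones y) (ev-* p' q ones y))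
      (trans (cong₂ (λ r s → r * e q' + s * e q) v v') (trans (lem a (e q) b (e q')) (cong (_*_ (a + b)) (sym (ev-* q q' ones y)))))) ,
    ℤP.+-mono-< w w'
    where
    lem : ∀ a x b z → a * x * z + b * z * x ≡ (a + b) * (x * z)
    lem = solve-∀
  div : ∀ {f g a b} → V f a → V g b → ∀ c → c * b ≡ a → V (f *F invF g) c
  div {p , q} {p' , q'} {a} {b} (u , v , w) (u' , v' , w') c h =
    subst (+ 0 ℤ.<_) (sym (ev-* q p' ones y)) (pos-*-pos u (subst (+ 0 ℤ.<_) (sym v') (pos-*-pos w' u'))) ,
    trans (ev-* p q' ones y) (trans (cong (_* e q') (trans v (cong (_* e q) (sym h))))
      (trans (lem c b (e q) (e q')) (cong (_*_ c) (sym (trans (ev-* q p' ones y) (cong (_*_ (e q)) v')))))) ,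
    quotient-pos c b w' (subst (+ 0 ℤ.<_) (sym h) w)
    where
    lem : ∀ c b x z → c * b * x * z ≡ c * (x * (b * z))
    lem = solve-∀
    quotient-pos : ∀ c b → + 0 ℤ.< b → + 0 ℤ.< c * b → + 0 ℤ.< c
    quotient-pos (+ zero)  b _ r = contradiction (subst (+ 0 ℤ.<_) (ℤP.*-zeroˡ b) r) (ℤP.<-irrefl refl)
    quotient-pos (+ suc c) b _ r = ℤ.+<+ ℕ.z<s
    quotient-pos -[1+ c ] (+ suc b) _ ()
    quotient-pos -[1+ c ] (+ zero) (ℤ.+<+ ()) _

deg : Fin n → ℤ × Mono n → ℕ
deg l u = lookup (proj₁ (proj₂ u)) l

-- Positive coefficients are built in: without cancellation the lowest degree of a sum is the
-- minimum of the lowest degrees.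
MinDeg : Fin n → Poly n → ℕ → Set
MinDeg l p m = All (λ u → + 0 ℤ.< proj₁ u) p × All (λ u → m ≤ deg l u) p × Any (λ u → deg l u ≡ m) p

deg-times : (l : Fin n) (u v : ℤ × Mono n) → deg l (times u v) ≡ deg l u ℕ.+ deg l v
deg-times l u v = VecP.lookup-zipWith ℕ._+_ l (proj₁ (proj₂ u)) (proj₁ (proj₂ v))

All-* : {P Q R : ℤ × Mono n → Set} → (∀ u v → P u → Q v → R (times u v)) → ∀ p q → All P p → All Q q → All R (p *P q)
All-* f []      q []       b = []
All-* {R = R} f (u ∷ p) q (a ∷ as) b = subst (All R) (sym (*P-∷ u p q)) (AllP.++⁺ (AllP.map⁺ (All.map (f u _ a) b)) (All-* f p q as b))

Any-* : {P Q R : ℤ × Mono n → Set} → (∀ u v → P u → Q v → R (times u v)) → ∀ p q → Any P p → Any Q q → Any R (p *P q)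
Any-* {R = R} f (u ∷ p) q (here a)  b = subst (Any R) (sym (*P-∷ u p q)) (AnyP.++⁺ˡ (AnyP.map⁺ (Any.map (f u _ a) b)))
Any-* {R = R} f (u ∷ p) q (there a) b = subst (Any R) (sym (*P-∷ u p q)) (AnyP.++⁺ʳ (List.map (times u) q) (Any-* f p q a b))

MinDeg-* : (l : Fin n) (p q : Poly n) → ∀ {i j} → MinDeg l p i → MinDeg l q j → MinDeg l (p *P q) (i ℕ.+ j)
MinDeg-* l p q {i} {j} (a , b , c) (a' , b' , c') =
  All-* (λ u v → pos-*-pos) p q a a' ,
  All-* (λ u v r s → subst (i ℕ.+ j ≤_) (sym (deg-times l u v)) (ℕP.+-mono-≤ r s)) p q b b' ,
  Any-* (λ u v r s → trans (deg-times l u v) (cong₂ ℕ._+_ r s)) p q c c'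

MinDeg-++ : (l : Fin n) (p q : Poly n) → ∀ {i j} → MinDeg l p i → MinDeg l q j → MinDeg l (p ++ q) (i ℕ.⊓ j)
MinDeg-++ l p q {i} {j} (a , b , c) (a' , b' , c') =
  AllP.++⁺ a a' , AllP.++⁺ (All.map (ℕP.≤-trans (ℕP.m⊓n≤m i j)) b) (All.map (ℕP.≤-trans (ℕP.m⊓n≤n i j)) b') , least
  where
  least : Any (λ u → deg l u ≡ i ℕ.⊓ j) (p ++ q)
  least with ℕP.≤-total i j
  ... | inj₁ r = AnyP.++⁺ˡ (Any.map (λ e → trans e (sym (ℕP.m≤n⇒m⊓n≡m r))) c)
  ... | inj₂ r = AnyP.++⁺ʳ p (Any.map (λ e → trans e (sym (ℕP.m≥n⇒m⊓n≡n r))) c')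

MinDeg-mono : (l : Fin n) (ex ey : Vec ℕ n) → MinDeg l ((+ 1 , (ex , ey)) ∷ []) (lookup ex l)
MinDeg-mono l ex ey = ℤ.+<+ ℕ.z<s ∷ [] , ℕP.≤-refl ∷ [] , here refl

VMin : Fin n → Frac n → ℤ → Set
VMin l (p , q) a = ∃₂ λ i j → MinDeg l p i × MinDeg l q j × a ≡ + i - + j

lookup-zeros : {m : ℕ} (l : Fin m) → lookup zeros l ≡ 0
lookup-zeros l = VecP.lookup-replicate l 0

-- The order of vanishing along x_l, in which every y has order 0.
order : Fin n → Valuation n
order {n} l = record
  { _·_ = _+_ ; _⊕_ = _⊓_ ; ε = + 0
  ; ·-assoc = ℤP.+-assoc ; ·-comm = ℤP.+-comm ; ·-idˡ = ℤP.+-identityˡ ; ⊕-comm = ℤP.⊓-comm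
  ; Y = λ _ → + 0
  ; V = VMin l
  ; V-one = 0 , 0 , one , one , refl
  ; V-y = λ b → 0 , 0 , subst (MinDeg l (yMono b)) (lookup-zeros l) (MinDeg-mono l zeros b) , one , refl
  ; V-mul = λ {f} {g} → mul {f} {g} ; V-add = λ {f} {g} → add {f} {g} ; V-div = λ {f} {g} → div {f} {g} }
  where
  one : MinDeg l oneP 0
  one = subst (MinDeg l oneP) (lookup-zeros l) (MinDeg-mono l zeros zeros)
  mul : ∀ {f g a b} → VMin l f a → VMin l g b → VMin l (f *F g) (a + b)
  mul {p , q} {p' , q'} (i , j , u , v , refl) (i' , j' , u' , v' , refl) =
    i ℕ.+ i' , j ℕ.+ j' , MinDeg-* l p p' u u' , MinDeg-* l q q' v v' ,
    trans (lem (+ i) (+ j) (+ i') (+ j')) (cong₂ _-_ (sym (ℤP.pos-+ i i')) (sym (ℤP.pos-+ j j')))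
    where
    lem : ∀ a b c d → (a - b) + (c - d) ≡ (a + c) - (b + d)
    lem = solve-∀
  add : ∀ {f g a b} → VMin l f a → VMin l g b → VMin l (f +F g) (a ⊓ b)
  add {p , q} {p' , q'} (i , j , u , v , refl) (i' , j' , u' , v' , refl) =
    (i ℕ.+ j') ℕ.⊓ (i' ℕ.+ j) , j ℕ.+ j' ,
    MinDeg-++ l (p *P q') (p' *P q) (MinDeg-* l p q' u v') (MinDeg-* l p' q u' v) , MinDeg-* l q q' v v' ,
    trans (cong₂ _⊓_ (trans (l₁ (+ i) (+ j) (+ j')) (cong₂ _-_ (sym (ℤP.pos-+ i j')) (sym (ℤP.pos-+ j j'))))
                     (trans (l₂ (+ i') (+ j') (+ j)) (cong₂ _-_ (sym (ℤP.pos-+ i' j)) (sym (ℤP.pos-+ j j')))))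
      (sym (ℤP.mono-≤-distrib-⊓ (ℤP.+-monoˡ-≤ (- + (j ℕ.+ j'))) (+ (i ℕ.+ j')) (+ (i' ℕ.+ j))))
    where
    l₁ : ∀ a b d → a - b ≡ (a + d) - (b + d)
    l₁ = solve-∀
    l₂ : ∀ c d b → c - d ≡ (c + b) - (b + d)
    l₂ = solve-∀
  div : ∀ {f g a b} → VMin l f a → VMin l g b → ∀ c → c + b ≡ a → VMin l (f *F invF g) c
  div {p , q} {p' , q'} (i , j , u , v , refl) (i' , j' , u' , v' , refl) c h =
    i ℕ.+ j' , j ℕ.+ i' , MinDeg-* l p q' u v' , MinDeg-* l q p' v u' ,
    trans (l₁ c (+ i') (+ j')) (trans (cong (_- (+ i' - + j')) h) (trans (l₂ (+ i) (+ j) (+ i') (+ j'))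
      (cong₂ _-_ (sym (ℤP.pos-+ i j')) (sym (ℤP.pos-+ j i')))))
    where
    l₁ : ∀ c a b → c ≡ c + (a - b) - (a - b)
    l₁ = solve-∀
    l₂ : ∀ a b c d → (a - b) - (c - d) ≡ (a + d) - (b + c)
    l₂ = solve-∀

-- Reading F-polynomial and denominator vector off the valuations

-- At x = 1 the monomial of the denominator vector becomes 1, so the numerator has the value of the
-- fraction.
evX1-value : (u : Frac n) (d : Fin n → ℤ) (p : Poly n) → HasDenomForm u d p → (y : Vec ℕ n) (y>0 : Positive y) →
  ∀ g → Valuation.V (evaluation y y>0) u g → evY (evalX1 p) y ≡ g
evX1-value {n} (N , M) d p (h , _) y y>0 g (M>0 , v , _) = trans (ev-X1 p y) (ℤP.*-cancelʳ-≡ _ _ (ev M ones y) {{ℤ.>-nonZero M>0}}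
  (sym (trans (sym v) (trans (sym lhs) (trans (≈P⇒ev ((N *P xp) *P oneP) (p *P (M *P xn)) h ones y) rhs)))))
  where
  xp xn : Poly _
  xp = xMono (tabulate (λ i → posℕ (d i)))
  xn = xMono (tabulate (λ i → posℕ (- d i)))
  x-one : ∀ e → ev (xMono e) ones y ≡ + 1
  x-one e = trans (ev-x e ones y) (cong +_ (pw-ones e))
  lhs : ev ((N *P xp) *P oneP) ones y ≡ ev N ones y
  lhs = trans (ev-* (N *P xp) oneP ones y) (trans (cong₂ _*_ (trans (ev-* N xp ones y)
    (trans (cong (_*_ (ev N ones y)) (x-one (tabulate (λ i → posℕ (d i))))) (ℤP.*-identityʳ (ev N ones y)))) (ev-one {n} ones y)) (ℤP.*-identityʳ (ev N ones y)))
  rhs : ev (p *P (M *P xn)) ones y ≡ ev p ones y * ev M ones y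
  rhs = trans (ev-* p (M *P xn) ones y) (cong (_*_ (ev p ones y)) (trans (ev-* M xn ones y)
    (trans (cong (_*_ (ev M ones y)) (x-one (tabulate (λ i → posℕ (- d i))))) (ℤP.*-identityʳ (ev M ones y)))))

lower : ℕ → Fin n → ℤ × Mono n → ℤ × Mono n
lower m l (a , (ex , ey)) = a , (Vec.updateAt ex l (ℕ._∸ m) , ey)

pw-lower : ∀ {k} (e x : Vec ℕ k) l m → m ≤ lookup e l → pw e x ≡ lookup x l ℕ.^ m ℕ.* pw (Vec.updateAt e l (ℕ._∸ m)) x
pw-lower (i ∷ e) (t ∷ x) Fin.zero    m p = trans (cong (λ z → t ℕ.^ z ℕ.* pw e x) (sym (ℕP.m+[n∸m]≡n p)))
  (trans (cong (ℕ._* pw e x) (ℕP.^-distribˡ-+-* t m (i ℕ.∸ m))) (ℕP.*-assoc (t ℕ.^ m) (t ℕ.^ (i ℕ.∸ m)) (pw e x)))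
pw-lower (i ∷ e) (t ∷ x) (Fin.suc l) m p = trans (cong (t ℕ.^ i ℕ.*_) (pw-lower e x l m p))
  (trans (sym (ℕP.*-assoc (t ℕ.^ i) (lookup x l ℕ.^ m) _)) (trans (cong (ℕ._* pw (Vec.updateAt e l (ℕ._∸ m)) x) (ℕP.*-comm (t ℕ.^ i) (lookup x l ℕ.^ m))) (ℕP.*-assoc (lookup x l ℕ.^ m) (t ℕ.^ i) _)))

ev-lower : (p : Poly n) (l : Fin n) (m : ℕ) → All (λ u → m ≤ deg l u) p → ∀ x y → ev p x y ≡ + (lookup x l ℕ.^ m) * ev (List.map (lower m l) p) x y
ev-lower [] l m [] x y = sym (ℤP.*-zeroʳ (+ (lookup x l ℕ.^ m)))
ev-lower ((a , (ex , ey)) ∷ p) l m (b ∷ bs) x y = trans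
  (cong₂ (λ v w → a * (v * + pw ey y) + w) (trans (cong +_ (pw-lower ex x l m b)) (ℤP.pos-* (lookup x l ℕ.^ m) _)) (ev-lower p l m bs x y))
  (lem a (+ (lookup x l ℕ.^ m)) (+ pw (Vec.updateAt ex l (ℕ._∸ m)) x) (+ pw ey y) (ev (List.map (lower m l) p) x y))
  where
  lem : ∀ a t z y r → a * (t * z * y) + t * r ≡ t * (a * (z * y) + r)
  lem = solve-∀

PositiveOff : {m : ℕ} → Fin m → Vec ℕ m → Set
PositiveOff l x = ∀ i → i ≢ l → 0 < lookup x i

pw-off : ∀ {k} (e x : Vec ℕ k) → (∀ i → lookup e i ≡ 0 ⊎ 0 < lookup x i) → 0 < pw e x
pw-off []      []      h = ℕ.z<s
pw-off (i ∷ e) (t ∷ x) h = ℕP.*-mono-< (factor i t (h Fin.zero)) (pw-off e x (h ∘ Fin.suc))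
  where
  factor : ∀ i t → i ≡ 0 ⊎ 0 < t → 0 < t ℕ.^ i
  factor .0 t (inj₁ refl) = ℕ.z<s
  factor i  t (inj₂ q)    = ℕP.m^n>0 t {{ℕ.>-nonZero q}} i

ev-nonneg : (p : Poly n) → All (λ u → + 0 ℤ.< proj₁ u) p → ∀ x y → + 0 ℤ.≤ ev p x y
ev-nonneg [] [] x y = ℤP.≤-refl
ev-nonneg ((+ suc a , (ex , ey)) ∷ p) (_ ∷ b) x y = ℤP.+-mono-≤ (subst (λ z → + 0 ℤ.≤ + suc a * z) (ℤP.pos-* (pw ex x) (pw ey y))
  (subst (+ 0 ℤ.≤_) (ℤP.pos-* (suc a) _) (ℤ.+≤+ z≤n))) (ev-nonneg p b x y)
ev-nonneg ((+ zero , _) ∷ p) (ℤ.+<+ () ∷ b) x y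

-- Even at x_l = 0 the term free of x_l survives, and no coefficient is negative.
ev-off-pos : (p : Poly n) (l : Fin n) → All (λ u → + 0 ℤ.< proj₁ u) p → Any (λ u → deg l u ≡ 0) p →
  ∀ x y → PositiveOff l x → Positive y → + 0 ℤ.< ev p x y
ev-off-pos ((a , (ex , ey)) ∷ p) l (b ∷ bs) (here z) x y x>0 y>0 = ℤP.+-mono-<-≤
  (pos-*-pos b (pos-*-pos (ℤ.+<+ (pw-off ex x off)) (ℤ.+<+ (pw-off ey y (inj₂ ∘ y>0))))) (ev-nonneg p bs x y)
  where
  off : ∀ i → lookup ex i ≡ 0 ⊎ 0 < lookup x i
  off i with i Fin.≟ l
  ... | yes refl = inj₁ z
  ... | no ne    = inj₂ (x>0 i ne)
ev-off-pos (u ∷ p) l (b ∷ bs) (there a) x y x>0 y>0 = ℤP.+-mono-≤-< (subst (+ 0 ℤ.≤_) (ℤP.+-identityʳ (proj₁ u * (+ pw (proj₁ (proj₂ u)) x * + pw (proj₂ (proj₂ u)) y))) (ev-nonneg (u ∷ []) (b ∷ []) x y))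
  (ev-off-pos p l bs a x y x>0 y>0)

zero-part rest-part : Fin n → Poly n → Poly n
zero-part l []      = []
zero-part l (u ∷ p) = if does (deg l u ℕ.≟ 0) then u ∷ zero-part l p else zero-part l p
rest-part l []      = []
rest-part l (u ∷ p) = if does (deg l u ℕ.≟ 0) then rest-part l p else u ∷ rest-part l p

kill : Fin n → Vec ℕ n → Vec ℕ n
kill l x = Vec.updateAt x l (λ _ → 0)

pw-kill : ∀ {k} (e x : Vec ℕ k) l → lookup e l ≡ 0 → pw e (kill l x) ≡ pw e x
pw-kill (i ∷ e) (t ∷ x) Fin.zero    refl = refl
pw-kill (i ∷ e) (t ∷ x) (Fin.suc l) p    = cong (t ℕ.^ i ℕ.*_) (pw-kill e x l p)

pw-killed : ∀ {k} (e x : Vec ℕ k) l → lookup e l ≢ 0 → pw e (kill l x) ≡ 0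
pw-killed (zero ∷ e)  (t ∷ x) Fin.zero    p = contradiction refl p
pw-killed (suc i ∷ e) (t ∷ x) Fin.zero    p = refl
pw-killed (i ∷ e)     (t ∷ x) (Fin.suc l) p = trans (cong (t ℕ.^ i ℕ.*_) (pw-killed e x l p)) (ℕP.*-zeroʳ (t ℕ.^ i))

ev-zero-part : (p : Poly n) (l : Fin n) → ∀ x y → ev (zero-part l p) x y ≡ ev p (kill l x) y
ev-zero-part [] l x y = refl
ev-zero-part ((a , (ex , ey)) ∷ p) l x y with lookup ex l ℕ.≟ 0
... | yes z rewrite dec-true (lookup ex l ℕ.≟ 0) z = cong₂ (λ v w → a * (+ v * + pw ey y) + w) (sym (pw-kill ex x l z)) (ev-zero-part p l x y)
... | no nz rewrite dec-false (lookup ex l ℕ.≟ 0) nz | pw-killed ex x l nz = trans (ev-zero-part p l x y) (lem a (+ pw ey y) (ev p (kill l x) y))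
  where
  lem : ∀ a z r → r ≡ a * (+ 0 * z) + r
  lem = solve-∀

ev-parts : (p : Poly n) (l : Fin n) → ∀ x y → ev p x y ≡ ev (zero-part l p) x y + ev (rest-part l p) x y
ev-parts [] l x y = refl
ev-parts (u ∷ p) l x y with does (deg l u ℕ.≟ 0)
... | true  = trans (ev-++ (u ∷ []) p x y) (trans (cong (_+_ (ev (u ∷ []) x y)) (ev-parts p l x y)) (trans (sym (ℤP.+-assoc (ev (u ∷ []) x y) _ _))
    (cong (_+ ev (rest-part l p) x y) (sym (ev-++ (u ∷ []) (zero-part l p) x y)))))
... | false = trans (ev-++ (u ∷ []) p x y) (trans (cong (_+_ (ev (u ∷ []) x y)) (ev-parts p l x y))
    (trans (lem (ev (u ∷ []) x y) (ev (zero-part l p) x y) (ev (rest-part l p) x y)) (cong (_+_ (ev (zero-part l p) x y)) (sym (ev-++ (u ∷ []) (rest-part l p) x y)))))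
  where
  lem : ∀ a b c → a + (b + c) ≡ b + (a + c)
  lem = solve-∀

rest-deg : (p : Poly n) (l : Fin n) → All (λ u → 1 ≤ deg l u) (rest-part l p)
rest-deg []      l = []
rest-deg (u ∷ p) l with deg l u ℕ.≟ 0
... | yes z rewrite dec-true (deg l u ℕ.≟ 0) z = rest-deg p l
... | no nz rewrite dec-false (deg l u ℕ.≟ 0) nz = ℕP.n≢0⇒n>0 nz ∷ rest-deg p l

unit : Fin n → Vec ℕ n
unit i = tabulate (λ j → if does (i Fin.≟ j) then 1 else 0)

pw-tab-zero : ∀ {k} (f : Fin k → ℕ) (x : Vec ℕ k) → (∀ i → f i ≡ 0) → pw (tabulate f) x ≡ 1
pw-tab-zero f []      e = refl
pw-tab-zero f (t ∷ x) e rewrite e Fin.zero = trans (ℕP.*-identityˡ _) (pw-tab-zero (f ∘ Fin.suc) x (e ∘ Fin.suc))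

pw-single : ∀ {k} (f : Fin k → ℕ) (x : Vec ℕ k) l m → f l ≡ m → (∀ i → i ≢ l → f i ≡ 0) → pw (tabulate f) x ≡ lookup x l ℕ.^ m
pw-single f (t ∷ x) Fin.zero    m refl e rewrite pw-tab-zero (f ∘ Fin.suc) x (λ i → e (Fin.suc i) (λ ())) = ℕP.*-identityʳ _
pw-single f (t ∷ x) (Fin.suc l) m h e rewrite e Fin.zero (λ ()) = trans (ℕP.*-identityˡ _)
  (pw-single (f ∘ Fin.suc) x l m h (λ i ne → e (Fin.suc i) (ne ∘ FinP.suc-injective)))

ev-power : (l : Fin n) (m : ℕ) → ∀ x y → ev (xMono (tabulate (λ j → if does (l Fin.≟ j) then m else 0))) x y ≡ + (lookup x l ℕ.^ m)
ev-power l m x y = trans (ev-x (tabulate power) x y) (cong +_ (pw-single power x l m hit miss))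
  where
  power : Fin _ → ℕ
  power j = if does (l Fin.≟ j) then m else 0
  hit : (if does (l Fin.≟ l) then m else 0) ≡ m
  hit rewrite dec-true (l Fin.≟ l) refl = refl
  miss : ∀ i → i ≢ l → (if does (l Fin.≟ i) then m else 0) ≡ 0
  miss i ne rewrite dec-false (l Fin.≟ i) (ne ∘ sym) = refl

-- What remains is `rest-part`, where x_l can be taken out term by term. This is the form in which
-- the indivisibility in `HasDenomForm` gets contradicted.
zero-part-vanishes : (p : Poly n) (l : Fin n) → (∀ x y → Positive x → Positive y → ev (zero-part l p) x y ≡ + 0) →
  Σ (Poly n) λ q → p ≈P (xVar l *P q)
zero-part-vanishes p l h = q , ev⇒≈P p (xVar l *P q) (λ x y x>0 y>0 → trans (ev-parts p l x y)
  (trans (cong (_+ ev (rest-part l p) x y) (h x y x>0 y>0)) (trans (ℤP.+-identityˡ _) (trans (ev-lower (rest-part l p) l 1 (rest-deg p l) x y)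
    (sym (trans (ev-* (xVar l) q x y) (cong (_* ev q x y) (ev-power l 1 x y))))))))
  where
  q : Poly _
  q = List.map (lower 1 l) (rest-part l p)

MinDeg-lower : (l : Fin n) (p : Poly n) → ∀ {m} → MinDeg l p m → MinDeg l (List.map (lower m l) p) 0
MinDeg-lower l p {m} (a , b , c) = AllP.map⁺ a , AllP.map⁺ (All.map (λ _ → z≤n) b) ,
  AnyP.map⁺ (Any.map (λ {u} e → trans (VecP.lookup∘updateAt l (proj₁ (proj₂ u))) (trans (cong (ℕ._∸ m) e) (ℕP.n∸n≡0 m))) c)

kill-off : (l : Fin n) (x : Vec ℕ n) → Positive x → PositiveOff l (kill l x)
kill-off l x x>0 i ne = subst (0 <_) (sym (VecP.lookup∘updateAt′ i l ne x)) (x>0 i)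

-- Both sides are divided by the power of x_l that they share; what remains is compared at x_l = 0.
minDeg-match : (l : Fin n) (p A R : Poly n) → ∀ {i j} → MinDeg l A i → MinDeg l R j → R ≈P (p *P A) →
  ¬ (Σ (Poly n) λ q → p ≈P (xVar l *P q)) → i ≡ j
minDeg-match {n} l p A R {i} {j} dA dR h indiv = compare (ℕP.<-cmp i j)
  where
  A′ R′ : Poly n
  A′ = List.map (lower i l) A
  R′ = List.map (lower j l) R
  power : ℕ → Poly n
  power m = xMono (tabulate (λ k → if does (l Fin.≟ k) then m else 0))
  relation : ∀ x y → + (lookup x l ℕ.^ j) * ev R′ x y ≡ ev p x y * (+ (lookup x l ℕ.^ i) * ev A′ x y)
  relation x y = trans (sym (ev-lower R l j (proj₁ (proj₂ dR)) x y)) (trans (≈P⇒ev R (p *P A) h x y)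
    (trans (ev-* p A x y) (cong (_*_ (ev p x y)) (ev-lower A l i (proj₁ (proj₂ dA)) x y))))
  cancel : ∀ t m {a b} → 0 < t → + (t ℕ.^ m) * a ≡ + (t ℕ.^ m) * b → a ≡ b
  cancel t m {a} {b} t>0 = ℤP.*-cancelˡ-≡ (+ (t ℕ.^ m)) a b {{ℕ.>-nonZero (ℕP.m^n>0 t {{ℕ.>-nonZero t>0}} m)}}
  killed : ∀ x → lookup (kill l x) l ≡ 0
  killed x = VecP.lookup∘updateAt l x
  ev-power-killed : ∀ δ x y → ev (power (suc δ)) (kill l x) y ≡ + 0
  ev-power-killed δ x y = trans (ev-power l (suc δ) (kill l x) y) (cong (λ z → + (z ℕ.^ suc δ)) (killed x))
  compare : Relation.Binary.Tri (i < j) (i ≡ j) (j < i) → i ≡ j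
  compare (tri≈ _ e _) = e
  -- At x_l = 0 the side with `R′` vanishes and `A′` is positive, so p vanishes there and is
  -- divisible by x_l.
  compare (tri< i<j _ _) = contradiction (zero-part-vanishes p l vanish) indiv
    where
    δ : ℕ
    δ = j ℕ.∸ suc i
    j≡ : j ≡ i ℕ.+ suc δ
    j≡ = trans (sym (ℕP.m+[n∸m]≡n i<j)) (sym (ℕP.+-suc i δ))
    same : (power (suc δ) *P R′) ≈P (p *P A′)
    same = ev⇒≈P (power (suc δ) *P R′) (p *P A′) (λ x y x>0 y>0 → trans (ev-* (power (suc δ)) R′ x y) (trans (cong (_* ev R′ x y) (ev-power l (suc δ) x y))
      (cancel (lookup x l) i (x>0 l) (trans (trans (lem₁ (+ (lookup x l ℕ.^ i)) (+ (lookup x l ℕ.^ suc δ)) (ev R′ x y))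
        (cong (_* ev R′ x y) (trans (sym (ℤP.pos-* (lookup x l ℕ.^ i) _)) (cong +_ (trans (sym (ℕP.^-distribˡ-+-* (lookup x l) i (suc δ))) (cong (lookup x l ℕ.^_) (sym j≡)))))))
        (trans (relation x y) (trans (lem₂ (ev p x y) (+ (lookup x l ℕ.^ i)) (ev A′ x y)) (cong (_*_ (+ (lookup x l ℕ.^ i))) (sym (ev-* p A′ x y)))))))))
      where
      lem₁ : ∀ a b c → a * (b * c) ≡ a * b * c
      lem₁ = solve-∀
      lem₂ : ∀ a b c → a * (b * c) ≡ b * (a * c)
      lem₂ = solve-∀
    vanish : ∀ x y → Positive x → Positive y → ev (zero-part l p) x y ≡ + 0
    vanish x y x>0 y>0 with ℤP.i*j≡0⇒i≡0∨j≡0 (ev p (kill l x) y) (trans (sym (ev-* p A′ (kill l x) y))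
        (trans (sym (≈P⇒ev (power (suc δ) *P R′) (p *P A′) same (kill l x) y)) (trans (ev-* (power (suc δ)) R′ (kill l x) y) (trans (cong (_* ev R′ (kill l x) y) (ev-power-killed δ x y)) refl))))
    ... | inj₁ z = trans (ev-zero-part p l x y) z
    ... | inj₂ z = contradiction (sym z) (ℤP.<⇒≢ (ev-off-pos A′ l (proj₁ low) (proj₂ (proj₂ low)) (kill l x) y (kill-off l x x>0) y>0))
      where
      low : MinDeg l A′ 0
      low = MinDeg-lower l A dA
  -- Here `R′` would vanish at x_l = 0, where it is positive.
  compare (tri> _ _ j<i) = contradiction vanish (λ z → ℤP.<⇒≢ (ev-off-pos R′ l (proj₁ low) (proj₂ (proj₂ low)) (kill l ones) ones (kill-off l ones ones>0) ones>0) (sym z))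
    where
    low : MinDeg l R′ 0
    low = MinDeg-lower l R dR
    ones>0 : ∀ {m} → Positive (ones {m})
    ones>0 k = subst (0 <_) (sym (VecP.lookup-replicate k 1)) ℕ.z<s
    δ : ℕ
    δ = i ℕ.∸ suc j
    i≡ : i ≡ j ℕ.+ suc δ
    i≡ = trans (sym (ℕP.m+[n∸m]≡n j<i)) (sym (ℕP.+-suc j δ))
    same : R′ ≈P (power (suc δ) *P (p *P A′))
    same = ev⇒≈P R′ (power (suc δ) *P (p *P A′)) (λ x y x>0 y>0 → cancel (lookup x l) j (x>0 l) (trans (relation x y)
      (trans (cong (λ z → ev p x y * (z * ev A′ x y)) (trans (cong +_ (trans (cong (lookup x l ℕ.^_) i≡) (ℕP.^-distribˡ-+-* (lookup x l) j (suc δ)))) (ℤP.pos-* (lookup x l ℕ.^ j) _)))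
        (trans (lem (ev p x y) (+ (lookup x l ℕ.^ j)) (+ (lookup x l ℕ.^ suc δ)) (ev A′ x y))
          (cong (_*_ (+ (lookup x l ℕ.^ j))) (sym (trans (ev-* (power (suc δ)) (p *P A′) x y) (cong₂ _*_ (ev-power l (suc δ) x y) (ev-* p A′ x y)))))))))
      where
      lem : ∀ p a b c → p * (a * b * c) ≡ a * (b * (p * c))
      lem = solve-∀
    vanish : ev R′ (kill l ones) ones ≡ + 0
    vanish = trans (≈P⇒ev R′ (power (suc δ) *P (p *P A′)) same (kill l ones) ones) (trans (ev-* (power (suc δ)) (p *P A′) (kill l ones) ones)
      (cong (_* ev (p *P A′) (kill l ones) ones) (ev-power-killed δ ones ones)))

-- Compare lowest degrees in x_l in the equation of the denominator form. The indivisible numerator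
-- contributes 0, which leaves minus the order of the fraction.
denominator-vector : (u : Frac n) (d : Fin n → ℤ) (p : Poly n) → HasDenomForm u d p → ∀ l g → VMin l u g → d l ≡ - g
denominator-vector (N , M) d p (h , indiv) l g (i , j , dN , dM , refl) = from (minDeg-match l p (M *P xn) ((N *P xp) *P oneP)
    (MinDeg-* l M xn dM (power (λ k → posℕ (- d k)))) (MinDeg-* l (N *P xp) oneP (MinDeg-* l N xp dN (power (posℕ ∘ d))) one) h (indiv l))
  where
  xp xn : Poly _
  xp = xMono (tabulate (λ i → posℕ (d i)))
  xn = xMono (tabulate (λ i → posℕ (- d i)))
  power : ∀ f → MinDeg l (xMono (tabulate f)) (f l)
  power f = subst (MinDeg l (xMono (tabulate f))) (VecP.lookup∘tabulate f l) (MinDeg-mono l (tabulate f) zeros)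
  one : MinDeg l oneP 0
  one = subst (MinDeg l oneP) (lookup-zeros l) (MinDeg-mono l zeros zeros)
  parts : ∀ z → z ≡ + posℕ z - + posℕ (- z)
  parts (+ zero)  = refl
  parts (+ suc m) = sym (ℤP.+-identityʳ _)
  parts -[1+ m ]  = refl
  from : j ℕ.+ posℕ (- d l) ≡ (i ℕ.+ posℕ (d l)) ℕ.+ 0 → d l ≡ - (+ i - + j)
  from e = trans (parts (d l)) (lem (+ i) (+ j) (+ posℕ (d l)) (+ posℕ (- d l)) (trans (sym (ℤP.pos-+ j _)) (trans (cong +_ (trans e (ℕP.+-identityʳ _))) (ℤP.pos-+ i _))))
    where
    lem : ∀ i j a b → j + b ≡ i + a → a - b ≡ - (i - j)
    lem i j a b f = trans (l₁ i j a b) (trans (cong (λ z → z - (i + b)) (sym f)) (l₂ i j b))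
      where
      l₁ : ∀ i j a b → a - b ≡ (i + a) - (i + b)
      l₁ = solve-∀
      l₂ : ∀ i j b → (j + b) - (i + b) ≡ - (i - j)
      l₂ = solve-∀

-- Triangulations

Edge : Set
Edge = ℕ × ℕ

_≟E_ : (e f : Edge) → Dec (e ≡ f)
_≟E_ = ProdP.≡-dec ℕ._≟_ ℕ._≟_

abstract
  δ : Edge → Edge → ℤ
  δ e f = if does (e ≟E f) then + 1 else + 0

  δ-yes : ∀ {e f} → e ≡ f → δ e f ≡ + 1
  δ-yes {e} {f} p rewrite dec-true (e ≟E f) p = refl

  δ-no : ∀ {e f} → e ≢ f → δ e f ≡ + 0
  δ-no {e} {f} p rewrite dec-false (e ≟E f) p = refl

  δ-cases : ∀ e f → (e ≡ f × δ e f ≡ + 1) ⊎ (e ≢ f × δ e f ≡ + 0)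
  δ-cases e f with e ≟E f
  ... | yes p = inj₁ (p , refl)
  ... | no p  = inj₂ (p , refl)

  δ-nonneg : ∀ e f → + 0 ℤ.≤ δ e f
  δ-nonneg e f with does (e ≟E f)
  ... | true  = ℤ.+≤+ z≤n
  ... | false = ℤ.+≤+ z≤n

δ-≢ : ∀ {e f} → δ e f ≡ + 0 → e ≢ f
δ-≢ z refl with trans (sym (δ-yes refl)) z
... | ()

record Tri : Set where
  constructor tri
  field
    {x y z} : ℕ
    x<y     : x < y
    y<z     : y < z

  xy yz xz : Edge
  xy = x , y
  yz = y , z
  xz = x , z

open Tri public using (xy; yz; xz)

-- Shear coordinate at f contributed by one triangle; for u the indicator of an edge this is the signed
-- adjacency of that edge and f in the triangle.
sh : (Edge → ℤ) → Edge → Tri → ℤ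
sh u f t = δ f (xz t) * (u (xy t) - u (yz t)) + δ f (xy t) * (u (yz t) - u (xz t)) + δ f (yz t) * (u (xz t) - u (xy t))

-- A diagonal spans the triangle on one side and is a short side of the triangle on the other. Both
-- totals are 1 for a diagonal of a triangulation, which says that it lies in exactly these two
-- triangles.
inner outer : Edge → Tri → ℤ
inner f t = δ f (xz t)
outer f t = δ f (xy t) + δ f (yz t)

total : (Tri → ℤ) → List Tri → ℤ
total g []      = + 0
total g (t ∷ T) = g t + total g T

sh-anti : ∀ e f t → sh (δ e) f t ≡ - sh (δ f) e t
sh-anti e f t = lem (δ f (xz t)) (δ f (xy t)) (δ f (yz t)) (δ e (xz t)) (δ e (xy t)) (δ e (yz t))
  where
  lem : ∀ a b c d e f → a * (e - f) + b * (f - d) + c * (d - e) ≡ - (d * (b - c) + e * (c - a) + f * (a - b))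
  lem = solve-∀

total-anti : ∀ e f T → total (sh (δ e) f) T ≡ - total (sh (δ f) e) T
total-anti e f []      = refl
total-anti e f (t ∷ T) rewrite total-anti e f T | sh-anti e f t = sym (ℤP.neg-distrib-+ (sh (δ f) e t) (total (sh (δ f) e) T))

data Pull : List Tri → Tri → List Tri → Set where
  here  : ∀ {t T} → Pull (t ∷ T) t T
  there : ∀ {s t T T′} → Pull T t T′ → Pull (s ∷ T) t (s ∷ T′)

total-pull : ∀ {T t T′} → Pull T t T′ → ∀ g → total g T ≡ g t + total g T′
total-pull here g = refl
total-pull (there {s} {t} {T} {T′} p) g = trans (cong (_+_ (g s)) (total-pull p g)) (lem (g s) (g t) (total g T′))
  where
  lem : ∀ a b c → a + (b + c) ≡ b + (a + c)
  lem = solve-∀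

All-pull : ∀ {P : Tri → Set} {T t T′} → Pull T t T′ → All P T → P t × All P T′
All-pull here      (a ∷ as) = a , as
All-pull (there p) (a ∷ as) = let b , bs = All-pull p as in b , a ∷ bs

find : ∀ {P : Tri → Set} g → (∀ t → P t ⊎ g t ≡ + 0) → ∀ T → total g T ≡ + 1 → ∃₂ λ t T′ → Pull T t T′ × P t
find g dec []      ()
find g dec (t ∷ T) e with dec t
... | inj₁ p = t , T , here , p
... | inj₂ z with find g dec T (trans (sym (ℤP.+-identityˡ _)) (trans (cong (_+ total g T) (sym z)) e))
...   | s , T′ , q , p = s , t ∷ T′ , there q , p

total-nonneg : ∀ g → (∀ t → + 0 ℤ.≤ g t) → ∀ T → + 0 ℤ.≤ total g T
total-nonneg g h []      = ℤP.≤-refl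
total-nonneg g h (t ∷ T) = ℤP.+-mono-≤ (h t) (total-nonneg g h T)

nonneg-split : ∀ {a b} → + 0 ℤ.≤ a → + 0 ℤ.≤ b → a + b ≡ + 0 → a ≡ + 0 × b ≡ + 0
nonneg-split (ℤ.+≤+ {n = zero} _)  (ℤ.+≤+ {n = zero} _)  e = refl , refl
nonneg-split (ℤ.+≤+ {n = zero} _)  (ℤ.+≤+ {n = suc b} _) ()
nonneg-split (ℤ.+≤+ {n = suc a} _) (ℤ.+≤+ _) ()

total-zero : ∀ g → (∀ t → + 0 ℤ.≤ g t) → ∀ T → total g T ≡ + 0 → All (λ t → g t ≡ + 0) T
total-zero g h []      e = []
total-zero g h (t ∷ T) e = let a , b = nonneg-split (h t) (total-nonneg g h T) e in a ∷ total-zero g h T b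

zero-total : ∀ g T → All (λ t → g t ≡ + 0) T → total g T ≡ + 0
zero-total g []      []       = refl
zero-total g (t ∷ T) (a ∷ as) rewrite a | zero-total g T as = refl

Avoids : Edge → Tri → Set
Avoids f t = f ≢ xz t × f ≢ xy t × f ≢ yz t

avoid-inner : ∀ f T → All (Avoids f) T → total (inner f) T ≡ + 0
avoid-inner f T a = zero-total _ T (All.map (λ { (p , q , r) → δ-no p }) a)

avoid-outer : ∀ f T → All (Avoids f) T → total (outer f) T ≡ + 0
avoid-outer f T a = zero-total _ T (All.map (λ { (p , q , r) → cong₂ _+_ (δ-no q) (δ-no r) }) a)

avoid-sh : ∀ u f T → All (Avoids f) T → total (sh u f) T ≡ + 0
avoid-sh u f T a = zero-total _ T (All.map (λ { {t} (p , q , r) →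
  cong₃ (λ a b c → a * (u (xy t) - u (yz t)) + b * (u (yz t) - u (xz t)) + c * (u (xz t) - u (xy t))) (δ-no p) (δ-no q) (δ-no r) }) a)

avoids : ∀ f T → total (inner f) T ≡ + 0 → total (outer f) T ≡ + 0 → All (Avoids f) T
avoids f T i o = All.zipWith (λ { {t} (p , q) → let r , s = nonneg-split (δ-nonneg f (xy t)) (δ-nonneg f (yz t)) q in δ-≢ p , δ-≢ r , δ-≢ s })
  (total-zero _ (λ t → δ-nonneg f (xz t)) T i , total-zero _ (λ t → ℤP.+-mono-≤ (δ-nonneg f (xy t)) (δ-nonneg f (yz t))) T o)

-- Flips: the diagonal e of a quadrilateral is replaced by e′; p₁, p₂ and m₁, m₂ are the pairs of opposite sides.

record Quad (a b c d : ℕ) : Set where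
  constructor quad
  field
    a<b : a < b
    b<c : b < c
    c<d : c < d

data Flip : (e e′ p₁ p₂ m₁ m₂ : Edge) (t₁ t₂ t₁′ t₂′ : Tri) → Set where
  flip₁ : ∀ {a b c d} (q : Quad a b c d) → let open Quad q in
    Flip (a , c) (b , d) (a , b) (c , d) (a , d) (b , c)
      (tri a<b b<c) (tri (ℕP.<-trans a<b b<c) c<d) (tri a<b (ℕP.<-trans b<c c<d)) (tri b<c c<d)
  flip₂ : ∀ {a b c d} (q : Quad a b c d) → let open Quad q in
    Flip (b , d) (a , c) (a , d) (b , c) (a , b) (c , d)
      (tri b<c c<d) (tri a<b (ℕP.<-trans b<c c<d)) (tri a<b b<c) (tri (ℕP.<-trans a<b b<c) c<d)

≢ˡ : ∀ {a b c d : ℕ} → a ≢ c → (a , b) ≢ (c , d)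
≢ˡ p e = p (cong proj₁ e)

≢ʳ : ∀ {a b c d : ℕ} → b ≢ d → (a , b) ≢ (c , d)
≢ʳ p e = p (cong proj₂ e)

module Distinct {a b c d : ℕ} (q : Quad a b c d) where
  open Quad q
  a≢b : a ≢ b
  a≢b = ℕP.<⇒≢ a<b
  b≢c : b ≢ c
  b≢c = ℕP.<⇒≢ b<c
  c≢d : c ≢ d
  c≢d = ℕP.<⇒≢ c<d
  a≢c : a ≢ c
  a≢c = ℕP.<⇒≢ (ℕP.<-trans a<b b<c)
  b≢d : b ≢ d
  b≢d = ℕP.<⇒≢ (ℕP.<-trans b<c c<d)

  abc acd abd bcd : Tri
  abc = tri a<b b<c
  acd = tri (ℕP.<-trans a<b b<c) c<d
  abd = tri a<b (ℕP.<-trans b<c c<d)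
  bcd = tri b<c c<d

  sh-at : ∀ u f t {i j k} → δ f (xz t) ≡ i → δ f (xy t) ≡ j → δ f (yz t) ≡ k →
    sh u f t ≡ i * (u (xy t) - u (yz t)) + j * (u (yz t) - u (xz t)) + k * (u (xz t) - u (xy t))
  sh-at u f t p q r = cong₃ (λ i j k → i * (u (xy t) - u (yz t)) + j * (u (yz t) - u (xz t)) + k * (u (xz t) - u (xy t))) p q r

  sh-ac : ∀ u → sh u (a , c) abc + sh u (a , c) acd ≡ (u (a , b) + u (c , d)) - (u (a , d) + u (b , c))
  sh-ac u = trans (cong₂ _+_
      (sh-at u (a , c) abc (δ-yes refl) (δ-no (≢ʳ (b≢c ∘ sym))) (δ-no (≢ˡ a≢b)))
      (sh-at u (a , c) acd (δ-no (≢ʳ c≢d)) (δ-yes refl) (δ-no (≢ˡ a≢c))))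
    (lem (u (a , b)) (u (b , c)) (u (a , c)) (u (a , d)) (u (c , d)))
    where
    lem : ∀ ab bc ac ad cd →
      (+ 1 * (ab - bc) + + 0 * (bc - ac) + + 0 * (ac - ab)) + (+ 0 * (ac - cd) + + 1 * (cd - ad) + + 0 * (ad - ac)) ≡ (ab + cd) - (ad + bc)
    lem = solve-∀

  sh-bd : ∀ u → sh u (b , d) bcd + sh u (b , d) abd ≡ (u (a , d) + u (b , c)) - (u (a , b) + u (c , d))
  sh-bd u = trans (cong₂ _+_
      (sh-at u (b , d) bcd (δ-yes refl) (δ-no (≢ʳ (c≢d ∘ sym))) (δ-no (≢ˡ b≢c)))
      (sh-at u (b , d) abd (δ-no (≢ˡ (a≢b ∘ sym))) (δ-no (≢ˡ (a≢b ∘ sym))) (δ-yes refl)))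
    (lem (u (a , b)) (u (b , c)) (u (b , d)) (u (a , d)) (u (c , d)))
    where
    lem : ∀ ab bc bd ad cd →
      (+ 1 * (bc - cd) + + 0 * (cd - bd) + + 0 * (bd - bc)) + (+ 0 * (ab - bd) + + 0 * (bd - ad) + + 1 * (ad - ab)) ≡ (ad + bc) - (ab + cd)
    lem = solve-∀

  sh-diff : ∀ u f → f ≢ (a , c) → f ≢ (b , d) →
    sh u f abd + sh u f bcd ≡ (sh u f abc + sh u f acd)
      + ((δ f (a , b) + δ f (c , d)) * ((u (a , c) + u (b , d)) - (u (a , d) + u (b , c)))
      + (δ f (a , d) + δ f (b , c)) * ((u (a , b) + u (c , d)) - (u (a , c) + u (b , d))))
  sh-diff u f p q rewrite δ-no p | δ-no q =
    lem (δ f (a , b)) (δ f (c , d)) (δ f (a , d)) (δ f (b , c)) (u (a , b)) (u (b , c)) (u (a , c)) (u (a , d)) (u (c , d)) (u (b , d))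
    where
    lem : ∀ AB CD AD BC ab bc ac ad cd bd →
      (AD * (ab - bd) + AB * (bd - ad) + + 0 * (ad - ab)) + (+ 0 * (bc - cd) + BC * (cd - bd) + CD * (bd - bc)) ≡
      ((+ 0 * (ab - bc) + AB * (bc - ac) + BC * (ac - ab)) + (AD * (ac - cd) + + 0 * (cd - ad) + CD * (ad - ac)))
      + ((AB + CD) * ((ac + bd) - (ad + bc)) + (AD + BC) * ((ab + cd) - (ac + bd)))
    lem = solve-∀

flip-old : ∀ {e e′ p₁ p₂ m₁ m₂ t₁ t₂ t₁′ t₂′} → Flip e e′ p₁ p₂ m₁ m₂ t₁ t₂ t₁′ t₂′ → ∀ u →
  sh u e t₁ + sh u e t₂ ≡ (u p₁ + u p₂) - (u m₁ + u m₂)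
flip-old (flip₁ q) u = Distinct.sh-ac q u
flip-old (flip₂ q) u = Distinct.sh-bd q u

flip-new : ∀ {e e′ p₁ p₂ m₁ m₂ t₁ t₂ t₁′ t₂′} → Flip e e′ p₁ p₂ m₁ m₂ t₁ t₂ t₁′ t₂′ → ∀ u →
  sh u e′ t₁′ + sh u e′ t₂′ ≡ (u m₁ + u m₂) - (u p₁ + u p₂)
flip-new (flip₁ {a} {b} {c} {d} q) u = trans (ℤP.+-comm (sh u (b , d) (Distinct.abd q)) (sh u (b , d) (Distinct.bcd q))) (Distinct.sh-bd q u)
flip-new (flip₂ q) u = Distinct.sh-ac q u

-- Only the four sides change their shear coordinates. This is an identity for arbitrary `u`; the
-- tropical relation enters in `exchange-row`.
flip-diff : ∀ {e e′ p₁ p₂ m₁ m₂ t₁ t₂ t₁′ t₂′} → Flip e e′ p₁ p₂ m₁ m₂ t₁ t₂ t₁′ t₂′ → ∀ u f → f ≢ e → f ≢ e′ →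
  sh u f t₁′ + sh u f t₂′ ≡ (sh u f t₁ + sh u f t₂)
    + ((δ f p₁ + δ f p₂) * ((u e + u e′) - (u m₁ + u m₂)) + (δ f m₁ + δ f m₂) * ((u p₁ + u p₂) - (u e + u e′)))
flip-diff (flip₁ q) u f p r = Distinct.sh-diff q u f p r
flip-diff (flip₂ {a} {b} {c} {d} q) u f p r = lem (sh u f (Distinct.abd q)) (sh u f (Distinct.bcd q)) (sh u f (Distinct.abc q)) (sh u f (Distinct.acd q))
    (δ f (a , b) + δ f (c , d)) (δ f (a , d) + δ f (b , c)) (u (a , c)) (u (b , d)) (u (a , d) + u (b , c)) (u (a , b) + u (c , d)) (Distinct.sh-diff q u f r p)
  where
  lem : ∀ s₁ s₂ r₁ r₂ P M ac bd m p → s₁ + s₂ ≡ (r₁ + r₂) + (P * ((ac + bd) - m) + M * (p - (ac + bd))) →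
    r₁ + r₂ ≡ (s₂ + s₁) + (M * ((bd + ac) - p) + P * (m - (bd + ac)))
  lem s₁ s₂ r₁ r₂ P M ac bd m p e = trans (l₁ (r₁ + r₂) P M ac bd m p) (trans (cong (_+ (M * ((bd + ac) - p) + P * (m - (bd + ac)))) (sym e))
    (cong (_+ (M * ((bd + ac) - p) + P * (m - (bd + ac)))) (ℤP.+-comm s₁ s₂)))
    where
    l₁ : ∀ r P M ac bd m p → r ≡ (r + (P * ((ac + bd) - m) + M * (p - (ac + bd)))) + (M * ((bd + ac) - p) + P * (m - (bd + ac)))
    l₁ = solve-∀

flip-inner : ∀ {e e′ p₁ p₂ m₁ m₂ t₁ t₂ t₁′ t₂′} → Flip e e′ p₁ p₂ m₁ m₂ t₁ t₂ t₁′ t₂′ → ∀ f → f ≢ e → f ≢ e′ →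
  inner f t₁′ + inner f t₂′ ≡ inner f t₁ + inner f t₂
flip-inner (flip₁ {a} {b} {c} {d} q) f p r rewrite δ-no p | δ-no r = ℤP.+-comm (δ f (a , d)) (+ 0)
flip-inner (flip₂ {a} {b} {c} {d} q) f p r rewrite δ-no p | δ-no r = refl

flip-outer : ∀ {e e′ p₁ p₂ m₁ m₂ t₁ t₂ t₁′ t₂′} → Flip e e′ p₁ p₂ m₁ m₂ t₁ t₂ t₁′ t₂′ → ∀ f → f ≢ e → f ≢ e′ →
  outer f t₁′ + outer f t₂′ ≡ outer f t₁ + outer f t₂
flip-outer (flip₁ {a} {b} {c} {d} q) f p r rewrite δ-no p | δ-no r = lem (δ f (a , b)) (δ f (b , c)) (δ f (c , d))
  where
  lem : ∀ x y z → (x + + 0) + (y + z) ≡ (x + y) + (+ 0 + z)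
  lem = solve-∀
flip-outer (flip₂ {a} {b} {c} {d} q) f p r rewrite δ-no p | δ-no r = lem (δ f (a , b)) (δ f (b , c)) (δ f (c , d))
  where
  lem : ∀ x y z → (x + y) + (+ 0 + z) ≡ (y + z) + (x + + 0)
  lem = solve-∀

flip-e′ : ∀ {e e′ p₁ p₂ m₁ m₂ t₁ t₂ t₁′ t₂′} → Flip e e′ p₁ p₂ m₁ m₂ t₁ t₂ t₁′ t₂′ →
  inner e′ t₁′ + inner e′ t₂′ ≡ + 1 × outer e′ t₁′ + outer e′ t₂′ ≡ + 1
flip-e′ (flip₁ q) = let open Distinct q in
  cong₂ _+_ (δ-no (≢ˡ (a≢b ∘ sym))) (δ-yes refl) ,
  cong₂ _+_ (cong₂ _+_ (δ-no (≢ˡ (a≢b ∘ sym))) (δ-yes refl)) (cong₂ _+_ (δ-no (≢ʳ (c≢d ∘ sym))) (δ-no (≢ˡ b≢c)))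
flip-e′ (flip₂ q) = let open Distinct q in
  cong₂ _+_ (δ-yes refl) (δ-no (≢ʳ c≢d)) ,
  cong₂ _+_ (cong₂ _+_ (δ-no (≢ʳ (b≢c ∘ sym))) (δ-no (≢ˡ a≢b))) (cong₂ _+_ (δ-yes refl) (δ-no (≢ˡ a≢c)))

flip-e : ∀ {e e′ p₁ p₂ m₁ m₂ t₁ t₂ t₁′ t₂′} → Flip e e′ p₁ p₂ m₁ m₂ t₁ t₂ t₁′ t₂′ →
  inner e t₁ + inner e t₂ ≡ + 1 × outer e t₁ + outer e t₂ ≡ + 1
flip-e (flip₁ q) = flip-e′ (flip₂ q)
flip-e (flip₂ {a} {b} {c} {d} q) = let i , o = flip-e′ (flip₁ q); open Distinct q in
  trans (ℤP.+-comm (inner (b , d) bcd) (inner (b , d) abd)) i , trans (ℤP.+-comm (outer (b , d) bcd) (outer (b , d) abd)) o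

data Sides (e p₁ p₂ m₁ m₂ : Edge) : Set where
  on-p₁ : e ≡ p₁ → δ e p₁ ≡ + 1 → δ e p₂ ≡ + 0 → δ e m₁ ≡ + 0 → δ e m₂ ≡ + 0 → Sides e p₁ p₂ m₁ m₂
  on-p₂ : e ≡ p₂ → δ e p₁ ≡ + 0 → δ e p₂ ≡ + 1 → δ e m₁ ≡ + 0 → δ e m₂ ≡ + 0 → Sides e p₁ p₂ m₁ m₂
  on-m₁ : e ≡ m₁ → δ e p₁ ≡ + 0 → δ e p₂ ≡ + 0 → δ e m₁ ≡ + 1 → δ e m₂ ≡ + 0 → Sides e p₁ p₂ m₁ m₂
  on-m₂ : e ≡ m₂ → δ e p₁ ≡ + 0 → δ e p₂ ≡ + 0 → δ e m₁ ≡ + 0 → δ e m₂ ≡ + 1 → Sides e p₁ p₂ m₁ m₂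
  off   : δ e p₁ ≡ + 0 → δ e p₂ ≡ + 0 → δ e m₁ ≡ + 0 → δ e m₂ ≡ + 0 → Sides e p₁ p₂ m₁ m₂

sides : ∀ e {p₁ p₂ m₁ m₂} → p₁ ≢ p₂ → p₁ ≢ m₁ → p₁ ≢ m₂ → p₂ ≢ m₁ → p₂ ≢ m₂ → m₁ ≢ m₂ → Sides e p₁ p₂ m₁ m₂
sides e {p₁} {p₂} {m₁} {m₂} a b c d f g with δ-cases e p₁
... | inj₁ (refl , i) = on-p₁ refl i (δ-no a) (δ-no b) (δ-no c)
... | inj₂ (_ , i) with δ-cases e p₂
...   | inj₁ (refl , j) = on-p₂ refl i j (δ-no d) (δ-no f)
...   | inj₂ (_ , j) with δ-cases e m₁
...     | inj₁ (refl , k) = on-m₁ refl i j k (δ-no g)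
...     | inj₂ (_ , k) with δ-cases e m₂
...       | inj₁ (refl , l) = on-m₂ refl i j k l
...       | inj₂ (_ , l) = off i j k l

flip-sides : ∀ {e e′ p₁ p₂ m₁ m₂ t₁ t₂ t₁′ t₂′} → Flip e e′ p₁ p₂ m₁ m₂ t₁ t₂ t₁′ t₂′ → ∀ f → Sides f p₁ p₂ m₁ m₂
flip-sides (flip₁ q) f = let open Distinct q in
  sides f (≢ˡ a≢c) (≢ʳ b≢d) (≢ˡ a≢b) (≢ˡ (a≢c ∘ sym)) (≢ˡ (b≢c ∘ sym)) (≢ˡ a≢b)
flip-sides (flip₂ q) f = let open Distinct q in
  sides f (≢ˡ a≢b) (≢ʳ (b≢d ∘ sym)) (≢ˡ a≢c) (≢ˡ (a≢b ∘ sym)) (≢ˡ b≢c) (≢ˡ a≢c)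

flip-distinct : ∀ {e e′ p₁ p₂ m₁ m₂ t₁ t₂ t₁′ t₂′} → Flip e e′ p₁ p₂ m₁ m₂ t₁ t₂ t₁′ t₂′ →
  (e′ ≢ p₁ × e′ ≢ p₂ × e′ ≢ m₁ × e′ ≢ m₂) × (e ≢ p₁ × e ≢ p₂ × e ≢ m₁ × e ≢ m₂) × e ≢ e′
flip-distinct (flip₁ q) = let open Distinct q in
  (≢ˡ (a≢b ∘ sym) , ≢ˡ b≢c , ≢ˡ (a≢b ∘ sym) , ≢ʳ (c≢d ∘ sym)) , (≢ʳ (b≢c ∘ sym) , ≢ˡ a≢c , ≢ʳ c≢d , ≢ˡ a≢b) , ≢ˡ a≢b
flip-distinct (flip₂ q) = let open Distinct q in
  (≢ʳ c≢d , ≢ˡ a≢b , ≢ʳ (b≢c ∘ sym) , ≢ˡ a≢c) , (≢ˡ (a≢b ∘ sym) , ≢ʳ (c≢d ∘ sym) , ≢ˡ (a≢b ∘ sym) , ≢ˡ b≢c) , ≢ˡ (a≢b ∘ sym)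

Cross : Edge → Edge → Set
Cross (a , b) (c , d) = a < c × c < b × b < d

flip-cross : ∀ {e e′ p₁ p₂ m₁ m₂ t₁ t₂ t₁′ t₂′} → Flip e e′ p₁ p₂ m₁ m₂ t₁ t₂ t₁′ t₂′ → Cross e e′ ⊎ Cross e′ e
flip-cross (flip₁ (quad a b c)) = inj₁ (a , b , c)
flip-cross (flip₂ (quad a b c)) = inj₂ (a , b , c)

Clear : Edge → Edge → Set
Clear e f = ¬ Cross e f × ¬ Cross f e

-- A chord through the inside of a quadrilateral that crosses none of its sides is a diagonal, and
-- the one that crosses (b , d) is excluded.
clear-bd : ∀ {a b c d} → Quad a b c d → ∀ f → Clear (a , b) f → Clear (b , c) f → Clear (c , d) f → Clear (a , d) f → f ≢ (a , c) → Clear (b , d) f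
clear-bd {a} {b} {c} {d} (quad a<b b<c c<d) (u , v) ab bc cd ad ne = left , right
  where
  left : ¬ Cross (b , d) (u , v)
  left (b<u , u<d , d<v) with ℕP.<-cmp u c
  ... | tri< u<c _ _ = proj₁ bc (b<u , u<c , ℕP.<-trans c<d d<v)
  ... | tri≈ _ refl _ = proj₁ ad (ℕP.<-trans a<b b<u , u<d , d<v)
  ... | tri> _ _ c<u = proj₁ cd (c<u , u<d , d<v)
  right : ¬ Cross (u , v) (b , d)
  right (u<b , b<v , v<d) with ℕP.<-cmp v c
  ... | tri< v<c _ _ = proj₂ bc (u<b , b<v , v<c)
  ... | tri> _ _ c<v = proj₂ cd (ℕP.<-trans u<b b<c , c<v , v<d)
  ... | tri≈ _ refl _ with ℕP.<-cmp u a
  ...   | tri< u<a _ _ = proj₂ ad (u<a , ℕP.<-trans a<b b<c , c<d)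
  ...   | tri≈ _ refl _ = ne refl
  ...   | tri> _ _ a<u = proj₁ ab (a<u , u<b , b<v)

clear-ac : ∀ {a b c d} → Quad a b c d → ∀ f → Clear (a , b) f → Clear (b , c) f → Clear (c , d) f → Clear (a , d) f → f ≢ (b , d) → Clear (a , c) f
clear-ac {a} {b} {c} {d} (quad a<b b<c c<d) (u , v) ab bc cd ad ne = left , right
  where
  left : ¬ Cross (a , c) (u , v)
  left (a<u , u<c , c<v) with ℕP.<-cmp u b
  ... | tri< u<b _ _ = proj₁ ab (a<u , u<b , ℕP.<-trans b<c c<v)
  ... | tri> _ _ b<u = proj₁ bc (b<u , u<c , c<v)
  ... | tri≈ _ refl _ with ℕP.<-cmp v d
  ...   | tri< v<d _ _ = proj₂ cd (u<c , c<v , v<d)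
  ...   | tri≈ _ refl _ = ne refl
  ...   | tri> _ _ d<v = proj₁ ad (a<u , ℕP.<-trans u<c c<d , d<v)
  right : ¬ Cross (u , v) (a , c)
  right (u<a , a<v , v<c) with ℕP.<-cmp v b
  ... | tri< v<b _ _ = proj₂ ab (u<a , a<v , v<b)
  ... | tri≈ _ refl _ = proj₂ ad (u<a , a<b , ℕP.<-trans b<c c<d)
  ... | tri> _ _ b<v = proj₂ bc (ℕP.<-trans u<a a<b , b<v , v<c)

flip-clear : ∀ {e e′ p₁ p₂ m₁ m₂ t₁ t₂ t₁′ t₂′} → Flip e e′ p₁ p₂ m₁ m₂ t₁ t₂ t₁′ t₂′ → ∀ f →
  Clear p₁ f → Clear p₂ f → Clear m₁ f → Clear m₂ f → f ≢ e → Clear e′ f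
flip-clear (flip₁ q) f p₁ p₂ m₁ m₂ = clear-bd q f p₁ m₂ p₂ m₁
flip-clear (flip₂ q) f p₁ p₂ m₁ m₂ = clear-ac q f m₁ p₂ m₂ p₁

-- Seeds of triangulations

Bd : ℕ → Edge → Set
Bd N (a , b) = (suc a ≡ b × b ≤ N) ⊎ (a ≡ 0 × b ≡ N)

Edges : (Edge → Set) → Tri → Set
Edges P t = P (xy t) × P (yz t) × P (xz t)

flip-edges : ∀ {P : Edge → Set} {e e′ p₁ p₂ m₁ m₂ t₁ t₂ t₁′ t₂′} → Flip e e′ p₁ p₂ m₁ m₂ t₁ t₂ t₁′ t₂′ →
  Edges P t₁ → Edges P t₂ → P p₁ × P p₂ × P m₁ × P m₂
flip-edges (flip₁ q) (ab , bc , ac) (_ , cd , ad) = ab , cd , ad , bc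
flip-edges (flip₂ q) (bc , cd , bd) (ab , _ , ad) = ad , bc , ab , cd

flip-edges′ : ∀ {P : Edge → Set} {e e′ p₁ p₂ m₁ m₂ t₁ t₂ t₁′ t₂′} → Flip e e′ p₁ p₂ m₁ m₂ t₁ t₂ t₁′ t₂′ →
  P e′ → P p₁ → P p₂ → P m₁ → P m₂ → Edges P t₁′ × Edges P t₂′
flip-edges′ (flip₁ q) bd ab cd ad bc = (ab , bd , ad) , (bc , cd , bd)
flip-edges′ (flip₂ q) ac ad bc ab cd = (ab , bc , ac) , (ac , cd , ad)

flip-inside : ∀ {N e e′ p₁ p₂ m₁ m₂ t₁ t₂ t₁′ t₂′} → Flip e e′ p₁ p₂ m₁ m₂ t₁ t₂ t₁′ t₂′ →
  proj₂ p₁ ≤ N → proj₂ p₂ ≤ N → ¬ Bd N e′ × proj₁ e′ < proj₂ e′ × proj₂ e′ ≤ N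
flip-inside (flip₁ (quad a<b b<c c<d)) _ d≤N =
  (λ { (inj₁ (refl , _)) → ℕP.<⇒≱ b<c (ℕP.≤-pred c<d) ; (inj₂ (refl , _)) → ℕP.n≮0 a<b }) , ℕP.<-trans b<c c<d , d≤N
flip-inside (flip₂ (quad a<b b<c c<d)) d≤N _ =
  (λ { (inj₁ (refl , _)) → ℕP.<⇒≱ a<b (ℕP.≤-pred b<c) ; (inj₂ (refl , refl)) → ℕP.<⇒≱ c<d d≤N }) , ℕP.<-trans a<b b<c , ℕP.≤-trans (ℕP.<⇒≤ c<d) d≤N

Bd-clear : ∀ {N e f} → Bd N e → proj₂ f ≤ N → Clear e f
Bd-clear (inj₁ (refl , _)) h = (λ { (p , q , _) → ℕP.<⇒≱ p (ℕP.≤-pred q) }) , (λ { (_ , q , r) → ℕP.<⇒≱ q (ℕP.≤-pred r) })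
Bd-clear (inj₂ (refl , refl)) h = (λ { (_ , _ , r) → ℕP.<⇒≱ r h }) , (λ { () })

Bd-≤ : ∀ {N e} → Bd N e → proj₂ e ≤ N
Bd-≤ (inj₁ (_ , p))    = p
Bd-≤ (inj₂ (_ , refl)) = ℕP.≤-refl

-- The tropical Plücker relation; minus the crossing number with a curve is the model case.
Tropical : (Edge → ℤ) → Set
Tropical u = ∀ {a b c d} → Quad a b c d → u (a , c) + u (b , d) ≡ (u (a , b) + u (c , d)) ⊓ (u (a , d) + u (b , c))

flip-tropical : ∀ {u} → Tropical u → ∀ {e e′ p₁ p₂ m₁ m₂ t₁ t₂ t₁′ t₂′} → Flip e e′ p₁ p₂ m₁ m₂ t₁ t₂ t₁′ t₂′ →
  u e + u e′ ≡ (u p₁ + u p₂) ⊓ (u m₁ + u m₂)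
flip-tropical h (flip₁ q) = h q
flip-tropical {u} h (flip₂ {a} {b} {c} {d} q) = trans (ℤP.+-comm (u (b , d)) (u (a , c))) (trans (h q) (ℤP.⊓-comm (u (a , b) + u (c , d)) (u (a , d) + u (b , c))))

min-minus : ∀ p m → (p ⊓ m) - m ≡ (p - m) ⊓ + 0
min-minus p m = trans (ℤP.mono-≤-distrib-⊓ (ℤP.+-monoˡ-≤ (- m)) p m) (cong ((p - m) ⊓_) (ℤP.+-inverseʳ m))

pos-minus : ∀ z → sgn z * pos (z * - (+ 1 - + 0)) ≡ z ⊓ + 0
pos-minus (+ zero)  = refl
pos-minus (+ suc m) = refl
pos-minus -[1+ m ] rewrite ℕP.*-identityʳ m | ℕP.+-identityʳ m = refl

pos-plus : ∀ z → sgn z * pos (z * - (+ 0 - + 1)) ≡ z - (z ⊓ + 0)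
pos-plus (+ zero)  = refl
pos-plus (+ suc m) rewrite ℕP.*-identityʳ m | ℕP.+-identityʳ m = refl
pos-plus -[1+ m ] = sym (ℤP.+-inverseʳ -[1+ m ])

pos-null : ∀ z → sgn z * pos (z * - (+ 0 - + 0)) ≡ + 0
pos-null z = trans (cong (λ y → sgn z * pos y) (ℤP.*-zeroʳ z)) (ℤP.*-zeroʳ (sgn z))

-- Put x = p - m. The tropical relation makes the increment x ⊓ 0 on the sides p₁, p₂ and x - (x ⊓
-- 0) on m₁, m₂. These are the values of sgn x · pos (x b) in matrix mutation for b = -1 and b = 1.
exchange-row : ∀ {f p₁ p₂ m₁ m₂} p m k → k ≡ p ⊓ m → Sides f p₁ p₂ m₁ m₂ →
  (δ f p₁ + δ f p₂) * (k - m) + (δ f m₁ + δ f m₂) * (p - k) ≡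
  sgn (p - m) * pos ((p - m) * - ((δ f p₁ + δ f p₂) - (δ f m₁ + δ f m₂)))
exchange-row {f} {p₁} {p₂} {m₁} {m₂} p m k refl s = by-case s
  where
  P-case : + 1 * ((p ⊓ m) - m) + + 0 * (p - (p ⊓ m)) ≡ sgn (p - m) * pos ((p - m) * - (+ 1 - + 0))
  P-case = trans (lem (p ⊓ m) m p) (trans (min-minus p m) (sym (pos-minus (p - m))))
    where
    lem : ∀ k m p → + 1 * (k - m) + + 0 * (p - k) ≡ k - m
    lem = solve-∀
  M-case : + 0 * ((p ⊓ m) - m) + + 1 * (p - (p ⊓ m)) ≡ sgn (p - m) * pos ((p - m) * - (+ 0 - + 1))
  M-case = trans (lem (p ⊓ m) m p) (trans (cong (_-_ (p - m)) (min-minus p m)) (sym (pos-plus (p - m))))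
    where
    lem : ∀ k m p → + 0 * (k - m) + + 1 * (p - k) ≡ (p - m) - (k - m)
    lem = solve-∀
  O-case : + 0 * ((p ⊓ m) - m) + + 0 * (p - (p ⊓ m)) ≡ sgn (p - m) * pos ((p - m) * - (+ 0 - + 0))
  O-case = trans (lem (p ⊓ m) m p) (sym (pos-null (p - m)))
    where
    lem : ∀ k m p → + 0 * (k - m) + + 0 * (p - k) ≡ + 0
    lem = solve-∀
  by-case : Sides f p₁ p₂ m₁ m₂ → (δ f p₁ + δ f p₂) * ((p ⊓ m) - m) + (δ f m₁ + δ f m₂) * (p - (p ⊓ m)) ≡
    sgn (p - m) * pos ((p - m) * - ((δ f p₁ + δ f p₂) - (δ f m₁ + δ f m₂)))
  by-case (on-p₁ _ a b c d) rewrite a | b | c | d = P-case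
  by-case (on-p₂ _ a b c d) rewrite a | b | c | d = P-case
  by-case (on-m₁ _ a b c d) rewrite a | b | c | d = M-case
  by-case (on-m₂ _ a b c d) rewrite a | b | c | d = M-case
  by-case (off a b c d)     rewrite a | b | c | d = O-case

sides-min : ∀ {f p₁ p₂ m₁ m₂} → Sides f p₁ p₂ m₁ m₂ → (δ f p₁ + δ f p₂) ⊓ (δ f m₁ + δ f m₂) ≡ + 0
sides-min (on-p₁ _ a b c d) rewrite a | b | c | d = refl
sides-min (on-p₂ _ a b c d) rewrite a | b | c | d = refl
sides-min (on-m₁ _ a b c d) rewrite a | b | c | d = refl
sides-min (on-m₂ _ a b c d) rewrite a | b | c | d = refl
sides-min (off a b c d)     rewrite a | b | c | d = refl

-- The input of the induction over mutations: edge functions whose shear coordinates are the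
-- coefficient rows, and for each valuation a value of every chord that satisfies the exchange
-- relation with these coefficients. It treats d-vectors and F-polynomials at once.
record Model (n N : ℕ) : Set₁ where
  field
    u      : Fin n → Edge → ℤ
    u-trop : ∀ i → Tropical (u i)
    W      : Set
    val    : W → Valuation n
    X      : W → Edge → ℤ
    X-bd   : ∀ w e → Bd N e → X w e ≡ Valuation.ε (val w)
    exch   : ∀ w {a b c d} → Quad a b c d → d ≤ N → let open Valuation (val w) in
      X w (a , c) · X w (b , d) ≡
        (X w (a , b) · X w (c , d) · Y (tabulate (λ i → posℕ ((u i (a , b) + u i (c , d)) - (u i (a , d) + u i (b , c))))))
        ⊕ (X w (a , d) · X w (b , c) · Y (tabulate (λ i → posℕ (- ((u i (a , b) + u i (c , d)) - (u i (a , d) + u i (b , c)))))))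

  exch-flip : ∀ w {e e′ p₁ p₂ m₁ m₂ t₁ t₂ t₁′ t₂′} → Flip e e′ p₁ p₂ m₁ m₂ t₁ t₂ t₁′ t₂′ → proj₂ p₁ ≤ N → proj₂ p₂ ≤ N →
    let open Valuation (val w) in
    X w e · X w e′ ≡ (X w p₁ · X w p₂ · Y (tabulate (λ i → posℕ ((u i p₁ + u i p₂) - (u i m₁ + u i m₂)))))
      ⊕ (X w m₁ · X w m₂ · Y (tabulate (λ i → posℕ (- ((u i p₁ + u i p₂) - (u i m₁ + u i m₂))))))
  exch-flip w (flip₁ q) _ h = exch w q h
  exch-flip w (flip₂ {a} {b} {c} {d} q) h _ = trans (·-comm _ _) (trans (exch w q h) (trans (⊕-comm _ _)
      (cong₂ (λ r s → (X w (a , d) · X w (b , c) · Y r) ⊕ (X w (a , b) · X w (c , d) · Y s))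
        (VecP.tabulate-cong (λ i → cong posℕ (l₁ (u i (a , b) + u i (c , d)) (u i (a , d) + u i (b , c)))))
        (VecP.tabulate-cong (λ i → cong posℕ (l₂ (u i (a , b) + u i (c , d)) (u i (a , d) + u i (b , c))))))))
    where
    open Valuation (val w)
    l₁ : ∀ p m → - (p - m) ≡ m - p
    l₁ = solve-∀
    l₂ : ∀ p m → p - m ≡ - (m - p)
    l₂ = solve-∀

module Mutation {n N : ℕ} (M : Model n N) where
  open Model M

  Ok : (Fin n → Edge) → Edge → Set
  Ok D e = Bd N e ⊎ ∃ λ i → D i ≡ e

  -- `in1`, `out1`, `nc` and `ok` are the local properties of a triangulation that a flip uses and
  -- restores; no global description of the polygon is kept.
  record Inv (s : Seed n) : Set where
    field
      D      : Fin n → Edge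
      Ts     : List Tri
      D-<    : ∀ k → proj₁ (D k) < proj₂ (D k)
      D-≤    : ∀ k → proj₂ (D k) ≤ N
      D-inj  : ∀ i j → D i ≡ D j → i ≡ j
      nc     : ∀ i j → ¬ Cross (D i) (D j)
      in1    : ∀ k → total (inner (D k)) Ts ≡ + 1
      out1   : ∀ k → total (outer (D k)) Ts ≡ + 1
      ok     : All (Edges (Ok D)) Ts
      B-eq   : ∀ i k → Seed.B s i k ≡ total (sh (δ (D i)) (D k)) Ts
      C-eq   : ∀ i k → Seed.C s i k ≡ total (sh (u i) (D k)) Ts
      values : ∀ w k → Valuation.V (val w) (Seed.cluster s k) (X w (D k))

  record FlipOf (e : Edge) (Ts : List Tri) : Set where
    field
      {e′ p₁ p₂ m₁ m₂}    : Edge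
      {t₁ t₂ t₁′ t₂′}     : Tri
      {mid rest}          : List Tri
      flip                : Flip e e′ p₁ p₂ m₁ m₂ t₁ t₂ t₁′ t₂′
      pull₁               : Pull Ts t₁ mid
      pull₂               : Pull mid t₂ rest

  -- First comes the triangle spanned by e. The other one has e as its first or as its second short
  -- side, which decides between `flip₁` and `flip₂`.
  find-flip : ∀ e Ts → total (inner e) Ts ≡ + 1 → total (outer e) Ts ≡ + 1 → FlipOf e Ts
  find-flip e Ts i o with find (inner e) inner? Ts i
    where
    inner? : ∀ t → e ≡ xz t ⊎ inner e t ≡ + 0
    inner? t with δ-cases e (xz t)
    ... | inj₁ (p , _) = inj₁ p
    ... | inj₂ (_ , z) = inj₂ z
  ... | tri {x} {y} {z} x<y y<z , mid , pull₁ , refl with find (outer (x , z)) outer? mid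
        (trans (sym (trans (total-pull pull₁ (outer (x , z))) (trans (cong (_+ total (outer (x , z)) mid)
          (cong₂ _+_ (δ-no (≢ʳ (λ f → ℕP.<⇒≢ y<z (sym f)))) (δ-no (≢ˡ (ℕP.<⇒≢ x<y))))) (ℤP.+-identityˡ _)))) o)
    where
    outer? : ∀ t → ((x , z) ≡ xy t ⊎ (x , z) ≡ yz t) ⊎ outer (x , z) t ≡ + 0
    outer? t with δ-cases (x , z) (xy t) | δ-cases (x , z) (yz t)
    ... | inj₁ (p , _) | _            = inj₁ (inj₁ p)
    ... | inj₂ _       | inj₁ (p , _) = inj₁ (inj₂ p)
    ... | inj₂ (_ , a) | inj₂ (_ , b) = inj₂ (cong₂ _+_ a b)
  ...   | tri x<z z<w , rest , pull₂ , inj₁ refl =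
          record { flip = flip₁ (quad x<y y<z z<w) ; pull₁ = pull₁ ; pull₂ = subst (λ r → Pull mid (tri r z<w) rest) (ℕP.<-irrelevant _ _) pull₂ }
  ...   | tri w<x x<z , rest , pull₂ , inj₂ refl =
          record { flip = flip₂ (quad w<x x<y y<z) ; pull₁ = pull₁ ; pull₂ = subst (λ r → Pull mid (tri w<x r) rest) (ℕP.<-irrelevant _ _) pull₂ }

  module Step (s : Seed n) (I : Inv s) (k : Fin n) where
    open Inv I

    open FlipOf (find-flip (D k) Ts (in1 k) (out1 k))

    e : Edge
    e = D k

    ok₁ : Edges (Ok D) t₁
    ok₁ = proj₁ (All-pull pull₁ ok)
    ok₂ : Edges (Ok D) t₂
    ok₂ = proj₁ (All-pull pull₂ (proj₂ (All-pull pull₁ ok)))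
    ok-rest : All (Edges (Ok D)) rest
    ok-rest = proj₂ (All-pull pull₂ (proj₂ (All-pull pull₁ ok)))

    ok-sides : Ok D p₁ × Ok D p₂ × Ok D m₁ × Ok D m₂
    ok-sides = flip-edges {P = Ok D} flip ok₁ ok₂

    Ok-≤ : ∀ {f} → Ok D f → proj₂ f ≤ N
    Ok-≤ (inj₁ b)          = Bd-≤ b
    Ok-≤ (inj₂ (i , refl)) = D-≤ i

    inside : ¬ Bd N e′ × proj₁ e′ < proj₂ e′ × proj₂ e′ ≤ N
    inside = flip-inside flip (Ok-≤ (proj₁ ok-sides)) (Ok-≤ (proj₁ (proj₂ ok-sides)))

    split : ∀ g → total g Ts ≡ (g t₁ + g t₂) + total g rest
    split g = trans (total-pull pull₁ g) (trans (cong (_+_ (g t₁)) (total-pull pull₂ g)) (sym (ℤP.+-assoc (g t₁) (g t₂) _)))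

    T′ : List Tri
    T′ = t₁′ ∷ t₂′ ∷ rest

    split′ : ∀ g → total g T′ ≡ (g t₁′ + g t₂′) + total g rest
    split′ g = sym (ℤP.+-assoc (g t₁′) (g t₂′) _)

    remainder : ∀ {a b} → a ≡ + 1 → a + b ≡ + 1 → b ≡ + 0
    remainder {a} {b} refl h = +-cancelˡ (+ 1) b (+ 0) h

    rest-avoids : All (Avoids e) rest
    rest-avoids = avoids e rest (remainder (proj₁ (flip-e flip)) (trans (sym (split (inner e))) (in1 k)))
      (remainder (proj₂ (flip-e flip)) (trans (sym (split (outer e))) (out1 k)))

    -- The new diagonal crosses the old one, which no diagonal of the triangulation does.
    e′≢D : ∀ i → D i ≢ e′
    e′≢D i p with i Fin.≟ k
    ... | yes refl = proj₂ (proj₂ (flip-distinct flip)) p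
    ... | no ne with flip-cross flip
    ...   | inj₁ c = nc k i (subst (Cross e) (sym p) c)
    ...   | inj₂ c = nc i k (subst (λ f → Cross f e) (sym p) c)

    not-ok : ∀ {f} → Ok D f → e′ ≢ f
    not-ok (inj₁ b)       q = proj₁ inside (subst (Bd N) (sym q) b)
    not-ok (inj₂ (i , p)) q = e′≢D i (trans p (sym q))

    rest-avoids′ : All (Avoids e′) rest
    rest-avoids′ = All.map (λ { (a , b , c) → not-ok c , not-ok a , not-ok b }) ok-rest

    D′ : Fin n → Edge
    D′ j = if does (j Fin.≟ k) then e′ else D j

    D′-k : D′ k ≡ e′
    D′-k rewrite dec-true (k Fin.≟ k) refl = refl

    D′-≢ : ∀ {j} → j ≢ k → D′ j ≡ D j
    D′-≢ {j} ne rewrite dec-false (j Fin.≟ k) ne = refl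

    D≢e : ∀ {j} → j ≢ k → D j ≢ e
    D≢e ne p = ne (D-inj _ _ p)

    by-D′ : (P : Fin n → Edge → Set) → P k e′ → (∀ j → j ≢ k → P j (D j)) → ∀ j → P j (D′ j)
    by-D′ P pk pj j with j Fin.≟ k
    ... | yes refl = pk
    ... | no ne    = pj j ne

    ok-clear : ∀ {f} j → Ok D f → Clear f (D j)
    ok-clear j (inj₁ b)          = Bd-clear b (D-≤ j)
    ok-clear j (inj₂ (i , refl)) = nc i j , nc j i

    e′-clear : ∀ j → j ≢ k → Clear e′ (D j)
    e′-clear j ne = let a , b , c , d = ok-sides in
      flip-clear flip (D j) (ok-clear j a) (ok-clear j b) (ok-clear j c) (ok-clear j d) (D≢e ne)

    irreflexive : ∀ f → ¬ Cross f f
    irreflexive f (p , _) = ℕP.<-irrefl refl p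

    Ok′ : ∀ {f} → f ≢ e → Ok D f → Ok D′ f
    Ok′ ne (inj₁ b) = inj₁ b
    Ok′ ne (inj₂ (i , refl)) with i Fin.≟ k
    ... | yes refl = contradiction refl ne
    ... | no i≢k   = inj₂ (i , D′-≢ i≢k)

    ok′ : All (Edges (Ok D′)) T′
    ok′ = let (_ , (a≢ , b≢ , c≢ , d≢) , _) = flip-distinct flip ; a , b , c , d = ok-sides
              x , y = flip-edges′ {P = Ok D′} flip (inj₂ (k , D′-k)) (Ok′ (a≢ ∘ sym) a) (Ok′ (b≢ ∘ sym) b) (Ok′ (c≢ ∘ sym) c) (Ok′ (d≢ ∘ sym) d)
          in x ∷ y ∷ All.zipWith (λ { ((a , b , c) , (p , q , r)) → Ok′ (q ∘ sym) a , Ok′ (r ∘ sym) b , Ok′ (p ∘ sym) c }) (ok-rest , rest-avoids)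

    old-row : ∀ v → total (sh v e) Ts ≡ (v p₁ + v p₂) - (v m₁ + v m₂)
    old-row v = trans (split (sh v e)) (trans (cong₂ _+_ (flip-old flip v) (avoid-sh v e rest rest-avoids)) (ℤP.+-identityʳ _))

    new-row : ∀ v → total (sh v e′) T′ ≡ (v m₁ + v m₂) - (v p₁ + v p₂)
    new-row v = trans (split′ (sh v e′)) (trans (cong₂ _+_ (flip-new flip v) (avoid-sh v e′ rest rest-avoids′)) (ℤP.+-identityʳ _))

    opposite : ∀ p m → m - p ≡ - (p - m)
    opposite = solve-∀

    new-old : ∀ v → total (sh v e′) T′ ≡ - total (sh v e) Ts
    new-old v = trans (new-row v) (trans (opposite (v p₁ + v p₂) (v m₁ + v m₂)) (cong -_ (sym (old-row v))))

    B-row : ∀ j → Seed.B s k j ≡ - ((δ (D j) p₁ + δ (D j) p₂) - (δ (D j) m₁ + δ (D j) m₂))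
    B-row j = trans (B-eq k j) (trans (total-anti (D k) (D j) Ts) (cong -_ (old-row (δ (D j)))))

    -- The relation is assumed at this quadrilateral only: rows of `C` come from functions that are
    -- tropical everywhere, but rows of `B` from indicators of single edges.
    exchanged : ∀ v → v e + v e′ ≡ (v p₁ + v p₂) ⊓ (v m₁ + v m₂) → ∀ j → j ≢ k →
      total (sh v (D j)) T′ ≡ total (sh v (D j)) Ts + sgn (total (sh v e) Ts) * pos (total (sh v e) Ts * Seed.B s k j)
    exchanged v h j ne = trans (split′ (sh v (D j))) (trans (cong (_+ total (sh v (D j)) rest) (flip-diff flip v (D j) (D≢e ne) (e′≢D j)))
      (trans (lem (sh v (D j) t₁ + sh v (D j) t₂) _ (total (sh v (D j)) rest))
      (cong₂ _+_ (sym (split (sh v (D j)))) (trans (exchange-row _ _ _ h (flip-sides flip (D j)))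
        (cong₂ (λ x b → sgn x * pos (x * b)) (sym (old-row v)) (sym (B-row j)))))))
      where
      lem : ∀ a b c → (a + b) + c ≡ (a + c) + b
      lem = solve-∀

    s′ : Seed n
    s′ = mutate k s

    B-eq′ : ∀ i j → Seed.B s′ i j ≡ total (sh (δ (D′ i)) (D′ j)) T′
    B-eq′ i j with i Fin.≟ k | j Fin.≟ k
    ... | no p | no q = sym (trans (exchanged (δ (D i)) local j q)
          (cong₃ (λ x y z → x + sgn y * pos (z * Seed.B s k j)) (sym (B-eq i j)) (sym (B-eq i k)) (sym (B-eq i k))))
      where
      -- `D i` is neither diagonal and lies in at most one of the two pairs of opposite sides, so
      -- both sides are 0.
      local : δ (D i) e + δ (D i) e′ ≡ (δ (D i) p₁ + δ (D i) p₂) ⊓ (δ (D i) m₁ + δ (D i) m₂)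
      local = trans (cong₂ _+_ (δ-no (D≢e p)) (δ-no (e′≢D i))) (sym (sides-min (flip-sides flip (D i))))
    ... | no p | yes refl = trans (cong -_ (B-eq i k)) (sym (new-old (δ (D i))))
    -- Antisymmetry reduces row k to column k.
    ... | yes refl | no q = trans (cong -_ (trans (B-eq k j) (total-anti e (D j) Ts)))
          (trans (cong -_ (sym (new-old (δ (D j))))) (sym (total-anti e′ (D j) T′)))
    ... | yes refl | yes refl = trans (cong -_ (trans (B-eq k k) (trans (old-row (δ e)) (null e₁ e₂ e₃ e₄))))
          (sym (trans (new-row (δ e′)) (null e₃′ e₄′ e₁′ e₂′)))
      where
      null : ∀ {a b c d} → a ≡ + 0 → b ≡ + 0 → c ≡ + 0 → d ≡ + 0 → (a + b) - (c + d) ≡ + 0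
      null refl refl refl refl = refl
      e₁ : δ e p₁ ≡ + 0
      e₁ = δ-no (proj₁ (proj₁ (proj₂ (flip-distinct flip))))
      e₂ : δ e p₂ ≡ + 0
      e₂ = δ-no (proj₁ (proj₂ (proj₁ (proj₂ (flip-distinct flip)))))
      e₃ : δ e m₁ ≡ + 0
      e₃ = δ-no (proj₁ (proj₂ (proj₂ (proj₁ (proj₂ (flip-distinct flip))))))
      e₄ : δ e m₂ ≡ + 0
      e₄ = δ-no (proj₂ (proj₂ (proj₂ (proj₁ (proj₂ (flip-distinct flip))))))
      e₁′ : δ e′ p₁ ≡ + 0
      e₁′ = δ-no (proj₁ (proj₁ (flip-distinct flip)))
      e₂′ : δ e′ p₂ ≡ + 0
      e₂′ = δ-no (proj₁ (proj₂ (proj₁ (flip-distinct flip))))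
      e₃′ : δ e′ m₁ ≡ + 0
      e₃′ = δ-no (proj₁ (proj₂ (proj₂ (proj₁ (flip-distinct flip)))))
      e₄′ : δ e′ m₂ ≡ + 0
      e₄′ = δ-no (proj₂ (proj₂ (proj₂ (proj₁ (flip-distinct flip)))))

    C-eq′ : ∀ i j → Seed.C s′ i j ≡ total (sh (u i) (D′ j)) T′
    C-eq′ i j with j Fin.≟ k
    ... | no q = sym (trans (exchanged (u i) (flip-tropical {u i} (u-trop i) flip) j q)
          (cong₃ (λ x y z → x + sgn y * pos (z * Seed.B s k j)) (sym (C-eq i j)) (sym (C-eq i k)) (sym (C-eq i k))))
    ... | yes refl = trans (cong -_ (C-eq i k)) (sym (new-old (u i)))

    module _ (w : W) where
      open Valuation (val w)

      side : Edge → Fin n → ℤ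
      side p i = pow (X w (D i)) (posℕ (δ (D i) p))

      -- Boundary edges have the neutral value, so a side contributes its value whether or not it is
      -- a cluster variable.
      prod-side : ∀ p → Ok D p → prod (side p) ≡ X w p
      prod-side p (inj₁ b) = trans (prod-ε (side p) each) (sym (X-bd w p b))
        where
        each : ∀ i → side p i ≡ ε
        each i with δ-cases (D i) p
        ... | inj₁ (h , z) rewrite z = trans (·-idʳ _) (trans (cong (X w) h) (X-bd w p b))
        ... | inj₂ (_ , z) rewrite z = refl
      prod-side p (inj₂ (l , refl)) = trans (prod-single (side p) l (λ i ne → cong (λ z → pow (X w (D i)) (posℕ z)) (δ-no (λ q → ne (D-inj i l q)))))
        (trans (cong (λ z → pow (X w (D l)) (posℕ z)) (δ-yes refl)) (·-idʳ _))

      power⁺ : ∀ i → pow (X w (D i)) (posℕ (Seed.B s i k)) ≡ side p₁ i · side p₂ i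
      power⁺ i rewrite B-eq i k | old-row (δ (D i)) with flip-sides flip (D i)
      ... | on-p₁ _ a b c d rewrite a | b | c | d = sym (·-idʳ _)
      ... | on-p₂ _ a b c d rewrite a | b | c | d = sym (·-idˡ _)
      ... | on-m₁ _ a b c d rewrite a | b | c | d = sym (·-idˡ _)
      ... | on-m₂ _ a b c d rewrite a | b | c | d = sym (·-idˡ _)
      ... | off a b c d     rewrite a | b | c | d = sym (·-idˡ _)

      power⁻ : ∀ i → pow (X w (D i)) (posℕ (- Seed.B s i k)) ≡ side m₁ i · side m₂ i
      power⁻ i rewrite B-eq i k | old-row (δ (D i)) with flip-sides flip (D i)
      ... | on-p₁ _ a b c d rewrite a | b | c | d = sym (·-idˡ _)
      ... | on-p₂ _ a b c d rewrite a | b | c | d = sym (·-idˡ _)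
      ... | on-m₁ _ a b c d rewrite a | b | c | d = sym (·-idʳ _)
      ... | on-m₂ _ a b c d rewrite a | b | c | d = sym (·-idˡ _)
      ... | off a b c d     rewrite a | b | c | d = sym (·-idˡ _)

      new-value : V (Seed.cluster s′ k) (X w e′)
      new-value rewrite dec-true (k Fin.≟ k) refl =
        V-div (V-add (V-mul (V-prod _ _ (λ i → V-pow (values w i) _)) (V-y _)) (V-mul (V-prod _ _ (λ i → V-pow (values w i) _)) (V-y _)))
          (values w k) (X w e′)
          (trans (·-comm _ _) (trans (exch-flip w flip (Ok-≤ (proj₁ ok-sides)) (Ok-≤ (proj₁ (proj₂ ok-sides))))
            (sym (cong₂ _⊕_
              (cong₂ _·_ (trans (prod-cong power⁺) (trans (prod-· (side p₁) (side p₂)) (cong₂ _·_ (prod-side p₁ (proj₁ ok-sides)) (prod-side p₂ (proj₁ (proj₂ ok-sides))))))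
                (cong Y (VecP.tabulate-cong (λ i → cong posℕ (trans (C-eq i k) (old-row (u i)))))))
              (cong₂ _·_ (trans (prod-cong power⁻) (trans (prod-· (side m₁) (side m₂)) (cong₂ _·_ (prod-side m₁ (proj₁ (proj₂ (proj₂ ok-sides)))) (prod-side m₂ (proj₂ (proj₂ (proj₂ ok-sides)))))))
                (cong Y (VecP.tabulate-cong (λ i → cong (posℕ ∘ -_) (trans (C-eq i k) (old-row (u i)))))))))))

      other-value : ∀ j → j ≢ k → V (Seed.cluster s′ j) (X w (D j))
      other-value j ne rewrite dec-false (j Fin.≟ k) ne = values w j

    mutate-Inv : Inv s′
    mutate-Inv = record
      { D = D′ ; Ts = T′
      ; D-< = by-D′ (λ _ f → proj₁ f < proj₂ f) (proj₁ (proj₂ inside)) (λ j _ → D-< j)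
      ; D-≤ = by-D′ (λ _ f → proj₂ f ≤ N) (proj₂ (proj₂ inside)) (λ j _ → D-≤ j)
      ; D-inj = inj
      ; nc = λ i j → by-D′ (λ i f → ¬ Cross f (D′ j))
          (by-D′ (λ j f → ¬ Cross e′ f) (irreflexive e′) (λ j q → proj₁ (e′-clear j q)) j)
          (λ i p → by-D′ (λ j f → ¬ Cross (D i) f) (proj₂ (e′-clear i p)) (λ j _ → nc i j) j) i
      ; in1 = by-D′ (λ _ f → total (inner f) T′ ≡ + 1)
          (trans (split′ (inner e′)) (trans (cong₂ _+_ (proj₁ (flip-e′ flip)) (avoid-inner e′ rest rest-avoids′)) refl))
          (λ j q → trans (split′ (inner (D j))) (trans (cong (_+ total (inner (D j)) rest) (flip-inner flip (D j) (D≢e q) (e′≢D j))) (trans (sym (split (inner (D j)))) (in1 j))))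
      ; out1 = by-D′ (λ _ f → total (outer f) T′ ≡ + 1)
          (trans (split′ (outer e′)) (trans (cong₂ _+_ (proj₂ (flip-e′ flip)) (avoid-outer e′ rest rest-avoids′)) refl))
          (λ j q → trans (split′ (outer (D j))) (trans (cong (_+ total (outer (D j)) rest) (flip-outer flip (D j) (D≢e q) (e′≢D j))) (trans (sym (split (outer (D j)))) (out1 j))))
      ; ok = ok′
      ; B-eq = B-eq′
      ; C-eq = C-eq′
      ; values = λ w → by-D′ (λ j f → Valuation.V (val w) (Seed.cluster s′ j) (X w f)) (new-value w) (other-value w)
      }
      where
      inj : ∀ i j → D′ i ≡ D′ j → i ≡ j
      inj i j with i Fin.≟ k | j Fin.≟ k
      ... | yes refl | yes refl = λ _ → refl
      ... | yes refl | no _     = λ h → contradiction (sym h) (e′≢D j)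
      ... | no _     | yes refl = λ h → contradiction h (e′≢D i)
      ... | no _     | no _     = D-inj i j

  mutations : (c : Vec (Fin n) n) → Inv (initialSeed c) → ∀ ks → Inv (mutSeq c ks)
  mutations c I []       = I
  mutations c I (k ∷ ks) = Step.mutate-Inv (mutSeq c ks) (mutations c I ks) k

-- The initial triangulation: nested chords d 0, d 1, …, d (n + 1) from (0 , n + 2) to a boundary edge; d i bounds
-- the triangles i - 1 and i, and ε i tells on which side d i shrinks to d (i + 1).

module Path (n : ℕ) (ε : ℕ → Bool) where

  N : ℕ
  N = suc (suc n)

  -- The endpoints of d i are at distance N - i: each step moves one of them inwards by one.
  p gap r : ℕ → ℕ
  p zero    = 0
  p (suc i) = if ε i then suc (p i) else p i
  gap i = N ℕ.∸ i
  r i = p i ℕ.+ gap i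

  d : ℕ → Edge
  d i = p i , r i

  gap-suc : ∀ {i} → i ≤ suc n → gap i ≡ suc (gap (suc i))
  gap-suc h = ℕP.+-∸-assoc 1 h

  p-true : ∀ {i} → ε i ≡ true → p (suc i) ≡ suc (p i)
  p-true e rewrite e = refl

  p-false : ∀ {i} → ε i ≡ false → p (suc i) ≡ p i
  p-false e rewrite e = refl

  r-true : ∀ {i} → ε i ≡ true → i ≤ suc n → r (suc i) ≡ r i
  r-true {i} e h rewrite e | gap-suc h = sym (ℕP.+-suc (p i) (gap (suc i)))

  r-false : ∀ {i} → ε i ≡ false → i ≤ suc n → r i ≡ suc (r (suc i))
  r-false {i} e h rewrite e | gap-suc h = ℕP.+-suc (p i) (gap (suc i))

  bool-cases : ∀ i → ε i ≡ true ⊎ ε i ≡ false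
  bool-cases i with ε i
  ... | true  = inj₁ refl
  ... | false = inj₂ refl

  p-step : ∀ i → p i ≤ p (suc i)
  p-step i with ε i
  ... | true  = ℕP.n≤1+n _
  ... | false = ℕP.≤-refl

  r-step : ∀ i → i ≤ suc n → r (suc i) ≤ r i
  r-step i h with bool-cases i
  ... | inj₁ e = ℕP.≤-reflexive (r-true e h)
  ... | inj₂ e = subst (r (suc i) ≤_) (sym (r-false e h)) (ℕP.n≤1+n _)

  p-mono+ : ∀ k i → p i ≤ p (k ℕ.+ i)
  p-mono+ zero    i = ℕP.≤-refl
  p-mono+ (suc k) i = ℕP.≤-trans (p-mono+ k i) (p-step (k ℕ.+ i))

  p-mono : ∀ {i j} → i ≤ j → p i ≤ p j
  p-mono {i} {j} h = subst (λ z → p i ≤ p z) (ℕP.m∸n+n≡m h) (p-mono+ (j ℕ.∸ i) i)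

  r-anti+ : ∀ k i → k ℕ.+ i ≤ N → r (k ℕ.+ i) ≤ r i
  r-anti+ zero    i h = ℕP.≤-refl
  r-anti+ (suc k) i h = ℕP.≤-trans (r-step (k ℕ.+ i) (ℕP.≤-pred h)) (r-anti+ k i (ℕP.<⇒≤ h))

  r-anti : ∀ {i j} → i ≤ j → j ≤ N → r j ≤ r i
  r-anti {i} {j} h k = subst (λ z → r z ≤ r i) (ℕP.m∸n+n≡m h) (r-anti+ (j ℕ.∸ i) i (subst (_≤ N) (sym (ℕP.m∸n+n≡m h)) k))

  p<r : ∀ {i} → i ≤ suc n → p i < r i
  p<r {i} h rewrite gap-suc h = ℕP.m<m+n (p i) ℕ.z<s

  p+1<r : ∀ {i} → i ≤ n → suc (p i) < r i
  p+1<r {i} h rewrite gap-suc (ℕP.m≤n⇒m≤1+n h) | gap-suc (s≤s h) =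
    subst (suc (suc (p i)) ≤_) (sym (trans (ℕP.+-suc (p i) _) (cong suc (ℕP.+-suc (p i) _)))) (s≤s (s≤s (ℕP.m≤m+n (p i) _)))

  r-last : r (suc n) ≡ suc (p (suc n))
  r-last = trans (cong (p (suc n) ℕ.+_) (trans (ℕP.+-∸-assoc 1 (ℕP.≤-refl {suc n})) (cong suc (ℕP.n∸n≡0 (suc n))))) (ℕP.+-comm (p (suc n)) 1)

  r≤N : ∀ {i} → i ≤ N → r i ≤ N
  r≤N h = r-anti z≤n h

  d-injective : ∀ {i j} → i ≤ N → j ≤ N → d i ≡ d j → i ≡ j
  d-injective {i} {j} hi hj e = ℕP.∸-cancelˡ-≡ hi hj (ℕP.+-cancelˡ-≡ (p i) _ _ (trans (cong proj₂ e) (cong (ℕ._+ gap j) (sym (cong proj₁ e)))))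

  d≢boundary : ∀ {i a} → i ≤ n → d i ≢ (a , suc a)
  d≢boundary h e = ℕP.<-irrefl (trans (cong suc (cong proj₁ e)) (sym (cong proj₂ e))) (p+1<r h)

  -- The third vertex of triangle i, which is the new endpoint of d (i + 1).
  mid : ℕ → ℕ
  mid i = if ε i then suc (p i) else r (suc i)

  mid-true : ∀ {i} → ε i ≡ true → mid i ≡ p (suc i)
  mid-true e rewrite e = refl

  mid-false : ∀ {i} → ε i ≡ false → mid i ≡ r (suc i)
  mid-false e rewrite e = refl

  p<mid : ∀ {i} → i ≤ n → p i < mid i
  p<mid {i} h with bool-cases i
  ... | inj₁ e rewrite mid-true e | p-true e = ℕP.≤-refl
  ... | inj₂ e rewrite mid-false e = subst (_< r (suc i)) (p-false e) (p<r (s≤s h))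

  mid<r : ∀ {i} → i ≤ n → mid i < r i
  mid<r {i} h with bool-cases i
  ... | inj₁ e rewrite mid-true e | p-true e = p+1<r h
  ... | inj₂ e rewrite mid-false e = ℕP.≤-reflexive (sym (r-false e (ℕP.m≤n⇒m≤1+n h)))

  triangle : ∀ i → i ≤ n → Tri
  triangle i h = tri (p<mid h) (mid<r h)

  -- The side of triangle i other than d i and d (i + 1).
  bnd : ℕ → Edge
  bnd i = if ε i then (p i , suc (p i)) else (r (suc i) , suc (r (suc i)))

  record Shape (i : ℕ) (t : Tri) : Set where
    field
      is-xz    : xz t ≡ d i
      is-true  : ε i ≡ true → xy t ≡ bnd i × yz t ≡ d (suc i)
      is-false : ε i ≡ false → xy t ≡ d (suc i) × yz t ≡ bnd i

  shape : ∀ i (h : i ≤ n) → Shape i (triangle i h)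
  shape i h = record { is-xz = refl ; is-true = when-true ; is-false = when-false }
    where
    when-true : ε i ≡ true → (p i , mid i) ≡ bnd i × (mid i , r i) ≡ d (suc i)
    when-true e = tx , cong₂ _,_ (mid-true e) (sym (r-true e (ℕP.m≤n⇒m≤1+n h)))
      where
      tx : (p i , mid i) ≡ bnd i
      tx rewrite e = refl
    when-false : ε i ≡ false → (p i , mid i) ≡ d (suc i) × (mid i , r i) ≡ bnd i
    when-false e = cong₂ _,_ (sym (p-false e)) (mid-false e) , fx
      where
      fx : (mid i , r i) ≡ bnd i
      fx = trans (cong₂ _,_ (mid-false e) (r-false e (ℕP.m≤n⇒m≤1+n h))) (sym be)
        where
        be : bnd i ≡ (r (suc i) , suc (r (suc i)))
        be rewrite e = refl

  d≢bnd : ∀ {l} i → l ≤ n → d l ≢ bnd i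
  d≢bnd i h with ε i
  ... | true  = d≢boundary h
  ... | false = d≢boundary h

  triangles : ∀ k → k ≤ suc n → List Tri
  triangles zero    h = []
  triangles (suc k) h = triangle k (ℕP.≤-pred h) ∷ triangles k (ℕP.<⇒≤ h)

  T₀ : List Tri
  T₀ = triangles (suc n) ℕP.≤-refl

  total-none : ∀ g l k (h : k ≤ suc n) → (∀ i hi → i ≢ l → i ≢ suc l → g (triangle i hi) ≡ + 0) → k ≤ l → total g (triangles k h) ≡ + 0
  total-none g l zero    h z k≤l = refl
  total-none g l (suc k) h z k<l = cong₂ _+_ (z k _ (ℕP.<⇒≢ k<l) (ℕP.<⇒≢ (ℕP.m≤n⇒m≤1+n k<l))) (total-none g l k _ z (ℕP.<⇒≤ k<l))

  -- Meant for sums at d (l + 1), which is a side of the triangles l and l + 1 only.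
  total-two : ∀ g l (h : suc l ≤ n) → (∀ i hi → i ≢ l → i ≢ suc l → g (triangle i hi) ≡ + 0) →
    total g T₀ ≡ g (triangle (suc l) h) + g (triangle l (ℕP.<⇒≤ h))
  total-two g l h z = go (suc n) ℕP.≤-refl (s≤s h)
    where
    at : ∀ i (a b : i ≤ n) → g (triangle i a) ≡ g (triangle i b)
    at i a b = cong (λ q → g (triangle i q)) (ℕP.≤-irrelevant a b)
    go : ∀ k (hk : k ≤ suc n) → suc (suc l) ≤ k → total g (triangles k hk) ≡ g (triangle (suc l) h) + g (triangle l (ℕP.<⇒≤ h))
    go (suc k) hk l<k with ℕP.m≤n⇒m<n∨m≡n l<k
    ... | inj₁ q = trans (cong₂ _+_ (z k _ (λ e → ℕP.<⇒≢ (ℕP.<-trans (ℕP.n<1+n l) (ℕP.≤-pred q)) (sym e)) (λ e → ℕP.<⇒≢ (ℕP.≤-pred q) (sym e))) (go k _ (ℕP.≤-pred q))) (ℤP.+-identityˡ _)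
    ... | inj₂ refl = cong₂ _+_ (at (suc l) _ _) (trans (cong₂ _+_ (at l _ _) (total-none g l l _ z ℕP.≤-refl)) (ℤP.+-identityʳ _))

  δ-d : ∀ {l i} → l ≤ N → i ≤ N → l ≢ i → δ (d l) (d i) ≡ + 0
  δ-d a b ne = δ-no (λ e → ne (d-injective a b e))

  weaken : ∀ {i} → i ≤ n → i ≤ N
  weaken h = ℕP.m≤n⇒m≤1+n (ℕP.m≤n⇒m≤1+n h)

  δ-xy : ∀ {l} i (hi : i ≤ n) → l ≤ n → l ≢ suc i → δ (d l) (xy (triangle i hi)) ≡ + 0
  δ-xy i hi hl ne with bool-cases i
  ... | inj₁ e = trans (cong (δ _) (proj₁ (Shape.is-true (shape i hi) e))) (δ-no (d≢bnd i hl))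
  ... | inj₂ e = trans (cong (δ _) (proj₁ (Shape.is-false (shape i hi) e))) (δ-d (weaken hl) (s≤s (ℕP.m≤n⇒m≤1+n hi)) ne)

  δ-yz : ∀ {l} i (hi : i ≤ n) → l ≤ n → l ≢ suc i → δ (d l) (yz (triangle i hi)) ≡ + 0
  δ-yz i hi hl ne with bool-cases i
  ... | inj₁ e = trans (cong (δ _) (proj₂ (Shape.is-true (shape i hi) e))) (δ-d (weaken hl) (s≤s (ℕP.m≤n⇒m≤1+n hi)) ne)
  ... | inj₂ e = trans (cong (δ _) (proj₂ (Shape.is-false (shape i hi) e))) (δ-no (d≢bnd i hl))

  δ-outer : ∀ l (h : l ≤ n) → suc l ≤ n → outer (d (suc l)) (triangle l h) ≡ + 1
  δ-outer l h hl with bool-cases l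
  ... | inj₁ e = cong₂ _+_ (trans (cong (δ _) (proj₁ (Shape.is-true (shape l h) e))) (δ-no (d≢bnd l hl))) (trans (cong (δ _) (proj₂ (Shape.is-true (shape l h) e))) (δ-yes refl))
  ... | inj₂ e = cong₂ _+_ (trans (cong (δ _) (proj₁ (Shape.is-false (shape l h) e))) (δ-yes refl)) (trans (cong (δ _) (proj₂ (Shape.is-false (shape l h) e))) (δ-no (d≢bnd l hl)))

  inner-one : ∀ l → suc l ≤ n → total (inner (d (suc l))) T₀ ≡ + 1
  inner-one l h = trans (total-two (inner (d (suc l))) l h (λ i hi a b → δ-d (weaken h) (weaken hi) (b ∘ sym)))
    (cong₂ _+_ (δ-yes refl) (δ-d (weaken h) (weaken (ℕP.<⇒≤ h)) (λ e → ℕP.1+n≢n e)))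

  outer-one : ∀ l → suc l ≤ n → total (outer (d (suc l))) T₀ ≡ + 1
  outer-one l h = trans (total-two (outer (d (suc l))) l h (λ i hi a b → cong₂ _+_ (δ-xy i hi h (a ∘ sym ∘ ℕP.suc-injective)) (δ-yz i hi h (a ∘ sym ∘ ℕP.suc-injective))))
    (cong₂ _+_ (cong₂ _+_ (δ-xy (suc l) h h n≢1+n) (δ-yz (suc l) h h n≢1+n)) (δ-outer l (ℕP.<⇒≤ h) h))

  sh-upper : ∀ v l (h : suc l ≤ n) → sh v (d (suc l)) (triangle (suc l) h) ≡ v (xy (triangle (suc l) h)) - v (yz (triangle (suc l) h))
  sh-upper v l h = trans (cong₃ (λ a b c → a * (v (xy t) - v (yz t)) + b * (v (yz t) - v (xz t)) + c * (v (xz t) - v (xy t)))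
      (δ-yes refl) (δ-xy (suc l) h h n≢1+n) (δ-yz (suc l) h h n≢1+n)) (lem (v (xy t)) (v (yz t)) (v (xz t)))
    where
    t : Tri
    t = triangle (suc l) h
    lem : ∀ a b c → + 1 * (a - b) + + 0 * (b - c) + + 0 * (c - a) ≡ a - b
    lem = solve-∀

  sh-lower-true : ∀ v l (h : l ≤ n) → suc l ≤ n → ε l ≡ true → sh v (d (suc l)) (triangle l h) ≡ v (d l) - v (bnd l)
  sh-lower-true v l h hl e = trans (cong₃ (λ a b c → a * (v (xy t) - v (yz t)) + b * (v (yz t) - v (xz t)) + c * (v (xz t) - v (xy t)))
      (δ-d (weaken hl) (weaken h) ℕP.1+n≢n)
      (trans (cong (δ _) (proj₁ (Shape.is-true (shape l h) e))) (δ-no (d≢bnd l hl)))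
      (trans (cong (δ _) (proj₂ (Shape.is-true (shape l h) e))) (δ-yes refl)))
      (trans (lem (v (xy t)) (v (yz t)) (v (xz t))) (cong (λ z → v (d l) - v z) (proj₁ (Shape.is-true (shape l h) e))))
    where
    t : Tri
    t = triangle l h
    lem : ∀ a b c → + 0 * (a - b) + + 0 * (b - c) + + 1 * (c - a) ≡ c - a
    lem = solve-∀

  sh-lower-false : ∀ v l (h : l ≤ n) → suc l ≤ n → ε l ≡ false → sh v (d (suc l)) (triangle l h) ≡ v (bnd l) - v (d l)
  sh-lower-false v l h hl e = trans (cong₃ (λ a b c → a * (v (xy t) - v (yz t)) + b * (v (yz t) - v (xz t)) + c * (v (xz t) - v (xy t)))
      (δ-d (weaken hl) (weaken h) ℕP.1+n≢n)
      (trans (cong (δ _) (proj₁ (Shape.is-false (shape l h) e))) (δ-yes refl))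
      (trans (cong (δ _) (proj₂ (Shape.is-false (shape l h) e))) (δ-no (d≢bnd l hl))))
      (trans (lem (v (xy t)) (v (yz t)) (v (xz t))) (cong (λ z → v z - v (d l)) (proj₂ (Shape.is-false (shape l h) e))))
    where
    t : Tri
    t = triangle l h
    lem : ∀ a b c → + 0 * (a - b) + + 1 * (b - c) + + 0 * (c - a) ≡ b - c
    lem = solve-∀

  signed : Bool → ℤ → ℤ
  signed true  z = z
  signed false z = - z

  row : ∀ v l (h : suc l ≤ n) → total (sh v (d (suc l))) T₀ ≡
    signed (ε (suc l)) (v (bnd (suc l)) - v (d (suc (suc l)))) + signed (ε l) (v (d l) - v (bnd l))
  row v l h = trans (total-two (sh v (d (suc l))) l h far-away) (cong₂ _+_ upper lower′)
    where
    far-away : ∀ i hi → i ≢ l → i ≢ suc l → sh v (d (suc l)) (triangle i hi) ≡ + 0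
    far-away i hi a b = trans (cong₃ (λ x y z → x * (v (xy t) - v (yz t)) + y * (v (yz t) - v (xz t)) + z * (v (xz t) - v (xy t)))
      (δ-d (weaken h) (weaken hi) (b ∘ sym)) (δ-xy i hi h (a ∘ sym ∘ ℕP.suc-injective)) (δ-yz i hi h (a ∘ sym ∘ ℕP.suc-injective)))
      (lem (v (xy t) - v (yz t)) (v (yz t) - v (xz t)) (v (xz t) - v (xy t)))
      where
      t : Tri
      t = triangle i hi
      lem : ∀ a b c → + 0 * a + + 0 * b + + 0 * c ≡ + 0
      lem = solve-∀
    opposite : ∀ a b → a - b ≡ - (b - a)
    opposite = solve-∀
    upper : sh v (d (suc l)) (triangle (suc l) h) ≡ signed (ε (suc l)) (v (bnd (suc l)) - v (d (suc (suc l))))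
    upper with bool-cases (suc l)
    ... | inj₁ e = trans (sh-upper v l h) (trans (cong₂ (λ a b → v a - v b) (proj₁ (Shape.is-true (shape (suc l) h) e)) (proj₂ (Shape.is-true (shape (suc l) h) e)))
          (cong (λ z → signed z (v (bnd (suc l)) - v (d (suc (suc l))))) (sym e)))
    ... | inj₂ e = trans (sh-upper v l h) (trans (cong₂ (λ a b → v a - v b) (proj₁ (Shape.is-false (shape (suc l) h) e)) (proj₂ (Shape.is-false (shape (suc l) h) e)))
          (trans (opposite (v (d (suc (suc l)))) (v (bnd (suc l)))) (cong (λ z → signed z (v (bnd (suc l)) - v (d (suc (suc l))))) (sym e))))
    lower′ : sh v (d (suc l)) (triangle l (ℕP.<⇒≤ h)) ≡ signed (ε l) (v (d l) - v (bnd l))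
    lower′ with bool-cases l
    ... | inj₁ e = trans (sh-lower-true v l (ℕP.<⇒≤ h) h e) (cong (λ z → signed z (v (d l) - v (bnd l))) (sym e))
    ... | inj₂ e = trans (sh-lower-false v l (ℕP.<⇒≤ h) h e) (trans (opposite (v (bnd l)) (v (d l))) (cong (λ z → signed z (v (d l) - v (bnd l))) (sym e)))

  d-nc : ∀ {i j} → i ≤ N → j ≤ N → ¬ Cross (d i) (d j)
  d-nc {i} {j} hi hj (a , _ , b) with ℕP.≤-total i j
  ... | inj₁ q = ℕP.<⇒≱ b (r-anti q hj)
  ... | inj₂ q = ℕP.<⇒≱ a (p-mono q)

  d-first : Bd N (d 0)
  d-first = inj₂ (refl , refl)

  d-last : Bd N (d (suc n))
  d-last = inj₁ (sym r-last , r≤N (ℕP.n≤1+n (suc n)))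

  bnd-Bd : ∀ i → i ≤ n → Bd N (bnd i)
  bnd-Bd i h with bool-cases i
  ... | inj₁ e rewrite e = inj₁ (refl , ℕP.≤-trans (ℕP.<⇒≤ (p+1<r h)) (r≤N (weaken h)))
  ... | inj₂ e rewrite e = inj₁ (refl , subst (_≤ N) (trans (r-false e (ℕP.m≤n⇒m≤1+n h)) (cong (λ z → suc (z ℕ.+ gap (suc i))) (p-false e))) (r≤N (weaken h)))

  edges-ok : ∀ (P : Edge → Set) → (∀ i → i ≤ suc n → P (d i)) → (∀ e → Bd N e → P e) → ∀ k (h : k ≤ suc n) → All (Edges P) (triangles k h)
  edges-ok P pd pb zero    h = []
  edges-ok P pd pb (suc k) h = one ∷ edges-ok P pd pb k _
    where
    hk : k ≤ n
    hk = ℕP.≤-pred h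
    one : Edges P (triangle k hk)
    one with bool-cases k
    ... | inj₁ e = subst P (sym (proj₁ (Shape.is-true (shape k hk) e))) (pb _ (bnd-Bd k hk)) , subst P (sym (proj₂ (Shape.is-true (shape k hk) e))) (pd (suc k) h) , pd k (ℕP.<⇒≤ h)
    ... | inj₂ e = subst P (sym (proj₁ (Shape.is-false (shape k hk) e))) (pd (suc k) h) , subst P (sym (proj₂ (Shape.is-false (shape k hk) e))) (pb _ (bnd-Bd k hk)) , pd k (ℕP.<⇒≤ h)

  -- Every chord is some d i, or crosses exactly d (i + 1), …, d (i + m).
  data Class (a b : ℕ) : Set where
    diag  : ∀ i → i ≤ suc n → a ≡ p i → b ≡ r i → Class a b
    left  : ∀ i m → m ℕ.+ i ≤ n → ε i ≡ true → a ≡ p i → b ≡ mid (m ℕ.+ i) → Class a b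
    right : ∀ i m → m ℕ.+ i ≤ n → ε i ≡ false → a ≡ mid (m ℕ.+ i) → b ≡ r i → Class a b

  -- Every vertex strictly between the ends of d i is the new vertex of triangle i or of a later
  -- one; `fuel` counts the triangles left.
  seek : ∀ fuel i v → fuel ℕ.+ i ≡ suc n → p i < v → v < r i → ∃ λ m → m ℕ.+ i ≤ n × v ≡ mid (m ℕ.+ i)
  seek zero .(suc n) v refl a b = contradiction a (ℕP.<⇒≱ (subst (v <_) r-last b))
  seek (suc f) i v e a b with v ℕ.≟ mid i
  ... | yes q = 0 , i≤n , q
    where
    i≤n : i ≤ n
    i≤n = subst (i ≤_) (ℕP.suc-injective e) (ℕP.m≤n+m i f)
  ... | no ne = let m , h , q = seek f (suc i) v (trans (ℕP.+-suc f i) e) below above in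
      suc m , subst (_≤ n) (ℕP.+-suc m i) h , subst (λ z → v ≡ mid z) (ℕP.+-suc m i) q
    where
    i≤n : i ≤ n
    i≤n = subst (i ≤_) (ℕP.suc-injective e) (ℕP.m≤n+m i f)
    below : p (suc i) < v
    below with bool-cases i
    ... | inj₁ t = ℕP.≤∧≢⇒< (subst (_≤ v) (sym (p-true t)) a) (λ h → ne (trans (sym h) (sym (mid-true t))))
    ... | inj₂ t = subst (_< v) (sym (p-false t)) a
    above : v < r (suc i)
    above with bool-cases i
    ... | inj₁ t = subst (v <_) (sym (r-true t (ℕP.m≤n⇒m≤1+n i≤n))) b
    ... | inj₂ t = ℕP.≤∧≢⇒< (ℕP.≤-pred (subst (v <_) (r-false t (ℕP.m≤n⇒m≤1+n i≤n)) b)) (λ h → ne (trans h (sym (mid-false t))))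

  -- The nested chords are followed inwards as long as the next one still encloses the given chord.
  -- When it does not, the current one shares an endpoint with it, and `seek` locates the other
  -- endpoint.
  classify-from : ∀ fuel i a b → fuel ℕ.+ i ≡ suc n → p i ≤ a → a < b → b ≤ r i → Class a b
  classify-from zero .(suc n) a b refl pa ab br = diag (suc n) ℕP.≤-refl
    (ℕP.≤-antisym (ℕP.≤-pred (subst (a <_) r-last (ℕP.<-≤-trans ab br))) pa)
    (ℕP.≤-antisym br (subst (_≤ b) (sym r-last) (ℕP.≤-trans (s≤s pa) ab)))
  classify-from (suc f) i a b e pa ab br with a ℕ.≟ p i | b ℕ.≟ r i | bool-cases i
  ... | yes x | yes y | _ = diag i (ℕP.m≤n⇒m≤1+n (subst (i ≤_) (ℕP.suc-injective e) (ℕP.m≤n+m i f))) x y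
  ... | yes x | no y | inj₁ t = let m , h , q = seek (suc f) i b e (subst (_< b) x ab) (ℕP.≤∧≢⇒< br y) in left i m h t x q
  ... | yes x | no y | inj₂ t = classify-from f (suc i) a b (trans (ℕP.+-suc f i) e) (subst (_≤ a) (sym (p-false t)) pa) ab
        (ℕP.≤-pred (subst (b <_) (r-false t (ℕP.m≤n⇒m≤1+n (subst (i ≤_) (ℕP.suc-injective e) (ℕP.m≤n+m i f)))) (ℕP.≤∧≢⇒< br y)))
  ... | no x | _ | inj₁ t = classify-from f (suc i) a b (trans (ℕP.+-suc f i) e) (subst (_≤ a) (sym (p-true t)) (ℕP.≤∧≢⇒< pa (x ∘ sym))) ab
        (subst (b ≤_) (sym (r-true t (ℕP.m≤n⇒m≤1+n (subst (i ≤_) (ℕP.suc-injective e) (ℕP.m≤n+m i f))))) br)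
  ... | no x | yes y | inj₂ t = let m , h , q = seek (suc f) i a e (ℕP.≤∧≢⇒< pa (x ∘ sym)) (subst (a <_) y ab) in right i m h t q y
  ... | no x | no y | inj₂ t = classify-from f (suc i) a b (trans (ℕP.+-suc f i) e) (subst (_≤ a) (sym (p-false t)) pa) ab
        (ℕP.≤-pred (subst (b <_) (r-false t (ℕP.m≤n⇒m≤1+n (subst (i ≤_) (ℕP.suc-injective e) (ℕP.m≤n+m i f)))) (ℕP.≤∧≢⇒< br y)))

  classify : ∀ a b → a < b → b ≤ N → Class a b
  classify a b ab h = classify-from (suc n) 0 a b (ℕP.+-identityʳ (suc n)) z≤n ab h

  p≤p+ : ∀ {i m} → p i ≤ p (m ℕ.+ i)
  p≤p+ {i} {m} = p-mono+ m i

  r+≤r : ∀ {i m} → m ℕ.+ i ≤ n → r (m ℕ.+ i) ≤ r i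
  r+≤r {i} {m} h = r-anti+ m i (weaken h)

-- Functions on chords satisfying the tropical relation

both : Fin 3 → Fin 3 → ℕ
both (Fin.suc Fin.zero) (Fin.suc Fin.zero) = 1
both _ _ = 0

-- The functions see a vertex only through its position relative to one chord, so the relation is a
-- finite check.
both-tropical : ∀ x y z w → x Fin.≤ y → y Fin.≤ z → z Fin.≤ w →
  + both x z + + both y w ≡ (+ both x y + + both z w) ⊓ (+ both x w + + both y z)
both-tropical = toWitness {a? = FinP.all? λ x → FinP.all? λ y → FinP.all? λ z → FinP.all? λ w →
  (x Fin.≤? y) →-dec ((y Fin.≤? z) →-dec ((z Fin.≤? w) →-dec (_ ℤ.≟ _)))} tt

-- The positions before, at, between, at, and after the two endpoints of a chord; across is minus the crossing
-- number of the chord with the chord joining two positions (and + 1 on the chord itself).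
across : Fin 5 → Fin 5 → ℤ
across Fin.zero                      (Fin.suc (Fin.suc Fin.zero))                         = -[1+ 0 ]
across (Fin.suc Fin.zero)            (Fin.suc (Fin.suc (Fin.suc Fin.zero)))               = + 1
across (Fin.suc (Fin.suc Fin.zero))  (Fin.suc (Fin.suc (Fin.suc (Fin.suc Fin.zero))))     = -[1+ 0 ]
across _ _ = + 0

-- The endpoints (classes 1 and 3) are single points, so two different points cannot both lie there.
apart : Fin 5 → Fin 5 → Bool
apart Fin.zero y                                        = true
apart (Fin.suc Fin.zero) y                              = does (2 ℕ.≤? toℕ y)
apart (Fin.suc (Fin.suc Fin.zero)) y                    = does (2 ℕ.≤? toℕ y)
apart (Fin.suc (Fin.suc (Fin.suc Fin.zero))) y          = does (4 ℕ.≤? toℕ y)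
apart (Fin.suc (Fin.suc (Fin.suc (Fin.suc Fin.zero)))) y = does (4 ℕ.≤? toℕ y)

across-tropical : ∀ x y z w → T (apart x y) → T (apart y z) → T (apart z w) →
  across x z + across y w ≡ (across x y + across z w) ⊓ (across x w + across y z)
across-tropical = toWitness {a? = FinP.all? λ x → FinP.all? λ y → FinP.all? λ z → FinP.all? λ w →
  T? (apart x y) →-dec (T? (apart y z) →-dec (T? (apart z w) →-dec (_ ℤ.≟ _)))} tt

pattern 0F = Fin.zero
pattern 1F = Fin.suc Fin.zero
pattern 2F = Fin.suc (Fin.suc Fin.zero)
pattern 3F = Fin.suc (Fin.suc (Fin.suc Fin.zero))
pattern 4F = Fin.suc (Fin.suc (Fin.suc (Fin.suc Fin.zero)))

trichotomy : ∀ a b → a < b ⊎ a ≡ b ⊎ b < a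
trichotomy a b with ℕP.<-cmp a b
... | tri< x _ _ = inj₁ x
... | tri≈ _ x _ = inj₂ (inj₁ x)
... | tri> _ _ x = inj₂ (inj₂ x)

module Values (n : ℕ) (ε : ℕ → Bool) where

  open Path n ε

  cl3 : ℕ → ℕ → Fin 3
  cl3 j v = if does (v ℕ.<? p j) then 0F else if does (v ℕ.<? r j) then 1F else 2F

  cl3-0 : ∀ {j v} → v < p j → cl3 j v ≡ 0F
  cl3-0 {j} {v} h rewrite dec-true (v ℕ.<? p j) h = refl

  cl3-1 : ∀ {j v} → p j ≤ v → v < r j → cl3 j v ≡ 1F
  cl3-1 {j} {v} h k rewrite dec-false (v ℕ.<? p j) (ℕP.≤⇒≯ h) | dec-true (v ℕ.<? r j) k = refl

  cl3-2 : ∀ {j v} → r j ≤ v → cl3 j v ≡ 2F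
  cl3-2 {j} {v} h rewrite dec-false (v ℕ.<? p j) (ℕP.≤⇒≯ (ℕP.≤-trans (ℕP.m≤m+n (p j) (gap j)) h)) | dec-false (v ℕ.<? r j) (ℕP.≤⇒≯ h) = refl

  cl3-mono : ∀ j {a b} → a < b → cl3 j a Fin.≤ cl3 j b
  cl3-mono j {a} {b} h with a ℕ.<? p j
  ... | yes q rewrite cl3-0 {j} q = z≤n
  ... | no q with b ℕ.<? r j
  ...   | no s rewrite cl3-2 {j} (ℕP.≮⇒≥ s) = FinP.≤fromℕ (cl3 j a)
  ...   | yes s rewrite cl3-1 {j} (ℕP.≮⇒≥ q) (ℕP.<-trans h s) | cl3-1 {j} (ℕP.≤-trans (ℕP.≮⇒≥ q) (ℕP.<⇒≤ h)) s = ℕP.≤-refl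

  -- Up to terms depending on a single endpoint, which cancel in shear coordinates, this is minus
  -- half the crossing number with d j after moving both ends of d j slightly downwards: the
  -- elementary lamination of d j. By `C-row` its shear coordinates at the initial chords form a
  -- unit vector.
  uℕ : ℕ → Edge → ℕ
  uℕ j (a , b) = both (cl3 j a) (cl3 j b)

  uℕ-tropical : ∀ j → Tropical (λ e → + uℕ j e)
  uℕ-tropical j {a} {b} {c} {e} (quad x y z) = both-tropical (cl3 j a) (cl3 j b) (cl3 j c) (cl3 j e) (cl3-mono j x) (cl3-mono j y) (cl3-mono j z)

  u-one : ∀ {j a b} → p j ≤ a → a < b → b < r j → uℕ j (a , b) ≡ 1
  u-one {j} h k l rewrite cl3-1 {j} h (ℕP.<-trans k l) | cl3-1 {j} (ℕP.≤-trans h (ℕP.<⇒≤ k)) l = refl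

  u-left : ∀ {j a b} → a < p j → uℕ j (a , b) ≡ 0
  u-left {j} h rewrite cl3-0 {j} h = refl

  u-right : ∀ {j a b} → r j ≤ b → uℕ j (a , b) ≡ 0
  u-right {j} {a} h rewrite cl3-2 {j} h with cl3 j a
  ... | 0F = refl
  ... | 1F = refl
  ... | 2F = refl

  upto : ℕ → ℕ → ℕ
  upto j i = if does (j ℕ.≤? i) then 1 else 0

  upto-yes : ∀ {j i} → j ≤ i → upto j i ≡ 1
  upto-yes {j} {i} h rewrite dec-true (j ℕ.≤? i) h = refl

  upto-no : ∀ {j i} → i < j → upto j i ≡ 0
  upto-no {j} {i} h rewrite dec-false (j ℕ.≤? i) (ℕP.<⇒≱ h) = refl

  index-≤ : ∀ {i j} → i ≤ n → j ≤ n → r i < r j → j ≤ i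
  index-≤ {i} {j} hi hj h with ℕP.≤-<-connex j i
  ... | inj₁ q = q
  ... | inj₂ q = contradiction h (ℕP.≤⇒≯ (r-anti (ℕP.<⇒≤ q) (weaken hj)))

  u-left-class : ∀ {i j m} → m ℕ.+ i ≤ n → j ≤ n → ε i ≡ true → uℕ j (p i , mid (m ℕ.+ i)) ≡ upto j i
  u-left-class {i} {j} {m} h hj e with ℕP.≤-<-connex j i
  ... | inj₁ q = trans (u-one {j} (p-mono q) (ℕP.≤-<-trans (p≤p+ {i} {m}) (p<mid h)) (ℕP.<-≤-trans (mid<r h) (ℕP.≤-trans (r+≤r {i} {m} h) (r-anti q (weaken (ℕP.≤-trans (ℕP.m≤n+m i m) h))))))
        (sym (upto-yes q))
  ... | inj₂ q = trans (u-left {j} (subst (_≤ p j) (p-true e) (p-mono q))) (sym (upto-no q))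

  u-right-class : ∀ {i j m} → m ℕ.+ i ≤ n → j ≤ n → uℕ j (mid (m ℕ.+ i) , r i) ≡ uℕ j (d i)
  u-right-class {i} {j} {m} h hj with ℕP.≤-<-connex (r j) (r i)
  ... | inj₁ q = trans (u-right {j} q) (sym (u-right {j} q))
  ... | inj₂ q = trans (u-one {j} (ℕP.≤-trans pj (ℕP.≤-trans (p≤p+ {i} {m}) (ℕP.<⇒≤ (p<mid h)))) (ℕP.<-≤-trans (mid<r h) (r+≤r {i} {m} h)) q)
        (sym (u-one {j} pj (p<r (ℕP.m≤n⇒m≤1+n hi)) q))
    where
    hi : i ≤ n
    hi = ℕP.≤-trans (ℕP.m≤n+m i m) h
    pj : p j ≤ p i
    pj = p-mono (index-≤ hi hj q)

  bnd-true : ∀ {i} → ε i ≡ true → bnd i ≡ (p i , mid i)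
  bnd-true e rewrite e = refl

  bnd-false : ∀ {i} → ε i ≡ false → i ≤ n → bnd i ≡ (mid i , r i)
  bnd-false {i} e h = sym (trans (cong₂ _,_ (mid-false e) (r-false e (ℕP.m≤n⇒m≤1+n h))) (sym be))
    where
    be : bnd i ≡ (r (suc i) , suc (r (suc i)))
    be rewrite e = refl

  u-d-true : ∀ {i j} → i ≤ n → j ≤ n → ε i ≡ true → uℕ j (d (suc i)) ≡ uℕ j (d i)
  u-d-true {i} {j} h hj e = trans (cong₂ (λ a b → uℕ j (a , b)) (sym (mid-true e)) (r-true e (ℕP.m≤n⇒m≤1+n h))) (u-right-class {i} {j} {0} h hj)

  u-d-false : ∀ {i j} → i ≤ n → j ≤ n → ε i ≡ false → uℕ j (d (suc i)) ≡ upto j i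
  u-d-false {i} {j} h hj e with ℕP.≤-<-connex j i
  ... | inj₁ q = trans (u-one {j} (subst (p j ≤_) (sym (p-false e)) (p-mono q)) (p<r (s≤s h))
          (ℕP.≤-trans (ℕP.≤-reflexive (sym (r-false e (ℕP.m≤n⇒m≤1+n h)))) (r-anti q (weaken h)))) (sym (upto-yes q))
  ... | inj₂ q = trans (u-right {j} (r-anti q (weaken hj))) (sym (upto-no q))

  u-d-zero : ∀ {j} → j ≤ n → uℕ j (d 0) ≡ 0
  u-d-zero {j} h = u-right {j} (r≤N (weaken h))

  -- However the chords turn, triangle l + 1 contributes `upto j (suc l)` and triangle l contributes
  -- `- upto j l`, up to a term at d (l + 1) that cancels. The difference is 1 exactly for j = l +
  -- 1.
  C-row : ∀ j l → j ≤ n → (h : suc l ≤ n) → total (sh (λ e → + uℕ j e) (d (suc l))) T₀ ≡ + upto j (suc l) - + upto j l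
  C-row j l hj h = trans (row (λ e → + uℕ j e) l h) (trans (cong (_+ signed (ε l) (+ uℕ j (d l) - + uℕ j (bnd l))) (upper (suc l) h)) lower′)
    where
    opp : ∀ a b → - (a - b) ≡ b - a
    opp = solve-∀
    upper : ∀ i → i ≤ n → signed (ε i) (+ uℕ j (bnd i) - + uℕ j (d (suc i))) ≡ + upto j i - + uℕ j (d i)
    upper i hi with bool-cases i
    ... | inj₁ e = trans (cong (λ z → signed z (+ uℕ j (bnd i) - + uℕ j (d (suc i)))) e) (cong₂ (λ a b → + a - + b)
          (trans (cong (uℕ j) (bnd-true e)) (u-left-class {i} {j} {0} hi hj e)) (u-d-true hi hj e))
    ... | inj₂ e = trans (cong (λ z → signed z (+ uℕ j (bnd i) - + uℕ j (d (suc i)))) e) (trans (cong₂ (λ a b → - (+ a - + b))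
          (trans (cong (uℕ j) (bnd-false e hi)) (u-right-class {i} {j} {0} hi hj)) (u-d-false hi hj e)) (opp (+ uℕ j (d i)) (+ upto j i)))
    hl : l ≤ n
    hl = ℕP.<⇒≤ h
    lower′ : (+ upto j (suc l) - + uℕ j (d (suc l))) + signed (ε l) (+ uℕ j (d l) - + uℕ j (bnd l)) ≡ + upto j (suc l) - + upto j l
    lower′ with bool-cases l
    ... | inj₁ e = trans (cong₂ (λ a b → (+ upto j (suc l) - + a) + b) (u-d-true hl hj e)
          (trans (cong (λ z → signed z (+ uℕ j (d l) - + uℕ j (bnd l))) e) (cong (λ b → + uℕ j (d l) - + b) (trans (cong (uℕ j) (bnd-true e)) (u-left-class {l} {j} {0} hl hj e)))))
          (lem (+ upto j (suc l)) (+ uℕ j (d l)) (+ upto j l))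
      where
      lem : ∀ a b c → (a - b) + (b - c) ≡ a - c
      lem = solve-∀
    ... | inj₂ e = trans (cong₂ (λ a b → (+ upto j (suc l) - + a) + b) (u-d-false hl hj e)
          (trans (cong (λ z → signed z (+ uℕ j (d l) - + uℕ j (bnd l))) e) (cong (λ b → - (+ uℕ j (d l) - + b)) (trans (cong (uℕ j) (bnd-false e hl)) (u-right-class {l} {j} {0} hl hj)))))
          (lem (+ upto j (suc l)) (+ uℕ j (d l)) (+ upto j l))
      where
      lem : ∀ a b c → (a - c) + - (b - b) ≡ a - c
      lem = solve-∀

  same-index : ℕ → ℕ → ℤ
  same-index m i = if does (m ℕ.≟ i) then + 1 else + 0

  δ-same : ∀ {m i} → m ≤ N → i ≤ N → δ (d m) (d i) ≡ same-index m i
  δ-same {m} {i} a b with m ℕ.≟ i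
  ... | yes refl rewrite dec-true (m ℕ.≟ m) refl = δ-yes refl
  ... | no ne rewrite dec-false (m ℕ.≟ i) ne = δ-d a b ne

  B-row₀ : ∀ m l → m ≤ n → (h : suc l ≤ n) → total (sh (δ (d m)) (d (suc l))) T₀ ≡
    signed (ε (suc l)) (- same-index m (suc (suc l))) + signed (ε l) (same-index m l)
  B-row₀ m l hm h = trans (row (δ (d m)) l h) (cong₂ (λ a b → signed (ε (suc l)) a + signed (ε l) b)
    (trans (cong₂ _-_ (δ-no (d≢bnd (suc l) hm)) (δ-same (weaken hm) (s≤s (ℕP.m≤n⇒m≤1+n h)))) (ℤP.+-identityˡ _))
    (trans (cong₂ _-_ (δ-same (weaken hm) (weaken (ℕP.<⇒≤ h))) (δ-no (d≢bnd l hm))) (ℤP.+-identityʳ _)))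

  cl5 : ℕ → ℕ → Fin 5
  cl5 l v with ℕP.<-cmp v (p l) | ℕP.<-cmp v (r l)
  ... | tri< _ _ _ | _          = 0F
  ... | tri≈ _ _ _ | _          = 1F
  ... | tri> _ _ _ | tri< _ _ _ = 2F
  ... | tri> _ _ _ | tri≈ _ _ _ = 3F
  ... | tri> _ _ _ | tri> _ _ _ = 4F

  module Chord (l : ℕ) (hl : l ≤ n) where

    pr : p l < r l
    pr = p<r (ℕP.m≤n⇒m≤1+n hl)

    cl5-0 : ∀ {v} → v < p l → cl5 l v ≡ 0F
    cl5-0 {v} h with ℕP.<-cmp v (p l) | ℕP.<-cmp v (r l)
    ... | tri< _ _ _ | _ = refl
    ... | tri≈ q _ _ | _ = contradiction h q
    ... | tri> q _ _ | _ = contradiction h q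

    cl5-1 : ∀ {v} → v ≡ p l → cl5 l v ≡ 1F
    cl5-1 {v} h with ℕP.<-cmp v (p l) | ℕP.<-cmp v (r l)
    ... | tri< _ q _ | _ = contradiction h q
    ... | tri≈ _ _ _ | _ = refl
    ... | tri> _ q _ | _ = contradiction h q

    cl5-2 : ∀ {v} → p l < v → v < r l → cl5 l v ≡ 2F
    cl5-2 {v} h k with ℕP.<-cmp v (p l) | ℕP.<-cmp v (r l)
    ... | tri< _ _ q | _          = contradiction h q
    ... | tri≈ _ _ q | _          = contradiction h q
    ... | tri> _ _ _ | tri< _ _ _ = refl
    ... | tri> _ _ _ | tri≈ q _ _ = contradiction k q
    ... | tri> _ _ _ | tri> q _ _ = contradiction k q

    cl5-3 : ∀ {v} → v ≡ r l → cl5 l v ≡ 3F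
    cl5-3 {v} refl with ℕP.<-cmp v (p l) | ℕP.<-cmp v (r l)
    ... | tri< _ _ q | _          = contradiction pr q
    ... | tri≈ _ _ q | _          = contradiction pr q
    ... | tri> _ _ _ | tri< _ q _ = contradiction refl q
    ... | tri> _ _ _ | tri≈ _ _ _ = refl
    ... | tri> _ _ _ | tri> _ q _ = contradiction refl q

    cl5-4 : ∀ {v} → r l < v → cl5 l v ≡ 4F
    cl5-4 {v} h with ℕP.<-cmp v (p l) | ℕP.<-cmp v (r l)
    ... | tri< _ _ q | _          = contradiction (ℕP.<-trans pr h) q
    ... | tri≈ _ _ q | _          = contradiction (ℕP.<-trans pr h) q
    ... | tri> _ _ _ | tri< _ _ q = contradiction h q
    ... | tri> _ _ _ | tri≈ _ _ q = contradiction h q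
    ... | tri> _ _ _ | tri> _ _ _ = refl

    not-after-p : ∀ {v} → v ≤ p l → cl5 l v ≡ 0F ⊎ cl5 l v ≡ 1F
    not-after-p h with ℕP.m≤n⇒m<n∨m≡n h
    ... | inj₁ q = inj₁ (cl5-0 q)
    ... | inj₂ q = inj₂ (cl5-1 q)

    not-before-r : ∀ {v} → r l ≤ v → cl5 l v ≡ 3F ⊎ cl5 l v ≡ 4F
    not-before-r h with ℕP.m≤n⇒m<n∨m≡n h
    ... | inj₁ q = inj₂ (cl5-4 q)
    ... | inj₂ q = inj₁ (cl5-3 (sym q))

    after-p : ∀ {v} → p l < v → cl5 l v ≡ 2F ⊎ cl5 l v ≡ 3F ⊎ cl5 l v ≡ 4F
    after-p {v} h with trichotomy v (r l)
    ... | inj₁ q        = inj₁ (cl5-2 h q)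
    ... | inj₂ (inj₁ q) = inj₂ (inj₁ (cl5-3 q))
    ... | inj₂ (inj₂ q) = inj₂ (inj₂ (cl5-4 q))

    late : ∀ {v} → p l < v → T (does (2 ℕ.≤? toℕ (cl5 l v)))
    late h with after-p h
    ... | inj₁ e        rewrite e = tt
    ... | inj₂ (inj₁ e) rewrite e = tt
    ... | inj₂ (inj₂ e) rewrite e = tt

    cl5-apart : ∀ {a b} → a < b → T (apart (cl5 l a) (cl5 l b))
    cl5-apart {a} {b} h with trichotomy a (p l)
    ... | inj₁ q rewrite cl5-0 q = tt
    ... | inj₂ (inj₁ refl) rewrite cl5-1 {a} refl = late h
    ... | inj₂ (inj₂ q) with trichotomy a (r l)
    ...   | inj₁ s rewrite cl5-2 q s = late (ℕP.<-trans q h)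
    ...   | inj₂ (inj₁ s) rewrite cl5-3 s | cl5-4 (subst (_< b) s h) = tt
    ...   | inj₂ (inj₂ s) rewrite cl5-4 s | cl5-4 (ℕP.<-trans s h) = tt

    X5 : Edge → ℤ
    X5 (a , b) = across (cl5 l a) (cl5 l b)

    X5-tropical : Tropical X5
    X5-tropical {a} {b} {c} {e} (quad x y z) = across-tropical (cl5 l a) (cl5 l b) (cl5 l c) (cl5 l e) (cl5-apart x) (cl5-apart y) (cl5-apart z)

    outside-zero : ∀ {a b} → cl5 l a ≡ 0F ⊎ cl5 l a ≡ 1F → cl5 l b ≡ 3F ⊎ cl5 l b ≡ 4F → ¬ (a ≡ p l × b ≡ r l) → a ≤ p l → r l ≤ b → X5 (a , b) ≡ + 0
    outside-zero (inj₁ x) (inj₁ y) ne _ _ = cong₂ across x y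
    outside-zero (inj₁ x) (inj₂ y) ne _ _ = cong₂ across x y
    outside-zero (inj₂ x) (inj₂ y) ne _ _ = cong₂ across x y
    outside-zero (inj₂ x) (inj₁ y) ne h k with ℕP.m≤n⇒m<n∨m≡n h | ℕP.m≤n⇒m<n∨m≡n k
    ... | inj₁ q | _ = contradiction (trans (sym (cl5-0 q)) x) (λ ())
    ... | inj₂ q | inj₁ s = contradiction (trans (sym (cl5-4 s)) y) (λ ())
    ... | inj₂ q | inj₂ s = contradiction (q , sym s) ne

    X5-outside : ∀ {a b} → a ≤ p l → r l ≤ b → ¬ (a ≡ p l × b ≡ r l) → X5 (a , b) ≡ + 0
    X5-outside h k ne = outside-zero (not-after-p h) (not-before-r k) ne h k

    X5-inside : ∀ {a b} → p l ≤ a → a < b → b ≤ r l → ¬ (a ≡ p l × b ≡ r l) → X5 (a , b) ≡ + 0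
    X5-inside {a} {b} h k m ne with ℕP.m≤n⇒m<n∨m≡n h | ℕP.m≤n⇒m<n∨m≡n m
    ... | inj₁ x | inj₁ y = cong₂ across (cl5-2 x (ℕP.<-trans k y)) (cl5-2 (ℕP.<-trans x k) y)
    ... | inj₁ x | inj₂ y = cong₂ across (cl5-2 x (subst (a <_) y k)) (cl5-3 y)
    ... | inj₂ x | inj₁ y = cong₂ across (cl5-1 (sym x)) (cl5-2 (subst (_< b) (sym x) k) y)
    ... | inj₂ x | inj₂ y = contradiction (sym x , y) ne

    X5-below : ∀ {a b} → a ≤ p l → b ≤ p l → X5 (a , b) ≡ + 0
    X5-below h k with not-after-p h | not-after-p k
    ... | inj₁ x | inj₁ y = cong₂ across x y
    ... | inj₁ x | inj₂ y = cong₂ across x y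
    ... | inj₂ x | inj₁ y = cong₂ across x y
    ... | inj₂ x | inj₂ y = cong₂ across x y

    X5-above : ∀ {a b} → r l ≤ a → r l ≤ b → X5 (a , b) ≡ + 0
    X5-above h k with not-before-r h | not-before-r k
    ... | inj₁ x | inj₁ y = cong₂ across x y
    ... | inj₁ x | inj₂ y = cong₂ across x y
    ... | inj₂ x | inj₁ y = cong₂ across x y
    ... | inj₂ x | inj₂ y = cong₂ across x y

    X5-d : ∀ {m} → m ≤ suc n → X5 (d m) ≡ same-index l m
    X5-d {m} hm with ℕP.<-cmp l m
    ... | tri< a ne _ rewrite dec-false (l ℕ.≟ m) ne =
          X5-inside (p-mono (ℕP.<⇒≤ a)) (p<r hm) (r-anti (ℕP.<⇒≤ a) (ℕP.m≤n⇒m≤1+n hm))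
            (λ { (x , y) → ne (d-injective (weaken hl) (ℕP.m≤n⇒m≤1+n hm) (cong₂ _,_ (sym x) (sym y))) })
    ... | tri≈ _ refl _ rewrite dec-true (l ℕ.≟ l) refl | cl5-1 {p l} refl | cl5-3 {r l} refl = refl
    ... | tri> _ ne a rewrite dec-false (l ℕ.≟ m) ne =
          X5-outside (p-mono (ℕP.<⇒≤ a)) (r-anti (ℕP.<⇒≤ a) (weaken hl))
            (λ { (x , y) → ne (d-injective (weaken hl) (ℕP.m≤n⇒m≤1+n hm) (cong₂ _,_ (sym x) (sym y))) })

    mid-beyond : ∀ {k} → k < l → mid k ≤ p l ⊎ r l ≤ mid k
    mid-beyond {k} h with bool-cases k
    ... | inj₁ e = inj₁ (subst (_≤ p l) (sym (mid-true e)) (p-mono h))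
    ... | inj₂ e = inj₂ (subst (r l ≤_) (sym (mid-false e)) (r-anti h (weaken hl)))

    crosses : ℕ → ℕ → ℤ
    crosses i m = if does (i ℕ.<? l) ∧ does (l ℕ.≤? m ℕ.+ i) then + 1 else + 0

    mid-inside : ∀ {k} → k ≤ n → l ≤ k → p l < mid k × mid k < r l
    mid-inside h k = ℕP.≤-<-trans (p-mono k) (p<mid h) , ℕP.<-≤-trans (mid<r h) (r-anti k (weaken h))

    X5-left : ∀ i m → m ℕ.+ i ≤ n → ε i ≡ true → X5 (p i , mid (m ℕ.+ i)) ≡ - crosses i m
    X5-left i m h e with ℕP.≤-<-connex l i | ℕP.≤-<-connex l (m ℕ.+ i)
    ... | inj₁ a | _ rewrite dec-false (i ℕ.<? l) (ℕP.≤⇒≯ a) =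
          X5-inside (p-mono a) (ℕP.≤-<-trans (p≤p+ {i} {m}) (p<mid h)) (ℕP.<⇒≤ (proj₂ mi)) (λ { (_ , y) → ℕP.<⇒≢ (proj₂ mi) y })
      where
      mi = mid-inside h (ℕP.≤-trans a (ℕP.m≤n+m i m))
    ... | inj₂ a | inj₁ b rewrite dec-true (i ℕ.<? l) a | dec-true (l ℕ.≤? m ℕ.+ i) b
          | cl5-0 (subst (_≤ p l) (p-true e) (p-mono a)) | cl5-2 (proj₁ (mid-inside h b)) (proj₂ (mid-inside h b)) = refl
    ... | inj₂ a | inj₂ b rewrite dec-true (i ℕ.<? l) a | dec-false (l ℕ.≤? m ℕ.+ i) (ℕP.<⇒≱ b) with mid-beyond b
    ...   | inj₁ q = X5-below (p-mono (ℕP.<⇒≤ a)) q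
    ...   | inj₂ q = X5-outside (p-mono (ℕP.<⇒≤ a)) q (λ { (x , _) → ℕP.<⇒≢ (subst (_≤ p l) (p-true e) (p-mono a)) x })

    X5-right : ∀ i m → m ℕ.+ i ≤ n → ε i ≡ false → X5 (mid (m ℕ.+ i) , r i) ≡ - crosses i m
    X5-right i m h e with ℕP.≤-<-connex l i | ℕP.≤-<-connex l (m ℕ.+ i)
    ... | inj₁ a | _ rewrite dec-false (i ℕ.<? l) (ℕP.≤⇒≯ a) =
          X5-inside (ℕP.<⇒≤ (proj₁ mi)) (ℕP.<-≤-trans (mid<r h) (r+≤r {i} {m} h)) (r-anti a (weaken hi)) (λ { (x , _) → ℕP.<⇒≢ (proj₁ mi) (sym x) })
      where
      mi = mid-inside h (ℕP.≤-trans a (ℕP.m≤n+m i m))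
      hi : i ≤ n
      hi = ℕP.≤-trans (ℕP.m≤n+m i m) h
    ... | inj₂ a | inj₁ b rewrite dec-true (i ℕ.<? l) a | dec-true (l ℕ.≤? m ℕ.+ i) b
          | cl5-2 (proj₁ (mid-inside h b)) (proj₂ (mid-inside h b))
          | cl5-4 {r i} (subst (r l <_) (sym (r-false e (ℕP.m≤n⇒m≤1+n (ℕP.≤-trans (ℕP.m≤n+m i m) h)))) (s≤s (r-anti a (weaken hl)))) = refl
    ... | inj₂ a | inj₂ b rewrite dec-true (i ℕ.<? l) a | dec-false (l ℕ.≤? m ℕ.+ i) (ℕP.<⇒≱ b) with mid-beyond b
    ...   | inj₂ q = X5-above q (r-anti (ℕP.<⇒≤ a) (weaken hl))
    ...   | inj₁ q = X5-outside q (r-anti (ℕP.<⇒≤ a) (weaken hl)) (λ { (_ , y) → ℕP.<⇒≢ (subst (r l <_) (sym (r-false e (ℕP.m≤n⇒m≤1+n hi))) (s≤s (r-anti a (weaken hl)))) (sym y) })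
      where
      hi : i ≤ n
      hi = ℕP.≤-trans (ℕP.m≤n+m i m) h

    -- The bound on `l` excludes d 0, itself a boundary edge, on which the value would be 1.
    X5-Bd : 0 < l → ∀ e → Bd N e → X5 e ≡ + 0
    X5-Bd l>0 (a , .(suc a)) (inj₁ (refl , _)) with trichotomy a (p l)
    ... | inj₁ q = X5-below (ℕP.<⇒≤ q) q
    ... | inj₂ (inj₁ q) = X5-inside (ℕP.≤-reflexive (sym q)) ℕP.≤-refl (ℕP.<⇒≤ (subst (λ z → suc z < r l) (sym q) (p+1<r hl)))
          (λ { (_ , y) → ℕP.<⇒≢ (subst (λ z → suc z < r l) (sym q) (p+1<r hl)) y })
    ... | inj₂ (inj₂ q) with ℕP.≤-<-connex (r l) a
    ...   | inj₁ s = X5-above s (ℕP.m≤n⇒m≤1+n s)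
    ...   | inj₂ s = X5-inside (ℕP.<⇒≤ q) ℕP.≤-refl s (λ { (x , _) → ℕP.<⇒≢ q (sym x) })
    X5-Bd l>0 (.0 , .N) (inj₂ (refl , refl)) = X5-outside z≤n (r≤N (weaken hl))
      (λ { (x , y) → ℕP.<⇒≢ l>0 (d-injective z≤n (weaken hl) (cong₂ _,_ x y)) })

-- Vertex vectors: in both directions the new vertex of triangle i is v (p i) + z i · v (r i), and the
-- 2 × 2 determinants of these vectors satisfy the Plücker relations.

Vec2 : Set
Vec2 = ℤ × ℤ

comb : Vec2 → ℤ → Vec2 → Vec2
comb (a , b) z (c , d) = a + z * c , b + z * d

det : Vec2 → Vec2 → ℤ
det (a , b) (c , d) = a * d - b * c

plücker : ∀ a b c d → det a c * det b d ≡ det a b * det c d + det a d * det b c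
plücker (a₁ , a₂) (b₁ , b₂) (c₁ , c₂) (d₁ , d₂) = lem a₁ a₂ b₁ b₂ c₁ c₂ d₁ d₂
  where
  lem : ∀ a₁ a₂ b₁ b₂ c₁ c₂ d₁ d₂ → (a₁ * c₂ - a₂ * c₁) * (b₁ * d₂ - b₂ * d₁) ≡
    (a₁ * b₂ - a₂ * b₁) * (c₁ * d₂ - c₂ * d₁) + (a₁ * d₂ - a₂ * d₁) * (b₁ * c₂ - b₂ * c₁)
  lem = solve-∀

Linear : (Vec2 → ℤ) → Set
Linear φ = ∀ a z b → φ (comb a z b) ≡ φ a + z * φ b

det-linearʳ : ∀ u → Linear (det u)
det-linearʳ (u₁ , u₂) (a₁ , a₂) z (b₁ , b₂) = lem u₁ u₂ a₁ a₂ z b₁ b₂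
  where
  lem : ∀ u₁ u₂ a₁ a₂ z b₁ b₂ → u₁ * (a₂ + z * b₂) - u₂ * (a₁ + z * b₁) ≡ (u₁ * a₂ - u₂ * a₁) + z * (u₁ * b₂ - u₂ * b₁)
  lem = solve-∀

det-linearˡ : ∀ u → Linear (λ w → det w u)
det-linearˡ (u₁ , u₂) (a₁ , a₂) z (b₁ , b₂) = lem u₁ u₂ a₁ a₂ z b₁ b₂
  where
  lem : ∀ u₁ u₂ a₁ a₂ z b₁ b₂ → (a₁ + z * b₁) * u₂ - (a₂ + z * b₂) * u₁ ≡ (a₁ * u₂ - a₂ * u₁) + z * (b₁ * u₂ - b₂ * u₁)
  lem = solve-∀

det-self : ∀ u → det u u ≡ + 0
det-self (a , b) = lem a b
  where
  lem : ∀ a b → a * b - b * a ≡ + 0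
  lem = solve-∀

module Vectors (n : ℕ) (ε : ℕ → Bool) (y : ℕ → ℤ) where

  open Path n ε

  -- Chosen so that z i · Δ i = y 1 ⋯ y i (`zΔ`). If the left end moves, the determinant is
  -- unchanged and z takes up the new factor; if the right end moves, the determinant takes up all
  -- of z, and z restarts with the new factor.
  z : ℕ → ℤ
  z zero    = + 1
  z (suc i) = if ε i then z i * y (suc i) else y (suc i)

  -- From stage k on, the vertices not strictly between the ends of d k have their final vectors.
  -- The start is the standard basis at the ends 0 and N of d 0.
  vecs : ℕ → ℕ → Vec2
  vecs zero    w = if does (w ℕ.≟ 0) then (+ 1 , + 0) else (+ 0 , + 1)
  vecs (suc k) w = if does (w ℕ.≟ mid k) then comb (vecs k (p k)) (z k) (vecs k (r k)) else vecs k w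

  v : ℕ → Vec2
  v = vecs (suc n)

  vecs-miss : ∀ k w → w ≢ mid k → vecs (suc k) w ≡ vecs k w
  vecs-miss k w ne rewrite dec-false (w ℕ.≟ mid k) ne = refl

  stable : ∀ j k w → j ℕ.+ k ≤ suc n → w ≤ p k ⊎ r k ≤ w → vecs (j ℕ.+ k) w ≡ vecs k w
  stable zero    k w h o = refl
  stable (suc j) k w h o = trans (vecs-miss (j ℕ.+ k) w (ne o)) (stable j k w (ℕP.<⇒≤ h) o)
    where
    ne : w ≤ p k ⊎ r k ≤ w → w ≢ mid (j ℕ.+ k)
    ne (inj₁ q) e = ℕP.<⇒≢ (ℕP.≤-<-trans (ℕP.≤-trans q (p≤p+ {k} {j})) (p<mid (ℕP.≤-pred h))) e
    ne (inj₂ q) e = ℕP.<⇒≢ (ℕP.<-≤-trans (mid<r (ℕP.≤-pred h)) (ℕP.≤-trans (r+≤r {k} {j} (ℕP.≤-pred h)) q)) (sym e)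

  v-stable : ∀ k w → k ≤ suc n → w ≤ p k ⊎ r k ≤ w → v w ≡ vecs k w
  v-stable k w h o = trans (cong (λ i → vecs i w) (sym (ℕP.m∸n+n≡m h))) (stable (suc n ℕ.∸ k) k w (ℕP.≤-reflexive (ℕP.m∸n+n≡m h)) o)

  v-mid : ∀ k → k ≤ n → v (mid k) ≡ comb (v (p k)) (z k) (v (r k))
  v-mid k h = trans (v-stable (suc k) (mid k) (s≤s h) outside) (trans hit
    (cong₂ (λ a b → comb a (z k) b) (sym (v-stable k (p k) (ℕP.m≤n⇒m≤1+n h) (inj₁ ℕP.≤-refl))) (sym (v-stable k (r k) (ℕP.m≤n⇒m≤1+n h) (inj₂ ℕP.≤-refl)))))
    where
    outside : mid k ≤ p (suc k) ⊎ r (suc k) ≤ mid k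
    outside with bool-cases k
    ... | inj₁ e = inj₁ (ℕP.≤-reflexive (mid-true e))
    ... | inj₂ e = inj₂ (ℕP.≤-reflexive (sym (mid-false e)))
    hit : vecs (suc k) (mid k) ≡ comb (vecs k (p k)) (z k) (vecs k (r k))
    hit rewrite dec-true (mid k ℕ.≟ mid k) refl = refl

  z-true : ∀ {i} → ε i ≡ true → z (suc i) ≡ z i * y (suc i)
  z-true e rewrite e = refl

  z-false : ∀ {i} → ε i ≡ false → z (suc i) ≡ y (suc i)
  z-false e rewrite e = refl

  Δ Wgt : ℕ → ℤ
  Δ i = det (v (p i)) (v (r i))
  Wgt zero    = + 1
  Wgt (suc i) = Wgt i * y (suc i)

  Δ-zero : Δ 0 ≡ + 1
  Δ-zero = cong₂ det (v-stable 0 0 z≤n (inj₁ z≤n)) (v-stable 0 N z≤n (inj₂ ℕP.≤-refl))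

  v-p-true : ∀ {i} → i ≤ n → ε i ≡ true → v (p (suc i)) ≡ comb (v (p i)) (z i) (v (r i))
  v-p-true {i} h e = trans (cong v (sym (mid-true e))) (v-mid i h)

  v-r-false : ∀ {i} → i ≤ n → ε i ≡ false → v (r (suc i)) ≡ comb (v (p i)) (z i) (v (r i))
  v-r-false {i} h e = trans (cong v (sym (mid-false e))) (v-mid i h)

  v-r-true : ∀ {i} → i ≤ n → ε i ≡ true → v (r (suc i)) ≡ v (r i)
  v-r-true h e = cong v (r-true e (ℕP.m≤n⇒m≤1+n h))

  v-p-false : ∀ {i} → ε i ≡ false → v (p (suc i)) ≡ v (p i)
  v-p-false e = cong v (p-false e)

  Δ-true : ∀ {i} → i ≤ n → ε i ≡ true → Δ (suc i) ≡ Δ i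
  Δ-true {i} h e = trans (cong₂ det (v-p-true h e) (v-r-true h e)) (trans (det-linearˡ (v (r i)) (v (p i)) (z i) (v (r i)))
    (trans (cong (λ x → Δ i + z i * x) (det-self (v (r i)))) (lem (Δ i) (z i))))
    where
    lem : ∀ a b → a + b * + 0 ≡ a
    lem = solve-∀

  Δ-false′ : ∀ {i} → i ≤ n → ε i ≡ false → Δ (suc i) ≡ z i * Δ i
  Δ-false′ {i} h e = trans (cong₂ det (v-p-false e) (v-r-false h e)) (trans (det-linearʳ (v (p i)) (v (p i)) (z i) (v (r i)))
    (trans (cong (_+ z i * Δ i) (det-self (v (p i)))) (ℤP.+-identityˡ _)))

  zΔ : ∀ i → i ≤ suc n → z i * Δ i ≡ Wgt i
  zΔ zero    h = trans (ℤP.*-identityˡ _) Δ-zero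
  zΔ (suc i) (s≤s h) with bool-cases i
  ... | inj₁ e = trans (cong₂ _*_ (z-true e) (Δ-true h e)) (trans (lem (z i) (y (suc i)) (Δ i)) (cong (_* y (suc i)) (zΔ i (ℕP.m≤n⇒m≤1+n h))))
    where
    lem : ∀ a b c → a * b * c ≡ a * c * b
    lem = solve-∀
  ... | inj₂ e = trans (cong₂ _*_ (z-false e) (Δ-false′ h e)) (trans (cong (_*_ (y (suc i))) (zΔ i (ℕP.m≤n⇒m≤1+n h))) (ℤP.*-comm (y (suc i)) (Wgt i)))

  Δ-false : ∀ {i} → i ≤ n → ε i ≡ false → Δ (suc i) ≡ Wgt i
  Δ-false {i} h e = trans (Δ-false′ h e) (zΔ i (ℕP.m≤n⇒m≤1+n h))

  -- FP i k and FR i k sum over the ideals in i + 1, …, i + k + 1 without, respectively with, the last label.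
  FP FR : ℕ → ℕ → ℤ
  FP i zero    = + 1
  FP i (suc k) = if ε (suc (k ℕ.+ i)) then FP i k + FR i k else FP i k
  FR i zero    = y (suc i)
  FR i (suc k) = y (suc (suc (k ℕ.+ i))) * (if ε (suc (k ℕ.+ i)) then FR i k else FP i k + FR i k)

  FP-true : ∀ i k → ε (suc (k ℕ.+ i)) ≡ true → FP i (suc k) ≡ FP i k + FR i k
  FP-true i k e rewrite e = refl

  FP-false : ∀ i k → ε (suc (k ℕ.+ i)) ≡ false → FP i (suc k) ≡ FP i k
  FP-false i k e rewrite e = refl

  FR-true : ∀ i k → ε (suc (k ℕ.+ i)) ≡ true → FR i (suc k) ≡ y (suc (suc (k ℕ.+ i))) * FR i k
  FR-true i k e rewrite e = refl

  FR-false : ∀ i k → ε (suc (k ℕ.+ i)) ≡ false → FR i (suc k) ≡ y (suc (suc (k ℕ.+ i))) * (FP i k + FR i k)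
  FR-false i k e rewrite e = refl

  F : ℕ → ℕ → ℤ
  F i zero    = + 1
  F i (suc k) = FP i k + FR i k

  -- The vectors obey the same two-term recursion as the sums over ideals. For linear `φ`, its
  -- values at the two ends of the current chord, the second one weighted by z, evolve like `FP` and
  -- `FR`; the start (K , y K) yields K times these sums.
  module Transfer (φ : Vec2 → ℤ) (linear : Linear φ) (i : ℕ) (K : ℤ)
    (start-p : φ (v (p (suc i))) ≡ K) (start-r : z (suc i) * φ (v (r (suc i))) ≡ y (suc i) * K) where

    φ-mid : ∀ j → j ≤ n → φ (v (mid j)) ≡ φ (v (p j)) + z j * φ (v (r j))
    φ-mid j h = trans (cong φ (v-mid j h)) (linear (v (p j)) (z j) (v (r j)))

    transfer : ∀ k → suc k ℕ.+ i ≤ n → φ (v (p (suc (k ℕ.+ i)))) ≡ K * FP i k × z (suc (k ℕ.+ i)) * φ (v (r (suc (k ℕ.+ i)))) ≡ K * FR i k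
    transfer zero    h = trans start-p (sym (ℤP.*-identityʳ K)) , trans start-r (ℤP.*-comm (y (suc i)) K)
    transfer (suc k) h with transfer k (ℕP.<⇒≤ h) | bool-cases (suc (k ℕ.+ i))
    ... | ep , er | inj₁ e =
          trans (cong (φ ∘ v) (sym (mid-true e))) (trans (φ-mid _ (ℕP.<⇒≤ h)) (trans (cong₂ _+_ ep er)
            (trans (sym (ℤP.*-distribˡ-+ K (FP i k) (FR i k))) (cong (_*_ K) (sym (FP-true i k e)))))) ,
          trans (cong₂ (λ a b → a * φ b) (z-true e) (v-r-true (ℕP.<⇒≤ h) e))
            (trans (l₁ (z (suc (k ℕ.+ i))) (y (suc (suc (k ℕ.+ i)))) _) (trans (cong (_*_ (y (suc (suc (k ℕ.+ i))))) er)
              (trans (l₂ (y (suc (suc (k ℕ.+ i)))) K (FR i k)) (cong (_*_ K) (sym (FR-true i k e))))))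
      where
      l₁ : ∀ a b c → a * b * c ≡ b * (a * c)
      l₁ = solve-∀
      l₂ : ∀ a b c → a * (b * c) ≡ b * (a * c)
      l₂ = solve-∀
    ... | ep , er | inj₂ e =
          trans (cong φ (v-p-false e)) (trans ep (cong (_*_ K) (sym (FP-false i k e)))) ,
          trans (cong₂ (λ a b → a * φ (v b)) (z-false e) (sym (mid-false e))) (trans (cong (_*_ (y (suc (suc (k ℕ.+ i)))))
            (trans (φ-mid _ (ℕP.<⇒≤ h)) (cong₂ _+_ ep er))) (trans (l₁ (y (suc (suc (k ℕ.+ i)))) K (FP i k) (FR i k)) (cong (_*_ K) (sym (FR-false i k e)))))
      where
      l₁ : ∀ a b c d → a * (b * c + b * d) ≡ b * (a * (c + d))
      l₁ = solve-∀

    transfer-mid : ∀ k → suc k ℕ.+ i ≤ n → φ (v (mid (suc k ℕ.+ i))) ≡ K * F i (suc k)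
    transfer-mid k h = trans (φ-mid _ h) (trans (cong₂ _+_ (proj₁ (transfer k h)) (proj₂ (transfer k h))) (sym (ℤP.*-distribˡ-+ K (FP i k) (FR i k))))

  λ-left : ∀ i m → m ℕ.+ i ≤ n → ε i ≡ true → det (v (p i)) (v (mid (m ℕ.+ i))) ≡ Wgt i * F i m
  λ-left i m h e = by m h
    where
    hi : i ≤ n
    hi = ℕP.≤-trans (ℕP.m≤n+m i m) h
    start : det (v (p i)) (v (mid i)) ≡ Wgt i
    start = trans (cong (det (v (p i))) (v-mid i hi)) (trans (det-linearʳ (v (p i)) (v (p i)) (z i) (v (r i)))
      (trans (cong (_+ z i * Δ i) (det-self (v (p i)))) (trans (ℤP.+-identityˡ _) (zΔ i (ℕP.m≤n⇒m≤1+n hi)))))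
    start-r : z (suc i) * det (v (p i)) (v (r (suc i))) ≡ y (suc i) * Wgt i
    start-r = trans (cong₂ (λ a b → a * det (v (p i)) b) (z-true e) (v-r-true hi e)) (trans (lem (z i) (y (suc i)) (Δ i)) (cong (_*_ (y (suc i))) (zΔ i (ℕP.m≤n⇒m≤1+n hi))))
      where
      lem : ∀ a b c → a * b * c ≡ b * (a * c)
      lem = solve-∀
    by : ∀ m → m ℕ.+ i ≤ n → det (v (p i)) (v (mid (m ℕ.+ i))) ≡ Wgt i * F i m
    by zero    h = trans start (sym (ℤP.*-identityʳ _))
    by (suc k) h = Transfer.transfer-mid (det (v (p i))) (det-linearʳ (v (p i))) i (Wgt i)
      (trans (cong (λ x → det (v (p i)) (v x)) (sym (mid-true e))) start) start-r k h

  λ-right : ∀ i m → m ℕ.+ i ≤ n → ε i ≡ false → det (v (mid (m ℕ.+ i))) (v (r i)) ≡ Δ i * F i m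
  λ-right i m h e = by m h
    where
    hi : i ≤ n
    hi = ℕP.≤-trans (ℕP.m≤n+m i m) h
    start : det (v (mid i)) (v (r i)) ≡ Δ i
    start = trans (cong (λ x → det x (v (r i))) (v-mid i hi)) (trans (det-linearˡ (v (r i)) (v (p i)) (z i) (v (r i)))
      (trans (cong (λ x → Δ i + z i * x) (det-self (v (r i)))) (lem (Δ i) (z i))))
      where
      lem : ∀ a b → a + b * + 0 ≡ a
      lem = solve-∀
    by : ∀ m → m ℕ.+ i ≤ n → det (v (mid (m ℕ.+ i))) (v (r i)) ≡ Δ i * F i m
    by zero    h = trans start (sym (ℤP.*-identityʳ _))
    by (suc k) h = Transfer.transfer-mid (λ w → det w (v (r i))) (det-linearˡ (v (r i))) i (Δ i)
      (cong (λ x → det x (v (r i))) (v-p-false e))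
      (trans (cong₂ (λ a b → a * det b (v (r i))) (z-false e) (cong v (sym (mid-false e)))) (cong (_*_ (y (suc i))) start)) k h

-- Enumeration of order ideals

Sub : Set
Sub = ℕ → ℕ

insert : ℕ → Sub → Sub
insert l S t = if does (t ℕ.≟ l) then suc (S t) else S t

insert-hit : ∀ l S → insert l S l ≡ suc (S l)
insert-hit l S rewrite dec-true (l ℕ.≟ l) refl = refl

insert-miss : ∀ l S t → t ≢ l → insert l S t ≡ S t
insert-miss l S t ne rewrite dec-false (t ℕ.≟ l) ne = refl

module Ideals (ε : ℕ → Bool) where

  -- Parallel to `FP`, `FR` and `F`, so that the determinant formula becomes a sum over explicit
  -- exponent functions.
  LP LR LF : ℕ → ℕ → List Sub
  LP i zero    = (λ _ → 0) ∷ []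
  LP i (suc k) = if ε (suc (k ℕ.+ i)) then LP i k ++ LR i k else LP i k
  LR i zero    = insert (suc i) (λ _ → 0) ∷ []
  LR i (suc k) = List.map (insert (suc (suc (k ℕ.+ i)))) (if ε (suc (k ℕ.+ i)) then LR i k else LP i k ++ LR i k)
  LF i zero    = (λ _ → 0) ∷ []
  LF i (suc k) = LP i k ++ LR i k

  record On (i k : ℕ) (S : Sub) : Set where
    field
      out : ∀ t → t ≤ i ⊎ k ℕ.+ i < t → S t ≡ 0
      bit : ∀ t → S t ≡ 0 ⊎ S t ≡ 1
      fwd : ∀ t → i < t → suc t ≤ k ℕ.+ i → ε t ≡ true → S (suc t) ≤ S t
      bwd : ∀ t → i < t → suc t ≤ k ℕ.+ i → ε t ≡ false → S t ≤ S (suc t)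

  On-zero : ∀ i → On i 0 (λ _ → 0)
  On-zero i = record { out = λ _ _ → refl ; bit = λ _ → inj₁ refl ; fwd = λ _ _ _ _ → z≤n ; bwd = λ _ _ _ _ → z≤n }

  extend : ∀ i k S → On i k S → (ε (k ℕ.+ i) ≡ false → S (k ℕ.+ i) ≡ 0) → On i (suc k) S
  extend i k S o h = record
    { out = λ { t (inj₁ q) → On.out o t (inj₁ q) ; t (inj₂ q) → On.out o t (inj₂ (ℕP.<⇒≤ q)) }
    ; bit = On.bit o
    ; fwd = λ t a b e → case ℕP.m≤n⇒m<n∨m≡n b of λ
        { (inj₁ q) → On.fwd o t a (ℕP.≤-pred q) e
        ; (inj₂ q) → subst (_≤ S t) (sym (On.out o (suc t) (inj₂ (ℕP.≤-reflexive (sym q))))) z≤n }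
    ; bwd = λ t a b e → case ℕP.m≤n⇒m<n∨m≡n b of λ
        { (inj₁ q) → On.bwd o t a (ℕP.≤-pred q) e
        ; (inj₂ refl) → subst (_≤ S (suc t)) (sym (h e)) z≤n } }

  extend-insert : ∀ i k S → On i k S → (ε (k ℕ.+ i) ≡ true → i < k ℕ.+ i → S (k ℕ.+ i) ≡ 1) → On i (suc k) (insert (suc (k ℕ.+ i)) S)
  extend-insert i k S o h = record
    { out = λ { t (inj₁ q) → trans (insert-miss top S t (ℕP.<⇒≢ (ℕP.≤-<-trans q (s≤s (ℕP.m≤n+m i k))))) (On.out o t (inj₁ q))
              ; t (inj₂ q) → trans (insert-miss top S t (λ e → ℕP.<⇒≢ q (sym e))) (On.out o t (inj₂ (ℕP.<⇒≤ q))) }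
    ; bit = bits
    ; fwd = λ t a b e → case ℕP.m≤n⇒m<n∨m≡n b of λ
        { (inj₁ q) → subst₂ _≤_ (sym (insert-miss top S (suc t) (ℕP.<⇒≢ q))) (sym (insert-miss top S t (ℕP.<⇒≢ (ℕP.<⇒≤ q)))) (On.fwd o t a (ℕP.≤-pred q) e)
        ; (inj₂ refl) → subst₂ _≤_ (sym top-one) (sym (trans (insert-miss top S t n≢1+n) (h e a))) ℕP.≤-refl }
    ; bwd = λ t a b e → case ℕP.m≤n⇒m<n∨m≡n b of λ
        { (inj₁ q) → subst₂ _≤_ (sym (insert-miss top S t (ℕP.<⇒≢ (ℕP.<⇒≤ q)))) (sym (insert-miss top S (suc t) (ℕP.<⇒≢ q))) (On.bwd o t a (ℕP.≤-pred q) e)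
        ; (inj₂ refl) → subst₂ _≤_ (sym (insert-miss top S t n≢1+n)) (sym top-one) (small t) } }
    where
    top : ℕ
    top = suc (k ℕ.+ i)
    top-one : insert top S top ≡ 1
    top-one = trans (insert-hit top S) (cong suc (On.out o top (inj₂ ℕP.≤-refl)))
    small : ∀ t → S t ≤ 1
    small t with On.bit o t
    ... | inj₁ e rewrite e = z≤n
    ... | inj₂ e rewrite e = ℕP.≤-refl
    bits : ∀ t → insert top S t ≡ 0 ⊎ insert top S t ≡ 1
    bits t with t ℕ.≟ top
    ... | yes e = inj₂ (trans (cong (insert top S) e) top-one)
    ... | no ne = subst (λ x → x ≡ 0 ⊎ x ≡ 1) (sym (insert-miss top S t ne)) (On.bit o t)

  sound : ∀ i k → All (λ S → On i (suc k) S × S (suc (k ℕ.+ i)) ≡ 0) (LP i k) × All (λ S → On i (suc k) S × S (suc (k ℕ.+ i)) ≡ 1) (LR i k)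
  sound i zero = (extend i 0 _ (On-zero i) (λ _ → refl) , refl) ∷ [] ,
    (extend-insert i 0 _ (On-zero i) (λ _ q → contradiction q (ℕP.<-irrefl refl)) , insert-hit (suc i) (λ _ → 0)) ∷ []
  sound i (suc k) with sound i k
  ... | sp , sr = lp , AllP.map⁺ lr
    where
    j top : ℕ
    j   = suc (k ℕ.+ i)
    top = suc j
    A B : Sub → Set
    A S = On i (suc k) S × S j ≡ 0
    B S = On i (suc k) S × S j ≡ 1
    plain : ∀ {S} → On i (suc k) S → (ε j ≡ false → S j ≡ 0) → On i (suc (suc k)) S × S top ≡ 0
    plain o h = extend i (suc k) _ o h , On.out o top (inj₂ ℕP.≤-refl)
    added : ∀ {S} → On i (suc k) S → (ε j ≡ true → S j ≡ 1) → On i (suc (suc k)) (insert top S) × insert top S top ≡ 1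
    added {S} o h = extend-insert i (suc k) _ o (λ e _ → h e) , trans (insert-hit top S) (cong suc (On.out o top (inj₂ ℕP.≤-refl)))
    absurd : ∀ {X : Set} {b} → b ≡ true → b ≡ false → X
    absurd refl ()
    lp : All (λ S → On i (suc (suc k)) S × S top ≡ 0) (LP i (suc k))
    lp with ε j in e
    ... | true  = AllP.++⁺ (All.map (λ { (o , _) → plain o (λ f → absurd e f) }) sp) (All.map (λ { (o , _) → plain o (λ f → absurd e f) }) sr)
    ... | false = All.map (λ { (o , q) → plain o (λ _ → q) }) sp
    lr : All (λ S → On i (suc (suc k)) (insert top S) × insert top S top ≡ 1) (if ε j then LR i k else LP i k ++ LR i k)
    lr with ε j in e
    ... | true  = All.map (λ { (o , q) → added o (λ _ → q) }) sr
    ... | false = AllP.++⁺ (All.map (λ { (o , _) → added o (λ f → absurd f e) }) sp) (All.map (λ { (o , _) → added o (λ f → absurd f e) }) sr)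

  sound-F : ∀ i m → All (On i m) (LF i m)
  sound-F i zero    = On-zero i ∷ []
  sound-F i (suc k) = AllP.++⁺ (All.map proj₁ (proj₁ (sound i k))) (All.map proj₁ (proj₂ (sound i k)))

  _≗S_ : Sub → Sub → Set
  S ≗S S′ = ∀ t → S t ≡ S′ t

  erase : ℕ → Sub → Sub
  erase l S t = if does (t ℕ.≟ l) then 0 else S t

  erase-hit : ∀ l S → erase l S l ≡ 0
  erase-hit l S rewrite dec-true (l ℕ.≟ l) refl = refl

  erase-miss : ∀ l S t → t ≢ l → erase l S t ≡ S t
  erase-miss l S t ne rewrite dec-false (t ℕ.≟ l) ne = refl

  erase-On : ∀ i k S → On i (suc k) S → On i k (erase (suc (k ℕ.+ i)) S)
  erase-On i k S o = record
    { out = outs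
    ; bit = bits
    ; fwd = λ t a b e → subst₂ _≤_ (sym (erase-miss top S (suc t) (ℕP.<⇒≢ (s≤s b)))) (sym (erase-miss top S t (ℕP.<⇒≢ (ℕP.m≤n⇒m≤1+n b)))) (On.fwd o t a (ℕP.m≤n⇒m≤1+n b) e)
    ; bwd = λ t a b e → subst₂ _≤_ (sym (erase-miss top S t (ℕP.<⇒≢ (ℕP.m≤n⇒m≤1+n b)))) (sym (erase-miss top S (suc t) (ℕP.<⇒≢ (s≤s b)))) (On.bwd o t a (ℕP.m≤n⇒m≤1+n b) e) }
    where
    top : ℕ
    top = suc (k ℕ.+ i)
    outs : ∀ t → t ≤ i ⊎ k ℕ.+ i < t → erase top S t ≡ 0
    outs t h with t ℕ.≟ top
    ... | yes e = trans (cong (erase top S) e) (erase-hit top S)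
    outs t (inj₁ q) | no ne = trans (erase-miss top S t ne) (On.out o t (inj₁ q))
    outs t (inj₂ q) | no ne = trans (erase-miss top S t ne) (On.out o t (inj₂ (ℕP.≤∧≢⇒< q (ne ∘ sym))))
    bits : ∀ t → erase top S t ≡ 0 ⊎ erase top S t ≡ 1
    bits t with t ℕ.≟ top
    ... | yes e = inj₁ (trans (cong (erase top S) e) (erase-hit top S))
    ... | no ne = subst (λ x → x ≡ 0 ⊎ x ≡ 1) (sym (erase-miss top S t ne)) (On.bit o t)

  empty-On : ∀ i S → On i 0 S → S ≗S (λ _ → 0)
  empty-On i S o t with ℕP.≤-<-connex t i
  ... | inj₁ q = On.out o t (inj₁ q)
  ... | inj₂ q = On.out o t (inj₂ q)

  restore-0 : ∀ l S → S l ≡ 0 → S ≗S erase l S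
  restore-0 l S h t with t ℕ.≟ l
  ... | yes refl = trans h (sym (erase-hit l S))
  ... | no ne    = sym (erase-miss l S t ne)

  restore-1 : ∀ l S → S l ≡ 1 → ∀ {S′} → erase l S ≗S S′ → S ≗S insert l S′
  restore-1 l S h {S′} e t with t ℕ.≟ l
  ... | yes refl = trans h (trans (cong suc (trans (sym (erase-hit l S)) (e l))) (sym (insert-hit l S′)))
  ... | no ne    = trans (sym (erase-miss l S t ne)) (trans (e t) (sym (insert-miss l S′ t ne)))

  -- Erasing the top label leaves an ideal on a shorter interval. Where the top label forces its
  -- neighbour, the neighbour's value selects the right sublist; otherwise both sublists are
  -- present.
  complete : ∀ i k S → On i (suc k) S → (S (suc (k ℕ.+ i)) ≡ 0 → Any (S ≗S_) (LP i k)) × (S (suc (k ℕ.+ i)) ≡ 1 → Any (S ≗S_) (LR i k))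
  complete i zero S o =
    (λ h → here (λ t → trans (restore-0 (suc i) S h t) (empty-On i _ (erase-On i 0 S o) t))) ,
    (λ h → here (restore-1 (suc i) S h (empty-On i _ (erase-On i 0 S o))))
  complete i (suc k) S o = zero-case , one-case
    where
    j top : ℕ
    j   = suc (k ℕ.+ i)
    top = suc j
    S₀ : Sub
    S₀ = erase top S
    o₀ : On i (suc k) S₀
    o₀ = erase-On i (suc k) S o
    S₀j : S₀ j ≡ S j
    S₀j = erase-miss top S j n≢1+n
    inP : S j ≡ 0 → Any (S₀ ≗S_) (LP i k)
    inP h = proj₁ (complete i k S₀ o₀) (trans S₀j h)
    inR : S j ≡ 1 → Any (S₀ ≗S_) (LR i k)
    inR h = proj₂ (complete i k S₀ o₀) (trans S₀j h)
    inF : Any (S₀ ≗S_) (LP i k ++ LR i k)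
    inF with On.bit o j
    ... | inj₁ h = AnyP.++⁺ˡ (inP h)
    ... | inj₂ h = AnyP.++⁺ʳ (LP i k) (inR h)
    i<j : i < j
    i<j = s≤s (ℕP.m≤n+m i k)
    force : ∀ {a} → a ≡ 0 ⊎ a ≡ 1 → 1 ≤ a → a ≡ 1
    force (inj₂ e) _ = e
    force (inj₁ refl) ()
    zero-case : S top ≡ 0 → Any (S ≗S_) (LP i (suc k))
    zero-case h = Any.map (λ e t → trans (restore-0 top S h t) (e t)) place
      where
      place : Any (S₀ ≗S_) (LP i (suc k))
      place with ε j in e
      ... | true  = inF
      ... | false = inP (ℕP.n≤0⇒n≡0 (subst (S j ≤_) h (On.bwd o j i<j ℕP.≤-refl e)))
    one-case : S top ≡ 1 → Any (S ≗S_) (LR i (suc k))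
    one-case h = AnyP.map⁺ (Any.map (λ e → restore-1 top S h e) place)
      where
      place : Any (S₀ ≗S_) (if ε j then LR i k else LP i k ++ LR i k)
      place with ε j in e
      ... | true  = inR (force (On.bit o j) (subst (_≤ S j) h (On.fwd o j i<j ℕP.≤-refl e)))
      ... | false = inF

  complete-F : ∀ i m S → On i m S → Any (S ≗S_) (LF i m)
  complete-F i zero    S o = here (empty-On i S o)
  complete-F i (suc k) S o with On.bit o (suc (k ℕ.+ i))
  ... | inj₁ h = AnyP.++⁺ˡ (proj₁ (complete i k S o) h)
  ... | inj₂ h = AnyP.++⁺ʳ (LP i k) (proj₂ (complete i k S o) h)

  weight : (Sub → ℤ) → List Sub → ℤ
  weight wt []      = + 0
  weight wt (S ∷ L) = wt S + weight wt L

  weight-++ : ∀ wt A B → weight wt (A ++ B) ≡ weight wt A + weight wt B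
  weight-++ wt []      B = sym (ℤP.+-identityˡ _)
  weight-++ wt (S ∷ A) B = trans (cong (_+_ (wt S)) (weight-++ wt A B)) (sym (ℤP.+-assoc (wt S) _ _))

  weight-insert : ∀ wt l c → (∀ S → wt (insert l S) ≡ c * wt S) → ∀ L → weight wt (List.map (insert l) L) ≡ c * weight wt L
  weight-insert wt l c h []      = sym (ℤP.*-zeroʳ c)
  weight-insert wt l c h (S ∷ L) = trans (cong₂ _+_ (h S) (weight-insert wt l c h L)) (sym (ℤP.*-distribˡ-+ c (wt S) (weight wt L)))

  module Weights (n : ℕ) (y : ℕ → ℤ) (wt : Sub → ℤ) (wt-zero : wt (λ _ → 0) ≡ + 1)
    (wt-insert : ∀ l S → 0 < l → l ≤ n → wt (insert l S) ≡ y l * wt S) where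

    open Vectors n ε y using (FP; FR; F)

    FP-FR : ∀ i k → suc k ℕ.+ i ≤ n → weight wt (LP i k) ≡ FP i k × weight wt (LR i k) ≡ FR i k
    FP-FR i zero    h = trans (ℤP.+-identityʳ _) wt-zero ,
      trans (ℤP.+-identityʳ _) (trans (wt-insert (suc i) _ ℕ.z<s h) (trans (cong (_*_ (y (suc i))) wt-zero) (ℤP.*-identityʳ _)))
    FP-FR i (suc k) h with FP-FR i k (ℕP.<⇒≤ h) | ε (suc (k ℕ.+ i))
    ... | ep , er | true  = trans (weight-++ wt (LP i k) (LR i k)) (cong₂ _+_ ep er) ,
          trans (weight-insert wt (suc (suc (k ℕ.+ i))) (y (suc (suc (k ℕ.+ i)))) (λ S → wt-insert _ S ℕ.z<s h) (LR i k)) (cong (_*_ (y (suc (suc (k ℕ.+ i))))) er)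
    ... | ep , er | false = ep , trans (weight-insert wt (suc (suc (k ℕ.+ i))) (y (suc (suc (k ℕ.+ i)))) (λ S → wt-insert _ S ℕ.z<s h) (LP i k ++ LR i k))
          (cong (_*_ (y (suc (suc (k ℕ.+ i))))) (trans (weight-++ wt (LP i k) (LR i k)) (cong₂ _+_ ep er)))

    F-weight : ∀ i m → m ℕ.+ i ≤ n → weight wt (LF i m) ≡ F i m
    F-weight i zero    h = trans (ℤP.+-identityʳ _) wt-zero
    F-weight i (suc k) h = trans (weight-++ wt (LP i k) (LR i k)) (cong₂ _+_ (proj₁ (FP-FR i k h)) (proj₂ (FP-FR i k h)))

-- The cluster algebra of c

pw-sum : {m : ℕ} (f g : Fin m → ℕ) (y : Vec ℕ m) → pw (tabulate (λ i → f i ℕ.+ g i)) y ≡ pw (tabulate f) y ℕ.* pw (tabulate g) y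
pw-sum f g y = trans (cong (λ e → pw e y) (zip f g)) (pw-+ (tabulate f) (tabulate g) y)
  where
  zip : ∀ {m} (f g : Fin m → ℕ) → tabulate (λ i → f i ℕ.+ g i) ≡ Vec.zipWith ℕ._+_ (tabulate f) (tabulate g)
  zip {zero}  f g = refl
  zip {suc m} f g = cong (f Fin.zero ℕ.+ g Fin.zero ∷_) (zip (f ∘ Fin.suc) (g ∘ Fin.suc))

pw-positive : {m : ℕ} (e y : Vec ℕ m) → Positive y → 0 < pw e y
pw-positive e y h = pw-off e y (inj₂ ∘ h)

pw-tabulate-cong : {m : ℕ} {f g : Fin m → ℕ} (y : Vec ℕ m) → (∀ i → f i ≡ g i) → pw (tabulate f) y ≡ pw (tabulate g) y
pw-tabulate-cong y e = cong (λ v → pw v y) (VecP.tabulate-cong e)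

-- All coefficients are 1, so repeated monomials add up and nothing cancels.
coeffs-one : {A : Set} {m : ℕ} (f : A → Vec ℕ m) (L : List A) → ∀ e →
  (Any (λ S → f S ≡ e) L × + 0 ℤ.< coeffY (List.map (λ S → + 1 , f S) L) e) ⊎ coeffY (List.map (λ S → + 1 , f S) L) e ≡ + 0
coeffs-one f [] e = inj₂ refl
coeffs-one f (S ∷ L) e with VecP.≡-dec ℕ._≟_ (f S) e | coeffs-one f L e
... | yes q | inj₁ (a , p) = inj₁ (here q , ℤP.+-mono-< (ℤ.+<+ ℕ.z<s) p)
... | yes q | inj₂ z rewrite z = inj₁ (here q , ℤ.+<+ ℕ.z<s)
... | no q  | inj₁ (a , p) = inj₁ (there a , p)
... | no q  | inj₂ z = inj₂ z

coeffs-member : {A : Set} {m : ℕ} (f : A → Vec ℕ m) (L : List A) → ∀ e → Any (λ S → f S ≡ e) L → coeffY (List.map (λ S → + 1 , f S) L) e ≢ + 0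
coeffs-member f L e a z with positive L a
  where
  nonneg : ∀ L → + 0 ℤ.≤ coeffY (List.map (λ S → + 1 , f S) L) e
  nonneg L with coeffs-one f L e
  ... | inj₁ (_ , p) = ℤP.<⇒≤ p
  ... | inj₂ z       = ℤP.≤-reflexive (sym z)
  positive : ∀ L → Any (λ S → f S ≡ e) L → + 0 ℤ.< coeffY (List.map (λ S → + 1 , f S) L) e
  positive (S ∷ L) (here q) rewrite dec-true (VecP.≡-dec ℕ._≟_ (f S) e) q = ℤP.+-mono-<-≤ (ℤ.+<+ ℕ.z<s) (nonneg L)
  positive (S ∷ L) (there a) with does (VecP.≡-dec ℕ._≟_ (f S) e)
  ... | true  = ℤP.+-mono-< (ℤ.+<+ ℕ.z<s) (positive L a)
  ... | false = positive L a
... | p = ℤP.<⇒≢ p (sym z)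

module Cluster {n : ℕ} (c : Vec (Fin n) n) (c-inj : IsCoxeterWord c) where

  pos′ : Fin n → Fin n
  pos′ x = proj₁ (injective⇒preimage (lookup c) c-inj x)

  lookup-pos : ∀ x → lookup c (pos′ x) ≡ x
  lookup-pos x = proj₂ (injective⇒preimage (lookup c) c-inj x)

  pos-lookup : ∀ i → pos′ (lookup c i) ≡ i
  pos-lookup i = c-inj (lookup-pos (lookup c i))

  -- Labels start at 1 to match the initial diagonals d 1, ..., d n; d 0 is a boundary edge.
  lab : Fin n → ℕ
  lab i = suc (toℕ (lookup c i))

  lab-≤ : ∀ i → lab i ≤ n
  lab-≤ i = FinP.toℕ<n (lookup c i)

  lab-injective : ∀ {i j} → lab i ≡ lab j → i ≡ j
  lab-injective e = c-inj (FinP.toℕ-injective (ℕP.suc-injective e))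

  by-label : {A : Set} → A → (Fin n → A) → ℕ → A
  by-label x f zero    = x
  by-label x f (suc s) with s ℕ.<? n
  ... | yes h = f (pos′ (fromℕ< h))
  ... | no _  = x

  by-label-lab : {A : Set} (x : A) (f : Fin n → A) → ∀ i → by-label x f (lab i) ≡ f i
  by-label-lab x f i with toℕ (lookup c i) ℕ.<? n
  ... | yes h = cong f (trans (cong pos′ (FinP.fromℕ<-toℕ (lookup c i) h)) (pos-lookup i))
  ... | no h  = contradiction (lab-≤ i) h

  position-of : ∀ t → 0 < t → t ≤ n → ∃ λ i → lab i ≡ t
  position-of (suc s) _ h = pos′ (fromℕ< h) , cong suc (trans (cong toℕ (lookup-pos (fromℕ< h))) (FinP.toℕ-fromℕ< h))

  by-label-cases : {A : Set} (x : A) (f : Fin n → A) → ∀ t → (∃ λ i → lab i ≡ t × by-label x f t ≡ f i) ⊎ by-label x f t ≡ x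
  by-label-cases x f zero = inj₂ refl
  by-label-cases x f (suc s) with s ℕ.<? n
  ... | yes h = inj₁ (pos′ (fromℕ< h) , cong suc (trans (cong toℕ (lookup-pos (fromℕ< h))) (FinP.toℕ-fromℕ< h)) , refl)
  ... | no h  = inj₂ refl

  -- The default n puts the labels 0 and n + 1 behind all others, which only settles the sides on
  -- which d 0 and d n shrink.
  posn : ℕ → ℕ
  posn = by-label n toℕ

  ε : ℕ → Bool
  ε t = does (posn t ℕ.<? posn (suc t))

  ε-true : ∀ i j → suc (lab i) ≡ lab j → toℕ i < toℕ j → ε (lab i) ≡ true
  ε-true i j e h = dec-true (_ ℕ.<? _) (subst₂ _<_ (sym (by-label-lab n toℕ i)) (sym (trans (cong posn e) (by-label-lab n toℕ j))) h)

  ε-false : ∀ i j → suc (lab i) ≡ lab j → toℕ j < toℕ i → ε (lab i) ≡ false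
  ε-false i j e h = dec-false (_ ℕ.<? _) (λ q → ℕP.<-asym h (subst₂ _<_ (by-label-lab n toℕ i) (trans (cong posn e) (by-label-lab n toℕ j)) q))

  ε-true⁻ : ∀ i j → suc (lab i) ≡ lab j → ε (lab i) ≡ true → toℕ i < toℕ j
  ε-true⁻ i j e h with ℕP.<-cmp (toℕ i) (toℕ j)
  ... | tri< q _ _ = q
  ... | tri≈ _ q _ = contradiction (trans e (cong lab (sym (FinP.toℕ-injective q)))) (λ f → n≢1+n (sym f))
  ... | tri> _ _ q = contradiction (trans (sym h) (ε-false i j e q)) (λ ())

  ε-false⁻ : ∀ i j → suc (lab i) ≡ lab j → ε (lab i) ≡ false → toℕ j < toℕ i
  ε-false⁻ i j e h with ℕP.<-cmp (toℕ i) (toℕ j)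
  ... | tri> _ _ q = q
  ... | tri≈ _ q _ = contradiction (trans e (cong lab (sym (FinP.toℕ-injective q)))) (λ f → n≢1+n (sym f))
  ... | tri< q _ _ = contradiction (trans (sym (ε-true i j e q)) h) (λ ())

  open Path n ε
  open Values n ε

  ind : ℕ → Fin n → ℕ
  ind t j = if does (lab j ℕ.≟ t) then 1 else 0

  module At-point (y : Vec ℕ n) (y>0 : Positive y) where

    PY : (Fin n → ℕ) → ℤ
    PY f = + pw (tabulate f) y

    PY-pos : ∀ f → + 0 ℤ.< PY f
    PY-pos f = ℤ.+<+ (pw-positive (tabulate f) y y>0)

    PY-+ : ∀ f g → PY (λ i → f i ℕ.+ g i) ≡ PY f * PY g
    PY-+ f g = trans (cong +_ (pw-sum f g y)) (ℤP.pos-* (pw (tabulate f) y) _)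

    PY-cong : ∀ {f g} → (∀ i → f i ≡ g i) → PY f ≡ PY g
    PY-cong e = cong +_ (pw-tabulate-cong y e)

    PY-zero : ∀ f → (∀ i → f i ≡ 0) → PY f ≡ + 1
    PY-zero f e = cong +_ (pw-tab-zero f y e)

    yl : ℕ → ℤ
    yl = by-label (+ 1) (λ i → + lookup y i)

    PY-ind : ∀ t → 0 < t → t ≤ n → PY (ind t) ≡ yl t
    PY-ind t t>0 t≤n with position-of t t>0 t≤n
    ... | i , refl = trans (cong +_ (trans (pw-single (ind (lab i)) y i 1 hit miss) (ℕP.*-identityʳ _))) (sym (by-label-lab (+ 1) (λ i → + lookup y i) i))
      where
      hit : ind (lab i) i ≡ 1
      hit rewrite dec-true (lab i ℕ.≟ lab i) refl = refl
      miss : ∀ j → j ≢ i → ind (lab i) j ≡ 0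
      miss j ne rewrite dec-false (lab j ℕ.≟ lab i) (ne ∘ lab-injective) = refl

    open Vectors n ε yl
    open Ideals ε

    uv : Edge → Fin n → ℕ
    uv e j = uℕ (lab j) e

    upto-suc : ∀ i j → upto (lab j) (suc i) ≡ upto (lab j) i ℕ.+ ind (suc i) j
    upto-suc i j with ℕP.<-cmp (lab j) (suc i)
    ... | tri< q ne _ rewrite upto-yes {lab j} {suc i} (ℕP.<⇒≤ q) | upto-yes {lab j} {i} (ℕP.≤-pred q) | dec-false (lab j ℕ.≟ suc i) ne = refl
    ... | tri≈ _ q _ rewrite upto-yes {lab j} {suc i} (ℕP.≤-reflexive q) | upto-no {lab j} {i} (ℕP.≤-reflexive (sym q)) | dec-true (lab j ℕ.≟ suc i) q = refl
    ... | tri> _ ne q rewrite upto-no {lab j} {suc i} q | upto-no {lab j} {i} (ℕP.<⇒≤ q) | dec-false (lab j ℕ.≟ suc i) ne = refl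

    Wgt-PY : ∀ i → i ≤ n → Wgt i ≡ PY (λ j → upto (lab j) i)
    Wgt-PY zero    h = sym (PY-zero _ (λ j → upto-no {lab j} {0} ℕ.z<s))
    Wgt-PY (suc i) h = trans (cong₂ _*_ (Wgt-PY i (ℕP.<⇒≤ h)) (sym (PY-ind (suc i) ℕ.z<s h)))
      (trans (sym (PY-+ (λ j → upto (lab j) i) (ind (suc i)))) (PY-cong (λ j → sym (upto-suc i j))))

    Δ-PY : ∀ i → i ≤ suc n → Δ i ≡ PY (uv (d i))
    Δ-PY zero    h = trans Δ-zero (sym (PY-zero _ (λ j → u-d-zero (lab-≤ j))))
    Δ-PY (suc i) (s≤s h) with bool-cases i
    ... | inj₁ e = trans (Δ-true h e) (trans (Δ-PY i (ℕP.m≤n⇒m≤1+n h)) (PY-cong (λ j → sym (u-d-true {i} h (lab-≤ j) e))))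
    ... | inj₂ e = trans (Δ-false h e) (trans (Wgt-PY i h) (PY-cong (λ j → sym (u-d-false {i} h (lab-≤ j) e))))

    Fc : ∀ {a b} → Class a b → ℤ
    Fc (diag i _ _ _)      = + 1
    Fc (left i m _ _ _ _)  = F i m
    Fc (right i m _ _ _ _) = F i m

    λ-class : ∀ {a b} (k : Class a b) → det (v a) (v b) ≡ Fc k * PY (uv (a , b))
    λ-class (diag i h refl refl) = trans (Δ-PY i h) (sym (ℤP.*-identityˡ _))
    λ-class (left i m h e refl refl) = trans (λ-left i m h e) (trans (ℤP.*-comm (Wgt i) (F i m)) (cong (_*_ (F i m))
      (trans (Wgt-PY i (ℕP.≤-trans (ℕP.m≤n+m i m) h)) (PY-cong (λ j → sym (u-left-class {i} {lab j} {m} h (lab-≤ j) e))))))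
    λ-class (right i m h e refl refl) = trans (λ-right i m h e) (trans (ℤP.*-comm (Δ i) (F i m)) (cong (_*_ (F i m))
      (trans (Δ-PY i (ℕP.m≤n⇒m≤1+n (ℕP.≤-trans (ℕP.m≤n+m i m) h))) (PY-cong (λ j → sym (u-right-class {i} {lab j} {m} h (lab-≤ j)))))))

    -- The determinant of the chord divided by its monomial `PY (uv e)`, as `λ-F` shows. It is
    -- defined through `Class` to avoid dividing; the value 1 on pairs that are not chords is
    -- arbitrary.
    Fval : Edge → ℤ
    Fval (a , b) with a ℕ.<? b | b ℕ.≤? N
    ... | yes h | yes k = Fc (classify a b h k)
    ... | _     | _     = + 1

    Fval-class : ∀ {a b} → (h : a < b) (k : b ≤ N) → Fval (a , b) ≡ Fc (classify a b h k)
    Fval-class {a} {b} h k with a ℕ.<? b | b ℕ.≤? N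
    ... | yes h′ | yes k′ = cong₂ (λ x y → Fc (classify a b x y)) (ℕP.<-irrelevant h′ h) (ℕP.≤-irrelevant k′ k)
    ... | yes _  | no q   = contradiction k q
    ... | no q   | _      = contradiction h q

    λ-F : ∀ {a b} → a < b → b ≤ N → det (v a) (v b) ≡ Fval (a , b) * PY (uv (a , b))
    λ-F {a} {b} h k = trans (λ-class (classify a b h k)) (cong (_* PY (uv (a , b))) (sym (Fval-class h k)))

    cancel-PY : ∀ f {a b} → a * PY f ≡ b * PY f → a ≡ b
    cancel-PY f {a} {b} = ℤP.*-cancelʳ-≡ a b (PY f) {{ℤ.>-nonZero (PY-pos f)}}

    Fval-d : ∀ i → i ≤ suc n → Fval (d i) ≡ + 1
    Fval-d i h = cancel-PY (uv (d i)) (trans (sym (λ-F (p<r h) (r≤N (ℕP.m≤n⇒m≤1+n h)))) (trans (Δ-PY i h) (sym (ℤP.*-identityˡ _))))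

    Fval-Bd : ∀ e → Bd N e → Fval e ≡ + 1
    Fval-Bd (a , b) bd = trans (Fval-class a<b (Bd-≤ bd)) (trivial (classify a b a<b (Bd-≤ bd)) bd)
      where
      a<b : a < b
      a<b = proper bd
        where
        proper : ∀ {a b} → Bd N (a , b) → a < b
        proper (inj₁ (refl , _))    = ℕP.≤-refl
        proper (inj₂ (refl , refl)) = ℕ.z<s
      trivial : ∀ {a b} (k : Class a b) → Bd N (a , b) → Fc k ≡ + 1
      trivial (diag _ _ _ _)            _ = refl
      trivial (left _ zero _ _ _ _)     _ = refl
      trivial (right _ zero _ _ _ _)    _ = refl
      trivial (left i (suc m) h e refl refl) (inj₁ (q , _)) = contradiction q
        (ℕP.<⇒≢ (ℕP.≤-<-trans (ℕP.≤-trans (ℕP.≤-reflexive (sym (p-true e))) (p-mono (s≤s (ℕP.m≤n+m i m)))) (p<mid h)))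
      trivial (left i (suc m) h e refl refl) (inj₂ (_ , q)) = contradiction q (ℕP.<⇒≢ (ℕP.<-≤-trans (mid<r h) (r≤N (weaken h))))
      trivial (right i (suc m) h e refl refl) (inj₁ (q , _)) = contradiction q
        (ℕP.<⇒≢ (ℕP.≤-<-trans (ℕP.≤-trans (mid<r h) (r-anti (s≤s (ℕP.m≤n+m i m)) (weaken h))) (ℕP.≤-reflexive (sym (r-false e (ℕP.m≤n⇒m≤1+n (ℕP.≤-trans (ℕP.m≤n+m i (suc m)) h)))))))
      trivial (right i (suc m) h e refl refl) (inj₂ (q , _)) = contradiction (ℕP.≤-<-trans z≤n (p<mid h)) (ℕP.≤⇒≯ (ℕP.≤-reflexive q))

    -- Multiplying by the weights of the two diagonals turns the exchange relation into the Plücker relation.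
    exchange-F : ∀ {a b c d} → Quad a b c d → d ≤ N →
      Fval (a , c) * Fval (b , d) ≡
        Fval (a , b) * Fval (c , d) * PY (λ i → posℕ ((+ uv (a , b) i + + uv (c , d) i) - (+ uv (a , d) i + + uv (b , c) i)))
        + Fval (a , d) * Fval (b , c) * PY (λ i → posℕ (- ((+ uv (a , b) i + + uv (c , d) i) - (+ uv (a , d) i + + uv (b , c) i))))
    exchange-F {a} {b} {c} {d} (quad a<b b<c c<d) d≤N = cancel-PY both-diagonals (trans
        (trans (cong (_*_ (Fval (a , c) * Fval (b , d))) (PY-+ (uv (a , c)) (uv (b , d))))
          (trans (l₁ (Fval (a , c)) (Fval (b , d)) (PY (uv (a , c))) (PY (uv (b , d))))
            (trans (cong₂ _*_ (sym (λ-F a<c c≤N)) (sym (λ-F b<d d≤N))) (plücker (v a) (v b) (v c) (v d)))))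
        (trans (cong₂ _+_ (cong₂ _*_ (λ-F a<b b≤N) (λ-F c<d d≤N)) (cong₂ _*_ (λ-F a<d d≤N) (λ-F b<c c≤N)))
          (trans (cong₂ _+_ (merge (a , b) (c , d) g⁺ (λ i → plus (uv (a , b) i) (uv (c , d) i) (uv (a , d) i) (uv (b , c) i) (uv (a , c) i) (uv (b , d) i) (rel i)))
                            (merge (a , d) (b , c) g⁻ (λ i → minus (uv (a , b) i) (uv (c , d) i) (uv (a , d) i) (uv (b , c) i) (uv (a , c) i) (uv (b , d) i) (rel i))))
            (sym (ℤP.*-distribʳ-+ (PY both-diagonals) (Fval (a , b) * Fval (c , d) * PY g⁺) (Fval (a , d) * Fval (b , c) * PY g⁻))))))
      where
      a<c : a < c
      a<c = ℕP.<-trans a<b b<c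
      b<d : b < d
      b<d = ℕP.<-trans b<c c<d
      a<d : a < d
      a<d = ℕP.<-trans a<c c<d
      c≤N : c ≤ N
      c≤N = ℕP.<⇒≤ (ℕP.<-≤-trans c<d d≤N)
      b≤N : b ≤ N
      b≤N = ℕP.<⇒≤ (ℕP.<-≤-trans b<c c≤N)
      both-diagonals g⁺ g⁻ : Fin n → ℕ
      g⁺ i = posℕ ((+ uv (a , b) i + + uv (c , d) i) - (+ uv (a , d) i + + uv (b , c) i))
      g⁻ i = posℕ (- ((+ uv (a , b) i + + uv (c , d) i) - (+ uv (a , d) i + + uv (b , c) i)))
      both-diagonals i = uv (a , c) i ℕ.+ uv (b , d) i
      l₁ : ∀ x y p q → x * y * (p * q) ≡ (x * p) * (y * q)
      l₁ = solve-∀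
      rel : ∀ i → + uv (a , c) i + + uv (b , d) i ≡ (+ uv (a , b) i + + uv (c , d) i) ⊓ (+ uv (a , d) i + + uv (b , c) i)
      rel i = uℕ-tropical (lab i) (quad a<b b<c c<d)
      merge : ∀ e f g → (∀ i → uv e i ℕ.+ uv f i ≡ both-diagonals i ℕ.+ g i) →
        (Fval e * PY (uv e)) * (Fval f * PY (uv f)) ≡ Fval e * Fval f * PY g * PY both-diagonals
      merge e f g h = trans (l₂ (Fval e) (Fval f) (PY (uv e)) (PY (uv f))) (trans (cong (_*_ (Fval e * Fval f))
        (trans (sym (PY-+ (uv e) (uv f))) (trans (PY-cong h) (trans (PY-+ both-diagonals g) (ℤP.*-comm (PY both-diagonals) (PY g)))))) (sym (ℤP.*-assoc (Fval e * Fval f) (PY g) (PY both-diagonals))))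
        where
        l₂ : ∀ x y p q → (x * p) * (y * q) ≡ x * y * (p * q)
        l₂ = solve-∀
      pos-part : ∀ x y → + x ≡ (+ x ⊓ + y) + + posℕ (+ x - + y)
      pos-part x y with ℕP.≤-total x y
      ... | inj₁ q = sym (trans (cong₂ (λ s t → s + + t) (ℤP.i≤j⇒i⊓j≡i (ℤ.+≤+ q)) (nonpos q)) (ℤP.+-identityʳ (+ x)))
        where
        nonpos : x ≤ y → posℕ (+ x - + y) ≡ 0
        nonpos q with + x - + y | ℤP.i≤j⇒i-j≤0 (ℤ.+≤+ q)
        ... | + zero   | _ = refl
        ... | + suc k  | ℤ.+≤+ ()
        ... | -[1+ k ] | _ = refl
      ... | inj₂ q = sym (trans (cong (_+ + posℕ (+ x - + y)) (ℤP.i≥j⇒i⊓j≡j (ℤ.+≤+ q))) (trans (cong (_+_ (+ y)) (nonneg q)) (l₃ (+ x) (+ y))))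
        where
        nonneg : y ≤ x → + posℕ (+ x - + y) ≡ + x - + y
        nonneg q with + x - + y | ℤP.i≤j⇒0≤j-i (ℤ.+≤+ q)
        ... | + k | _ = refl
        l₃ : ∀ x y → y + (x - y) ≡ x
        l₃ = solve-∀
      flip-sign : ∀ p m → m - p ≡ - (p - m)
      flip-sign = solve-∀
      plus : ∀ ab cd ad bc ac bd → + ac + + bd ≡ (+ ab + + cd) ⊓ (+ ad + + bc) → ab ℕ.+ cd ≡ ac ℕ.+ bd ℕ.+ posℕ ((+ ab + + cd) - (+ ad + + bc))
      plus ab cd ad bc ac bd h = ℤP.+-injective (trans (pos-part (ab ℕ.+ cd) (ad ℕ.+ bc)) (cong (_+ + posℕ ((+ ab + + cd) - (+ ad + + bc))) (sym h)))
      minus : ∀ ab cd ad bc ac bd → + ac + + bd ≡ (+ ab + + cd) ⊓ (+ ad + + bc) → ad ℕ.+ bc ≡ ac ℕ.+ bd ℕ.+ posℕ (- ((+ ab + + cd) - (+ ad + + bc)))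
      minus ab cd ad bc ac bd h = ℤP.+-injective (trans (pos-part (ad ℕ.+ bc) (ab ℕ.+ cd)) (cong₂ (λ s t → s + + posℕ t)
        (trans (ℤP.⊓-comm (+ (ad ℕ.+ bc)) (+ (ab ℕ.+ cd))) (sym h)) (flip-sign (+ ab + + cd) (+ ad + + bc))))

    wt : Sub → ℤ
    wt S = PY (S ∘ lab)

    insert-ind : ∀ l S j → insert l S (lab j) ≡ ind l j ℕ.+ S (lab j)
    insert-ind l S j with does (lab j ℕ.≟ l)
    ... | true  = refl
    ... | false = refl

    wt-insert : ∀ l S → 0 < l → l ≤ n → wt (insert l S) ≡ yl l * wt S
    wt-insert l S h k = trans (PY-cong (insert-ind l S)) (trans (PY-+ (ind l) (S ∘ lab)) (cong (_* wt S) (PY-ind l h k)))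

    ev-ideals : ∀ i m → m ℕ.+ i ≤ n → evY (List.map (λ S → + 1 , tabulate (S ∘ lab)) (LF i m)) y ≡ F i m
    ev-ideals i m h = trans (go (LF i m)) (Weights.F-weight n yl wt (PY-zero _ (λ _ → refl)) wt-insert i m h)
      where
      go : ∀ L → evY (List.map (λ S → + 1 , tabulate (S ∘ lab)) L) y ≡ weight wt L
      go []      = refl
      go (S ∷ L) = cong₂ _+_ (ℤP.*-identityˡ (wt S)) (go L)

-- Cluster variables as chords, and the support of F

module Support {n : ℕ} (c : Vec (Fin n) n) (c-inj : IsCoxeterWord c) where

  open Cluster c c-inj
  open Path n ε
  open Values n ε
  open Ideals ε

  module Ch (l : Fin n) = Chord (lab l) (lab-≤ l)

  -- One family of valuations for each x_l, with crossing numbers as values of chords, and one for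
  -- each positive y, with normalised determinants; both share the elementary laminations as
  -- coefficients.
  model : Model n N
  model = record
    { u      = λ i e → + uℕ (lab i) e
    ; u-trop = λ i → uℕ-tropical (lab i)
    ; W      = Fin n ⊎ Σ (Vec ℕ n) Positive
    ; val    = λ { (inj₁ l) → order l ; (inj₂ (y , h)) → evaluation y h }
    ; X      = λ { (inj₁ l) → Ch.X5 l ; (inj₂ (y , h)) → At-point.Fval y h }
    ; X-bd   = λ { (inj₁ l) → Ch.X5-Bd l ℕ.z<s ; (inj₂ (y , h)) → At-point.Fval-Bd y h }
    ; exch   = λ { (inj₁ l) q _ → trans (Ch.X5-tropical l q) (cong₂ _⊓_ (sym (ℤP.+-identityʳ _)) (sym (ℤP.+-identityʳ _)))
                 ; (inj₂ (y , h)) q k → At-point.exchange-F y h q k }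
    }

  open Mutation model

  ok-d : ∀ i → i ≤ suc n → Ok (d ∘ lab) (d i)
  ok-d zero    h = inj₁ d-first
  ok-d (suc i) h with ℕP.m≤n⇒m<n∨m≡n h
  ... | inj₂ refl = inj₁ d-last
  ... | inj₁ q = let j , e = position-of (suc i) ℕ.z<s (ℕP.≤-pred q) in inj₂ (j , cong d e)

  same-yes : ∀ {a b} → a ≡ b → same-index a b ≡ + 1
  same-yes {a} {b} e rewrite dec-true (a ℕ.≟ b) e = refl

  same-no : ∀ {a b} → a ≢ b → same-index a b ≡ + 0
  same-no {a} {b} e rewrite dec-false (a ℕ.≟ b) e = refl

  Bc-before : ∀ i j → toℕ i < toℕ j → Bc c i j ≡ - cartan (lookup c i) (lookup c j)
  Bc-before i j h rewrite dec-true (toℕ i ℕ.<? toℕ j) h = refl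

  Bc-after : ∀ i j → toℕ j < toℕ i → Bc c i j ≡ cartan (lookup c i) (lookup c j)
  Bc-after i j h rewrite dec-false (toℕ i ℕ.<? toℕ j) (ℕP.<-asym h) | dec-true (toℕ j ℕ.<? toℕ i) h = refl

  Bc-diagonal : ∀ i → Bc c i i ≡ + 0
  Bc-diagonal i rewrite dec-false (toℕ i ℕ.<? toℕ i) (ℕP.<-irrefl refl) = refl

  Bc-adjacent : ∀ i j → cartan (lookup c i) (lookup c j) ≡ -[1+ 0 ] → (toℕ i < toℕ j → Bc c i j ≡ + 1) × (toℕ j < toℕ i → Bc c i j ≡ -[1+ 0 ])
  Bc-adjacent i j e = (λ h → trans (Bc-before i j h) (cong -_ e)) , (λ h → trans (Bc-after i j h) e)

  signed-zero : ∀ b → signed b (+ 0) ≡ + 0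
  signed-zero true  = refl
  signed-zero false = refl

  -- Two different initial chords share a triangle only if their labels are adjacent. Then `ε`
  -- records which letter comes first in c, and this is the sign in B_c.
  B₀ : ∀ i k → Bc c i k ≡ total (sh (δ (d (lab i))) (d (lab k))) T₀
  B₀ i k = trans main (sym (B-row₀ (lab i) l (lab-≤ i) (lab-≤ k)))
    where
    l : ℕ
    l = toℕ (lookup c k)
    value : ∀ {x y} → same-index (lab i) (suc (suc l)) ≡ x → same-index (lab i) l ≡ y →
      signed (ε (suc l)) (- x) + signed (ε l) y ≡ signed (ε (suc l)) (- same-index (lab i) (suc (suc l))) + signed (ε l) (same-index (lab i) l)
    value refl refl = refl
    distinct : ∀ {i k} → toℕ (lookup c i) ≢ toℕ (lookup c k) → toℕ i < toℕ k ⊎ toℕ k < toℕ i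
    distinct {i} {k} ne with ℕP.<-cmp (toℕ i) (toℕ k)
    ... | tri< q _ _ = inj₁ q
    ... | tri≈ _ q _ = contradiction (cong (toℕ ∘ lookup c) (FinP.toℕ-injective q)) ne
    ... | tri> _ _ q = inj₂ q
    zeros-signed : signed (ε (suc l)) (+ 0) + signed (ε l) (+ 0) ≡ + 0
    zeros-signed = cong₂ _+_ (signed-zero (ε (suc l))) (signed-zero (ε l))
    main : Bc c i k ≡ signed (ε (suc l)) (- same-index (lab i) (suc (suc l))) + signed (ε l) (same-index (lab i) l)
    main with near (toℕ (lookup c i)) l
    ... | near-eq e = trans (subst (λ z → Bc c i z ≡ + 0) (lab-injective (cong suc e)) (Bc-diagonal i))
          (trans (sym zeros-signed) (value (same-no (λ f → n≢1+n (trans (sym (cong suc e)) f))) (same-no (λ f → n≢1+n (trans (sym f) (cong suc e))))))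
    ... | near-below e = trans (by (distinct (λ f → n≢1+n (trans f (sym e))))) (value (same-no (λ f → n≢2+n (trans (sym e) f))) (same-yes e))
      where
      el : ε l ≡ ε (lab i)
      el = cong ε (sym e)
      by : toℕ i < toℕ k ⊎ toℕ k < toℕ i → Bc c i k ≡ signed (ε (suc l)) (+ 0) + signed (ε l) (+ 1)
      by (inj₁ q) = trans (proj₁ (Bc-adjacent i k (cartan-below _ _ e)) q) (sym (cong₂ (λ a b → a + signed b (+ 1)) (signed-zero (ε (suc l))) (trans el (ε-true i k (cong suc e) q))))
      by (inj₂ q) = trans (proj₂ (Bc-adjacent i k (cartan-below _ _ e)) q) (sym (cong₂ (λ a b → a + signed b (+ 1)) (signed-zero (ε (suc l))) (trans el (ε-false i k (cong suc e) q))))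
    ... | near-above e = trans (by (distinct (λ f → n≢1+n (trans (sym f) (sym e))))) (value (same-yes (cong suc (sym e))) (same-no (λ f → n≢2+n (trans (sym f) (cong suc (sym e))))))
      where
      by : toℕ i < toℕ k ⊎ toℕ k < toℕ i → Bc c i k ≡ signed (ε (suc l)) (-[1+ 0 ]) + signed (ε l) (+ 0)
      by (inj₁ q) = trans (proj₁ (Bc-adjacent i k (cartan-above _ _ e)) q) (sym (cong₂ (λ a b → signed b -[1+ 0 ] + a) (signed-zero (ε l)) (ε-false k i (cong suc e) q)))
      by (inj₂ q) = trans (proj₂ (Bc-adjacent i k (cartan-above _ _ e)) q) (sym (cong₂ (λ a b → signed b -[1+ 0 ] + a) (signed-zero (ε l)) (ε-true k i (cong suc e) q)))
    ... | near-far x y w = trans (by (distinct x)) (trans (sym zeros-signed) (value (same-no (λ f → w (sym (ℕP.suc-injective f)))) (same-no y)))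
      where
      by : toℕ i < toℕ k ⊎ toℕ k < toℕ i → Bc c i k ≡ + 0
      by (inj₁ q) = trans (Bc-before i k q) (cong -_ (cartan-far _ _ x y w))
      by (inj₂ q) = trans (Bc-after i k q) (cartan-far _ _ x y w)

  C₀ : ∀ i k → (if does (i Fin.≟ k) then + 1 else + 0) ≡ total (sh (λ e → + uℕ (lab i) e) (d (lab k))) T₀
  C₀ i k = trans main (sym (C-row (lab i) (toℕ (lookup c k)) (lab-≤ i) (lab-≤ k)))
    where
    main : (if does (i Fin.≟ k) then + 1 else + 0) ≡ + upto (lab i) (lab k) - + upto (lab i) (toℕ (lookup c k))
    main with i Fin.≟ k
    ... | yes refl rewrite upto-yes {lab i} ℕP.≤-refl | upto-no {lab i} {toℕ (lookup c i)} ℕP.≤-refl = refl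
    ... | no ne with ℕP.<-cmp (lab i) (lab k)
    ...   | tri< q _ _ rewrite upto-yes {lab i} {lab k} (ℕP.<⇒≤ q) | upto-yes {lab i} (ℕP.≤-pred q) = refl
    ...   | tri≈ _ q _ = contradiction (lab-injective q) ne
    ...   | tri> _ _ q rewrite upto-no {lab i} q | upto-no {lab i} (ℕP.<⇒≤ q) = refl

  value₀ : ∀ w k → Valuation.V (Model.val model w) (xVar k , oneP) (Model.X model w (d (lab k)))
  value₀ (inj₁ l) k = deg-k , 0 , subst (MinDeg l (xVar k)) (VecP.lookup∘tabulate _ l) (MinDeg-mono l _ zeros) ,
      subst (MinDeg l oneP) (lookup-zeros l) (MinDeg-mono l zeros zeros) , trans (Ch.X5-d l (ℕP.m≤n⇒m≤1+n (lab-≤ k))) agree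
    where
    deg-k : ℕ
    deg-k = if does (k Fin.≟ l) then 1 else 0
    agree : same-index (lab l) (lab k) ≡ + deg-k - + 0
    agree with k Fin.≟ l
    ... | yes refl = same-yes {lab k} refl
    ... | no ne    = same-no (λ e → ne (sym (lab-injective e)))
  value₀ (inj₂ (y , h)) k = subst (Valuation.V (evaluation y h) (xVar k , oneP)) (sym (At-point.Fval-d y h (lab k) (ℕP.m≤n⇒m≤1+n (lab-≤ k))))
    ( subst (+ 0 ℤ.<_) (sym (ev-one {n} ones y)) (ℤ.+<+ ℕ.z<s)
    , trans (ev-x (unit k) ones y) (trans (cong +_ (pw-ones (unit k))) (sym (trans (ℤP.*-identityˡ (ev {n} oneP ones y)) (ev-one {n} ones y))))
    , ℤ.+<+ ℕ.z<s )

  initial : Inv (initialSeed c)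
  initial = record
    { D      = d ∘ lab
    ; Ts     = T₀
    ; D-<    = λ k → p<r (ℕP.m≤n⇒m≤1+n (lab-≤ k))
    ; D-≤    = λ k → r≤N (weaken (lab-≤ k))
    ; D-inj  = λ i j e → lab-injective (d-injective (weaken (lab-≤ i)) (weaken (lab-≤ j)) e)
    ; nc     = λ i j → d-nc (weaken (lab-≤ i)) (weaken (lab-≤ j))
    ; in1    = λ k → inner-one (toℕ (lookup c k)) (lab-≤ k)
    ; out1   = λ k → outer-one (toℕ (lookup c k)) (lab-≤ k)
    ; ok     = edges-ok (Ok (d ∘ lab)) ok-d (λ _ → inj₁) (suc n) ℕP.≤-refl
    ; B-eq   = B₀
    ; C-eq   = C₀
    ; values = value₀
    }

  crosses : Fin n → ℕ → ℕ → ℤ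
  crosses l = Ch.crosses l

  crosses-in : ∀ l i m → i < lab l → lab l ≤ m ℕ.+ i → crosses l i m ≡ + 1
  crosses-in l i m a b rewrite dec-true (i ℕ.<? lab l) a | dec-true (lab l ℕ.≤? m ℕ.+ i) b = refl

  crosses-low : ∀ l i m → lab l ≤ i → crosses l i m ≡ + 0
  crosses-low l i m a rewrite dec-false (i ℕ.<? lab l) (ℕP.≤⇒≯ a) = refl

  crosses-high : ∀ l i m → m ℕ.+ i < lab l → crosses l i m ≡ + 0
  crosses-high l i m a rewrite dec-true (i ℕ.<? lab l) (ℕP.≤-<-trans (ℕP.m≤n+m i m) a) | dec-false (lab l ℕ.≤? m ℕ.+ i) (ℕP.<⇒≱ a) = refl

  crosses-where : ∀ l i m → (i < lab l × lab l ≤ m ℕ.+ i × crosses l i m ≡ + 1) ⊎ ((lab l ≤ i ⊎ m ℕ.+ i < lab l) × crosses l i m ≡ + 0)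
  crosses-where l i m with ℕP.≤-<-connex (lab l) i | ℕP.≤-<-connex (lab l) (m ℕ.+ i)
  ... | inj₁ a | _      = inj₂ (inj₁ a , crosses-low l i m a)
  ... | inj₂ a | inj₁ b = inj₁ (a , b , crosses-in l i m a b)
  ... | inj₂ a | inj₂ b = inj₂ (inj₂ b , crosses-high l i m b)

  module Variable (ks : List (Fin n)) (j : Fin n) (dv : Fin n → ℤ) (f : Poly n) (form : HasDenomForm (clusterVar c ks j) dv f)
    (dv≥0 : ∀ l → + 0 ℤ.≤ dv l) where

    I : Inv (mutSeq c ks)
    I = mutations c initial ks

    e : Edge
    e = Inv.D I j

    dv-eq : ∀ l → dv l ≡ - Ch.X5 l e
    dv-eq l = denominator-vector (clusterVar c ks j) dv f form l (Ch.X5 l e) (Inv.values I (inj₁ l) j)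

    f-value : ∀ y (h : Positive y) → evY (evalX1 f) y ≡ At-point.Fval y h e
    f-value y h = evX1-value (clusterVar c ks j) dv f form y h (At-point.Fval y h e) (Inv.values I (inj₂ (y , h)) j)

    record Interval : Set where
      field
        i m    : ℕ
        bound′ : m ℕ.+ i ≤ n
        dv-is  : ∀ l → dv l ≡ crosses l i m
        F-is   : ∀ y (h : Positive y) → At-point.Fval y h e ≡ Vectors.F n ε (At-point.yl y h) i m

    interval : Interval
    interval = go (proj₁ e) (proj₂ e) refl (Inv.D-< I j) (Inv.D-≤ I j) (classify _ _ (Inv.D-< I j) (Inv.D-≤ I j)) refl
      where
      go : ∀ a b → (a , b) ≡ e → (h : a < b) (k : b ≤ N) (cl : Class a b) → cl ≡ classify a b h k → Interval
      go a b refl h k cl@(left i m hb t x y) eq = record { i = i ; m = m ; bound′ = hb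
        ; dv-is = λ l → trans (dv-eq l) (trans (cong -_ (trans (cong₂ (λ s t → Ch.X5 l (s , t)) x y) (Ch.X5-left l i m hb t))) (ℤP.neg-involutive _))
        ; F-is = λ yy hy → trans (At-point.Fval-class yy hy h k) (cong (At-point.Fc yy hy) (sym eq)) }
      go a b refl h k cl@(right i m hb t x y) eq = record { i = i ; m = m ; bound′ = hb
        ; dv-is = λ l → trans (dv-eq l) (trans (cong -_ (trans (cong₂ (λ s t → Ch.X5 l (s , t)) x y) (Ch.X5-right l i m hb t))) (ℤP.neg-involutive _))
        ; F-is = λ yy hy → trans (At-point.Fval-class yy hy h k) (cong (At-point.Fc yy hy) (sym eq)) }
      -- A labelled chord is an initial variable, whose entry -1 contradicts `dv≥0`. For d 0 and d
      -- (n + 1) the empty interval serves.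
      go a b refl h k cl@(diag i hi x y) eq = record { i = 0 ; m = 0 ; bound′ = z≤n
        ; dv-is = λ l → trans (dv-eq l) (trans (cong -_ (trans (cong₂ (λ s t → Ch.X5 l (s , t)) x y) (trans (Ch.X5-d l hi) (same-no (not-initial l)))))
            (sym (crosses-high l 0 0 ℕ.z<s)))
        ; F-is = λ yy hy → trans (At-point.Fval-class yy hy h k) (cong (At-point.Fc yy hy) (sym eq)) }
        where
        not-initial : ∀ l → lab l ≢ i
        not-initial l q = contradiction (subst (+ 0 ℤ.≤_) (trans (dv-eq l) (cong -_ (trans (cong₂ (λ s t → Ch.X5 l (s , t)) x y) (trans (Ch.X5-d l hi) (same-yes q))))) (dv≥0 l)) (λ ())

    open Interval interval

    D : Fin n → ℤ
    D s = dv (pos′ s)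

    D-lab : ∀ j → D (lookup c j) ≡ crosses j i m
    D-lab j = trans (cong dv (pos-lookup j)) (dv-is j)

    D-bit : ∀ l → Bit (dv l)
    D-bit l with crosses-where l i m
    ... | inj₁ (_ , _ , q) = inj₂ (trans (dv-is l) q)
    ... | inj₂ (_ , q)     = inj₁ (trans (dv-is l) q)

    ideal-poly : YPoly n
    ideal-poly = List.map (λ S → + 1 , tabulate (S ∘ lab)) (LF i m)

    same-poly : ∀ μ → coeffY (evalX1 f) μ ≡ coeffY ideal-poly μ
    same-poly = values⇒coeff (evalX1 f) ideal-poly (λ y h → trans (f-value y h) (trans (F-is y h) (sym (At-point.ev-ideals y h i m bound′))))

    exps : Vec ℕ n → Fin n → ℤ
    exps μ s = + lookup μ (pos′ s)

    exps-lab : ∀ μ j → exps μ (lookup c j) ≡ + lookup μ j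
    exps-lab μ j = cong (λ k → + lookup μ k) (pos-lookup j)

    inside : ∀ j → D (lookup c j) ≡ + 1 → i < lab j × lab j ≤ m ℕ.+ i
    inside j h with crosses-where j i m
    ... | inj₁ (a , b , _) = a , b
    ... | inj₂ (_ , z)     = contradiction (trans (sym h) (trans (D-lab j) z)) (λ ())

    support⇒ideal : ∀ μ → coeffY (evalX1 f) μ ≢ + 0 → Ideal c D (exps μ)
    support⇒ideal μ ne with coeffs-one (λ S → tabulate (S ∘ lab)) (LF i m) μ
    ... | inj₂ z = contradiction (trans (same-poly μ) z) ne
    ... | inj₁ (a , _) with All.lookupAny (sound-F i m) a
    ...   | on , S≡μ = record
            { nonneg = λ s → ℤ.+≤+ z≤n
            ; under  = λ s → subst₂ ℤ._≤_ refl (sym (dv-is (pos′ s))) (bound-at (pos′ s))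
            ; fwd = λ x y adj Dx Dy x<y → subst₂ ℤ._≤_ (trans (cong +_ (at y)) (sym (exps-lab μ y))) (trans (cong +_ (at x)) (sym (exps-lab μ x)))
                (ℤ.+≤+ (subst (λ t → S t ≤ S (lab x)) (cong suc adj) (On.fwd on (lab x) (proj₁ (inside x Dx)) (subst (_≤ m ℕ.+ i) (cong suc (sym adj)) (proj₂ (inside y Dy))) (ε-true x y (cong suc adj) x<y))))
            ; bwd = λ x y adj Dx Dy y<x → subst₂ ℤ._≤_ (trans (cong +_ (at x)) (sym (exps-lab μ x))) (trans (cong +_ (at y)) (sym (exps-lab μ y)))
                (ℤ.+≤+ (subst (λ t → S (lab x) ≤ S t) (cong suc adj) (On.bwd on (lab x) (proj₁ (inside x Dx)) (subst (_≤ m ℕ.+ i) (cong suc (sym adj)) (proj₂ (inside y Dy))) (ε-false x y (cong suc adj) y<x))))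
            }
      where
      S : Sub
      S = Any.lookup a
      at : ∀ j → S (lab j) ≡ lookup μ j
      at j = trans (sym (VecP.lookup∘tabulate (S ∘ lab) j)) (cong (λ v → lookup v j) S≡μ)
      bound-at : ∀ j → + lookup μ j ℤ.≤ crosses j i m
      bound-at j with crosses-where j i m
      ... | inj₂ (o , z) = subst₂ ℤ._≤_ (cong +_ (trans (sym (On.out on (lab j) o)) (at j))) (sym z) ℤP.≤-refl
      ... | inj₁ (_ , _ , z) with On.bit on (lab j)
      ...   | inj₁ q = subst₂ ℤ._≤_ (cong +_ (trans (sym q) (at j))) (sym z) (ℤ.+≤+ z≤n)
      ...   | inj₂ q = subst₂ ℤ._≤_ (cong +_ (trans (sym q) (at j))) (sym z) ℤP.≤-refl

    ideal⇒support : ∀ μ → Ideal c D (exps μ) → coeffY (evalX1 f) μ ≢ + 0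
    ideal⇒support μ ideal z = coeffs-member (λ S → tabulate (S ∘ lab)) (LF i m) μ
        (Any.map (λ {S′} q → trans (VecP.tabulate-cong (λ j → trans (sym (q (lab j))) (S-lab j))) (VecP.tabulate∘lookup μ)) (complete-F i m S on))
        (trans (sym (same-poly μ)) z)
      where
      open Ideal ideal
      S : Sub
      S = by-label 0 (lookup μ)
      S-lab : ∀ j → S (lab j) ≡ lookup μ j
      S-lab = by-label-lab 0 (lookup μ)
      under′ : ∀ j → + lookup μ j ℤ.≤ crosses j i m
      under′ j = subst₂ ℤ._≤_ (exps-lab μ j) (D-lab j) (under (lookup c j))
      label-of : ∀ t → i < t → t ≤ m ℕ.+ i → ∃ λ j → lab j ≡ t
      label-of t a b = position-of t (ℕP.≤-<-trans z≤n a) (ℕP.≤-trans b bound′)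
      D-one : ∀ j → i < lab j → lab j ≤ m ℕ.+ i → D (lookup c j) ≡ + 1
      D-one j a b = trans (D-lab j) (crosses-in j i m a b)
      on : On i m S
      on = record { out = out ; bit = bit ; fwd = fwd′ ; bwd = bwd′ }
        where
        out : ∀ t → t ≤ i ⊎ m ℕ.+ i < t → S t ≡ 0
        out t o with by-label-cases 0 (lookup μ) t
        ... | inj₂ q = q
        ... | inj₁ (j , refl , q) = trans q (ℕP.n≤0⇒n≡0 (ℤP.drop‿+≤+ (subst (+ lookup μ j ℤ.≤_) (zero-at o) (under′ j))))
          where
          zero-at : lab j ≤ i ⊎ m ℕ.+ i < lab j → crosses j i m ≡ + 0
          zero-at (inj₁ a) = crosses-low j i m a
          zero-at (inj₂ a) = crosses-high j i m a
        bit : ∀ t → S t ≡ 0 ⊎ S t ≡ 1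
        bit t with by-label-cases 0 (lookup μ) t
        ... | inj₂ q = inj₁ q
        ... | inj₁ (j , refl , q) with squeeze (ℤ.+≤+ z≤n) (under′ j) (subst Bit (dv-is j) (D-bit j))
        ...   | inj₁ x = inj₁ (trans q (ℤP.+-injective x))
        ...   | inj₂ x = inj₂ (trans q (ℤP.+-injective x))
        fwd′ : ∀ t → i < t → suc t ≤ m ℕ.+ i → ε t ≡ true → S (suc t) ≤ S t
        fwd′ t a b h with label-of t a (ℕP.<⇒≤ b) | label-of (suc t) (ℕP.m≤n⇒m≤1+n a) b
        ... | x , refl | y , ey = subst₂ _≤_ (trans (sym (S-lab y)) (cong S ey)) (sym (S-lab x)) (ℤP.drop‿+≤+ (subst₂ ℤ._≤_ (exps-lab μ y) (exps-lab μ x)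
              (fwd x y (sym (ℕP.suc-injective ey)) (D-one x a (ℕP.<⇒≤ b)) (D-one y (subst (i <_) (sym ey) (ℕP.m≤n⇒m≤1+n a)) (subst (_≤ m ℕ.+ i) (sym ey) b)) (ε-true⁻ x y (sym ey) h))))
        bwd′ : ∀ t → i < t → suc t ≤ m ℕ.+ i → ε t ≡ false → S t ≤ S (suc t)
        bwd′ t a b h with label-of t a (ℕP.<⇒≤ b) | label-of (suc t) (ℕP.m≤n⇒m≤1+n a) b
        ... | x , refl | y , ey = subst₂ _≤_ (sym (S-lab x)) (trans (sym (S-lab y)) (cong S ey)) (ℤP.drop‿+≤+ (subst₂ ℤ._≤_ (exps-lab μ x) (exps-lab μ y)
              (bwd x y (sym (ℕP.suc-injective ey)) (D-one x a (ℕP.<⇒≤ b)) (D-one y (subst (i <_) (sym ey) (ℕP.m≤n⇒m≤1+n a)) (subst (_≤ m ℕ.+ i) (sym ey) b)) (ε-false⁻ x y (sym ey) h))))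

-- Simple roots and fundamental weights

sumℤ-sum : {m : ℕ} (f : Fin m → ℤ) → sumℤ f ≡ Sum.sum f
sumℤ-sum {zero}  f = refl
sumℤ-sum {suc m} f = cong (_+_ (f Fin.zero)) (sumℤ-sum (f ∘ Fin.suc))

sumℤ-cong : {m : ℕ} {f g : Fin m → ℤ} → (∀ i → f i ≡ g i) → sumℤ f ≡ sumℤ g
sumℤ-cong {zero}  e = refl
sumℤ-cong {suc m} e = cong₂ _+_ (e Fin.zero) (sumℤ-cong (e ∘ Fin.suc))

kron : ℕ → ℕ → ℤ
kron a b = if does (a ℕ.≟ b) then + 1 else + 0

kron-yes : ∀ {a b} → a ≡ b → kron a b ≡ + 1
kron-yes {a} {b} e rewrite dec-true (a ℕ.≟ b) e = refl

kron-no : ∀ {a b} → a ≢ b → kron a b ≡ + 0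
kron-no {a} {b} e rewrite dec-false (a ℕ.≟ b) e = refl

sum-kron : (D : Fin n → ℤ) → ∀ t → sumℤ (λ s → D s * kron (toℕ s) t) ≡ extF D t
sum-kron {zero}  D t = refl
sum-kron {suc n} D zero = trans (cong (_+_ (D Fin.zero * + 1)) (vanish (D ∘ Fin.suc))) (lem (D Fin.zero))
  where
  vanish : ∀ {m} (f : Fin m → ℤ) → sumℤ (λ s → f s * kron (suc (toℕ s)) 0) ≡ + 0
  vanish {zero}  f = refl
  vanish {suc m} f = cong₂ _+_ (ℤP.*-zeroʳ (f Fin.zero)) (null-sum (f ∘ Fin.suc))
    where
    null-sum : ∀ {m} (f : Fin m → ℤ) → sumℤ (λ s → f s * + 0) ≡ + 0
    null-sum {zero}  f = refl
    null-sum {suc m} f = cong₂ _+_ (ℤP.*-zeroʳ (f Fin.zero)) (null-sum (f ∘ Fin.suc))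
  lem : ∀ a → a * + 1 + + 0 ≡ a
  lem = solve-∀
sum-kron {suc n} D (suc t) = trans (cong₂ _+_ (ℤP.*-zeroʳ (D Fin.zero)) (sum-kron (D ∘ Fin.suc) t)) (ℤP.+-identityˡ _)

sum-kron-suc : (D : Fin n → ℤ) → ∀ t → sumℤ (λ s → D s * kron (suc (toℕ s)) t) ≡ ext D t
sum-kron-suc D zero    = go D
  where
  go : ∀ {m} (f : Fin m → ℤ) → sumℤ (λ s → f s * + 0) ≡ + 0
  go {zero}  f = refl
  go {suc m} f = cong₂ _+_ (ℤP.*-zeroʳ (f Fin.zero)) (go (f ∘ Fin.suc))
sum-kron-suc D (suc t) = sum-kron D t

cartan-kron : (s j : Fin n) → cartan s j ≡ + 2 * kron (toℕ s) (toℕ j) - kron (suc (toℕ s)) (toℕ j) - kron (toℕ s) (suc (toℕ j))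
cartan-kron s j with near (toℕ s) (toℕ j)
... | near-eq e = trans (cartan-same s j e) (sym (cong₃ (λ a b c → + 2 * a - b - c) (kron-yes e) (kron-no (λ f → n≢1+n (trans e (sym f)))) (kron-no (λ f → n≢1+n (trans (sym e) f)))))
... | near-below e = trans (cartan-below s j e) (sym (cong₃ (λ a b c → + 2 * a - b - c) (kron-no (λ f → n≢1+n (trans f (sym e)))) (kron-yes e) (kron-no (λ f → n≢2+n (trans f (cong suc (sym e)))))))
... | near-above e = trans (cartan-above s j e) (sym (cong₃ (λ a b c → + 2 * a - b - c) (kron-no (λ f → n≢1+n (trans (sym f) (sym e)))) (kron-no (λ f → n≢2+n (trans (sym f) (cong suc (sym e))))) (kron-yes (sym e))))
... | near-far a b c = trans (cartan-far s j a b c) (sym (cong₃ (λ a b c → + 2 * a - b - c) (kron-no a) (kron-no b) (kron-no (c ∘ sym))))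

sum-cartan : (D : Fin n → ℤ) → ∀ j → sumℤ (λ s → D s * cartan s j) ≡ dd (ext D) (toℕ j)
sum-cartan D j = trans (sumℤ-cong (λ s → cong (_*_ (D s)) (cartan-kron s j)))
  (trans (split (λ s → kron (toℕ s) (toℕ j)) (λ s → kron (suc (toℕ s)) (toℕ j)) (λ s → kron (toℕ s) (suc (toℕ j))) D)
    (cong₃ (λ a b c → + 2 * a - b - c) (sum-kron D (toℕ j)) (sum-kron-suc D (toℕ j)) (sum-kron D (suc (toℕ j)))))
  where
  split : ∀ {m} (f g h D : Fin m → ℤ) → sumℤ (λ s → D s * (+ 2 * f s - g s - h s)) ≡ + 2 * sumℤ (λ s → D s * f s) - sumℤ (λ s → D s * g s) - sumℤ (λ s → D s * h s)
  split {zero}  f g h D = refl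
  split {suc m} f g h D = trans (cong (_+_ (D Fin.zero * (+ 2 * f Fin.zero - g Fin.zero - h Fin.zero))) (split (f ∘ Fin.suc) (g ∘ Fin.suc) (h ∘ Fin.suc) (D ∘ Fin.suc)))
    (lem (D Fin.zero) (f Fin.zero) (g Fin.zero) (h Fin.zero) _ _ _)
    where
    lem : ∀ d f g h x y z → d * (+ 2 * f - g - h) + (+ 2 * x - y - z) ≡ + 2 * (d * f + x) - (d * g + y) - (d * h + z)
    lem = solve-∀

-- Convex combinations of coefficient vectors

ι : ℤ → ℚ
ι z = z ℚ./ 1

ι-+ : ∀ a b → ι (a + b) ≡ ι a ℚ.+ ι b
ι-+ a b = ℚP.toℚᵘ-injective (ℚᵘP.≃-trans (ℚP.toℚᵘ-fromℚᵘ (ℚᵘ.mkℚᵘ (a + b) 0)) (ℚᵘP.≃-trans (ℚᵘ.*≡* (lem a b))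
  (ℚᵘP.≃-trans (ℚᵘP.+-cong (ℚᵘP.≃-sym (ℚP.toℚᵘ-fromℚᵘ (ℚᵘ.mkℚᵘ a 0))) (ℚᵘP.≃-sym (ℚP.toℚᵘ-fromℚᵘ (ℚᵘ.mkℚᵘ b 0))))
    (ℚᵘP.≃-sym (ℚP.toℚᵘ-homo-+ (ι a) (ι b))))))
  where
  lem : ∀ a b → (a + b) * + 1 ≡ (a * + 1 + b * + 1) * + 1
  lem = solve-∀

ι-≤ : ∀ {a b} → a ℤ.≤ b → ι a ℚ.≤ ι b
ι-≤ {a} {b} h = ℚP.toℚᵘ-cancel-≤ (ℚᵘP.≤-respˡ-≃ (ℚᵘP.≃-sym (ℚP.toℚᵘ-fromℚᵘ (ℚᵘ.mkℚᵘ a 0)))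
  (ℚᵘP.≤-respʳ-≃ (ℚᵘP.≃-sym (ℚP.toℚᵘ-fromℚᵘ (ℚᵘ.mkℚᵘ b 0))) (ℚᵘ.*≤* (ℤP.*-monoʳ-≤-nonNeg (+ 1) h))))

ι-≤⁻ : ∀ {a b} → ι a ℚ.≤ ι b → a ℤ.≤ b
ι-≤⁻ {a} {b} h with ℚᵘP.≤-respˡ-≃ (ℚP.toℚᵘ-fromℚᵘ (ℚᵘ.mkℚᵘ a 0)) (ℚᵘP.≤-respʳ-≃ (ℚP.toℚᵘ-fromℚᵘ (ℚᵘ.mkℚᵘ b 0)) (ℚP.toℚᵘ-mono-≤ h))
... | ℚᵘ.*≤* q = subst₂ ℤ._≤_ (ℤP.*-identityʳ a) (ℤP.*-identityʳ b) q

-- A sequence with zero second differences is linear, hence zero if it vanishes at both ends.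
harmonic : ∀ n (w : ℕ → ℚ) → (∀ j → j < n → w j ℚ.+ w (suc (suc j)) ≡ w (suc j) ℚ.+ w (suc j)) → w 0 ≡ 0ℚ → w (suc n) ≡ 0ℚ →
  ∀ m → m ≤ suc n → w m ≡ 0ℚ
harmonic n w h w₀ wₙ = all-zero
  where
  open ℚS.+-*-Solver
  difference : ∀ m → m ≤ n → w (suc m) ≡ w m ℚ.+ w 1
  difference zero    _   = trans (sym (ℚP.+-identityˡ (w 1))) (cong (ℚ._+ w 1) (sym w₀))
  difference (suc m) m<n = trans (l₁ (w m) (w (suc (suc m)))) (trans (cong (ℚ._+ (ℚ.- w m)) (h m m<n))
    (trans (cong (λ z → (w (suc m) ℚ.+ z) ℚ.+ (ℚ.- w m)) (difference m (ℕP.<⇒≤ m<n))) (l₂ (w (suc m)) (w m) (w 1))))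
    where
    l₁ : ∀ x y → y ≡ (x ℚ.+ y) ℚ.+ (ℚ.- x)
    l₁ = solve 2 (λ x y → y := (x :+ y) :+ (:- x)) refl
    l₂ : ∀ a b c → (a ℚ.+ (b ℚ.+ c)) ℚ.+ (ℚ.- b) ≡ a ℚ.+ c
    l₂ = solve 3 (λ a b c → (a :+ (b :+ c)) :+ (:- b) := a :+ c) refl
  grows : 0ℚ ℚ.< w 1 → ∀ m → m ≤ n → 0ℚ ℚ.< w (suc m)
  grows p zero    _   = p
  grows p (suc m) m<n = subst (0ℚ ℚ.<_) (sym (difference (suc m) m<n)) (subst (ℚ._< w (suc m) ℚ.+ w 1) (ℚP.+-identityˡ 0ℚ) (ℚP.+-mono-< (grows p m (ℕP.<⇒≤ m<n)) p))
  shrinks : w 1 ℚ.< 0ℚ → ∀ m → m ≤ n → w (suc m) ℚ.< 0ℚ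
  shrinks p zero    _   = p
  shrinks p (suc m) m<n = subst (ℚ._< 0ℚ) (sym (difference (suc m) m<n)) (subst (w (suc m) ℚ.+ w 1 ℚ.<_) (ℚP.+-identityˡ 0ℚ) (ℚP.+-mono-< (shrinks p m (ℕP.<⇒≤ m<n)) p))
  w₁ : w 1 ≡ 0ℚ
  w₁ with ℚP.<-cmp (w 1) 0ℚ
  ... | tri< q _ _ = contradiction (subst (ℚ._< 0ℚ) wₙ (shrinks q n ℕP.≤-refl)) (ℚP.<-irrefl refl)
  ... | tri≈ _ q _ = q
  ... | tri> _ _ q = contradiction (subst (0ℚ ℚ.<_) wₙ (grows q n ℕP.≤-refl)) (ℚP.<-irrefl refl)
  all-zero : ∀ m → m ≤ suc n → w m ≡ 0ℚ
  all-zero zero    _       = w₀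
  all-zero (suc m) (s≤s q) = trans (difference m q) (trans (cong₂ ℚ._+_ (all-zero m (ℕP.m≤n⇒m≤1+n q)) w₁) (ℚP.+-identityˡ 0ℚ))

average : {A : Set} → (A → ℚ) → List (ℚ × A) → ℚ
average g = foldr (λ tp x → proj₁ tp ℚ.* g (proj₂ tp) ℚ.+ x) 0ℚ

average-cong : {A : Set} {g h : A → ℚ} → (∀ a → g a ≡ h a) → ∀ L → average g L ≡ average h L
average-cong e []            = refl
average-cong e ((t , a) ∷ L) = cong₂ (λ x y → t ℚ.* x ℚ.+ y) (e a) (average-cong e L)

average-+ : {A : Set} (g h : A → ℚ) → ∀ L → average (λ a → g a ℚ.+ h a) L ≡ average g L ℚ.+ average h L
average-+ g h []            = sym (ℚP.+-identityˡ 0ℚ)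
average-+ g h ((t , a) ∷ L) = trans (cong (t ℚ.* (g a ℚ.+ h a) ℚ.+_) (average-+ g h L)) (lem t (g a) (h a) (average g L) (average h L))
  where
  open ℚS.+-*-Solver
  lem : ∀ t x y p q → t ℚ.* (x ℚ.+ y) ℚ.+ (p ℚ.+ q) ≡ (t ℚ.* x ℚ.+ p) ℚ.+ (t ℚ.* y ℚ.+ q)
  lem = solve 5 (λ t x y p q → t :* (x :+ y) :+ (p :+ q) := (t :* x :+ p) :+ (t :* y :+ q)) refl

average-mono : {A : Set} (g h : A → ℚ) → ∀ L → All (λ tp → 0ℚ ℚ.≤ proj₁ tp × g (proj₂ tp) ℚ.≤ h (proj₂ tp)) L → average g L ℚ.≤ average h L
average-mono g h []            []            = ℚP.≤-refl
average-mono g h ((t , a) ∷ L) ((p , q) ∷ b) = ℚP.+-mono-≤ (ℚP.*-monoˡ-≤-nonNeg t {{ℚ.nonNegative p}} q) (average-mono g h L b)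

average-const : {A : Set} (x : ℚ) (L : List (ℚ × A)) → average (λ _ → x) L ≡ foldr (λ tp r → proj₁ tp ℚ.+ r) 0ℚ L ℚ.* x
average-const x []            = sym (ℚP.*-zeroˡ x)
average-const x ((t , a) ∷ L) = trans (cong (t ℚ.* x ℚ.+_) (average-const x L)) (sym (ℚP.*-distribʳ-+ x t _))

module Roots {n : ℕ} (c : Vec (Fin n) n) (c-inj : IsCoxeterWord c) where

  open Cluster c c-inj using (pos′; lookup-pos; pos-lookup)

  -- The sum over positions in c is permuted into a sum over simple roots.
  rootComb-dd : (f : Fin n → ℤ) → ∀ j → rootComb c f j ≡ dd (ext (f ∘ pos′)) (toℕ j)
  rootComb-dd f j = trans (sumℤ-cong (λ i → cong (λ k → f k * cartan (lookup c i) j) (sym (pos-lookup i))))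
    (trans (trans (sumℤ-sum (λ i → f (pos′ (lookup c i)) * cartan (lookup c i) j)) (trans (sym (Sum.sum-permute (λ s → f (pos′ s) * cartan s j) (Perm.permutation (lookup c) pos′ lookup-pos pos-lookup))) (sym (sumℤ-sum (λ s → f (pos′ s) * cartan s j)))))
      (sum-cartan (f ∘ pos′) j))

  second-difference : (f : Fin n → ℤ) → ∀ j → ι (ext f j) ℚ.+ ι (ext f (suc (suc j))) ℚ.+ ι (dd (ext f) j) ≡ ι (ext f (suc j)) ℚ.+ ι (ext f (suc j))
  second-difference f j = trans (cong (ℚ._+ ι (dd (ext f) j)) (sym (ι-+ (ext f j) _))) (trans (sym (ι-+ (ext f j + ext f (suc (suc j))) _))
    (trans (cong ι (lem (ext f j) (ext f (suc j)) (ext f (suc (suc j))))) (ι-+ (ext f (suc j)) (ext f (suc j)))))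
    where
    lem : ∀ a b c → (a + c) + (+ 2 * b - a - c) ≡ b + b
    lem = solve-∀

  -- Points of a hull are given at fundamental weights, but ideals are conditions at simple roots.
  -- The difference of both sides has zero second differences and vanishes at both ends, so
  -- `harmonic` applies.
  average-coefficients : (L : List (ℚ × (Fin n → ℤ))) (f : Fin n → ℤ) →
    (∀ (j : Fin n) → average (λ g → ι (dd (ext g) (toℕ j))) L ≡ ι (dd (ext f) (toℕ j))) → ∀ s → average (λ g → ι (g s)) L ≡ ι (f s)
  average-coefficients L f h s = trans (sym (cong-at s)) (trans (equal (suc (toℕ s)) (ℕP.m≤n⇒m≤1+n (FinP.toℕ<n s))) (cong ι (extF-toℕ f s)))
    where
    open ℚS.+-*-Solver
    A B w : ℕ → ℚ
    A m = average (λ g → ι (ext g m)) L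
    B m = ι (ext f m)
    w m = A m ℚ.+ (ℚ.- B m)
    cong-at : ∀ s → A (suc (toℕ s)) ≡ average (λ g → ι (g s)) L
    cong-at s = average-cong (λ g → cong ι (extF-toℕ g s)) L
    A-second : ∀ j → A j ℚ.+ A (suc (suc j)) ℚ.+ average (λ g → ι (dd (ext g) j)) L ≡ A (suc j) ℚ.+ A (suc j)
    A-second j = trans (cong (ℚ._+ average (λ g → ι (dd (ext g) j)) L) (sym (average-+ (λ g → ι (ext g j)) (λ g → ι (ext g (suc (suc j)))) L)))
      (trans (sym (average-+ (λ g → ι (ext g j) ℚ.+ ι (ext g (suc (suc j)))) (λ g → ι (dd (ext g) j)) L))
        (trans (average-cong (λ g → second-difference g j) L) (average-+ (λ g → ι (ext g (suc j))) (λ g → ι (ext g (suc j))) L)))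
    subtract : ∀ a₀ a₁ a₂ b₀ b₁ b₂ {x y} → a₀ ℚ.+ a₂ ℚ.+ x ≡ a₁ ℚ.+ a₁ → b₀ ℚ.+ b₂ ℚ.+ y ≡ b₁ ℚ.+ b₁ → x ≡ y →
      (a₀ ℚ.+ (ℚ.- b₀)) ℚ.+ (a₂ ℚ.+ (ℚ.- b₂)) ≡ (a₁ ℚ.+ (ℚ.- b₁)) ℚ.+ (a₁ ℚ.+ (ℚ.- b₁))
    subtract a₀ a₁ a₂ b₀ b₁ b₂ {x} p q refl = trans (l₁ a₀ a₂ b₀ b₂ x) (trans (cong₂ (λ s t → s ℚ.+ (ℚ.- t)) p q) (l₂ a₁ b₁))
      where
      l₁ : ∀ a c b d x → (a ℚ.+ (ℚ.- b)) ℚ.+ (c ℚ.+ (ℚ.- d)) ≡ (a ℚ.+ c ℚ.+ x) ℚ.+ (ℚ.- (b ℚ.+ d ℚ.+ x))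
      l₁ = solve 5 (λ a c b d x → (a :+ (:- b)) :+ (c :+ (:- d)) := (a :+ c :+ x) :+ (:- (b :+ d :+ x))) refl
      l₂ : ∀ a b → (a ℚ.+ a) ℚ.+ (ℚ.- (b ℚ.+ b)) ≡ (a ℚ.+ (ℚ.- b)) ℚ.+ (a ℚ.+ (ℚ.- b))
      l₂ = solve 2 (λ a b → (a :+ a) :+ (:- (b :+ b)) := (a :+ (:- b)) :+ (a :+ (:- b))) refl
    w-second : ∀ j → j < n → w j ℚ.+ w (suc (suc j)) ≡ w (suc j) ℚ.+ w (suc j)
    w-second j j<n = subtract (A j) (A (suc j)) (A (suc (suc j))) (B j) (B (suc j)) (B (suc (suc j))) (A-second j) (second-difference f j)
      (subst (λ z → average (λ g → ι (dd (ext g) z)) L ≡ ι (dd (ext f) z)) (FinP.toℕ-fromℕ< j<n) (h (fromℕ< j<n)))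
    ends : ∀ m → (∀ g → ext {n} g m ≡ + 0) → w m ≡ 0ℚ
    ends m z = trans (cong₂ (λ x y → x ℚ.+ (ℚ.- y)) (trans (average-cong (λ g → cong ι (z g)) L) (trans (average-const (ι (+ 0)) L) (ℚP.*-zeroʳ (foldr (λ tp r → proj₁ tp ℚ.+ r) 0ℚ L)))) (cong ι (z f))) refl
    equal : ∀ m → m ≤ suc n → A m ≡ B m
    equal m p = trans (l (A m) (B m)) (trans (cong (ℚ._+ B m) (harmonic n w w-second (ends 0 (λ _ → refl)) (ends (suc n) extF-top) m p)) (ℚP.+-identityˡ (B m)))
      where
      l : ∀ a b → a ≡ (a ℚ.+ (ℚ.- b)) ℚ.+ b
      l = solve 2 (λ a b → a := (a :+ (:- b)) :+ b) refl

  -- The case of a single point with weight 1.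
  dd-injective : (f g : Fin n → ℤ) → (∀ (j : Fin n) → dd (ext f) (toℕ j) ≡ dd (ext g) (toℕ j)) → ∀ s → f s ≡ g s
  dd-injective f g h s = ℤP.≤-antisym (ι-≤⁻ (ℚP.≤-reflexive eq)) (ι-≤⁻ (ℚP.≤-reflexive (sym eq)))
    where
    single : ∀ x → 1ℚ ℚ.* x ℚ.+ 0ℚ ≡ x
    single x = trans (ℚP.+-identityʳ _) (ℚP.*-identityˡ x)
    eq : ι (f s) ≡ ι (g s)
    eq = trans (sym (single (ι (f s)))) (average-coefficients ((1ℚ , f) ∷ []) g (λ j → trans (single _) (cong ι (h j))) s)

Ideal-cong : {c : Vec (Fin n) n} {D D′ μ μ′ : Fin n → ℤ} → (∀ s → D s ≡ D′ s) → (∀ s → μ s ≡ μ′ s) → Ideal c D μ → Ideal c D′ μ′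
Ideal-cong {D = D} {D′} {μ} {μ′} e f I = record
  { nonneg = λ s → subst (+ 0 ℤ.≤_) (f s) (nonneg s)
  ; under  = λ s → subst₂ ℤ._≤_ (f s) (e s) (under s)
  ; fwd    = λ i j a x y l → subst₂ ℤ._≤_ (f _) (f _) (fwd i j a (trans (e _) x) (trans (e _) y) l)
  ; bwd    = λ i j a x y l → subst₂ ℤ._≤_ (f _) (f _) (bwd i j a (trans (e _) x) (trans (e _) y) l) }
  where
  open Ideal I

dd-cong : (f g : Fin n → ℤ) → (∀ s → f s ≡ g s) → ∀ j → dd (ext f) j ≡ dd (ext g) j
dd-cong f g e j = cong₃ (λ a b c → + 2 * a - b - c) (at (suc j)) (at j) (at (suc (suc j)))
  where
  extF-cong : ∀ {m} (f g : Fin m → ℤ) → (∀ s → f s ≡ g s) → ∀ i → extF f i ≡ extF g i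
  extF-cong {zero}  f g e i       = refl
  extF-cong {suc m} f g e zero    = e Fin.zero
  extF-cong {suc m} f g e (suc i) = extF-cong (f ∘ Fin.suc) (g ∘ Fin.suc) (e ∘ Fin.suc) i
  at : ∀ i → ext f i ≡ ext g i
  at zero    = refl
  at (suc i) = extF-cong f g e i

-- Newton polytopes and hulls of weights

split-list : {A : Set} (xs : List A) → ∀ m → m < length xs → ∃ λ ys → ∃₂ λ x zs → xs ≡ ys ++ x ∷ zs × length ys ≡ m
split-list (x ∷ xs) zero    h = [] , x , xs , refl , refl
split-list (x ∷ xs) (suc m) (s≤s h) = let ys , y , zs , e , l = split-list xs m h in x ∷ ys , y , zs , cong (x ∷_) e , cong suc l

lookup-split : {A : Set} (xs ys : List A) (y : A) (zs : List A) (k : Fin (length xs)) → xs ≡ ys ++ y ∷ zs → toℕ k ≡ length ys → List.lookup xs k ≡ y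
lookup-split (x ∷ xs) []       y zs Fin.zero    refl e = refl
lookup-split (x ∷ xs) (z ∷ ys) y zs (Fin.suc k) e   f = lookup-split xs ys y zs k (ListP.∷-injectiveʳ e) (ℕP.suc-injective f)
lookup-split []       []       y zs ()
lookup-split []       (z ∷ ys) y zs ()

ConvHull-mono : {P Q : Vℚ n → Set} → (∀ v → P v → Q v) → ∀ v → ConvHull P v → ConvHull Q v
ConvHull-mono h v (L , a , s , e) = L , All.map (λ { (p , q) → p , h _ q }) a , s , e

module Polytopes {n : ℕ} .{{_ : NonZero n}} (c : Vec (Fin n) n) (c-inj : IsCoxeterWord c) (ps : List ℕ) (woc : IsWoc c ps)
  (ps₁ : List ℕ) (p : ℕ) (ps₂ : List ℕ) (split : ps ≡ ps₁ ++ p ∷ ps₂)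
  (Ig Iag : List ℕ) (greedy-Ig : IsGreedy (Qword c ps) Ig) (anti : IsAntigreedy (Qword c ps) Iag)
  (ks : List (Fin n)) (j : Fin n) (dv : Fin n → ℤ) (f : Poly n) (form : HasDenomForm (clusterVar c ks j) dv f) where

  open Cluster c c-inj using (pos′; lookup-pos; pos-lookup)
  open Roots c c-inj
  open Coxeter c c-inj
  open Sorting ps woc
  open At ps₁ p ps₂ split
  module Fa = Facets c c-inj ps woc ps₁ p ps₂ split
  module Re = Realise c c-inj ps woc ps₁ p ps₂ split
  open Fa using (K; Q′)

  module Matched (β-eq : ∀ i → act (Π Q′ Ig K) (α s₀) i ≡ rootComb c dv i) where

    -- The junction of both halves: the root function gives `Fa.D`, the cluster variable gives `dv`,
    -- and both are the coefficients of β at the simple roots.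
    D≡ : ∀ s → Fa.D s ≡ dv (pos′ s)
    D≡ = dd-injective Fa.D (dv ∘ pos′) (λ i → trans (sym (Fa.root-heights Ig greedy-Ig i)) (trans (β-eq i) (rootComb-dd dv i)))

    -- Obtained on the facet side, from V ≤ U; on the cluster side it rules out initial variables.
    dv≥0 : ∀ l → + 0 ℤ.≤ dv l
    dv≥0 l = subst (+ 0 ℤ.≤_) (trans (D≡ (lookup c l)) (cong dv (pos-lookup l)))
      (ℤP.i≤j⇒0≤j-i (subst (ℤ._≤ Fa.U _) (sym (Fa.V-push _)) (Re.push-≤ Fa.C _)))

    module S = Support.Variable c c-inj ks j dv f form dv≥0

    F : YPoly n
    F = evalX1 f

    D-bit : ∀ s → Bit (Fa.D s)
    D-bit s = subst Bit (sym (D≡ s)) (S.D-bit (pos′ s))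

    exps-root : ∀ μ i → dd (ext (S.exps μ)) (toℕ i) ≡ rootComb c (λ k → + lookup μ k) i
    exps-root μ i = sym (rootComb-dd (λ k → + lookup μ k) i)

    weight : List ℕ → Wt n
    weight I = act (Π Q′ I K) (ω s₀)

    FacetPts′ : Vℚ n → Set
    FacetPts′ v = Σ (List ℕ) λ I → IsFacet Q′ I × (∀ i → v i ≡ toℚv (λ i′ → weight I i′ - weight Iag i′) i)

    newton⇒facet : ∀ v → NewtonPts c F v → FacetPts′ v
    newton⇒facet v (μ , ne , e) =
      let I , facet , h = Re.ideal⇒facet (S.exps μ) D-bit (Ideal-cong (λ s → sym (D≡ s)) (λ _ → refl) (S.support⇒ideal μ ne)) Iag anti
      in I , facet , λ i → trans (e i) (cong ι {x = rootComb c (λ k → + lookup μ k) i} {y = weight I i - weight Iag i} (sym (trans (h i) (exps-root μ i))))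

    facet⇒newton : ∀ v → FacetPts′ v → NewtonPts c F v
    facet⇒newton v (I , facet , e) = μ , S.ideal⇒support μ (Ideal-cong D≡ same-exps ideal) ,
        λ i → trans (e i) (cong ι {x = weight I i - weight Iag i} {y = rootComb c (λ k → + lookup μ k) i}
          (trans (proj₂ (proj₂ found) i) (trans (dd-cong ν (S.exps μ) same-exps (toℕ i)) (exps-root μ i))))
      where
      found = Fa.facet⇒ideal I Iag facet anti
      ν : Fin n → ℤ
      ν = proj₁ found
      ideal = proj₁ (proj₂ found)
      -- Entries of an ideal are nonnegative, so absolute values lose nothing.
      μ : Vec ℕ n
      μ = tabulate (λ k → ℤ.∣ ν (lookup c k) ∣)
      same-exps : ∀ s → ν s ≡ S.exps μ s
      same-exps s = sym (trans (cong +_ (VecP.lookup∘tabulate _ (pos′ s))) (trans (ℤP.0≤i⇒+∣i∣≡i (Ideal.nonneg ideal (lookup c (pos′ s)))) (cong ν (lookup-pos s))))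

    polytopes : ∀ v → Newton c F v ⇔ ConvHull FacetPts′ v
    polytopes v = mk⇔ (ConvHull-mono newton⇒facet v) (ConvHull-mono facet⇒newton v)

    -- The inequalities that define ideals are linear, so they pass to lattice points of the hull.
    hull⇒ideal : ∀ (μ : Fin n → ℕ) v → v ≋ rootComb c (λ i → + μ i) → Newton c F (toℚv v) → Ideal c S.D (λ s → + μ (pos′ s))
    hull⇒ideal μ v ev (L , pts , sum , bary) = record
      { nonneg = λ s → ℤ.+≤+ z≤n
      ; under  = λ s → compare (λ g → g s) (λ _ → S.D s) (average-at s)
          (trans (average-const (ι (S.D s)) L′) (trans (cong (ℚ._* ι (S.D s)) sum′) (ℚP.*-identityˡ _))) (λ I → Ideal.under I s)
      ; fwd    = λ x y adj Dx Dy x<y → compare (λ g → g (lookup c y)) (λ g → g (lookup c x)) (average-at (lookup c y)) (average-at (lookup c x)) (λ I → Ideal.fwd I x y adj Dx Dy x<y)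
      ; bwd    = λ x y adj Dx Dy y<x → compare (λ g → g (lookup c x)) (λ g → g (lookup c y)) (average-at (lookup c x)) (average-at (lookup c y)) (λ I → Ideal.bwd I x y adj Dx Dy y<x)
      }
      where
      Good : ℚ × (Fin n → ℤ) → Set
      Good tp = 0ℚ ℚ.≤ proj₁ tp × Ideal c S.D (proj₂ tp)
      convert : ∀ L → All (λ tp → 0ℚ ℚ.≤ proj₁ tp × NewtonPts c F (proj₂ tp)) L → ∃ λ L′ → All Good L′
        × foldr (λ tp x → proj₁ tp ℚ.+ x) 0ℚ L′ ≡ foldr (λ tp x → proj₁ tp ℚ.+ x) 0ℚ L
        × (∀ i → average (λ g → ι (dd (ext g) (toℕ i))) L′ ≡ foldr (λ tp x → proj₁ tp ℚ.* proj₂ tp i ℚ.+ x) 0ℚ L)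
      convert [] [] = [] , [] , refl , λ _ → refl
      convert ((t , w) ∷ L) ((t≥0 , (λ′ , ne , e)) ∷ a) = let L′ , g , s , b = convert L a in
        (t , S.exps λ′) ∷ L′ , (t≥0 , S.support⇒ideal λ′ ne) ∷ g , cong (t ℚ.+_) s ,
        λ i → cong₂ (λ x y → t ℚ.* x ℚ.+ y) (trans (cong ι (exps-root λ′ i)) (sym (e i))) (b i)
      converted = convert L pts
      L′ : List (ℚ × (Fin n → ℤ))
      L′ = proj₁ converted
      good : All Good L′
      good = proj₁ (proj₂ converted)
      sum′ : foldr (λ tp x → proj₁ tp ℚ.+ x) 0ℚ L′ ≡ 1ℚ
      sum′ = trans (proj₁ (proj₂ (proj₂ converted))) sum
      average-at : ∀ s → average (λ g → ι (g s)) L′ ≡ ι (+ μ (pos′ s))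
      average-at = average-coefficients L′ (λ s → + μ (pos′ s)) (λ i → trans (proj₂ (proj₂ (proj₂ converted)) i)
        (trans (bary i) (cong ι (trans (ev i) (rootComb-dd (λ k → + μ k) i)))))
      compare : (g h : (Fin n → ℤ) → ℤ) → ∀ {a b} → average (ι ∘ g) L′ ≡ ι a → average (ι ∘ h) L′ ≡ ι b → (∀ {ν} → Ideal c S.D ν → g ν ℤ.≤ h ν) → a ℤ.≤ b
      compare g h p q le = ι-≤⁻ (subst₂ ℚ._≤_ p q (average-mono (ι ∘ g) (ι ∘ h) L′ (All.map (λ { (x , y) → x , ι-≤ (le y) }) good)))

    lattice-points : ∀ v → ExpPts c F v ⇔ (Newton c F (toℚv v) × InNatSpan c v)
    lattice-points v = mk⇔ to from
      where
      to : ExpPts c F v → Newton c F (toℚv v) × InNatSpan c v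
      to (μ , ne , e) = ((1ℚ , toℚv v) ∷ [] , ((ℚP.nonNegative⁻¹ 1ℚ , (μ , ne , λ i → cong ι (e i))) ∷ []) ,
          ℚP.+-identityʳ 1ℚ , λ i → trans (ℚP.+-identityʳ _) (ℚP.*-identityˡ _)) , lookup μ , e
      from : Newton c F (toℚv v) × InNatSpan c v → ExpPts c F v
      from (hull , (μ , e)) = tabulate μ , S.ideal⇒support (tabulate μ) (Ideal-cong (λ _ → refl)
          (λ s → cong +_ (sym (VecP.lookup∘tabulate μ (pos′ s)))) (hull⇒ideal μ v e hull)) ,
        λ i → trans (e i) (sumℤ-cong (λ k → cong (λ z → + z * α (lookup c k) i) (sym (VecP.lookup∘tabulate μ k))))

theorem2p13 : (n : ℕ) .{{_ : NonZero n}} (c : Vec (Fin n) n) → IsCoxeterWord c →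
    (ps : List ℕ) → IsWoc c ps →
    (Ig Iag : List ℕ) → IsGreedy (Qword c ps) Ig → IsAntigreedy (Qword c ps) Iag →
    (β : Wt n) → IsPosRoot β →
    (k : Fin (length (Qword c ps))) → n ≤ toℕ k → rootFn (Qword c ps) Ig k ≋ β →
    (ks : List (Fin n)) (j : Fin n) (d : Fin n → ℤ) (p : Poly n) →
    HasDenomForm (clusterVar c ks j) d p → β ≋ rootComb c d →
    ((v : Vℚ n) → Newton c (evalX1 p) v ⇔ ConvHull (FacetPts (Qword c ps) Iag k) v)
    × ((v : Wt n) → ExpPts c (evalX1 p) v ⇔ (Newton c (evalX1 p) (toℚv v) × InNatSpan c v))
theorem2p13 n c c-inj ps woc Ig Iag greedy-Ig anti β _ k n≤k root ks j d f form β-comb = by-position (split-list ps (toℕ k ℕ.∸ n) index)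
  where
  length-Q : length (Qword c ps) ≡ n ℕ.+ length ps
  length-Q = trans (ListP.length-++ (toList c)) (cong₂ ℕ._+_ (VecP.length-toList c) (ListP.length-map (letter c) ps))
  index : toℕ k ℕ.∸ n < length ps
  index = ℕP.+-cancelˡ-< n _ _ (subst₂ _<_ (sym (ℕP.m+[n∸m]≡n n≤k)) length-Q (FinP.toℕ<n k))
  by-position : (∃ λ ps₁ → ∃₂ λ p ps₂ → ps ≡ ps₁ ++ p ∷ ps₂ × length ps₁ ≡ toℕ k ℕ.∸ n) → _
  -- `Facets` is phrased with the length `K` of the part of Q before `k` and with the letter behind
  -- it; both are transported to the data of `k`.
  by-position (ps₁ , p , ps₂ , split , len) = subst₂ (λ K s → ∀ v → Newton c (evalX1 f) v ⇔ ConvHull (λ v → Σ (List ℕ) λ I → IsFacet (Qword c ps) I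
        × (∀ i → v i ≡ toℚv (λ i′ → act (Π (Qword c ps) I K) (ω s) i′ - act (Π (Qword c ps) Iag K) (ω s) i′) i)) v) K≡ s≡ polytopes , lattice-points
    where
    open Facets c c-inj ps woc ps₁ p ps₂ split using (K; Q-split)
    K≡ : K ≡ toℕ k
    K≡ = trans (ListP.length-++ (toList c)) (trans (cong₂ ℕ._+_ (VecP.length-toList c) (trans (ListP.length-map (letter c) ps₁) len)) (ℕP.m+[n∸m]≡n n≤k))
    s≡ : letter c p ≡ List.lookup (Qword c ps) k
    s≡ = sym (lookup-split (Qword c ps) (toList c ++ List.map (letter c) ps₁) (letter c p) (List.map (letter c) ps₂) k Q-split (sym K≡))
    open Polytopes c c-inj ps woc ps₁ p ps₂ split Ig Iag greedy-Ig anti ks j d f form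
    open Matched (λ i → trans (subst₂ (λ K s → act (Π (Qword c ps) Ig K) (α s) i ≡ β i) (sym K≡) (sym s≡) (root i)) (β-comb i))
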